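{- Up to isomorphism, the set of forbidden minors of the class of planar graphs consists of exactly the two graphs $K_5$ and $K_{3,3}$: $$F(Planar) = \{K_5, K_{3,3}\}.$$
   Context: Graphs are finite and simple, considered up to isomorphism. $H$ is a minor of $G$, written $H \prec G$, if $H$ can be obtained from $G$ by vertex deletions, edge deletions and edge contractions (every graph is a minor of itself). $Planar$ is the class of graphs embeddable in the plane. For a minor closed class $A$ of graphs, $F(A)$ is its set of forbidden minors, i.e. the set of minor-minimal graphs not in $A$: graphs $G \notin A$ such that every $H \notin A$ with $H \prec G$ satisfies $H \cong G$. -}

module Defs where

open import Data.Bool.Base using (Bool; true; false)
import Data.Bool.Properties as Bool
open import Data.Fin.Base using (Fin; punchIn; splitAt) renaming (_<_ to _<ᶠ_)
open import Data.Fin.Properties using (_≟_; any?)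
open import Data.Integer.Base using (+_)
open import Data.Nat.Base using (ℕ; suc) renaming (_+_ to _+ⁿ_)
open import Data.Product.Base using (Σ; ∃; ∃₂; _×_; _,_; proj₁)
open import Data.Rational.Base using (ℚ; 0ℚ; 1ℚ; _/_; _+_; _-_; ∣_∣; _≤_; _<_)
import Data.Rational.Properties as ℚ
open import Data.Sum.Base using (_⊎_; inj₁; inj₂; [_,_]′)
open import Function.Base using (_∘_; const)
open import Function.Bundles using (_⇔_; _↔_; Inverse)
open import Level using (0ℓ)
open import Relation.Binary.Core using (Rel)
open import Relation.Binary.Definitions using (Decidable; Symmetric; Irreflexive)
open import Relation.Binary.PropositionalEquality using (_≡_; _≢_; refl; sym; subst)
open import Relation.Nullary using (¬_; Dec)
open import Relation.Nullary.Decidable using (¬?; _×-dec_; _⊎-dec_)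

------------------------------------------------------------------------
-- Finite simple graphs

record Graph (n : ℕ) : Set₁ where
  field
    Adj    : Rel (Fin n) 0ℓ
    adj?   : Decidable Adj
    symm   : Symmetric Adj
    irrefl : Irreflexive _≡_ Adj

open Graph public

infix 4 _≅_ _≺_

record _≅_ {m n : ℕ} (G : Graph m) (H : Graph n) : Set where
  field
    bijection : Fin m ↔ Fin n
  open Inverse bijection public using (to; from)
  field
    adj⇔ : ∀ u v → Adj G u v ⇔ Adj H (to u) (to v)

complete : ∀ n → Graph n
complete n = record
  { Adj    = _≢_
  ; adj?   = λ u v → ¬? (u ≟ v)
  ; symm   = _∘ sym
  ; irrefl = λ u≡v u≢v → u≢v u≡v
  }

side : ∀ m {n} → Fin (m +ⁿ n) → Bool
side m u = [ const true , const false ]′ (splitAt m u)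

completeBipartite : ∀ m n → Graph (m +ⁿ n)
completeBipartite m n = record
  { Adj    = λ u v → side m u ≢ side m v
  ; adj?   = λ u v → ¬? (side m u Bool.≟ side m v)
  ; symm   = _∘ sym
  ; irrefl = λ { refl s≢s → s≢s refl }
  }

K₅ : Graph 5
K₅ = complete 5

K₃,₃ : Graph 6
K₃,₃ = completeBipartite 3 3

------------------------------------------------------------------------
-- Minors

-- punchIn v enumerates the vertices other than v.
deleteVertex : ∀ {n} → Graph (suc n) → Fin (suc n) → Graph n
deleteVertex G v = record
  { Adj    = λ x y → Adj G (punchIn v x) (punchIn v y)
  ; adj?   = λ x y → adj? G (punchIn v x) (punchIn v y)
  ; symm   = symm G
  ; irrefl = λ { refl → irrefl G refl }
  }

deleteEdge : ∀ {n} → Graph n → Fin n → Fin n → Graph n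
deleteEdge G u v = record
  { Adj    = λ x y → Adj G x y × ¬ Ends x y
  ; adj?   = λ x y → adj? G x y ×-dec ¬? (ends? x y)
  ; symm   = λ { (a , ¬e) → symm G a , ¬e ∘ ends-sym }
  ; irrefl = λ { x≡y (a , _) → irrefl G x≡y a }
  }
  where
  Ends : Rel (Fin _) 0ℓ
  Ends x y = (x ≡ u × y ≡ v) ⊎ (x ≡ v × y ≡ u)

  ends? : Decidable Ends
  ends? x y = ((x ≟ u) ×-dec (y ≟ v)) ⊎-dec ((x ≟ v) ×-dec (y ≟ u))

  ends-sym : Symmetric Ends
  ends-sym (inj₁ (p , q)) = inj₂ (q , p)
  ends-sym (inj₂ (p , q)) = inj₁ (q , p)

-- Contraction of the edge uv: v is absorbed into u, and the loop and the
-- parallel edges that arise are suppressed.  MergedInto x′ x says that the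
-- vertex x′ of G becomes the vertex x of the contracted graph.
contractEdge : ∀ {n} → Graph (suc n) → Fin (suc n) → Fin (suc n) → Graph n
contractEdge {n} G u v = record
  { Adj    = λ x y → x ≢ y × Joined x y
  ; adj?   = λ x y → ¬? (x ≟ y) ×-dec joined? x y
  ; symm   = λ { (x≢y , x′ , y′ , p , q , a) →
                 x≢y ∘ sym , y′ , x′ , q , p , symm G a }
  ; irrefl = λ { x≡y (x≢y , _) → x≢y x≡y }
  }
  where
  MergedInto : Fin (suc n) → Fin n → Set
  MergedInto x′ x = (x′ ≡ punchIn v x) ⊎ (x′ ≡ v × punchIn v x ≡ u)

  mergedInto? : ∀ x′ x → Dec (MergedInto x′ x)
  mergedInto? x′ x = (x′ ≟ punchIn v x) ⊎-dec ((x′ ≟ v) ×-dec (punchIn v x ≟ u))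

  Joined : Rel (Fin n) 0ℓ
  Joined x y = ∃₂ λ x′ y′ → MergedInto x′ x × MergedInto y′ y × Adj G x′ y′

  joined? : Decidable Joined
  joined? x y = any? λ x′ → any? λ y′ →
    mergedInto? x′ x ×-dec mergedInto? y′ y ×-dec adj? G x′ y′

data _≺_ {m : ℕ} (H : Graph m) : ∀ {n} → Graph n → Set₁ where
  iso           : ∀ {n} {G : Graph n} → H ≅ G → H ≺ G
  vertexDeleted : ∀ {n} {G : Graph (suc n)} v →
                  H ≺ deleteVertex G v → H ≺ G
  edgeDeleted   : ∀ {n} {G : Graph n} u v → Adj G u v →
                  H ≺ deleteEdge G u v → H ≺ G
  edgeContracted : ∀ {n} {G : Graph (suc n)} u v → Adj G u v →
                   H ≺ contractEdge G u v → H ≺ G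

-- Membership of G in F(A).
F : (∀ {n} → Graph n → Set) → ∀ {n} → Graph n → Set₁
F A G = ¬ A G × (∀ {m} (H : Graph m) → ¬ A H → H ≺ G → H ≅ G)

------------------------------------------------------------------------
-- The real plane

-- Bishop's real numbers: approx k is within 1/(k+1) of the number.
record ℝ : Set where
  field
    approx  : ℕ → ℚ
    regular : ∀ j k → ∣ approx j - approx k ∣ ≤ (+ 1 / suc j) + (+ 1 / suc k)

open ℝ public

infix 4 _≤ᴿ_

_≤ᴿ_ : Rel ℝ 0ℓ
x ≤ᴿ y = ∀ k → approx x k ≤ approx y k + (+ 2 / suc k)

fromℚ : ℚ → ℝ
fromℚ q = record
  { approx  = const q
  ; regular = λ j k → subst (_≤ (+ 1 / suc j) + (+ 1 / suc k))
                (sym (∣q-q∣≡0 q))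
                (ℚ.+-mono-≤ (nonNeg j) (nonNeg k))
  }
  where
  ∣q-q∣≡0 : ∀ p → ∣ p - p ∣ ≡ 0ℚ
  ∣q-q∣≡0 p rewrite ℚ.+-inverseʳ p = refl

  nonNeg : ∀ k → 0ℚ ≤ + 1 / suc k
  nonNeg k = ℚ.nonNegative⁻¹ (+ 1 / suc k) {{ℚ.normalize-nonNeg 1 (suc k)}}

-- The distance between x and y is at most ε.
Close : ℚ → Rel ℝ 0ℓ
Close ε x y = ∀ k → ∣ approx x k - approx y k ∣ ≤ ε + (+ 2 / suc k)

Plane : Set
Plane = ℝ × ℝ

-- Closeness in the maximum metric.
Close² : ℚ → Rel Plane 0ℓ
Close² ε (x , y) (x′ , y′) = Close ε x x′ × Close ε y y′

UnitInterval : Set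
UnitInterval = Σ ℝ λ t → fromℚ 0ℚ ≤ᴿ t × t ≤ᴿ fromℚ 1ℚ

------------------------------------------------------------------------
-- Planarity

module _ {n : ℕ} (G : Graph n) where

  -- The geometric realisation of G: a unit interval is glued in for every
  -- edge, oriented from its smaller end (t = 0) to its larger end (t = 1).
  -- The gluing is expressed by Near below: points that are Near ε for
  -- every ε > 0 are the same point of the realisation.
  data Point : Set where
    vertex : Fin n → Point
    along  : ∀ {u v} → u <ᶠ v → Adj G u v → UnitInterval → Point

  data NearVertex (ε : ℚ) (w : Fin n) : Point → Set where
    here   : NearVertex ε w (vertex w)
    source : ∀ {v} {w<v : w <ᶠ v} {a : Adj G w v} {t} →
             Close ε (proj₁ t) (fromℚ 0ℚ) → NearVertex ε w (along w<v a t)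
    target : ∀ {u} {u<w : u <ᶠ w} {a : Adj G u w} {t} →
             Close ε (proj₁ t) (fromℚ 1ℚ) → NearVertex ε w (along u<w a t)

  -- A base of the uniformity of the geometric realisation.
  data Near (ε : ℚ) : Rel Point 0ℓ where
    sameEdge   : ∀ {u v} {p q : u <ᶠ v} {a b : Adj G u v} {s t} →
                 Close ε (proj₁ s) (proj₁ t) → Near ε (along p a s) (along q b t)
    sameVertex : ∀ {w x y} →
                 NearVertex ε w x → NearVertex ε w y → Near ε x y

  -- An embedding of the geometric realisation in the plane, that is, a
  -- homeomorphism onto its image.  As usual in constructive analysis,
  -- continuity on a compact space means uniform continuity, so the map and
  -- its inverse are both required to be uniformly continuous.  Since the
  -- realisation of a finite graph is compact, this is classically the same
  -- as being continuous and injective.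
  record PlaneEmbedding : Set where
    field
      map        : Point → Plane
      continuous : ∀ ε → 0ℚ < ε → ∃ λ δ → 0ℚ < δ ×
                   (∀ x y → Near δ x y → Close² ε (map x) (map y))
      inverse-continuous :
                   ∀ ε → 0ℚ < ε → ∃ λ δ → 0ℚ < δ ×
                   (∀ x y → Close² δ (map x) (map y) → Near ε x y)

Planar : ∀ {n} → Graph n → Set
Planar = PlaneEmbedding

-- Sample every edge of a planar embedding so finely that disjoint edges remain
-- apart, and count modulo 2 how often an edge passes above a vertex.  Over the
-- grid of differences of the samples of two disjoint edges these parities
-- satisfy one linear equation, and the equations of all pairs of disjoint
-- edges of K₅, or of K₃,₃, sum up to 0 = 1.
--
-- Conversely, a graph without these minors has a straight-line drawing with
-- integer coordinates.  If no two vertices cut off a part of the graph, it is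
-- drawn ear by ear, with minimal ears, keeping the vertices that still have
-- undrawn neighbours visible from above; an ear that does not fit yields one
-- of the minors.  If a and b cut it, both sides are drawn with the edge ab
-- added, for which a path through the other side stands in, and are glued
-- along ab.  In the drawing, two edges or vertices are separated by a line, so
-- the distance of their points is bounded from below linearly in the distance
-- from a common end; this makes the inverse uniformly continuous.
module Submission where

open import Defs
open import Data.Nat.Base using (ℕ)
open import Data.Sum.Base using (_⊎_)
open import Function.Bundles using (_⇔_)
open import Data.Empty using (⊥-elim)
open import Data.Product.Base using (_,_)
open import Data.Sum.Base as Sum using (inj₁; inj₂)
open import Function.Bundles using (mk⇔)
open import Function.Construct.Identity using (↔-id)
open import Relation.Nullary using (¬_)

-- The induction over separations needs drawings that can be glued. It is therefore carried out for
-- a connected set with a chosen edge st in the stronger form `Poles`: s is lowest, t is highest,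
-- and all else lies to the right of the segment st. The second side of a cut is then a drawing with
-- poles a and b, which an affine map flattens into a thin strip beside the segment ab of the first.
--
-- Cuts ab that are edges of the graph are treated before all others. They include the cut vertices,
-- and once they are gone, both sides of any remaining cut contain a path from a to b.
--
-- Disjointness in a drawing is certified by separating lines with integer coefficients. Such
-- certificates are finite, are carried along by affine maps, and have values of size at least 1
-- wherever they do not vanish; this yields explicit constants for the inverse of the embedding.
--
-- For nonplanarity, the parity equations take the place of the Jordan curve theorem: they say that
-- disjoint edges cross evenly, and their inconsistency is the nonvanishing of the van Kampen
-- obstruction modulo 2 for the two graphs.

-- Decidable vertex sets, connectedness and components

module Sets where

  open import Data.Empty using (⊥-elim)
  open import Data.Fin.Base using (Fin)
  open import Data.Fin.Properties using (any?; all?)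
  open import Data.Fin.Subset using (Subset; _∈_; _∉_; _⊆_; ∣_∣)
  open import Data.Fin.Subset.Properties using (_∈?_; p⊂q⇒∣p∣<∣q∣; anySubset?)
  open import Data.Nat.Base using (ℕ; _<_)
  open import Data.Nat.Induction using (<-wellFounded)
  open import Data.Product.Base using (_×_; _,_; proj₁; proj₂)
  open import Data.Vec.Base using (tabulate)
  open import Data.Vec.Properties using (lookup∘tabulate; []=⇒lookup; lookup⇒[]=)
  open import Induction.WellFounded using (Acc; acc)
  open import Relation.Binary.PropositionalEquality
  open import Relation.Nullary
  open import Relation.Nullary.Decidable using (dec-true; _×-dec_; _→-dec_; ¬?)
  open import Relation.Unary using (Decidable)

  module _ {n : ℕ} where

    abstract
      sub : {P : Fin n → Set} → Decidable P → Subset n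
      sub P? = tabulate (λ v → does (P? v))

      in⁺ : {P : Fin n → Set} (P? : Decidable P) → ∀ {v} → P v → v ∈ sub P?
      in⁺ P? {v} p = lookup⇒[]= v _ (trans (lookup∘tabulate _ v) (dec-true (P? v) p))

      in⁻ : {P : Fin n → Set} (P? : Decidable P) → ∀ {v} → v ∈ sub P? → P v
      in⁻ P? {v} m with P? v | trans (sym (lookup∘tabulate (λ u → does (P? u)) v)) ([]=⇒lookup m)
      ... | yes p | _ = p
      ... | no _  | ()

    card-< : ∀ {X Y : Subset n} {v} → X ⊆ Y → v ∈ Y → v ∉ X → ∣ X ∣ < ∣ Y ∣
    card-< X⊆Y v∈Y v∉X = p⊂q⇒∣p∣<∣q∣ (X⊆Y , _ , v∈Y , v∉X)

    Closed : Graph n → Subset n → Subset n → Set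
    Closed G X Y = ∀ u v → u ∈ X → v ∈ X → u ∈ Y → Adj G u v → v ∈ Y

    closed? : ∀ G X Y → Dec (Closed G X Y)
    closed? G X Y = all? λ u → all? λ v →
      (u ∈? X) →-dec ((v ∈? X) →-dec ((u ∈? Y) →-dec (adj? G u v →-dec (v ∈? Y))))

    -- Connectedness as an induction principle instead of the existence of paths. The empty set
    -- satisfies it, so nonemptiness is always demanded separately.
    record Conn (G : Graph n) (X : Subset n) : Set where
      constructor connected
      field
        spread : ∀ Y {u v} → u ∈ X → u ∈ Y → Closed G X Y → v ∈ X → v ∈ Y

    open Conn public

    conn-ind : ∀ {G X} → Conn G X → {P : Fin n → Set} → Decidable P →
               (∀ u v → u ∈ X → v ∈ X → P u → Adj G u v → P v) →
               ∀ {u v} → u ∈ X → P u → v ∈ X → P v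
    conn-ind c P? step u∈X pu v∈X =
      in⁻ P? (spread c (sub P?) u∈X (in⁺ P? pu)
        (λ a b a∈ b∈ a∈Y ab → in⁺ P? (step a b a∈ b∈ (in⁻ P? a∈Y) ab)) v∈X)

    record Component (G : Graph n) (X : Subset n) (v : Fin n) : Set where
      field
        set    : Subset n
        ⊆X     : set ⊆ X
        closed : ∀ {u w} → u ∈ set → w ∈ X → Adj G u w → w ∈ set
        root   : v ∈ X → v ∈ set
        conn   : v ∈ X → Conn G set

    -- Shrinks X: as long as some set Y around v is closed within J but misses a vertex of J, J is
    -- cut down to its part in Y. Being closed in X survives every cut, and when none is possible J
    -- is connected.
    component′ : ∀ G X v → Component G X v
    component′ G X v = go X (<-wellFounded _) (λ u∈ → u∈) (λ _ w∈ _ → w∈) (λ v∈ → v∈)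
      where
      go : ∀ J → Acc _<_ ∣ J ∣ → J ⊆ X → (∀ {u w} → u ∈ J → w ∈ X → Adj G u w → w ∈ J) →
           (v ∈ X → v ∈ J) → Component G X v
      go J (acc rs) J⊆X clJ rt with anySubset? (λ Y →
           (v ∈? Y) ×-dec (closed? G J Y ×-dec any? (λ w → (w ∈? J) ×-dec ¬? (w ∈? Y))))
      ... | yes (Y , v∈Y , clY , w , w∈J , w∉Y) =
            go J′ (rs (card-< (λ m → proj₁ (in⁻ J? m)) w∈J (λ m → w∉Y (proj₂ (in⁻ J? m)))))
               (λ m → J⊆X (proj₁ (in⁻ J? m)))
               (λ {u} {z} u∈ z∈X uz → let (uJ , uY) = in⁻ J? u∈ ; zJ = clJ uJ z∈X uz in
                  in⁺ J? (zJ , clY u z uJ zJ uY uz))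
               (λ v∈X → in⁺ J? (rt v∈X , v∈Y))
        where
        J? : Decidable (λ u → u ∈ J × u ∈ Y)
        J? u = (u ∈? J) ×-dec (u ∈? Y)
        J′ = sub J?
      ... | no none = record { set = J ; ⊆X = J⊆X ; closed = clJ ; root = rt ; conn = cn }
        where
        cn : v ∈ X → Conn G J
        cn v∈X = connected λ Y → compare Y (v ∈? Y)
          where
          compare : ∀ Y {u w} → Dec (v ∈ Y) → u ∈ J → u ∈ Y → Closed G J Y → w ∈ J → w ∈ Y
          compare Y {u} {w} v∈?Y u∈J u∈Y cl w∈J with w ∈? Y | v∈?Y
          ... | yes w∈Y | _ = w∈Y
          ... | no w∉Y | yes v∈Y = ⊥-elim (none (Y , v∈Y , cl , w , w∈J , w∉Y))
          -- By symmetry of adjacency the complement of Y is closed too. It contains v and misses u,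
          -- so it would have allowed another cut.
          ... | no w∉Y | no v∉Y = ⊥-elim (none (sub C? , in⁺ C? v∉Y ,
                  (λ a b aJ bJ a∈ ab → in⁺ C? λ bY → in⁻ C? a∈ (cl b a bJ aJ bY (symm G ab))) ,
                  u , u∈J , (λ m → in⁻ C? m u∈Y)))
            where
            C? : Decidable (_∉ Y)
            C? z = ¬? (z ∈? Y)

    abstract
      component : ∀ G X v → Component G X v
      component = component′

-- Minimal ears that leave the undrawn part connected

module Ears where

  open import Data.Empty using (⊥; ⊥-elim)
  open import Data.Fin.Base using (Fin)
  open import Data.Fin.Properties using (any?; _≟_)
  open import Data.Fin.Subset using (Subset; _∈_; _∉_; _⊆_; ∣_∣)
  open import Data.Fin.Subset.Properties using (_∈?_)
  open import Data.Nat.Base using (ℕ; _<_)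
  open import Data.Nat.Induction using (<-wellFounded)
  open import Data.Product.Base using (∃; _×_; _,_; proj₁; proj₂)
  open import Data.Sum.Base using (_⊎_; inj₁; inj₂; [_,_]′)
  open import Induction.WellFounded using (Acc; acc)
  open import Relation.Binary.PropositionalEquality
  open import Relation.Nullary
  open import Relation.Nullary.Decidable using (_×-dec_; _⊎-dec_; ¬?)
  open import Relation.Unary using (Decidable)
  open Sets

  module _ {n : ℕ} where

    conn-join : ∀ {G : Graph n} {X Z W x z} → Conn G X → Conn G Z → x ∈ X → z ∈ Z → Adj G x z →
                X ⊆ W → Z ⊆ W → (∀ {v} → v ∈ W → v ∈ X ⊎ v ∈ Z) → Conn G W
    conn-join {G} {X} {Z} {W} {x} {z} cX cZ x∈ z∈ xz X⊆ Z⊆ W⊆ = connected λ Y {u} {v} u∈W u∈Y cl v∈W → go Y u∈W u∈Y cl v∈W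
      where
     module _ Y {u v} (u∈W : u ∈ W) (u∈Y : u ∈ Y) (cl : Closed G W Y) (v∈W : v ∈ W) where
      clX : Closed G X Y
      clX a b a∈ b∈ = cl a b (X⊆ a∈) (X⊆ b∈)
      clZ : Closed G Z Y
      clZ a b a∈ b∈ = cl a b (Z⊆ a∈) (Z⊆ b∈)
      xz∈Y : x ∈ Y × z ∈ Y
      xz∈Y with W⊆ u∈W
      ... | inj₁ u∈X = let xY = spread cX Y u∈X u∈Y clX x∈ in xY , cl x z (X⊆ x∈) (Z⊆ z∈) xY xz
      ... | inj₂ u∈Z = let zY = spread cZ Y u∈Z u∈Y clZ z∈ in cl z x (Z⊆ z∈) (X⊆ x∈) zY (symm G xz) , zY
      xY = proj₁ xz∈Y
      zY = proj₂ xz∈Y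
      go : v ∈ Y
      go = [ (λ v∈X → spread cX Y x∈ xY clX v∈X) , (λ v∈Z → spread cZ Y z∈ zY clZ v∈Z) ]′ (W⊆ v∈W)

    conn-single : ∀ {G : Graph n} {X y} → (∀ {v} → v ∈ X → v ≡ y) → Conn G X
    conn-single only = connected λ Y u∈X u∈Y _ v∈X → subst (_∈ Y) (trans (only u∈X) (sym (only v∈X))) u∈Y

    single? : (y : Fin n) → Decidable (_≡ y)
    single? y v = v ≟ y

    conn-add : ∀ {G : Graph n} {X W x y} → Conn G X → x ∈ X → Adj G x y →
               X ⊆ W → y ∈ W → (∀ {v} → v ∈ W → v ∈ X ⊎ v ≡ y) → Conn G W
    conn-add {y = y} cX x∈ xy X⊆ y∈ W⊆ =
      conn-join cX (conn-single {X = sub (single? y)} {y} (in⁻ (single? y)))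
        x∈ (in⁺ (single? y) refl) xy X⊆
        (λ m → subst (_∈ _) (sym (in⁻ (single? y) m)) y∈)
        (λ m → [ inj₁ , (λ e → inj₂ (in⁺ (single? y) e)) ]′ (W⊆ m))

    _≁_ : Subset n → Subset n → Set
    X ≁ Y = ∀ {v} → v ∈ X → v ∉ Y

    -- The form of 3-connectedness that the sweep uses. The case a ≡ b is included, so cut vertices
    -- are excluded together with separating pairs.
    NoCut : Graph n → Subset n → Set
    NoCut G S = ∀ a b M → a ∈ S → b ∈ S → a ∉ M → b ∉ M → M ⊆ S → ∀ {m} → m ∈ M →
      (∀ u v → u ∈ M → v ∈ S → Adj G u v → v ∈ M ⊎ v ≡ a ⊎ v ≡ b) →
      ∀ z → z ∈ S → z ∈ M ⊎ z ≡ a ⊎ z ≡ b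

    Touch : Graph n → Subset n → Fin n → Set
    Touch G X p = ∃ λ u → u ∈ X × Adj G u p

    touch? : ∀ G X p → Dec (Touch G X p)
    touch? G X p = any? λ u → (u ∈? X) ×-dec adj? G u p

    Touch₂ : Graph n → Subset n → Subset n → Set
    Touch₂ G Q X = ∃ λ p → ∃ λ q → p ∈ Q × q ∈ Q × p ≢ q × Touch G X p × Touch G X q

    touch₂? : ∀ G Q X → Dec (Touch₂ G Q X)
    touch₂? G Q X = any? λ p → any? λ q → (p ∈? Q) ×-dec ((q ∈? Q) ×-dec
      (¬? (p ≟ q) ×-dec (touch? G X p ×-dec touch? G X q)))

    touch-mono : ∀ {G X Y p} → X ⊆ Y → Touch G X p → Touch G Y p
    touch-mono X⊆Y (u , u∈ , up) = u , X⊆Y u∈ , up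

    -- Q is drawn, R is not; P is drawn next and K stays behind, connected and around t. By
    -- `minimal`, P is an induced path, and if it has several vertices only its ends touch Q.
    -- `nearK` joins P to K, which the obstructions need as an edge between two branch sets.
    record Ear (G : Graph n) (Q R : Subset n) (t : Fin n) : Set where
      field
        P K    : Subset n
        P⊆R    : P ⊆ R
        K⊆R    : K ⊆ R
        split  : ∀ {v} → v ∈ R → v ∈ P ⊎ v ∈ K
        disj   : P ≁ K
        t∈K    : t ∈ K
        connK  : Conn G K
        connP  : Conn G P
        two    : Touch₂ G Q P
        nearK  : ∀ {z} → z ∈ P → Touch G K z
        minimal : ∀ X → X ⊆ P → Conn G X → Touch₂ G Q X → P ⊆ X

    module _ {G : Graph n} {S : Subset n} (nc : NoCut G S)
             {Q R : Subset n} (Q⊆S : Q ⊆ S) (R⊆S : R ⊆ S)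
             (QR : ∀ {v} → v ∈ S → v ∈ Q ⊎ v ∈ R) (Q≁R : Q ≁ R)
             {t} (t∈R : t ∈ R) (connR : Conn G R)
             {q₁ q₂} (q₁∈Q : q₁ ∈ Q) (q₂∈Q : q₂ ∈ Q) (q₁≢q₂ : q₁ ≢ q₂) where

      private
        only : ∀ {X p q} → ¬ Touch₂ G Q X → p ∈ Q → q ∈ Q → Touch G X p → Touch G X q → p ≡ q
        only {p = p} {q} ntw p∈ q∈ tp tq with p ≟ q
        ... | yes e = e
        ... | no ne = ⊥-elim (ntw (p , q , p∈ , q∈ , ne , tp , tq))

        removal? : (P : Subset n) (y : Fin n) → Decidable (λ u → u ∈ P × u ≢ y)
        removal? P y u = (u ∈? P) ×-dec ¬? (u ≟ y)

        _∖_ : Subset n → Fin n → Subset n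
        P ∖ y = sub (removal? P y)

        rest? : (K : Subset n) → Decidable (λ v → v ∈ R × v ∉ K)
        rest? K v = (v ∈? R) ×-dec ¬? (v ∈? K)

        plus? : (K : Subset n) (y : Fin n) → Decidable (λ v → v ∈ K ⊎ v ≡ y)
        plus? K y v = (v ∈? K) ⊎-dec (v ≟ y)

        -- Invariant of the search for an ear: `closed` and `connP` make P a whole component of R
        -- without K.
        record Split (K P : Subset n) : Set where
          field
            K⊆R    : K ⊆ R
            P⊆R    : P ⊆ R
            disj   : P ≁ K
            t∈K    : t ∈ K
            connK  : Conn G K
            connP  : Conn G P
            closed : ∀ {u v} → u ∈ P → v ∈ R → v ∉ K → Adj G u v → v ∈ P
            two    : Touch₂ G Q P

        -- The search has come to a halt: `outer` says that K can absorb nothing outside of P,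
        -- `inner` that it can absorb no vertex of P without leaving only pieces with fewer than two
        -- attachments.
        module Final {K P} (s : Split K P)
            (outer : ∀ {y} → y ∈ R → y ∉ K → y ∉ P → ¬ Touch G K y)
            (inner : ∀ {y v} → y ∈ P → Touch G K y → v ∈ P ∖ y →
                     ¬ Touch₂ G Q (Component.set (component G (P ∖ y) v))) where
          open Split s

          split : ∀ {v} → v ∈ R → v ∈ P ⊎ v ∈ K
          split v∈R = conn-ind connR (λ v → (v ∈? P) ⊎-dec (v ∈? K))
            (λ { u v u∈R v∈R (inj₁ u∈P) uv → [ inj₂ , (λ v∉K → inj₁ (closed u∈P v∈R v∉K uv)) ]′ (dec v)
               ; u v u∈R v∈R (inj₂ u∈K) uv → [ inj₂ , (λ v∉K → [ inj₁ , (λ v∉P →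
                    ⊥-elim (outer v∈R v∉K v∉P (u , u∈K , uv))) ]′ (decP v)) ]′ (dec v) })
            t∈R (inj₂ t∈K) v∈R
            where
            dec : ∀ v → v ∈ K ⊎ v ∉ K
            dec v with v ∈? K
            ... | yes m = inj₁ m
            ... | no m = inj₂ m
            decP : ∀ v → v ∈ P ⊎ v ∉ P
            decP v with v ∈? P
            ... | yes m = inj₁ m
            ... | no m = inj₂ m

          -- A component M of the part of P without neighbours in K is cut off by
          -- its neighbours y: the component E y of M in P - y sees one vertex of
          -- Q only, while any two of the sets E y cover P.
          module Far {z₀} (z₀∈P : z₀ ∈ P) (far : ¬ Touch G K z₀) where
            D? : Decidable (λ v → v ∈ P × ¬ Touch G K v)
            D? v = (v ∈? P) ×-dec ¬? (touch? G K v)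
            module M = Component (component G (sub D?) z₀)
            z₀∈D = in⁺ D? (z₀∈P , far)
            M⊆P : M.set ⊆ P
            M⊆P m = proj₁ (in⁻ D? (M.⊆X m))
            z₀∈M = M.root z₀∈D

            Y? : Decidable (λ y → y ∈ P × y ∉ M.set × Touch G M.set y)
            Y? y = (y ∈? P) ×-dec (¬? (y ∈? M.set) ×-dec touch? G M.set y)
            Y = sub Y?

            out : ∀ {u v} → u ∈ M.set → v ∈ S → Adj G u v → v ∉ M.set → v ∈ Y ⊎ v ∈ Q × Touch G M.set v
            out {u} {v} u∈ v∈S uv v∉M with QR v∈S
            ... | inj₁ v∈Q = inj₂ (v∈Q , u , u∈ , uv)
            ... | inj₂ v∈R with split v∈R
            ...   | inj₁ v∈P = inj₁ (in⁺ Y? (v∈P , v∉M , u , u∈ , uv))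
            ...   | inj₂ v∈K = ⊥-elim (proj₂ (in⁻ D? (M.⊆X u∈)) (v , v∈K , symm G uv))

            Y-near : ∀ {y} → y ∈ Y → Touch G K y
            Y-near {y} y∈ with in⁻ Y? y∈
            ... | y∈P , y∉M , u , u∈ , uy with touch? G K y
            ...   | yes tk = tk
            ...   | no nk = ⊥-elim (y∉M (M.closed u∈ (in⁺ D? (y∈P , nk)) uy))

            module E (y : Fin n) = Component (component G (P ∖ y) z₀)

            module _ {y} (y∈Y : y ∈ Y) where
              y∈P = proj₁ (in⁻ Y? y∈Y)
              y∉M = proj₁ (proj₂ (in⁻ Y? y∈Y))
              M⊆P∖y : M.set ⊆ P ∖ y
              M⊆P∖y m = in⁺ (removal? P y) (M⊆P m , λ { refl → y∉M m })
              E-root = E.root y (M⊆P∖y z₀∈M)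
              M⊆E : M.set ⊆ E.set y
              M⊆E m = spread (M.conn z₀∈D) (E.set y) z₀∈M E-root
                (λ a b _ b∈ a∈ ab → E.closed y a∈ (M⊆P∖y b∈) ab) m
              ¬two : ¬ Touch₂ G Q (E.set y)
              ¬two = inner y∈P (Y-near y∈Y) (M⊆P∖y z₀∈M)

            -- y itself lies in E y′ because it is adjacent to M.
            cover : ∀ {y y′} → y ∈ Y → y′ ∈ Y → y ≢ y′ → ∀ {v} → v ∈ P → v ∈ E.set y ⊎ v ∈ E.set y′
            cover {y} {y′} y∈ y′∈ ne = conn-ind connP
              (λ v → (v ∈? E.set y) ⊎-dec (v ∈? E.set y′)) step z₀∈P (inj₁ (E-root y∈))
              where
              mid : ∀ {y y′} → y ∈ Y → y′ ∈ Y → y ≢ y′ → y ∈ E.set y′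
              mid {y} {y′} y∈ y′∈ ne with in⁻ Y? y∈
              ... | yP , _ , u , u∈ , uy = E.closed y′ (M⊆E y′∈ u∈) (in⁺ (removal? P y′) (yP , ne)) uy
              step : ∀ u v → u ∈ P → v ∈ P → u ∈ E.set y ⊎ u ∈ E.set y′ → Adj G u v →
                     v ∈ E.set y ⊎ v ∈ E.set y′
              step u v _ vP (inj₁ uE) uv with v ≟ y
              ... | yes refl = inj₂ (mid y∈ y′∈ ne)
              ... | no v≢y = inj₁ (E.closed y uE (in⁺ (removal? P y) (vP , v≢y)) uv)
              step u v _ vP (inj₂ uE) uv with v ≟ y′
              ... | yes refl = inj₁ (mid y′∈ y∈ (≢-sym ne))
              ... | no v≢y = inj₂ (E.closed y′ uE (in⁺ (removal? P y′) (vP , v≢y)) uv)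

            seen : ∀ {y y′ p} → y ∈ Y → y′ ∈ Y → y ≢ y′ → Touch G P p → Touch G (E.set y) p ⊎ Touch G (E.set y′) p
            seen y∈ y′∈ ne (u , u∈ , up) with cover y∈ y′∈ ne u∈
            ... | inj₁ m = inj₁ (u , m , up)
            ... | inj₂ m = inj₂ (u , m , up)

            -- Any two of the three sets `E.set y` cover P, so p is seen from at least two of them,
            -- and so is q. Hence one of the three sees both, against `¬two`.
            no-three : ∀ {y₁ y₂ y₃} → y₁ ∈ Y → y₂ ∈ Y → y₃ ∈ Y → y₁ ≢ y₂ → y₁ ≢ y₃ → y₂ ≢ y₃ → ⊥
            no-three {y₁} {y₂} {y₃} ∈₁ ∈₂ ∈₃ n₁₂ n₁₃ n₂₃ with two
            ... | p , q , p∈ , q∈ , p≢q , tp , tq = case₁ (seen ∈₁ ∈₂ n₁₂ tp)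
              where
              both : ∀ {y} → y ∈ Y → Touch G (E.set y) p → Touch G (E.set y) q → ⊥
              both y∈ a b = ¬two y∈ (p , q , p∈ , q∈ , p≢q , a , b)
              case₂ : Touch G (E.set y₁) p → ⊥
              case₂ p₁ = [ (λ q₁ → both ∈₁ p₁ q₁) , (λ q₂ → [ (λ p₂ → both ∈₂ p₂ q₂) , (λ p₃ →
                [ (λ q₁ → both ∈₁ p₁ q₁) , (λ q₃ → both ∈₃ p₃ q₃) ]′ (seen ∈₁ ∈₃ n₁₃ tq)) ]′
                (seen ∈₂ ∈₃ n₂₃ tp)) ]′ (seen ∈₁ ∈₂ n₁₂ tq)
              case₁ : Touch G (E.set y₁) p ⊎ Touch G (E.set y₂) p → ⊥
              case₁ (inj₁ p₁) = case₂ p₁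
              case₁ (inj₂ p₂) = [ case₂ , (λ p₃ → [ (λ q₂ → both ∈₂ p₂ q₂) , (λ q₃ → both ∈₃ p₃ q₃) ]′
                (seen ∈₂ ∈₃ n₂₃ tq)) ]′ (seen ∈₁ ∈₃ n₁₃ tp)

            -- Each `E.set y` contains M and so sees m, and nothing else of Q. As two of them cover
            -- P, m would be the only attachment of P.
            no-more : ∀ {y₁ y₂ m} → y₁ ∈ Y → y₂ ∈ Y → y₁ ≢ y₂ → m ∈ Q → Touch G M.set m → ⊥
            no-more ∈₁ ∈₂ ne m∈ tm with two
            ... | p , q , p∈ , q∈ , p≢q , tp , tq = p≢q (trans (is-m p∈ tp) (sym (is-m q∈ tq)))
              where
              is-m : ∀ {p} → p ∈ Q → Touch G P p → p ≡ _
              is-m p∈ tp with seen ∈₁ ∈₂ ne tp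
              ... | inj₁ a = only (¬two ∈₁) p∈ m∈ a (touch-mono {G = G} (M⊆E ∈₁) tm)
              ... | inj₂ a = only (¬two ∈₂) p∈ m∈ a (touch-mono {G = G} (M⊆E ∈₂) tm)

            -- If all outer neighbours of M are among a and b, `NoCut` leaves no place for t.
            absurd : ∀ {a b} → a ∈ S → b ∈ S → a ∉ M.set → b ∉ M.set → a ≢ t → b ≢ t →
                     (∀ {v} → v ∈ Y → v ≡ a ⊎ v ≡ b) →
                     (∀ {v} → v ∈ Q → Touch G M.set v → v ≡ a ⊎ v ≡ b) → ⊥
            absurd {a} {b} a∈ b∈ a∉ b∉ a≢t b≢t onY onQ with
              nc a b M.set a∈ b∈ a∉ b∉ (λ m → R⊆S (P⊆R (M⊆P m))) z₀∈M nbr t (R⊆S t∈R)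
              where
              nbr : ∀ u v → u ∈ M.set → v ∈ S → Adj G u v → v ∈ M.set ⊎ v ≡ a ⊎ v ≡ b
              nbr u v u∈ v∈S uv with v ∈? M.set
              ... | yes m = inj₁ m
              ... | no v∉M with out u∈ v∈S uv v∉M
              ...   | inj₁ y = inj₂ (onY y)
              ...   | inj₂ (v∈Q , tv) = inj₂ (onQ v∈Q tv)
            ... | inj₁ t∈M = disj (M⊆P t∈M) t∈K
            ... | inj₂ (inj₁ e) = a≢t (sym e)
            ... | inj₂ (inj₂ e) = b≢t (sym e)

            -- Otherwise M is closed in R, and the connectedness of R puts t into M.
            Y-nonempty : ∃ λ y → y ∈ Y
            Y-nonempty with any? (λ y → y ∈? Y)
            ... | yes w = w
            ... | no none = ⊥-elim (disj (P∋ (conn-ind connR (λ v → v ∈? M.set) step (P⊆R z₀∈P) z₀∈M t∈R)) t∈K)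
              where
              P∋ : t ∈ M.set → t ∈ P
              P∋ = M⊆P
              step : ∀ u v → u ∈ R → v ∈ R → u ∈ M.set → Adj G u v → v ∈ M.set
              step u v _ v∈R u∈ uv with v ∈? M.set
              ... | yes m = m
              ... | no v∉ with out u∈ (R⊆S v∈R) uv v∉
              ...   | inj₁ y = ⊥-elim (none (v , y))
              ...   | inj₂ (v∈Q , _) = ⊥-elim (Q≁R v∈Q v∈R)

            P∌t : ∀ {v} → v ∈ P → v ≢ t
            P∌t v∈ refl = disj v∈ t∈K
            Q∌t : ∀ {v} → v ∈ Q → v ≢ t
            Q∌t v∈ refl = Q≁R v∈ t∈R
            P⊆S : P ⊆ S
            P⊆S v∈ = R⊆S (P⊆R v∈)

            -- In every case M has at most two outer neighbours: one y and one vertex of Q, or one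
            -- or two vertices of Y.
            contradiction-far : ⊥
            contradiction-far with Y-nonempty
            ... | y , y∈ with any? (λ m → (m ∈? Q) ×-dec touch? G M.set m)
            ...   | yes (m , m∈ , tm) =
                    absurd (P⊆S (y∈P y∈)) (Q⊆S m∈) (y∉M y∈) (λ m∈M → Q≁R m∈ (P⊆R (M⊆P m∈M)))
                      (P∌t (y∈P y∈)) (Q∌t m∈)
                      (λ {v} v∈ → [ (λ e → inj₁ e) , (λ ne → ⊥-elim (no-more v∈ y∈ ne m∈ tm)) ]′ (dec≡ v y))
                      (λ v∈ tv → inj₂ (only (λ tw → ¬two y∈ (mono₂ tw)) v∈ m∈ tv tm))
              where
              dec≡ : ∀ (v y : Fin n) → v ≡ y ⊎ v ≢ y
              dec≡ v y with v ≟ y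
              ... | yes e = inj₁ e
              ... | no ne = inj₂ ne
              mono₂ : Touch₂ G Q M.set → Touch₂ G Q (E.set y)
              mono₂ (p , q , a , b , c , d , e) = p , q , a , b , c ,
                touch-mono {G = G} (M⊆E y∈) d , touch-mono {G = G} (M⊆E y∈) e
            ...   | no noQ with any? (λ y′ → (y′ ∈? Y) ×-dec ¬? (y ≟ y′))
            ...     | no same =
                      absurd (P⊆S (y∈P y∈)) (P⊆S (y∈P y∈)) (y∉M y∈) (y∉M y∈) (P∌t (y∈P y∈)) (P∌t (y∈P y∈))
                        (λ {v} v∈ → inj₁ (eq v∈)) (λ v∈ tv → ⊥-elim (noQ (_ , v∈ , tv)))
              where
              eq : ∀ {v} → v ∈ Y → v ≡ y
              eq {v} v∈ with y ≟ v
              ... | yes e = sym e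
              ... | no ne = ⊥-elim (same (v , v∈ , ne))
            ...     | yes (y′ , y′∈ , y≢y′) =
                      absurd (P⊆S (y∈P y∈)) (P⊆S (y∈P y′∈)) (y∉M y∈) (y∉M y′∈) (P∌t (y∈P y∈)) (P∌t (y∈P y′∈))
                        eq (λ v∈ tv → ⊥-elim (noQ (_ , v∈ , tv)))
              where
              eq : ∀ {v} → v ∈ Y → v ≡ y ⊎ v ≡ y′
              eq {v} v∈ with v ≟ y | v ≟ y′
              ... | yes e | _ = inj₁ e
              ... | no _ | yes e = inj₂ e
              ... | no n₁ | no n₂ = ⊥-elim (no-three y∈ y′∈ v∈ y≢y′ (≢-sym n₁) (≢-sym n₂))

          near : ∀ {z} → z ∈ P → Touch G K z
          near {z} z∈ with touch? G K z
          ... | yes tk = tk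
          ... | no nk = ⊥-elim (Far.contradiction-far z∈ nk)

          -- If X misses z, it lies in one component of P - z, which then has two attachments. Since
          -- z has a neighbour in K, K could have absorbed z.
          min : ∀ X → X ⊆ P → Conn G X → Touch₂ G Q X → P ⊆ X
          min X X⊆ cX tX@(_ , _ , _ , _ , _ , (x , x∈X , _) , _) {z} z∈ with z ∈? X
          ... | yes m = m
          ... | no z∉X = ⊥-elim (inner z∈ (near z∈) (X⊆P∖z x∈X) (mono tX))
            where
            module C = Component (component G (P ∖ z) x)
            X⊆P∖z : X ⊆ P ∖ z
            X⊆P∖z m = in⁺ (removal? P z) (X⊆ m , λ { refl → z∉X m })
            X⊆C : X ⊆ C.set
            X⊆C m = spread cX C.set x∈X (C.root (X⊆P∖z x∈X)) (λ a b _ b∈ a∈ ab → C.closed a∈ (X⊆P∖z b∈) ab) m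
            mono : Touch₂ G Q X → Touch₂ G Q C.set
            mono (p , q , a , b , c , d , e) = p , q , a , b , c ,
              touch-mono {G = G} X⊆C d , touch-mono {G = G} X⊆C e

          ear : Ear G Q R t
          ear = record { P = P ; K = K ; P⊆R = P⊆R ; K⊆R = K⊆R ; split = split ; disj = disj ; t∈K = t∈K
                       ; connK = connK ; connP = connP ; two = two ; nearK = near ; minimal = min }

        grow : ∀ {K P} (s : Split K P) {y} → y ∈ R → y ∉ K → Touch G K y →
               ∀ {J} → J ⊆ R → J ≁ K → y ∉ J → Conn G J →
               (∀ {u v} → u ∈ J → v ∈ R → v ∉ K → v ≢ y → Adj G u v → v ∈ J) → Touch₂ G Q J →
               Split (sub (plus? K y)) J
        grow {K} s {y} y∈R y∉K (k , k∈ , ky) J⊆R J≁K y∉J cJ clJ tJ = record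
          { K⊆R = λ m → [ K⊆R , (λ { refl → y∈R }) ]′ (in⁻ (plus? K y) m)
          ; P⊆R = J⊆R
          ; disj = λ m m′ → [ J≁K m , (λ { refl → y∉J m }) ]′ (in⁻ (plus? K y) m′)
          ; t∈K = in⁺ (plus? K y) (inj₁ t∈K)
          ; connK = conn-add connK k∈ ky (λ m → in⁺ (plus? K y) (inj₁ m)) (in⁺ (plus? K y) (inj₂ refl)) (in⁻ (plus? K y))
          ; connP = cJ
          ; closed = λ u∈ v∈R v∉ → clJ u∈ v∈R (λ m → v∉ (in⁺ (plus? K y) (inj₁ m))) (λ e → v∉ (in⁺ (plus? K y) (inj₂ e)))
          ; two = tJ }
          where
          open Split s

        -- K absorbs one vertex per round, first from outside of P, otherwise a vertex y of P such
        -- that some component of P - y keeps two attachments; that component becomes the new P. The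
        -- part of R outside of K decreases.
        loop : ∀ {K P} → Split K P → Acc _<_ ∣ sub (rest? K) ∣ → Ear G Q R t
        loop {K} {P} s (acc rs) with any? (λ y → (y ∈? R) ×-dec (¬? (y ∈? K) ×-dec (¬? (y ∈? P) ×-dec touch? G K y)))
        ... | yes (y , y∈R , y∉K , y∉P , tk) =
              loop (grow s y∈R y∉K tk P⊆R disj y∉P connP (λ u∈ v∈ v∉ _ → closed u∈ v∈ v∉) two)
                   (rs (card-< (λ m → in⁺ (rest? K) (proj₁ (in⁻ (rest? _) m) ,
                          λ m′ → proj₂ (in⁻ (rest? _) m) (in⁺ (plus? K y) (inj₁ m′))))
                        (in⁺ (rest? K) (y∈R , y∉K))
                        (λ m → proj₂ (in⁻ (rest? _) m) (in⁺ (plus? K y) (inj₂ refl)))))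
          where
          open Split s
        ... | no none with any? (λ y → any? (λ v → (y ∈? P) ×-dec (touch? G K y ×-dec ((v ∈? (P ∖ y)) ×-dec
                            touch₂? G Q (Component.set (component G (P ∖ y) v))))))
        ...   | no none₂ = Final.ear s (λ a b c d → none (_ , a , b , c , d)) (λ a b c d → none₂ (_ , _ , a , b , c , d))
        ...   | yes (y , v , y∈P , tk , v∈ , tw) =
              loop (grow s (P⊆R y∈P) (disj y∈P) tk (λ m → P⊆R (J⊆P m)) (λ m → disj (J⊆P m))
                      (λ m → proj₂ (in⁻ (removal? P y) (J.⊆X m)) refl) (J.conn v∈)
                      (λ u∈ w∈ w∉ ne uw → J.closed u∈ (in⁺ (removal? P y) (closed (J⊆P u∈) w∈ w∉ uw , ne)) uw) tw)
                   (rs (card-< (λ m → in⁺ (rest? K) (proj₁ (in⁻ (rest? _) m) ,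
                          λ m′ → proj₂ (in⁻ (rest? _) m) (in⁺ (plus? K y) (inj₁ m′))))
                        (in⁺ (rest? K) (P⊆R y∈P , disj y∈P))
                        (λ m → proj₂ (in⁻ (rest? _) m) (in⁺ (plus? K y) (inj₂ refl)))))
          where
          open Split s
          module J = Component (component G (P ∖ y) v)
          J⊆P : J.set ⊆ P
          J⊆P m = proj₁ (in⁻ (removal? P y) (J.⊆X m))

      exists-ear : ∀ {r} → r ∈ R → r ≢ t → Ear G Q R t
      exists-ear {r} r∈R r≢t = loop start (<-wellFounded _)
        where
        module J = Component (component G (R ∖ t) r)
        r∈ = in⁺ (removal? R t) (r∈R , r≢t)
        J⊆R : J.set ⊆ R
        J⊆R m = proj₁ (in⁻ (removal? R t) (J.⊆X m))
        J∌t : t ∉ J.set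
        J∌t m = proj₂ (in⁻ (removal? R t) (J.⊆X m)) refl
        -- Then t and q separate J from the rest of Q, and q₁ ≢ q₂ shows that there is such a rest.
        stuck : ∀ q → q ∈ Q → (∀ {v} → v ∈ Q → Touch G J.set v → v ≡ q) → ⊥
        stuck q q∈ all = q₁≢q₂ (trans (is-q q₁∈Q) (sym (is-q q₂∈Q)))
          where
          nbr : ∀ u v → u ∈ J.set → v ∈ S → Adj G u v → v ∈ J.set ⊎ v ≡ t ⊎ v ≡ q
          nbr u v u∈ v∈S uv with v ≟ t
          ... | yes e = inj₂ (inj₁ e)
          ... | no v≢t with QR v∈S
          ...   | inj₁ v∈Q = inj₂ (inj₂ (all v∈Q (u , u∈ , uv)))
          ...   | inj₂ v∈R = inj₁ (J.closed u∈ (in⁺ (removal? R t) (v∈R , v≢t)) uv)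
          is-q : ∀ {v} → v ∈ Q → v ≡ q
          is-q {v} v∈ with nc t q J.set (R⊆S t∈R) (Q⊆S q∈) J∌t (λ m → Q≁R q∈ (J⊆R m))
                            (λ m → R⊆S (J⊆R m)) (J.root r∈) nbr v (Q⊆S v∈)
          ... | inj₁ m = ⊥-elim (Q≁R v∈ (J⊆R m))
          ... | inj₂ (inj₁ refl) = ⊥-elim (Q≁R v∈ t∈R)
          ... | inj₂ (inj₂ e) = e
        twoJ : Touch₂ G Q J.set
        twoJ with touch₂? G Q J.set
        ... | yes tw = tw
        ... | no ntw with any? (λ q → (q ∈? Q) ×-dec touch? G J.set q)
        ...   | yes (q , q∈ , tq) = ⊥-elim (stuck q q∈ (λ v∈ tv → only ntw v∈ q∈ tv tq))
        ...   | no nq = ⊥-elim (stuck q₁ q₁∈Q (λ v∈ tv → ⊥-elim (nq (_ , v∈ , tv))))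
        start : Split (sub (single? t)) J.set
        start = record
          { K⊆R = λ m → subst (_∈ R) (sym (in⁻ (single? t) m)) t∈R
          ; P⊆R = J⊆R
          ; disj = λ m m′ → J∌t (subst (_∈ J.set) (in⁻ (single? t) m′) m)
          ; t∈K = in⁺ (single? t) refl
          ; connK = conn-single (in⁻ (single? t))
          ; connP = J.conn r∈
          ; closed = λ u∈ v∈R v∉ uv → J.closed u∈ (in⁺ (removal? R t) (v∈R , λ { refl → v∉ (in⁺ (single? t) refl) })) uv
          ; two = twoJ }

-- Models of K₅ and K₃,₃ around a cycle

module Obstructions where

  open import Data.Empty using (⊥-elim)
  open import Data.Fin.Base using (Fin; zero; suc; splitAt)
  open import Data.Fin.Patterns
  open import Data.Fin.Properties using (_≟_)
  open import Data.Fin.Subset using (Subset; _∈_; _∉_; _⊆_)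
  open import Data.List.Base using (List; []; _∷_; _++_; [_])
  import Data.List.Membership.DecPropositional as DecMem
  open import Data.List.Membership.Propositional using () renaming (_∈_ to _∈ˡ_; _∉_ to _∉ˡ_)
  open import Data.List.Membership.Propositional.Properties using (∈-++⁺ˡ; ∈-++⁺ʳ; ∈-++⁻)
  open import Data.List.Relation.Unary.All as All using (All; []; _∷_)
  open import Data.List.Relation.Unary.AllPairs using ([]; _∷_)
  open import Data.List.Relation.Unary.Any using (here; there)
  open import Data.List.Relation.Unary.Unique.Propositional using (Unique)
  open import Data.Nat.Base using (ℕ)
  open import Data.Product.Base using (∃; ∃₂; _×_; _,_; proj₁; proj₂)
  open import Data.Sum.Base using (_⊎_; inj₁; inj₂; [_,_]′)
  open import Data.Vec.Base as Vec using (Vec; []; _∷_; lookup)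
  open import Data.Vec.Properties using (lookup-splitAt)
  import Data.Vec.Relation.Unary.All as VAll
  open VAll using ([]; _∷_)
  open import Data.Vec.Relation.Unary.All.Properties using (lookup⁺)
  open import Relation.Binary.PropositionalEquality hiding ([_])
  open import Relation.Nullary
  open import Relation.Unary using (Decidable)
  open Sets
  open Ears

  module _ {n : ℕ} where

    Join : Graph n → Subset n → Subset n → Set
    Join G X Y = ∃₂ λ u v → u ∈ X × v ∈ Y × Adj G u v

    join-sym : ∀ (G : Graph n) {X Y} → Join G X Y → Join G Y X
    join-sym G (u , v , u∈ , v∈ , uv) = v , u , v∈ , u∈ , symm G uv

    -- Branch sets of a minor. Only the edges of H have to be present, and S need not be exhausted;
    -- `model⇒minor` turns a model into a sequence of deletions and contractions.
    record Model {k} (H : Graph k) (S : Subset n) (G : Graph n) : Set where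
      field
        branch   : Fin k → Subset n
        inside   : ∀ i → branch i ⊆ S
        disjoint : ∀ {i j v} → v ∈ branch i → v ∈ branch j → i ≡ j
        nonempty : ∀ i → ∃ λ v → v ∈ branch i
        conn     : ∀ i → Conn G (branch i)
        edge     : ∀ i j → Adj H i j → Join G (branch i) (branch j)

    data Disjoint : ∀ {k} → Vec (Subset n) k → Set where
      []  : Disjoint []
      _∷_ : ∀ {k X} {Xs : Vec (Subset n) k} → VAll.All (X ≁_) Xs → Disjoint Xs → Disjoint (X ∷ Xs)

    disjoint-lookup : ∀ {k} {Xs : Vec (Subset n) k} → Disjoint Xs →
                      ∀ i j {v} → v ∈ lookup Xs i → v ∈ lookup Xs j → i ≡ j
    disjoint-lookup (_ ∷ _) zero zero _ _ = refl
    disjoint-lookup (d ∷ _) zero (suc j) v∈ w∈ = ⊥-elim (lookup⁺ d j v∈ w∈)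
    disjoint-lookup (d ∷ _) (suc i) zero v∈ w∈ = ⊥-elim (lookup⁺ d i w∈ v∈)
    disjoint-lookup (_ ∷ ds) (suc i) (suc j) v∈ w∈ = cong suc (disjoint-lookup ds i j v∈ w∈)

    Block : Graph n → Subset n → Subset n → Set
    Block G S X = X ⊆ S × (∃ λ v → v ∈ X) × Conn G X

    data Joined (G : Graph n) : ∀ {k} → Vec (Subset n) k → Set where
      []  : Joined G []
      _∷_ : ∀ {k X} {Xs : Vec (Subset n) k} → VAll.All (Join G X) Xs → Joined G Xs → Joined G (X ∷ Xs)

    joined-lookup : ∀ {G k} {Xs : Vec (Subset n) k} → Joined G Xs →
                    ∀ i j → i ≢ j → Join G (lookup Xs i) (lookup Xs j)
    joined-lookup (_ ∷ _) zero zero ne = ⊥-elim (ne refl)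
    joined-lookup (d ∷ _) zero (suc j) _ = lookup⁺ d j
    joined-lookup {G} (d ∷ _) (suc i) zero _ = join-sym G (lookup⁺ d i)
    joined-lookup (_ ∷ ds) (suc i) (suc j) ne = joined-lookup ds i j (λ e → ne (cong suc e))

    K₅-model : ∀ {G S} (Xs : Vec (Subset n) 5) → Disjoint Xs → VAll.All (Block G S) Xs →
               Joined G Xs → Model K₅ S G
    K₅-model Xs d bs js = record
      { branch = lookup Xs
      ; inside = λ i → proj₁ (lookup⁺ bs i)
      ; disjoint = λ {i} {j} → disjoint-lookup d i j
      ; nonempty = λ i → proj₁ (proj₂ (lookup⁺ bs i))
      ; conn = λ i → proj₂ (proj₂ (lookup⁺ bs i))
      ; edge = joined-lookup js }

    K₃,₃-model : ∀ {G S} (As Bs : Vec (Subset n) 3) → Disjoint (As Vec.++ Bs) → VAll.All (Block G S) (As Vec.++ Bs) →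
                 VAll.All (λ A → VAll.All (Join G A) Bs) As → Model K₃,₃ S G
    K₃,₃-model {G} As Bs d bs js = record
      { branch = lookup (As Vec.++ Bs)
      ; inside = λ i → proj₁ (lookup⁺ bs i)
      ; disjoint = λ {i} {j} → disjoint-lookup d i j
      ; nonempty = λ i → proj₁ (proj₂ (lookup⁺ bs i))
      ; conn = λ i → proj₂ (proj₂ (lookup⁺ bs i))
      ; edge = λ i j ne → subst₂ (Join G) (sym (lookup-splitAt 3 As Bs i)) (sym (lookup-splitAt 3 As Bs j))
                  (go (splitAt 3 i) (splitAt 3 j) ne) }
      where
      go : ∀ s s′ → [ (λ _ → _) , (λ _ → _) ]′ s ≢ [ (λ _ → _) , (λ _ → _) ]′ s′ →
           Join G ([ lookup As , lookup Bs ]′ s) ([ lookup As , lookup Bs ]′ s′)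
      go (inj₁ i) (inj₁ j) ne = ⊥-elim (ne refl)
      go (inj₁ i) (inj₂ j) ne = lookup⁺ (lookup⁺ js i) j
      go (inj₂ i) (inj₁ j) ne = join-sym G (lookup⁺ (lookup⁺ js j) i)
      go (inj₂ i) (inj₂ j) ne = ⊥-elim (ne refl)

    open DecMem (_≟_ {n}) using () renaming (_∈?_ to _∈ˡ?_)

    list? : ∀ xs → Decidable (_∈ˡ xs)
    list? xs v = v ∈ˡ? xs

    fromList : List (Fin n) → Subset n
    fromList xs = sub (list? xs)

    Chain : Graph n → Fin n → List (Fin n) → Fin n → Set
    Chain G u [] v = Adj G u v
    Chain G u (x ∷ xs) v = Adj G u x × Chain G x xs v

    module _ {G : Graph n} where

      chain-split : ∀ {u v} xs {y ys} → Chain G u (xs ++ y ∷ ys) v → Chain G u xs y × Chain G y ys v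
      chain-split [] c = c
      chain-split (x ∷ xs) (ux , c) = let (a , b) = chain-split xs c in (ux , a) , b

      chain-++ : ∀ {u v} xs {y ys} → Chain G u xs y → Chain G y ys v → Chain G u (xs ++ y ∷ ys) v
      chain-++ [] c d = c , d
      chain-++ (x ∷ xs) (ux , c) d = ux , chain-++ xs c d

      chain-head : ∀ {u v} xs → Chain G u xs v → ∃ λ w → w ∈ˡ xs ++ [ v ] × Adj G u w
      chain-head [] c = _ , here refl , c
      chain-head (x ∷ xs) (ux , _) = x , here refl , ux

      chain-last : ∀ {u v c} xs → Chain G u xs v → c ∈ˡ xs → ∃ λ w → w ∈ˡ xs × Adj G w v
      chain-last (x ∷ []) (_ , xv) _ = x , here refl , xv
      chain-last (x ∷ y ∷ ys) (_ , c) _ = let (w , w∈ , wv) = chain-last (y ∷ ys) c (here refl) in w , there w∈ , wv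

      chain-conn : ∀ {u v} xs → Chain G u xs v → Conn G (fromList (xs ++ [ v ]))
      chain-conn {v = v} [] _ = conn-single (λ m → case-here (in⁻ (list? _) m))
        where
        case-here : ∀ {z} → z ∈ˡ [ v ] → z ≡ v
        case-here (here e) = e
      chain-conn (x ∷ xs) (_ , c) with chain-head xs c
      ... | w , w∈ , xw = conn-add (chain-conn xs c) (in⁺ (list? _) w∈) (symm G xw)
              (λ m → in⁺ (list? _) (there (in⁻ (list? _) m))) (in⁺ (list? _) (here refl))
              (λ m → split (in⁻ (list? _) m))
        where
        split : ∀ {z} → z ∈ˡ x ∷ xs ++ [ _ ] → z ∈ fromList (xs ++ [ _ ]) ⊎ z ≡ x
        split (here e) = inj₂ e
        split (there m) = inj₁ (in⁺ (list? _) m)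

      chain-inner : ∀ {u v} xs → Chain G u xs v → Conn G (fromList xs)
      chain-inner [] _ = connected λ _ u∈ → ⊥-elim (¬empty (in⁻ (list? []) u∈))
        where
        ¬empty : ∀ {z : Fin n} → z ∉ˡ []
        ¬empty ()
      chain-inner (x ∷ []) _ = conn-single (λ m → case-here (in⁻ (list? _) m))
        where
        case-here : ∀ {z} → z ∈ˡ [ x ] → z ≡ x
        case-here (here e) = e
      chain-inner (x ∷ y ∷ ys) (_ , xy , c) =
        conn-add (chain-inner (y ∷ ys) (xy , c)) (in⁺ (list? _) (here refl)) (symm G xy)
          (λ m → in⁺ (list? _) (there (in⁻ (list? _) m))) (in⁺ (list? _) (here refl))
          (λ m → split (in⁻ (list? _) m))
        where
        split : ∀ {z} → z ∈ˡ x ∷ y ∷ ys → z ∈ fromList (y ∷ ys) ⊎ z ≡ x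
        split (here e) = inj₂ e
        split (there m) = inj₁ (in⁺ (list? _) m)

    unique-disjoint : ∀ (xs : List (Fin n)) {ys v} → Unique (xs ++ ys) → v ∈ˡ xs → v ∉ˡ ys
    unique-disjoint (x ∷ xs) (a ∷ u) (here refl) v∈ys = All.lookup a (∈-++⁺ʳ xs v∈ys) refl
    unique-disjoint (x ∷ xs) (a ∷ u) (there v∈) v∈ys = unique-disjoint xs u v∈ v∈ys

    unique-right : ∀ (xs : List (Fin n)) {ys} → Unique (xs ++ ys) → Unique ys
    unique-right [] u = u
    unique-right (x ∷ xs) (_ ∷ u) = unique-right xs u

    ∈-mid : ∀ {v a : Fin n} xs {ys} → v ∈ˡ xs ++ [ a ] → v ∈ˡ xs ++ a ∷ ys
    ∈-mid xs m with ∈-++⁻ xs m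
    ... | inj₁ m = ∈-++⁺ˡ m
    ... | inj₂ (here e) = ∈-++⁺ʳ xs (here e)

    arcs-disjoint : ∀ {a : Fin n} xs {ys} → Unique (xs ++ a ∷ ys) → ∀ {v} → v ∈ˡ xs ++ [ a ] → v ∉ˡ ys
    arcs-disjoint {a} xs {ys} u {v} m m′ with ∈-++⁻ xs m
    ... | inj₁ v∈ = unique-disjoint xs u v∈ (there m′)
    ... | inj₂ (here refl) with unique-right xs u
    ...   | a≢ ∷ _ = All.lookup a≢ m′ refl

    -- A cycle s - L - s and two disjoint connected sets X, Y outside of it
    -- that are adjacent to each other.
    record Ring (G : Graph n) (S : Subset n) (s : Fin n) (L : List (Fin n)) (X Y : Subset n) : Set where
      field
        chain  : Chain G s L s
        s∈S    : s ∈ S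
        L⊆S    : ∀ {v} → v ∈ˡ L → v ∈ S
        X⊆S    : X ⊆ S
        Y⊆S    : Y ⊆ S
        s∉L    : s ∉ˡ L
        unique : Unique L
        connX  : Conn G X
        connY  : Conn G Y
        join   : Join G X Y
        X≁Y    : X ≁ Y
        s∉X    : s ∉ X
        s∉Y    : s ∉ Y
        X≁L    : ∀ {v} → v ∈ X → v ∉ˡ L
        Y≁L    : ∀ {v} → v ∈ Y → v ∉ˡ L

    ring-sym : ∀ {G : Graph n} {S s L X Y} → Ring G S s L X Y → Ring G S s L Y X
    ring-sym {G = G} r = record
      { chain = chain ; s∈S = s∈S ; L⊆S = L⊆S ; X⊆S = Y⊆S ; Y⊆S = X⊆S ; s∉L = s∉L ; unique = unique
      ; connX = connY ; connY = connX ; join = join-sym G join ; X≁Y = λ a b → X≁Y b a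
      ; s∉X = s∉Y ; s∉Y = s∉X ; X≁L = Y≁L ; Y≁L = X≁L }
      where
      open Ring r

    module _ {G : Graph n} where

      touch-join : ∀ {X Y p} → Touch G X p → p ∈ Y → Join G X Y
      touch-join (u , u∈ , up) p∈ = u , _ , u∈ , p∈ , up

      ∈⁺ : ∀ {v} xs → v ∈ˡ xs → v ∈ fromList xs
      ∈⁺ xs = in⁺ (list? xs)

      ∈⁻ : ∀ {v} xs → v ∈ fromList xs → v ∈ˡ xs
      ∈⁻ xs = in⁻ (list? xs)

      -- The cycle is cut into s, the arc up to a, the arc up to b and the rest, which contains c. X
      -- and the arcs of a and c form one side of K₃,₃; Y, s and the arc of b form the other. Four
      -- of the nine edges lie on the cycle, four are the attachments, and the last joins X to Y.
      crossing-chords : ∀ {S s X Y} L₁ {a} L₂ {b} L₃ {c} →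
        Ring G S s (L₁ ++ a ∷ L₂ ++ b ∷ L₃) X Y → c ∈ˡ L₃ →
        Touch G X s → Touch G X b → Touch G Y a → Touch G Y c → Model K₃,₃ S G
      crossing-chords {S} {s} {X} {Y} L₁ {a} L₂ {b} L₃ {c} r c∈ Xs Xb Ya Yc =
        K₃,₃-model (X ∷ α ∷ γ ∷ []) (Y ∷ σ ∷ β ∷ [])
          ((X≁arc (∈-mid L₁) ∷ X≁arc γ⊆ ∷ X≁Y ∷ X≁σ ∷ X≁arc β⊆ ∷ [])
            ∷ ((λ m m′ → arcs-disjoint L₁ unique (∈⁻ A m) (∈-++⁺ʳ L₂ (there (∈⁻ L₃ m′)))) ∷ (λ m m′ → Y≁L m′ (∈-mid L₁ (∈⁻ A m)))
                ∷ (λ m m′ → s∉L (subst (_∈ˡ _) (σ-s m′) (∈-mid L₁ (∈⁻ A m))))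
                ∷ (λ m m′ → arcs-disjoint L₁ unique (∈⁻ A m) (∈-mid L₂ (∈⁻ B m′))) ∷ [])
            ∷ ((λ m m′ → Y≁L m′ (γ⊆ (∈⁻ L₃ m))) ∷ (λ m m′ → s∉L (subst (_∈ˡ _) (σ-s m′) (γ⊆ (∈⁻ L₃ m))))
                ∷ (λ m m′ → arcs-disjoint L₂ uniq₂ (∈⁻ B m′) (∈⁻ L₃ m)) ∷ [])
            ∷ ((λ m m′ → s∉Y (subst (_∈ Y) (σ-s m′) m)) ∷ (λ m m′ → Y≁L m (β⊆ (∈⁻ B m′))) ∷ [])
            ∷ ((λ m m′ → s∉L (subst (_∈ˡ _) (σ-s m) (β⊆ (∈⁻ B m′)))) ∷ [])
            ∷ [] ∷ [])
          ((X⊆S , (_ , proj₁ (proj₂ Xs)) , connX) ∷ (arc⊆S A (∈-mid L₁) , (a , a∈α) , chain-conn L₁ cα)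
            ∷ (arc⊆S L₃ γ⊆ , (c , ∈⁺ L₃ c∈) , chain-inner L₃ cγ)
            ∷ (Y⊆S , (_ , proj₁ (proj₂ Ya)) , connY)
            ∷ ((λ m → subst (_∈ S) (sym (σ-s m)) s∈S) , (s , s∈σ) , conn-single σ-s)
            ∷ (arc⊆S B β⊆ , (b , b∈β) , chain-conn L₂ cβ) ∷ [])
          ((join ∷ touch-join Xs s∈σ ∷ touch-join Xb b∈β ∷ [])
            ∷ (join-sym G (touch-join Ya a∈α) ∷ join-sym G (headS cα) ∷ headα cβ ∷ [])
            ∷ (join-sym G (touch-join Yc (∈⁺ L₃ c∈)) ∷ lastγ ∷ join-sym G headβ ∷ []) ∷ [])
        where
        open Ring r
        A = L₁ ++ [ a ]
        B = L₂ ++ [ b ]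
        α = fromList A
        β = fromList B
        γ = fromList L₃
        σ = sub (single? s)
        σ-s : ∀ {v} → v ∈ σ → v ≡ s
        σ-s = in⁻ (single? s)
        s∈σ = in⁺ (single? s) refl
        X≁σ : X ≁ σ
        X≁σ m m′ = s∉X (subst (_∈ X) (σ-s m′) m)
        uniq₂ : Unique (L₂ ++ b ∷ L₃)
        uniq₂ with unique-right L₁ unique
        ... | _ ∷ u = u
        cα = proj₁ (chain-split {G = G} L₁ chain)
        c′ = proj₂ (chain-split {G = G} L₁ chain)
        cβ = proj₁ (chain-split {G = G} L₂ c′)
        cγ = proj₂ (chain-split {G = G} L₂ c′)
        a∈α : a ∈ α
        a∈α = ∈⁺ A (∈-++⁺ʳ L₁ (here refl))
        b∈β : b ∈ β
        b∈β = ∈⁺ B (∈-++⁺ʳ L₂ (here refl))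
        β⊆ : ∀ {v} → v ∈ˡ B → v ∈ˡ L₁ ++ a ∷ L₂ ++ b ∷ L₃
        β⊆ m = ∈-++⁺ʳ L₁ (there (∈-mid L₂ m))
        γ⊆ : ∀ {v} → v ∈ˡ L₃ → v ∈ˡ L₁ ++ a ∷ L₂ ++ b ∷ L₃
        γ⊆ m = ∈-++⁺ʳ L₁ (there (∈-++⁺ʳ L₂ (there m)))
        X≁arc : ∀ {xs} → (∀ {v} → v ∈ˡ xs → v ∈ˡ L₁ ++ a ∷ L₂ ++ b ∷ L₃) → X ≁ fromList xs
        X≁arc sub m m′ = X≁L m (sub (∈⁻ _ m′))
        arc⊆S : ∀ xs → (∀ {v} → v ∈ˡ xs → v ∈ˡ L₁ ++ a ∷ L₂ ++ b ∷ L₃) → fromList xs ⊆ S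
        arc⊆S xs sub m = L⊆S (sub (∈⁻ xs m))
        headS : Chain G s L₁ a → Join G σ α
        headS c = let (w , w∈ , sw) = chain-head L₁ c in s , w , s∈σ , ∈⁺ A w∈ , sw
        headα : Chain G a L₂ b → Join G α β
        headα c = let (w , w∈ , aw) = chain-head L₂ c in a , w , a∈α , ∈⁺ B w∈ , aw
        headβ : Join G β γ
        headβ = go L₃ cγ c∈
          where
          go : ∀ L → Chain G b L s → c ∈ˡ L → Join G β (fromList L)
          go (w ∷ L) (bw , _) _ = b , w , b∈β , ∈⁺ (w ∷ L) (here refl) , bw
        lastγ : Join G γ σ
        lastγ = let (w , w∈ , ws) = chain-last L₃ cγ c∈ in w , s , ∈⁺ L₃ w∈ , s∈σ , ws

      -- X, Y, s, the arc up to a and the remaining arc are pairwise adjacent: the cycle joins the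
      -- last three, and X and Y see all of them and each other.
      three-common : ∀ {S s X Y} L₁ {a} L₂ {c} →
        Ring G S s (L₁ ++ a ∷ L₂) X Y → c ∈ˡ L₂ →
        Touch G X s → Touch G X a → Touch G X c → Touch G Y s → Touch G Y a → Touch G Y c → Model K₅ S G
      three-common {S} {s} {X} {Y} L₁ {a} L₂ {c} r c∈ Xs Xa Xc Ys Ya Yc =
        K₅-model (X ∷ Y ∷ σ ∷ α ∷ β ∷ [])
          ((X≁Y ∷ (λ m m′ → s∉X (subst (_∈ X) (σ-s m′) m)) ∷ (λ m m′ → X≁L m (∈-mid L₁ (∈⁻ A m′)))
              ∷ (λ m m′ → X≁L m (β⊆ (∈⁻ L₂ m′))) ∷ [])
            ∷ ((λ m m′ → s∉Y (subst (_∈ Y) (σ-s m′) m)) ∷ (λ m m′ → Y≁L m (∈-mid L₁ (∈⁻ A m′)))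
                ∷ (λ m m′ → Y≁L m (β⊆ (∈⁻ L₂ m′))) ∷ [])
            ∷ ((λ m m′ → s∉L (subst (_∈ˡ _) (σ-s m) (∈-mid L₁ (∈⁻ A m′))))
                ∷ (λ m m′ → s∉L (subst (_∈ˡ _) (σ-s m) (β⊆ (∈⁻ L₂ m′)))) ∷ [])
            ∷ ((λ m m′ → arcs-disjoint L₁ unique (∈⁻ A m) (∈⁻ L₂ m′)) ∷ [])
            ∷ [] ∷ [])
          ((X⊆S , (_ , proj₁ (proj₂ Xs)) , connX) ∷ (Y⊆S , (_ , proj₁ (proj₂ Ya)) , connY)
            ∷ ((λ m → subst (_∈ S) (sym (σ-s m)) s∈S) , (s , s∈σ) , conn-single σ-s)
            ∷ ((λ m → L⊆S (∈-mid L₁ (∈⁻ A m))) , (a , a∈α) , chain-conn L₁ cα)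
            ∷ ((λ m → L⊆S (β⊆ (∈⁻ L₂ m))) , (c , ∈⁺ L₂ c∈) , chain-inner L₂ cβ) ∷ [])
          ((join ∷ touch-join Xs s∈σ ∷ touch-join Xa a∈α ∷ touch-join Xc (∈⁺ L₂ c∈) ∷ [])
            ∷ (touch-join Ys s∈σ ∷ touch-join Ya a∈α ∷ touch-join Yc (∈⁺ L₂ c∈) ∷ [])
            ∷ (headS cα ∷ join-sym G lastβ ∷ [])
            ∷ (headα L₂ cβ c∈ ∷ [])
            ∷ [] ∷ [])
        where
        open Ring r
        A = L₁ ++ [ a ]
        α = fromList A
        β = fromList L₂
        σ = sub (single? s)
        σ-s : ∀ {v} → v ∈ σ → v ≡ s
        σ-s = in⁻ (single? s)
        s∈σ = in⁺ (single? s) refl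
        cα = proj₁ (chain-split {G = G} L₁ chain)
        cβ = proj₂ (chain-split {G = G} L₁ chain)
        a∈α : a ∈ α
        a∈α = ∈⁺ A (∈-++⁺ʳ L₁ (here refl))
        β⊆ : ∀ {v} → v ∈ˡ L₂ → v ∈ˡ L₁ ++ a ∷ L₂
        β⊆ m = ∈-++⁺ʳ L₁ (there m)
        headS : Chain G s L₁ a → Join G σ α
        headS c = let (w , w∈ , sw) = chain-head L₁ c in s , w , s∈σ , ∈⁺ A w∈ , sw
        headα : ∀ L → Chain G a L s → c ∈ˡ L → Join G α (fromList L)
        headα (w ∷ L) (aw , _) _ = a , w , a∈α , ∈⁺ (w ∷ L) (here refl) , aw
        lastβ : Join G β σ
        lastβ = let (w , w∈ , ws) = chain-last L₂ cβ c∈ in w , s , ∈⁺ L₂ w∈ , s∈σ , ws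

-- Adding an edge and replacing it by a connected set

module VirtualEdges where

  open import Data.Empty using (⊥-elim)
  open import Data.Fin.Base using (Fin)
  open import Data.Fin.Properties using (_≟_)
  open import Data.Fin.Subset using (_∈_; _∉_; _⊆_)
  open import Data.Fin.Subset.Properties using (_∈?_)
  open import Data.Nat.Base using (ℕ)
  open import Data.Product.Base using (_×_; _,_)
  open import Data.Sum.Base using (_⊎_; inj₁; inj₂; [_,_]′)
  open import Relation.Binary.PropositionalEquality hiding ([_])
  open import Relation.Nullary
  open import Relation.Nullary.Decidable using (_×-dec_; _⊎-dec_; ¬?)
  open import Relation.Unary using (Decidable)
  open Sets
  open Ears
  open Obstructions

  module _ {n : ℕ} where

    Same : (a b x y : Fin n) → Set
    Same a b x y = (x ≡ a × y ≡ b) ⊎ (x ≡ b × y ≡ a)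

    addEdge : Graph n → ∀ {a b} → a ≢ b → Graph n
    addEdge G {a} {b} a≢b = record
      { Adj = λ x y → Adj G x y ⊎ Same a b x y
      ; adj? = λ x y → adj? G x y ⊎-dec (((x ≟ a) ×-dec (y ≟ b)) ⊎-dec ((x ≟ b) ×-dec (y ≟ a)))
      ; symm = λ { (inj₁ xy) → inj₁ (symm G xy)
                 ; (inj₂ (inj₁ (p , q))) → inj₂ (inj₂ (q , p))
                 ; (inj₂ (inj₂ (p , q))) → inj₂ (inj₁ (q , p)) }
      ; irrefl = λ { x≡y (inj₁ xy) → irrefl G x≡y xy
                   ; refl (inj₂ (inj₁ (refl , q))) → a≢b q
                   ; refl (inj₂ (inj₂ (refl , q))) → a≢b (sym q) } }

    module _ {G : Graph n} {a b : Fin n} (a≢b : a ≢ b) where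

      -- The connected set D stands in for the edge ab.
      lift : ∀ {k} {H : Graph k} {S S′ D} → Model H S′ (addEdge G a≢b) → S′ ⊆ S → D ⊆ S → Conn G D → a ∈ D →
             (∀ {v} → v ∈ D → v ∈ S′ → v ≡ a) → Touch G D b → Model H S G
      lift {S = S} {S′} {D} m S′⊆S D⊆S cD a∈D meet (d , d∈D , db) = record
        { branch = λ i → sub (W? i)
        ; inside = λ i v∈ → [ (λ v∈B → S′⊆S (inside i v∈B)) , (λ (_ , v∈D) → D⊆S v∈D) ]′ (in⁻ (W? i) v∈)
        ; disjoint = λ {i} {j} v∈ v∈′ → dis (in⁻ (W? i) v∈) (in⁻ (W? j) v∈′)
        ; nonempty = λ i → let (v , v∈) = nonempty i in v , in⁺ (W? i) (inj₁ v∈)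
        ; conn = cn
        ; edge = λ i j ij → eg (edge i j ij) }
        where
        open Model m
        -- Only the branch set of a receives D. Since D meets S′ in a alone, the branch sets stay
        -- disjoint, and every use of the edge ab can enter D at a and leave it for b.
        W? : ∀ i → Decidable (λ v → v ∈ branch i ⊎ (a ∈ branch i × v ∈ D))
        W? i v = (v ∈? branch i) ⊎-dec ((a ∈? branch i) ×-dec (v ∈? D))

        dis : ∀ {i j v} → v ∈ branch i ⊎ (a ∈ branch i × v ∈ D) → v ∈ branch j ⊎ (a ∈ branch j × v ∈ D) → i ≡ j
        dis (inj₁ p) (inj₁ q) = disjoint p q
        dis {i} (inj₁ p) (inj₂ (a∈ , v∈D)) = disjoint (subst (_∈ branch i) (meet v∈D (inside i p)) p) a∈
        dis {j = j} (inj₂ (a∈ , v∈D)) (inj₁ q) = disjoint a∈ (subst (_∈ branch j) (meet v∈D (inside j q)) q)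
        dis (inj₂ (p , _)) (inj₂ (q , _)) = disjoint p q

        cn : ∀ i → Conn G (sub (W? i))
        cn i = connected λ Y {u} {v} u∈ u∈Y cl v∈ → go Y cl u∈Y (in⁻ (W? i) u∈) (in⁻ (W? i) v∈)
          where
          module _ Y (cl : Closed G (sub (W? i)) Y) where
            step : ∀ {u v} → u ∈ branch i ⊎ (a ∈ branch i × u ∈ D) → v ∈ branch i ⊎ (a ∈ branch i × v ∈ D) →
                   u ∈ Y → Adj G u v → v ∈ Y
            step p q = cl _ _ (in⁺ (W? i) p) (in⁺ (W? i) q)
            inD : ∀ {u v} → a ∈ branch i → u ∈ D → v ∈ D → u ∈ Y → v ∈ Y
            inD a∈ u∈ v∈ uY = spread cD Y u∈ uY (λ x y x∈ y∈ xY xy → step (inj₂ (a∈ , x∈)) (inj₂ (a∈ , y∈)) xY xy) v∈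
            clB : Closed (addEdge G a≢b) (branch i) Y
            clB u v u∈ v∈ uY (inj₁ uv) = step (inj₁ u∈) (inj₁ v∈) uY uv
            clB u v u∈ v∈ uY (inj₂ (inj₁ (refl , refl))) = step (inj₂ (u∈ , d∈D)) (inj₁ v∈) (inD u∈ a∈D d∈D uY) db
            clB u v u∈ v∈ uY (inj₂ (inj₂ (refl , refl))) = inD v∈ d∈D a∈D (step (inj₁ u∈) (inj₂ (v∈ , d∈D)) uY (symm G db))
            inB : ∀ {u v} → u ∈ branch i → v ∈ branch i → u ∈ Y → v ∈ Y
            inB u∈ v∈ uY = spread (conn i) Y u∈ uY clB v∈
            go : ∀ {u v} → u ∈ Y → u ∈ branch i ⊎ (a ∈ branch i × u ∈ D) → v ∈ branch i ⊎ (a ∈ branch i × v ∈ D) → v ∈ Y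
            go uY (inj₁ p) (inj₁ q) = inB p q uY
            go uY (inj₁ p) (inj₂ (a∈ , q)) = inD a∈ a∈D q (inB p a∈ uY)
            go uY (inj₂ (a∈ , p)) (inj₁ q) = inB a∈ q (inD a∈ p a∈D uY)
            go uY (inj₂ (a∈ , p)) (inj₂ (_ , q)) = inD a∈ p q uY

        eg : ∀ {i j} → Join (addEdge G a≢b) (branch i) (branch j) → Join G (sub (W? i)) (sub (W? j))
        eg (u , v , u∈ , v∈ , inj₁ uv) = u , v , in⁺ (W? _) (inj₁ u∈) , in⁺ (W? _) (inj₁ v∈) , uv
        eg (u , v , u∈ , v∈ , inj₂ (inj₁ (refl , refl))) = d , v , in⁺ (W? _) (inj₂ (u∈ , d∈D)) , in⁺ (W? _) (inj₁ v∈) , db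
        eg (u , v , u∈ , v∈ , inj₂ (inj₂ (refl , refl))) = u , d , in⁺ (W? _) (inj₁ u∈) , in⁺ (W? _) (inj₂ (v∈ , d∈D)) , symm G db

      -- A connection in S leaves and reenters X only at a or b, where the added edge shortens it.
      conn-shortcut : ∀ {S X} → Conn G S → X ⊆ S → a ∈ X → b ∈ X →
        (∀ u v → u ∈ S → u ∉ X → v ∈ X → Adj G u v → v ≡ a ⊎ v ≡ b) → Conn (addEdge G a≢b) X
      conn-shortcut {S} {X} cS X⊆S a∈X b∈X att = connected go
        where
        go : ∀ Y {u v} → u ∈ X → u ∈ Y → Closed (addEdge G a≢b) X Y → v ∈ X → v ∈ Y
        go Y {u} {v} u∈X u∈Y cl v∈X = back (conn-ind cS P? step (X⊆S u∈X) (inj₁ (u∈X , u∈Y)) (X⊆S v∈X))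
          where
          -- Y says nothing useful about vertices outside of X, so there the invariant only
          -- remembers that a has been reached.
          P? : Decidable (λ w → (w ∈ X × w ∈ Y) ⊎ (w ∉ X × a ∈ Y))
          P? w = ((w ∈? X) ×-dec (w ∈? Y)) ⊎-dec (¬? (w ∈? X) ×-dec (a ∈? Y))
          back : (v ∈ X × v ∈ Y) ⊎ (v ∉ X × a ∈ Y) → v ∈ Y
          back (inj₁ (_ , v∈Y)) = v∈Y
          back (inj₂ (v∉X , _)) = ⊥-elim (v∉X v∈X)
          to-a : ∀ {w} → w ≡ a ⊎ w ≡ b → w ∈ Y → a ∈ Y
          to-a (inj₁ refl) w∈ = w∈
          to-a (inj₂ refl) w∈ = cl b a b∈X a∈X w∈ (inj₂ (inj₂ (refl , refl)))
          from-a : ∀ {w} → w ≡ a ⊎ w ≡ b → a ∈ Y → w ∈ Y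
          from-a (inj₁ refl) a∈ = a∈
          from-a (inj₂ refl) a∈ = cl a b a∈X b∈X a∈ (inj₂ (inj₁ (refl , refl)))
          step : ∀ w w′ → w ∈ S → w′ ∈ S → (w ∈ X × w ∈ Y) ⊎ (w ∉ X × a ∈ Y) → Adj G w w′ →
                 (w′ ∈ X × w′ ∈ Y) ⊎ (w′ ∉ X × a ∈ Y)
          step w w′ w∈S w′∈S p ww′ with w′ ∈? X | p
          ... | yes w′∈X | inj₁ (w∈X , w∈Y) = inj₁ (w′∈X , cl w w′ w∈X w′∈X w∈Y (inj₁ ww′))
          ... | yes w′∈X | inj₂ (w∉X , a∈Y) = inj₁ (w′∈X , from-a (att w w′ w∈S w∉X w′∈X ww′) a∈Y)
          ... | no w′∉X | inj₁ (w∈X , w∈Y) = inj₂ (w′∉X , to-a (att w′ w w′∈S w′∉X w∈X (symm G ww′)) w∈Y)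
          ... | no w′∉X | inj₂ (w∉X , a∈Y) = inj₂ (w′∉X , a∈Y)

-- Combinatorial drawings: abscissas, insertion times and visibility

module Layouts where

  open import Data.Empty using (⊥-elim)
  open import Data.Fin.Base using (Fin; zero; suc)
  open import Data.Fin.Properties using (_≟_)
  open import Data.Fin.Subset using (Subset; _∈_; _∉_; _⊆_)
  open import Data.List.Base using (List; []; _∷_; _++_; [_]; reverse)
  open import Data.List.Properties using (unfold-reverse)
  open import Data.List.Membership.Propositional using () renaming (_∈_ to _∈ˡ_)
  open import Data.List.Membership.Propositional.Properties using (∈-++⁺ˡ; ∈-++⁺ʳ; ∈-++⁻)
  open import Data.List.Relation.Unary.Any.Properties using (reverse⁻)
  open import Data.List.Relation.Unary.Any using (here; there)
  open import Data.Nat.Base using (ℕ; zero; suc; _+_; _*_; _∸_; _≤_; _<_; _⊔_; z≤n; s≤s)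
  open import Data.Nat.Properties hiding (_≟_)
  open import Data.Product.Base using (∃; _×_; _,_; proj₁; proj₂; swap)
  open import Data.Sum.Base as Sum using (_⊎_; inj₁; inj₂; [_,_]′)
  open import Relation.Binary.PropositionalEquality hiding ([_])
  open import Relation.Nullary

  module _ {n : ℕ} where

    bounded : ∀ {m} (f : Fin m → ℕ) → ∃ λ b → ∀ i → f i ≤ b
    bounded {zero} f = 0 , λ ()
    bounded {suc m} f with bounded (λ i → f (suc i))
    ... | b , f≤b = f zero ⊔ b , λ { zero → m≤m⊔n (f zero) b ; (suc i) → ≤-trans (f≤b i) (m≤n⊔m (f zero) b) }

    data Sorted (x : Fin n → ℕ) : ℕ → List (Fin n) → Set where
      []  : ∀ {k} → Sorted x k []
      _∷_ : ∀ {k y ys} → k < x y → Sorted x (x y) ys → Sorted x k (y ∷ ys)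

    weaken : ∀ {x k k′ ys} → k′ ≤ k → Sorted x k ys → Sorted x k′ ys
    weaken le [] = []
    weaken le (lt ∷ s) = ≤-<-trans le lt ∷ s

    drop-sorted : ∀ {x k} ys {zs} → Sorted x k (ys ++ zs) → Sorted x k zs
    drop-sorted [] s = s
    drop-sorted (y ∷ ys) (lt ∷ s) = weaken (<⇒≤ lt) (drop-sorted ys s)

    above : ∀ {x k ys u} → Sorted x k ys → u ∈ˡ ys → k < x u
    above (lt ∷ s) (here refl) = lt
    above (lt ∷ s) (there m) = <-trans lt (above s m)

    before : ∀ {x k} ys {zs u w} → Sorted x k (ys ++ zs) → u ∈ˡ ys → w ∈ˡ zs → x u < x w
    before (y ∷ ys) (lt ∷ s) (here refl) m = above s (∈-++⁺ʳ ys m)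
    before (y ∷ ys) (lt ∷ s) (there u∈) m = before ys s u∈ m

    Between : ℕ → ℕ → ℕ → Set
    Between a u b = (a < u × u < b) ⊎ (b < u × u < a)

    -- A drawing of the vertices Q, inserted in the order τ, with s far below:
    -- an edge u v with τ u < τ v leaves u vertically and reaches v horizontally.
    -- L lists the vertices of Q that can still be reached from above.
    record Layout (G : Graph n) (s : Fin n) (Q : Subset n) (L : List (Fin n)) : Set where
      field
        x τ     : Fin n → ℕ
        clock   : ℕ
        τ<      : ∀ {v} → v ∈ Q → τ v < clock
        x>0     : ∀ {v} → v ∈ Q → 0 < x v
        x-inj   : ∀ {u v} → u ∈ Q → v ∈ Q → x u ≡ x v → u ≡ v
        τ-inj   : ∀ {u v} → u ∈ Q → v ∈ Q → τ u ≡ τ v → u ≡ v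
        L⊆Q     : ∀ {v} → v ∈ˡ L → v ∈ Q
        sorted  : Sorted x 0 L
        visible : ∀ {u v w} → u ∈ˡ L → v ∈ Q → w ∈ Q → Adj G v w → τ v < τ w → τ u < τ w →
                  ¬ Between (x v) (x u) (x w)
        -- The vertical part of uv stands at `x u`, the horizontal part of u′v′ lies at height
        -- `τ v′`; the two must not cross.
        good    : ∀ {u v u′ v′} → u ∈ Q → v ∈ Q → u′ ∈ Q → v′ ∈ Q → Adj G u v → Adj G u′ v′ →
                  τ u < τ v → τ u′ < τ v′ → τ u < τ v′ → τ v′ < τ v → ¬ Between (x u′) (x u) (x v′)
        -- A neighbour of s is outermost when it is inserted, so that the long edge from s passes
        -- beside everything older.
        record-breaking : ∀ {w} → w ∈ Q → Adj G s w →
                  (∀ {z} → z ∈ Q → τ z < τ w → x z < x w) ⊎ (∀ {z} → z ∈ Q → τ z < τ w → x w < x z)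

    empty-layout : ∀ {G : Graph n} {s Q} → (∀ {v} → v ∉ Q) → Layout G s Q []
    empty-layout ∉Q = record
      { x = λ _ → 0 ; τ = λ _ → 0 ; clock = 0 ; τ< = λ m → ⊥-elim (∉Q m) ; x>0 = λ m → ⊥-elim (∉Q m)
      ; x-inj = λ m → ⊥-elim (∉Q m) ; τ-inj = λ m → ⊥-elim (∉Q m) ; L⊆Q = λ () ; sorted = []
      ; visible = λ () ; good = λ m → ⊥-elim (∉Q m) ; record-breaking = λ m → ⊥-elim (∉Q m) }

    module _ {G : Graph n} {s : Fin n} where

      -- Reflection of the abscissas. It lets an ear that fits only along the reversed cycle be
      -- inserted in the standard way.
      mirror : ∀ {Q L} → Layout G s Q L → Layout G s Q (reverse L)
      mirror {Q} {L} ly = record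
        { x = x′ ; τ = τ ; clock = clock ; τ< = τ< ; x>0 = λ {v} _ → m<n⇒0<n∸m (s≤s (x≤b v))
        ; x-inj = λ {u} {v} u∈ v∈ e → x-inj u∈ v∈ (∸-cancelˡ-≡ (m≤n⇒m≤1+n (x≤b u)) (m≤n⇒m≤1+n (x≤b v)) e)
        ; τ-inj = τ-inj
        ; L⊆Q = λ m → L⊆Q (reverse⁻ m)
        ; sorted = rev sorted z≤n
        ; visible = λ u∈ v∈ w∈ vw lt lt′ bt → visible (reverse⁻ u∈) v∈ w∈ vw lt lt′ (unbetween bt)
        ; good = λ a b c d e f g h i j bt → good a b c d e f g h i j (unbetween bt)
        ; record-breaking = λ w∈ sw → Sum.swap (Sum.map (λ f m lt → flip (f m lt)) (λ f m lt → flip (f m lt)) (record-breaking w∈ sw)) }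
        where
        open Layout ly
        b = proj₁ (bounded x)
        x≤b : ∀ v → x v ≤ b
        x≤b = proj₂ (bounded x)
        x′ : Fin n → ℕ
        x′ v = suc b ∸ x v
        flip : ∀ {u v} → x u < x v → x′ v < x′ u
        flip {u} {v} lt = ∸-monoʳ-< lt (m≤n⇒m≤1+n (x≤b v))
        unflip : ∀ {u v} → x′ u < x′ v → x v < x u
        unflip lt = ∸-cancelʳ-< lt
        unbetween : ∀ {u v w} → Between (x′ u) (x′ v) (x′ w) → Between (x u) (x v) (x w)
        unbetween (inj₁ (p , q)) = inj₂ (unflip q , unflip p)
        unbetween (inj₂ (p , q)) = inj₁ (unflip q , unflip p)
        snoc : ∀ {k} ys {y} → Sorted x′ k ys → k < x′ y → (∀ {u} → u ∈ˡ ys → x′ u < x′ y) → Sorted x′ k (ys ++ [ y ])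
        snoc [] [] lt _ = lt ∷ []
        snoc (z ∷ ys) (lt′ ∷ so) lt all = lt′ ∷ snoc ys so (all (here refl)) (λ m → all (there m))
        rev : ∀ {ys k k′} → Sorted x k ys → k′ ≤ 0 → Sorted x′ k′ (reverse ys)
        rev {[]} [] _ = []
        rev {y ∷ ys} {k} {k′} (lt ∷ so) z≤n = subst (Sorted x′ k′) (sym (unfold-reverse y ys))
          (snoc (reverse ys) (rev so z≤n) (m<n⇒0<n∸m (s≤s (x≤b y))) (λ m → flip (above so (reverse⁻ m))))

      gap : (Fin n → ℕ) → ℕ → List (Fin n) → ℕ
      gap x k [] = k
      gap x k (y ∷ ys) = gap x (x y) ys

      -- The new vertex v goes right after L₁ and hides M.
      insert-vertex : ∀ {Q Q′} L₁ M L₂ {v} → Layout G s Q (L₁ ++ M ++ L₂) → v ∉ Q →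
        Q ⊆ Q′ → v ∈ Q′ → (∀ {z} → z ∈ Q′ → z ∈ Q ⊎ z ≡ v) →
        (∀ {w} → w ∈ Q → Adj G w v → (∃ λ L₁′ → L₁ ≡ L₁′ ++ [ w ]) ⊎ w ∈ˡ M ⊎ (∃ λ L₂′ → L₂ ≡ w ∷ L₂′)) →
        (Adj G s v → L₁ ≡ []) → ∃ λ (ly : Layout G s Q′ (L₁ ++ v ∷ L₂)) →
        (∀ {z} → z ∈ Q → Layout.τ ly z < Layout.τ ly v) × (L₁ ≡ [] → ∀ {z} → z ∈ Q → Layout.x ly v < Layout.x ly z)
      insert-vertex {Q} {Q′} L₁ M L₂ {v} ly v∉Q Q⊆Q′ v∈Q′ Q′⊆ nbr sv = record
        { x = x′ ; τ = τ′ ; clock = suc clock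
        ; τ< = λ {z} z∈ → [ (λ m → subst (_< suc clock) (sym (τ-old m)) (m<n⇒m<1+n (τ< m)))
                          , (λ { refl → subst (_< suc clock) (sym τ-new) ≤-refl }) ]′ (Q′⊆ z∈)
        ; x>0 = λ {z} z∈ → [ (λ m → subst (0 <_) (sym (x-old m)) (≤-trans (x>0 m) (m≤m+n (x z) _)))
                           , (λ { refl → subst (0 <_) (sym x-new) (s≤s z≤n) }) ]′ (Q′⊆ z∈)
        ; x-inj = λ a b e → x-inj′ (Q′⊆ a) (Q′⊆ b) e
        ; τ-inj = λ a b e → τ-inj′ (Q′⊆ a) (Q′⊆ b) e
        ; L⊆Q = L⊆Q′
        ; sorted = insert 0 L₁ x-new sorted L⊆Q
        ; visible = vis
        ; good = λ a b c d → good′ (Q′⊆ a) (Q′⊆ b) (Q′⊆ c) (Q′⊆ d)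
        ; record-breaking = λ w∈ sw → rec (Q′⊆ w∈) sw } , newest , leftmost
        where
        open Layout ly
        g = gap x 0 L₁
        x′ τ′ : Fin n → ℕ
        x′ z with z ≟ v
        -- Old abscissas are doubled, so the odd number after the last vertex of L₁ is free; for
        -- empty L₁ it is 1, to the left of everything.
        ... | yes _ = suc (2 * g)
        ... | no _ = 2 * x z
        τ′ z with z ≟ v
        ... | yes _ = clock
        ... | no _ = τ z
        x-old : ∀ {z} → z ∈ Q → x′ z ≡ 2 * x z
        x-old {z} m with z ≟ v
        ... | yes refl = ⊥-elim (v∉Q m)
        ... | no _ = refl
        x-new : x′ v ≡ suc (2 * g)
        x-new with v ≟ v
        ... | yes _ = refl
        ... | no ne = ⊥-elim (ne refl)
        τ-old : ∀ {z} → z ∈ Q → τ′ z ≡ τ z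
        τ-old {z} m with z ≟ v
        ... | yes refl = ⊥-elim (v∉Q m)
        ... | no _ = refl
        τ-new : τ′ v ≡ clock
        τ-new with v ≟ v
        ... | yes _ = refl
        ... | no ne = ⊥-elim (ne refl)

        double : ∀ {a b} → a < b → suc (2 * a) < 2 * b
        double {a} {b} lt = ≤-trans (≤-reflexive (cong suc (cong suc (cong (a +_) (+-identityʳ a)))))
          (≤-trans (≤-reflexive (sym (cong suc (+-suc a a)))) (≤-trans (+-mono-≤ lt lt) (≤-reflexive (cong (b +_) (sym (+-identityʳ b))))))
        odd : ∀ a b → 2 * a ≢ suc (2 * b)
        odd a b e = <-irrefl (sym e) (double {b} {a} (*-cancelˡ-< 2 b a (≤-reflexive (sym e))))

        x-lt : ∀ {y z} → y ∈ Q → z ∈ Q → x′ y < x′ z → x y < x z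
        x-lt y∈ z∈ lt = *-cancelˡ-< 2 _ _ (subst₂ _<_ (x-old y∈) (x-old z∈) lt)
        x-lt⁺ : ∀ {y z} → y ∈ Q → z ∈ Q → x y < x z → x′ y < x′ z
        x-lt⁺ y∈ z∈ lt = subst₂ _<_ (sym (x-old y∈)) (sym (x-old z∈)) (*-monoʳ-< 2 lt)
        τ-lt : ∀ {y z} → y ∈ Q → z ∈ Q → τ′ y < τ′ z → τ y < τ z
        τ-lt y∈ z∈ = subst₂ _<_ (τ-old y∈) (τ-old z∈)
        τ-last : ∀ {z} → z ∈ Q ⊎ z ≡ v → ¬ τ′ v < τ′ z
        τ-last (inj₁ m) lt = <-asym (τ< m) (subst₂ _<_ τ-new (τ-old m) lt)
        τ-last (inj₂ refl) lt = <-irrefl refl lt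
        bt : ∀ {a u b} → a ∈ Q → u ∈ Q → b ∈ Q → Between (x′ a) (x′ u) (x′ b) → Between (x a) (x u) (x b)
        bt a∈ u∈ b∈ (inj₁ (p , q)) = inj₁ (x-lt a∈ u∈ p , x-lt u∈ b∈ q)
        bt a∈ u∈ b∈ (inj₂ (p , q)) = inj₂ (x-lt b∈ u∈ p , x-lt u∈ a∈ q)

        x-inj′ : ∀ {y z} → y ∈ Q ⊎ y ≡ v → z ∈ Q ⊎ z ≡ v → x′ y ≡ x′ z → y ≡ z
        x-inj′ {y} {z} (inj₁ p) (inj₁ q) e = x-inj p q (*-cancelˡ-≡ (x y) (x z) 2 (trans (sym (x-old p)) (trans e (x-old q))))
        x-inj′ {y} (inj₁ p) (inj₂ refl) e = ⊥-elim (odd (x y) g (trans (sym (x-old p)) (trans e x-new)))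
        x-inj′ {_} {z} (inj₂ refl) (inj₁ q) e = ⊥-elim (odd (x z) g (trans (sym (x-old q)) (trans (sym e) x-new)))
        x-inj′ (inj₂ refl) (inj₂ refl) e = refl
        τ-inj′ : ∀ {y z} → y ∈ Q ⊎ y ≡ v → z ∈ Q ⊎ z ≡ v → τ′ y ≡ τ′ z → y ≡ z
        τ-inj′ (inj₁ p) (inj₁ q) e = τ-inj p q (trans (sym (τ-old p)) (trans e (τ-old q)))
        τ-inj′ (inj₁ p) (inj₂ refl) e = ⊥-elim (<-irrefl (trans (sym (τ-old p)) (trans e τ-new)) (τ< p))
        τ-inj′ (inj₂ refl) (inj₁ q) e = ⊥-elim (<-irrefl (trans (sym (τ-old q)) (trans (sym e) τ-new)) (τ< q))
        τ-inj′ (inj₂ refl) (inj₂ refl) e = refl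

        split-L : ∀ {z} → z ∈ˡ L₁ ++ v ∷ L₂ → z ∈ˡ L₁ ⊎ z ≡ v ⊎ z ∈ˡ L₂
        split-L m with ∈-++⁻ L₁ m
        ... | inj₁ p = inj₁ p
        ... | inj₂ (here e) = inj₂ (inj₁ e)
        ... | inj₂ (there p) = inj₂ (inj₂ p)
        L₁⊆ : ∀ {z} → z ∈ˡ L₁ → z ∈ˡ L₁ ++ M ++ L₂
        L₁⊆ = ∈-++⁺ˡ
        M⊆ : ∀ {z} → z ∈ˡ M → z ∈ˡ L₁ ++ M ++ L₂
        M⊆ m = ∈-++⁺ʳ L₁ (∈-++⁺ˡ m)
        L₂⊆ : ∀ {z} → z ∈ˡ L₂ → z ∈ˡ L₁ ++ M ++ L₂
        L₂⊆ m = ∈-++⁺ʳ L₁ (∈-++⁺ʳ M m)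
        L⊆Q′ : ∀ {z} → z ∈ˡ L₁ ++ v ∷ L₂ → z ∈ Q′
        L⊆Q′ m with split-L m
        ... | inj₁ p = Q⊆Q′ (L⊆Q (L₁⊆ p))
        ... | inj₂ (inj₁ refl) = v∈Q′
        ... | inj₂ (inj₂ p) = Q⊆Q′ (L⊆Q (L₂⊆ p))

        doubled : ∀ {k} ys → Sorted x k ys → (∀ {z} → z ∈ˡ ys → z ∈ Q) → Sorted x′ (2 * k) ys
        doubled [] [] _ = []
        doubled {k} (y ∷ ys) (lt ∷ so) ⊆Q = subst (2 * k <_) (sym (x-old (⊆Q (here refl)))) (*-monoʳ-< 2 lt)
          ∷ subst (λ z → Sorted x′ z ys) (sym (x-old (⊆Q (here refl)))) (doubled ys so (λ m → ⊆Q (there m)))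
        odd-start : ∀ {k} ys → Sorted x k ys → (∀ {z} → z ∈ˡ ys → z ∈ Q) → Sorted x′ (suc (2 * k)) ys
        odd-start [] [] _ = []
        odd-start {k} (y ∷ ys) (lt ∷ so) ⊆Q = subst (suc (2 * k) <_) (sym (x-old (⊆Q (here refl)))) (double lt)
          ∷ subst (λ z → Sorted x′ z ys) (sym (x-old (⊆Q (here refl)))) (doubled ys so (λ m → ⊆Q (there m)))
        insert : ∀ k A → x′ v ≡ suc (2 * gap x k A) → Sorted x k (A ++ M ++ L₂) →
                 (∀ {z} → z ∈ˡ A ++ M ++ L₂ → z ∈ Q) → Sorted x′ (2 * k) (A ++ v ∷ L₂)
        insert k [] e so ⊆Q = subst (2 * k <_) (sym e) ≤-refl
          ∷ subst (λ z → Sorted x′ z L₂) (sym e) (odd-start L₂ (drop-sorted M so) (λ m → ⊆Q (∈-++⁺ʳ M m)))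
        insert k (y ∷ A) e (lt ∷ so) ⊆Q = subst (2 * k <_) (sym (x-old (⊆Q (here refl)))) (*-monoʳ-< 2 lt)
          ∷ subst (λ z → Sorted x′ z (A ++ v ∷ L₂)) (sym (x-old (⊆Q (here refl)))) (insert (x y) A e so (λ m → ⊆Q (there m)))

        sorted′ : Sorted x′ 0 (L₁ ++ v ∷ L₂)
        sorted′ = insert 0 L₁ x-new sorted L⊆Q
        reassoc : Sorted x 0 ((L₁ ++ M) ++ L₂)
        reassoc = subst (Sorted x 0) (sym (++-assoc′ L₁)) sorted
          where
          ++-assoc′ : ∀ A → (A ++ M) ++ L₂ ≡ A ++ M ++ L₂
          ++-assoc′ [] = refl
          ++-assoc′ (y ∷ A) = cong (y ∷_) (++-assoc′ A)

        -- With `high`: the older neighbours of v lie between the end of L₁ and the start of L₂, so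
        -- the new edges run above M only and leave L₁ and L₂ visible.
        low : ∀ {u w} → u ∈ˡ L₁ → w ∈ Q → Adj G w v → x u ≤ x w
        low {u} u∈ w∈ wv with nbr w∈ wv
        ... | inj₁ (A , refl) with ∈-++⁻ A u∈
        ...   | inj₁ u∈A = <⇒≤ (before A (subst (Sorted x 0) (assoc₁ A) sorted) u∈A (here refl))
          where
          assoc₁ : ∀ A {w} → (A ++ [ w ]) ++ M ++ L₂ ≡ A ++ w ∷ M ++ L₂
          assoc₁ [] = refl
          assoc₁ (y ∷ A) = cong (y ∷_) (assoc₁ A)
        ...   | inj₂ (here refl) = ≤-refl
        low u∈ w∈ wv | inj₂ (inj₁ m) = <⇒≤ (before L₁ sorted u∈ (∈-++⁺ˡ m))
        low u∈ w∈ wv | inj₂ (inj₂ (_ , refl)) = <⇒≤ (before L₁ sorted u∈ (∈-++⁺ʳ M (here refl)))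
        high : ∀ {u w} → u ∈ˡ L₂ → w ∈ Q → Adj G w v → x w ≤ x u
        high {u} u∈ w∈ wv with nbr w∈ wv
        ... | inj₁ (A , refl) = <⇒≤ (before L₁ sorted (∈-++⁺ʳ A (here refl)) (∈-++⁺ʳ M u∈))
        ... | inj₂ (inj₁ m) = <⇒≤ (before (L₁ ++ M) reassoc (∈-++⁺ʳ L₁ m) u∈)
        ... | inj₂ (inj₂ (_ , refl)) = at-head u∈ (drop-sorted M (drop-sorted L₁ sorted))
          where
          at-head : ∀ {u w B k} → u ∈ˡ w ∷ B → Sorted x k (w ∷ B) → x w ≤ x u
          at-head (here refl) _ = ≤-refl
          at-head (there m) (_ ∷ so) = <⇒≤ (above so m)
        nbr-L : ∀ {w} → w ∈ Q → Adj G w v → w ∈ˡ L₁ ++ M ++ L₂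
        nbr-L w∈ wv with nbr w∈ wv
        ... | inj₁ (A , refl) = L₁⊆ (∈-++⁺ʳ A (here refl))
        ... | inj₂ (inj₁ m) = M⊆ m
        ... | inj₂ (inj₂ (_ , refl)) = L₂⊆ (here refl)

        vis : ∀ {u y w} → u ∈ˡ L₁ ++ v ∷ L₂ → y ∈ Q′ → w ∈ Q′ → Adj G y w → τ′ y < τ′ w → τ′ u < τ′ w →
              ¬ Between (x′ y) (x′ u) (x′ w)
        vis {u} u∈ y∈ w∈ yw lt lt′ b with Q′⊆ y∈ | Q′⊆ w∈ | split-L u∈
        ... | inj₂ refl | w∈? | _ = τ-last w∈? lt
        ... | _ | w∈? | inj₂ (inj₁ refl) = τ-last w∈? lt′
        ... | inj₁ yQ | inj₁ wQ | inj₁ u∈₁ = visible (L₁⊆ u∈₁) yQ wQ yw (τ-lt yQ wQ lt) (τ-lt (L⊆Q (L₁⊆ u∈₁)) wQ lt′)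
                   (bt yQ (L⊆Q (L₁⊆ u∈₁)) wQ b)
        ... | inj₁ yQ | inj₁ wQ | inj₂ (inj₂ u∈₂) = visible (L₂⊆ u∈₂) yQ wQ yw (τ-lt yQ wQ lt) (τ-lt (L⊆Q (L₂⊆ u∈₂)) wQ lt′)
                   (bt yQ (L⊆Q (L₂⊆ u∈₂)) wQ b)
        ... | inj₁ yQ | inj₂ refl | inj₁ u∈₁ = [ (λ (p , _) → <⇒≱ (x-lt yQ uQ p) (low u∈₁ yQ yw))
                                               , (λ (p , _) → <-asym p (before L₁ sorted′ u∈₁ (here refl))) ]′ b
          where uQ = L⊆Q (L₁⊆ u∈₁)
        ... | inj₁ yQ | inj₂ refl | inj₂ (inj₂ u∈₂) = [ (λ (_ , q) → <-asym q (v<u (drop-sorted L₁ sorted′)))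
                                                      , (λ (_ , q) → <⇒≱ (x-lt uQ yQ q) (high u∈₂ yQ yw)) ]′ b
          where
          uQ = L⊆Q (L₂⊆ u∈₂)
          v<u : ∀ {k} → Sorted x′ k (v ∷ L₂) → x′ v < x′ u
          v<u (_ ∷ so) = above so u∈₂

        good′ : ∀ {a b c d} → a ∈ Q ⊎ a ≡ v → b ∈ Q ⊎ b ≡ v → c ∈ Q ⊎ c ≡ v → d ∈ Q ⊎ d ≡ v →
                Adj G a b → Adj G c d → τ′ a < τ′ b → τ′ c < τ′ d → τ′ a < τ′ d → τ′ d < τ′ b →
                ¬ Between (x′ c) (x′ a) (x′ d)
        good′ (inj₂ refl) b _ _ _ _ lt _ _ _ = ⊥-elim (τ-last b lt)
        good′ (inj₁ _) b (inj₂ refl) d _ _ _ lt _ _ = ⊥-elim (τ-last d lt)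
        good′ (inj₁ _) b (inj₁ _) (inj₂ refl) _ _ _ _ _ lt = ⊥-elim (τ-last b lt)
        good′ (inj₁ a) (inj₁ b) (inj₁ c) (inj₁ d) ab cd l₁ l₂ l₃ l₄ bw =
          good a b c d ab cd (τ-lt a b l₁) (τ-lt c d l₂) (τ-lt a d l₃) (τ-lt d b l₄) (bt c a d bw)
        -- The edge ab ends in the new vertex. Its lower end was visible from above, so no old
        -- horizontal part crosses its vertical part.
        good′ (inj₁ a) (inj₂ refl) (inj₁ c) (inj₁ d) ab cd l₁ l₂ l₃ l₄ bw =
          visible (nbr-L a ab) c d cd (τ-lt c d l₂) (τ-lt a d l₃) (bt c a d bw)

        newest : ∀ {z} → z ∈ Q → τ′ z < τ′ v
        newest m = subst₂ _<_ (sym (τ-old m)) (sym τ-new) (τ< m)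

        leftmost : L₁ ≡ [] → ∀ {z} → z ∈ Q → x′ v < x′ z
        leftmost e m = subst₂ _<_ (sym (trans x-new (cong (λ A → suc (2 * gap x 0 A)) e))) (sym (x-old m)) (double (x>0 m))

        rec : ∀ {w} → w ∈ Q ⊎ w ≡ v → Adj G s w →
              (∀ {z} → z ∈ Q′ → τ′ z < τ′ w → x′ z < x′ w) ⊎ (∀ {z} → z ∈ Q′ → τ′ z < τ′ w → x′ w < x′ z)
        rec (inj₁ wQ) sw with record-breaking wQ sw
        ... | inj₁ f = inj₁ λ z∈ lt → [ (λ zQ → x-lt⁺ zQ wQ (f zQ (τ-lt zQ wQ lt))) , (λ { refl → ⊥-elim (τ-last (inj₁ wQ) lt) }) ]′ (Q′⊆ z∈)
        ... | inj₂ f = inj₂ λ z∈ lt → [ (λ zQ → x-lt⁺ wQ zQ (f zQ (τ-lt zQ wQ lt))) , (λ { refl → ⊥-elim (τ-last (inj₁ wQ) lt) }) ]′ (Q′⊆ z∈)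
        rec (inj₂ refl) sw = inj₂ λ z∈ lt → [ leftmost (sv sw) , (λ { refl → ⊥-elim (<-irrefl refl lt) }) ]′ (Q′⊆ z∈)

      place : ∀ {Q Q′} L₁ M L₂ {v} → Layout G s Q (L₁ ++ M ++ L₂) → v ∉ Q →
        Q ⊆ Q′ → v ∈ Q′ → (∀ {z} → z ∈ Q′ → z ∈ Q ⊎ z ≡ v) →
        (∀ {w} → w ∈ Q → Adj G w v → (∃ λ L₁′ → L₁ ≡ L₁′ ++ [ w ]) ⊎ w ∈ˡ M ⊎ (∃ λ L₂′ → L₂ ≡ w ∷ L₂′)) →
        (Adj G s v → L₁ ≡ []) → Layout G s Q′ (L₁ ++ v ∷ L₂)
      place L₁ M L₂ ly v∉Q a b c d e = proj₁ (insert-vertex L₁ M L₂ ly v∉Q a b c d e)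

-- Statements about all large natural numbers

module Eventual where

  open import Data.Fin.Base using (Fin; zero; suc)
  open import Data.Nat.Base as ℕ using (ℕ)
  import Data.Nat.Properties as ℕ
  open import Data.Product.Base using (∃; _×_; _,_)

  Eventually : (ℕ → Set) → Set
  Eventually P = ∃ λ N₀ → ∀ N → N₀ ℕ.≤ N → P N

  eventually-all : ∀ {m} {P : Fin m → ℕ → Set} → (∀ i → Eventually (P i)) → Eventually (λ N → ∀ i → P i N)
  eventually-all {ℕ.zero} ev = 0 , λ _ _ ()
  eventually-all {ℕ.suc m} {P} ev with ev zero | eventually-all (λ i → ev (suc i))
  ... | N₀ , f | N₁ , g = N₀ ℕ.⊔ N₁ , λ { N le zero → f N (ℕ.≤-trans (ℕ.m≤m⊔n N₀ N₁) le)
                                         ; N le (suc i) → g N (ℕ.≤-trans (ℕ.m≤n⊔m N₀ N₁) le) i }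

  eventually-× : ∀ {P Q : ℕ → Set} → Eventually P → Eventually Q → Eventually (λ N → P N × Q N)
  eventually-× (N₀ , f) (N₁ , g) = N₀ ℕ.⊔ N₁ , λ N le →
    f N (ℕ.≤-trans (ℕ.m≤m⊔n N₀ N₁) le) , g N (ℕ.≤-trans (ℕ.m≤n⊔m N₀ N₁) le)

  eventually-map : ∀ {P Q : ℕ → Set} → (∀ N → P N → Q N) → Eventually P → Eventually Q
  eventually-map h (N₀ , f) = N₀ , λ N le → h N (f N le)

-- Separating lines with integer coefficients

module Geometry where

  open import Data.Empty using (⊥-elim)
  open import Data.Fin.Base using (Fin)
  open import Data.Fin.Subset using (Subset; _∈_)
  open import Data.Integer.Base hiding (∣_∣; suc; pred)
  open import Data.Integer.Properties hiding (_≟_)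
  open import Data.Integer.Tactic.RingSolver using (solve-∀)
  open import Data.Nat.Base as ℕ using (ℕ)
  open import Data.Product.Base using (_×_; _,_)
  open import Data.Sum.Base as Sum using (_⊎_; inj₁; inj₂)
  open import Relation.Binary.PropositionalEquality hiding ([_])
  open import Relation.Binary.Definitions using (tri<; tri≈; tri>)
  open import Relation.Nullary using (¬_)

  infixl 6 _⊕_ _⊕′_
  infixl 7 _⊗_

  _⊕_ : ∀ {a b} → 0ℤ ≤ a → 0ℤ ≤ b → 0ℤ ≤ a + b
  _⊕_ = +-mono-≤

  _⊕′_ : ∀ {a b} → 0ℤ < a → 0ℤ ≤ b → 0ℤ < a + b
  _⊕′_ = +-mono-<-≤

  _⊗_ : ∀ {a b} → 0ℤ ≤ a → 0ℤ ≤ b → 0ℤ ≤ a * b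
  _⊗_ {+ m} {+ n} _ _ = subst (0ℤ ≤_) (pos-* m n) (+≤+ ℕ.z≤n)

  _⊗′_ : ∀ {a b} → 0ℤ < a → 0ℤ < b → 0ℤ < a * b
  _⊗′_ {+ ℕ.suc m} {+ ℕ.suc n} _ _ = +<+ (ℕ.s≤s ℕ.z≤n)
  _⊗′_ {+ ℕ.zero} (+<+ ()) _
  _⊗′_ {+ ℕ.suc m} {+ ℕ.zero} _ (+<+ ())

  ≤⇒0≤ : ∀ {a b} → a ≤ b → 0ℤ ≤ b - a
  ≤⇒0≤ = i≤j⇒0≤j-i

  <⇒0< : ∀ {a b} → a < b → 0ℤ < b - a
  <⇒0< {a} {b} lt = subst (_< b - a) (+-inverseʳ a) (+-monoˡ-< (- a) lt)

  0<⇒< : ∀ {a b} → 0ℤ < b - a → a < b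
  0<⇒< {a} {b} lt = subst₂ _<_ (+-identityˡ a) (solve′ a b) (+-monoˡ-< a lt)
    where
    solve′ : ∀ a b → b - a + a ≡ b
    solve′ = solve-∀

  0<⇒1≤ : ∀ {a} → 0ℤ < a → 0ℤ ≤ a - 1ℤ
  0<⇒1≤ lt = ≤⇒0≤ (i<j⇒suc[i]≤j lt)

  neg⇒pos : ∀ {a} → a < 0ℤ → 0ℤ < - a
  neg⇒pos lt = neg-mono-< lt

  pos⇒neg : ∀ {a} → 0ℤ < a → - a < 0ℤ
  pos⇒neg lt = neg-mono-< lt

  record Form : Set where
    constructor form
    field
      α β γ : ℤ

  eval : Form → ℤ → ℤ → ℤ
  eval (form α β γ) x y = α * x + β * y + γ

  negate : Form → Form
  negate (form α β γ) = form (- α) (- β) (- γ)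

  eval-negate : ∀ ℓ x y → eval (negate ℓ) x y ≡ - eval ℓ x y
  eval-negate (form α β γ) x y = go α β γ x y
    where
    go : ∀ α β γ x y → - α * x + - β * y + - γ ≡ - (α * x + β * y + γ)
    go = solve-∀

  module _ {n : ℕ} where

    _∈₂_,_ : Fin n → Fin n → Fin n → Set
    w ∈₂ u , v = w ≡ u ⊎ w ≡ v

    swap₂ : ∀ {w u v} → w ∈₂ u , v → w ∈₂ v , u
    swap₂ = Sum.swap

    module Plane (X Y : Fin n → ℤ) where

      at : Form → Fin n → ℤ
      at ℓ w = eval ℓ (X w) (Y w)

      -- The cells uv and pq, each an edge or a vertex (u ≡ v), lie in opposite
      -- closed half planes and touch the line only in common vertices.
      record Sep (u v p q : Fin n) : Set where
        constructor sep
        field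
          line : Form
          minus : ∀ {w} → w ∈₂ u , v → at line w < 0ℤ ⊎ at line w ≡ 0ℤ × w ∈₂ p , q
          plus  : ∀ {w} → w ∈₂ p , q → 0ℤ < at line w ⊎ at line w ≡ 0ℤ × w ∈₂ u , v

      sep-sym : ∀ {u v p q} → Sep u v p q → Sep p q u v
      sep-sym (sep ℓ ng ps) = sep (negate ℓ)
        (λ {w} m → Sum.map (λ lt → subst (_< 0ℤ) (sym (e w)) (pos⇒neg lt)) (λ (z , m′) → trans (e w) (cong -_ z) , m′) (ps m))
        (λ {w} m → Sum.map (λ lt → subst (0ℤ <_) (sym (e w)) (neg⇒pos lt)) (λ (z , m′) → trans (e w) (cong -_ z) , m′) (ng m))
        where
        e : ∀ w → at (negate ℓ) w ≡ - at ℓ w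
        e w = eval-negate ℓ (X w) (Y w)

      sep-swap : ∀ {u v p q} → Sep u v p q → Sep v u p q
      sep-swap (sep ℓ ng ps) = sep ℓ (λ m → ng (swap₂ m)) (λ m → Sum.map₂ (λ (z , m′) → z , swap₂ m′) (ps m))

      sep-swapʳ : ∀ {u v p q} → Sep u v p q → Sep u v q p
      sep-swapʳ s = sep-sym (sep-swap (sep-sym s))

      strict : ∀ {u v p q} (ℓ : Form) → at ℓ u < 0ℤ → at ℓ v < 0ℤ → 0ℤ < at ℓ p → 0ℤ < at ℓ q → Sep u v p q
      strict ℓ a b c d = sep ℓ (λ { (inj₁ refl) → inj₁ a ; (inj₂ refl) → inj₁ b }) (λ { (inj₁ refl) → inj₁ c ; (inj₂ refl) → inj₁ d })

      det : Fin n → Fin n → Fin n → ℤ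
      det u v w = (X v - X u) * (Y w - Y u) - (Y v - Y u) * (X w - X u)

      det-form : Fin n → Fin n → Form
      det-form u v = form (- (Y v - Y u)) (X v - X u) ((Y v - Y u) * X u - (X v - X u) * Y u)

      at-det : ∀ u v w → at (det-form u v) w ≡ det u v w
      at-det u v w = go (X u) (Y u) (X v) (Y v) (X w) (Y w)
        where
        go : ∀ xu yu xv yv xw yw → - (yv - yu) * xw + (xv - xu) * yw + ((yv - yu) * xu - (xv - xu) * yu)
             ≡ (xv - xu) * (yw - yu) - (yv - yu) * (xw - xu)
        go = solve-∀

      det-swap : ∀ u v w → det v u w ≡ - det u v w
      det-swap u v w = go (X u) (Y u) (X v) (Y v) (X w) (Y w)
        where
        go : ∀ xu yu xv yv xw yw → (xu - xv) * (yw - yv) - (yu - yv) * (xw - xv)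
             ≡ - ((xv - xu) * (yw - yu) - (yv - yu) * (xw - xu))
        go = solve-∀

      det-exchange : ∀ u v w → det u w v ≡ - det u v w
      det-exchange u v w = go (X u) (Y u) (X v) (Y v) (X w) (Y w)
        where
        go : ∀ xu yu xv yv xw yw → (xw - xu) * (yv - yu) - (yw - yu) * (xv - xu)
             ≡ - ((xv - xu) * (yw - yu) - (yv - yu) * (xw - xu))
        go = solve-∀

      det-self : ∀ u v → det u v u ≡ 0ℤ
      det-self u v = go (X u) (Y u) (X v) (Y v)
        where
        go : ∀ xu yu xv yv → (xv - xu) * (yu - yu) - (yv - yu) * (xu - xu) ≡ 0ℤ
        go = solve-∀

      det-self′ : ∀ u v → det u v v ≡ 0ℤ
      det-self′ u v = go (X u) (Y u) (X v) (Y v)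
        where
        go : ∀ xu yu xv yv → (xv - xu) * (yv - yu) - (yv - yu) * (xv - xu) ≡ 0ℤ
        go = solve-∀

      -- Integer values that are not positive are at most 0, the others at least 1. Passing from ℓ
      -- to 2ℓ - 1 makes both signs strict.
      shift : Form → Form
      shift (form α β γ) = form (+ 2 * α) (+ 2 * β) (+ 2 * γ - 1ℤ)

      at-shift : ∀ ℓ w → at (shift ℓ) w ≡ + 2 * at ℓ w - 1ℤ
      at-shift (form α β γ) w = go α β γ (X w) (Y w)
        where
        go : ∀ α β γ x y → + 2 * α * x + + 2 * β * y + (+ 2 * γ - 1ℤ) ≡ + 2 * (α * x + β * y + γ) - 1ℤ
        go = solve-∀

      shift-neg : ∀ ℓ {w} → at ℓ w ≤ 0ℤ → at (shift ℓ) w < 0ℤ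
      shift-neg ℓ {w} le = subst (_< 0ℤ) (sym (at-shift ℓ w)) (≤-<-trans (+-monoˡ-≤ -1ℤ (*-monoˡ-≤-nonNeg (+ 2) le)) -<+)

      shift-pos : ∀ ℓ {w} → 0ℤ < at ℓ w → 0ℤ < at (shift ℓ) w
      shift-pos ℓ {w} lt = subst (0ℤ <_) (sym (at-shift ℓ w))
        (<-≤-trans (+<+ (ℕ.s≤s ℕ.z≤n)) (+-monoˡ-≤ -1ℤ (*-monoˡ-≤-nonNeg (+ 2) (i<j⇒suc[i]≤j lt))))

      half-strict : ∀ {u v p q} (ℓ : Form) → at ℓ u ≤ 0ℤ → at ℓ v ≤ 0ℤ → 0ℤ < at ℓ p → 0ℤ < at ℓ q → Sep u v p q
      half-strict ℓ a b c d = strict (shift ℓ) (shift-neg ℓ a) (shift-neg ℓ b) (shift-pos ℓ c) (shift-pos ℓ d)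

      same-side : ∀ {u v p q} → (0ℤ < det u v p × 0ℤ < det u v q) ⊎ (det u v p < 0ℤ × det u v q < 0ℤ) → Sep u v p q
      same-side {u} {v} {p} {q} (inj₁ (a , b)) = half-strict (det-form u v)
        (≤-reflexive (trans (at-det u v u) (det-self u v))) (≤-reflexive (trans (at-det u v v) (det-self′ u v)))
        (subst (0ℤ <_) (sym (at-det u v p)) a) (subst (0ℤ <_) (sym (at-det u v q)) b)
      same-side {u} {v} {p} {q} (inj₂ (a , b)) = half-strict (det-form v u)
        (≤-reflexive (trans (at-det v u u) (det-self′ v u))) (≤-reflexive (trans (at-det v u v) (det-self v u)))
        (subst (0ℤ <_) (sym (trans (at-det v u p) (det-swap u v p))) (neg⇒pos a))
        (subst (0ℤ <_) (sym (trans (at-det v u q) (det-swap u v q))) (neg⇒pos b))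

      -- The sum of the two edge lines vanishes at u and is negative at v, positive at q.
      common-end⁺ : ∀ {u v q} → 0ℤ < det u v q → Sep u v u q
      common-end⁺ {u} {v} {q} lt = sep ℓ
        (λ { (inj₁ refl) → inj₂ (at-u , inj₁ refl) ; (inj₂ refl) → inj₁ (subst (_< 0ℤ) (sym at-v) (pos⇒neg lt)) })
        (λ { (inj₁ refl) → inj₂ (at-u , inj₁ refl) ; (inj₂ refl) → inj₁ (subst (0ℤ <_) (sym at-q) lt) })
        where
        ℓ : Form
        ℓ = form (- (Y v - Y u) - (Y q - Y u)) ((X v - X u) + (X q - X u))
                 ((Y v - Y u) * X u - (X v - X u) * Y u + ((Y q - Y u) * X u - (X q - X u) * Y u))
        sum : ∀ w → at ℓ w ≡ det u v w + det u q w
        sum w = go (X u) (Y u) (X v) (Y v) (X q) (Y q) (X w) (Y w)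
          where
          go : ∀ xu yu xv yv xq yq xw yw →
               (- (yv - yu) - (yq - yu)) * xw + ((xv - xu) + (xq - xu)) * yw
                 + ((yv - yu) * xu - (xv - xu) * yu + ((yq - yu) * xu - (xq - xu) * yu))
               ≡ ((xv - xu) * (yw - yu) - (yv - yu) * (xw - xu)) + ((xq - xu) * (yw - yu) - (yq - yu) * (xw - xu))
          go = solve-∀
        at-u = trans (sum u) (cong₂ _+_ (det-self u v) (det-self u q))
        at-v : at ℓ v ≡ - det u v q
        at-v = trans (sum v) (trans (cong₂ _+_ (det-self′ u v) (det-exchange u v q)) (+-identityˡ _))
        at-q : at ℓ q ≡ det u v q
        at-q = trans (sum q) (trans (cong (λ z → det u v q + z) (det-self′ u q)) (+-identityʳ _))

      common-end : ∀ {u v q} → det u v q ≢ 0ℤ → Sep u v u q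
      common-end {u} {v} {q} ne with <-cmp 0ℤ (det u v q)
      ... | tri< lt _ _ = common-end⁺ lt
      ... | tri≈ _ e _ = ⊥-elim (ne (sym e))
      ... | tri> _ _ gt = sep-sym (common-end⁺ (subst (0ℤ <_) (sym (det-exchange u v q)) (neg⇒pos gt)))

      horizontal : ∀ {u v p q} c → Y u ≤ c → Y v ≤ c → c < Y p → c < Y q → Sep u v p q
      horizontal {u} {v} {p} {q} c a b l₁ l₂ = half-strict (form 0ℤ 1ℤ (- c))
        (subst (_≤ 0ℤ) (sym (e u)) (i≤j⇒i-j≤0 a)) (subst (_≤ 0ℤ) (sym (e v)) (i≤j⇒i-j≤0 b))
        (subst (0ℤ <_) (sym (e p)) (<⇒0< l₁)) (subst (0ℤ <_) (sym (e q)) (<⇒0< l₂))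
        where
        e : ∀ w → at (form 0ℤ 1ℤ (- c)) w ≡ Y w - c
        e w = go (X w) (Y w) c
          where
          go : ∀ x y c → 0ℤ * x + 1ℤ * y + - c ≡ y - c
          go = solve-∀

      Cell : Graph n → Fin n → Fin n → Set
      Cell G u v = u ≡ v ⊎ Adj G u v

      Inside : (u v p q : Fin n) → Set
      Inside u v p q = u ∈₂ p , q × v ∈₂ p , q

      -- Vertices count as degenerate cells, so this one condition says at once that vertices are
      -- distinct points, that they avoid foreign edges, and that edges meet in common ends only.
      Drawing : Graph n → Subset n → Set
      Drawing G S = ∀ {u v p q} → u ∈ S → v ∈ S → p ∈ S → q ∈ S → Cell G u v → Cell G p q →
                    ¬ Inside u v p q → ¬ Inside p q u v → Sep u v p q

    -- The segment st lies on the outer boundary, with the drawing entirely on its right and between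
    -- the heights of its ends. This is what allows the drawing to be squeezed along an edge of
    -- another one.
    record Poles (G : Graph n) (S : Subset n) (s t : Fin n) : Set where
      field
        X Y     : Fin n → ℤ
      open Plane X Y
      field
        drawing : Drawing G S
        low     : ∀ {v} → v ∈ S → v ≢ s → Y s < Y v
        high    : ∀ {v} → v ∈ S → v ≢ t → Y v < Y t
        right   : ∀ {v} → v ∈ S → v ≢ s → v ≢ t → det s t v < 0ℤ

-- From layouts to straight-line drawings

module StraightLines where

  import Data.Integer.Properties
  open import Data.Empty using (⊥-elim)
  open import Data.Fin.Base using (Fin)
  open import Data.Fin.Properties using (_≟_)
  open import Data.Fin.Subset using (Subset; _∈_; _∉_)
  open import Data.Integer.Base hiding (∣_∣; suc; pred)
  open import Data.Integer.Properties using (pos-*; +-mono-≤; ≤-reflexive; ≤-trans)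
  open import Data.Integer.Tactic.RingSolver using (solve-∀)
  open import Data.Nat.Base as ℕ using (ℕ)
  import Data.Nat.Properties as ℕ
  import Data.Nat.Tactic.RingSolver as ℕ-solver
  open import Data.Product.Base using (_×_; _,_; proj₁; proj₂)
  open import Data.Sum.Base using (_⊎_; inj₁; inj₂; [_,_]′)
  open import Relation.Binary.Definitions using (tri<; tri≈; tri>)
  open import Relation.Binary.PropositionalEquality hiding ([_])
  open import Relation.Nullary using (¬_; yes; no)
  open Geometry
  open Layouts

  0≤+ : ∀ {m} → 0ℤ ≤ + m
  0≤+ = +≤+ ℕ.z≤n

  0≤* : ∀ m n → 0ℤ ≤ + m * + n
  0≤* m n = subst (0ℤ ≤_) (pos-* m n) 0≤+

  gap-1 : ∀ {a b} → a ℕ.< b → 0ℤ ≤ + b - + a - 1ℤ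
  gap-1 {a} {b} lt = 0<⇒1≤ (<⇒0< (+<+ lt))

  gap-0 : ∀ {a b} → a ℕ.≤ b → 0ℤ ≤ + b - + a
  gap-0 le = ≤⇒0≤ (+≤+ le)

  -- `Yv` outweighs all products with lower heights, so the line uv is nearly vertical and z lies
  -- beside it as it lies beside u. As in the next lemmas, the determinant is written as a sum of
  -- products of nonnegative quantities.
  lean-right : ∀ {b xu xv xz Yu Yv Yz} → xu ℕ.≤ b → xv ℕ.≤ b → Yu ℕ.≤ Yv → b ℕ.* Yz ℕ.+ b ℕ.* Yu ℕ.+ Yu ℕ.< Yv → xu ℕ.< xz →
    0ℤ < - ((+ xv - + xu) * (+ Yz - + Yu) - (+ Yv - + Yu) * (+ xz - + xu))
  lean-right {b} {xu} {xv} {xz} {Yu} {Yv} {Yz} bu bv le lt x< =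
    subst (0ℤ <_) (trans (cong (λ h → (((((+ Yv - h) + (+ Yv - + Yu) * (+ xz - + xu - 1ℤ)) + (+ b - + xv) * + Yz) + (+ b - + xu) * + Yu) + + xv * + Yu) + + xu * + Yz) e)
        (go (+ b) (+ xu) (+ xv) (+ xz) (+ Yu) (+ Yv) (+ Yz)))
      (<⇒0< (+<+ lt) ⊕′ (gap-0 le ⊗ gap-1 x<) ⊕′ (gap-0 bv ⊗ 0≤+) ⊕′ (gap-0 bu ⊗ 0≤+) ⊕′ 0≤* xv Yu ⊕′ 0≤* xu Yz)
    where
    e : + (b ℕ.* Yz ℕ.+ b ℕ.* Yu ℕ.+ Yu) ≡ + b * + Yz + + b * + Yu + + Yu
    e = cong₂ (λ p q → p + q + + Yu) (pos-* b Yz) (pos-* b Yu)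
    go : ∀ b xu xv xz Yu Yv Yz →
      (((((Yv - (b * Yz + b * Yu + Yu)) + (Yv - Yu) * (xz - xu - 1ℤ)) + (b - xv) * Yz) + (b - xu) * Yu) + xv * Yu) + xu * Yz
      ≡ - ((xv - xu) * (Yz - Yu) - (Yv - Yu) * (xz - xu))
    go = solve-∀

  lean-left : ∀ {b xu xv xz Yu Yv Yz} → xu ℕ.≤ b → xv ℕ.≤ b → Yu ℕ.≤ Yv → b ℕ.* Yz ℕ.+ b ℕ.* Yu ℕ.+ Yu ℕ.< Yv → xz ℕ.< xu →
    0ℤ < (+ xv - + xu) * (+ Yz - + Yu) - (+ Yv - + Yu) * (+ xz - + xu)
  lean-left {b} {xu} {xv} {xz} {Yu} {Yv} {Yz} bu bv le lt x< =
    subst (0ℤ <_) (trans (cong (λ h → (((((+ Yv - h) + (+ Yv - + Yu) * (+ xu - + xz - 1ℤ)) + (+ b - + xv) * + Yu) + (+ b - + xu) * + Yz) + + xv * + Yz) + + xu * + Yu) e)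
        (go (+ b) (+ xu) (+ xv) (+ xz) (+ Yu) (+ Yv) (+ Yz)))
      (<⇒0< (+<+ lt) ⊕′ (gap-0 le ⊗ gap-1 x<) ⊕′ (gap-0 bv ⊗ 0≤+) ⊕′ (gap-0 bu ⊗ 0≤+) ⊕′ 0≤* xv Yz ⊕′ 0≤* xu Yu)
    where
    e : + (b ℕ.* Yz ℕ.+ b ℕ.* Yu ℕ.+ Yu) ≡ + b * + Yz + + b * + Yu + + Yu
    e = cong₂ (λ p q → p + q + + Yu) (pos-* b Yz) (pos-* b Yu)
    go : ∀ b xu xv xz Yu Yv Yz →
      (((((Yv - (b * Yz + b * Yu + Yu)) + (Yv - Yu) * (xu - xz - 1ℤ)) + (b - xv) * Yu) + (b - xu) * Yz) + xv * Yz) + xu * Yu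
      ≡ (xv - xu) * (Yz - Yu) - (Yv - Yu) * (xz - xu)
    go = solve-∀

  -- Seen from the depth D, the directions of the vertices are ordered like their abscissas.
  steep : ∀ {D xw xz Yw Yz} → xz ℕ.* Yw ℕ.< D → xz ℕ.< xw →
    0ℤ < (+ xw - 0ℤ) * (+ Yz - - + D) - (+ Yw - - + D) * (+ xz - 0ℤ)
  steep {D} {xw} {xz} {Yw} {Yz} lt x< =
    subst (0ℤ <_) (trans (cong (λ h → ((+ D - h) + (+ xw - + xz - 1ℤ) * + D) + + xw * + Yz) (pos-* xz Yw)) (go (+ D) (+ xw) (+ xz) (+ Yw) (+ Yz)))
      (<⇒0< (+<+ lt) ⊕′ (gap-1 x< ⊗ 0≤+) ⊕′ 0≤* xw Yz)
    where
    go : ∀ D xw xz Yw Yz → ((D - xz * Yw) + (xw - xz - 1ℤ) * D) + xw * Yz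
       ≡ (xw - 0ℤ) * (Yz - - D) - (Yw - - D) * (xz - 0ℤ)
    go = solve-∀

  deep-right : ∀ {D xu xv Yu Yv} → xu ℕ.* Yv ℕ.< D → xu ℕ.< xv →
    0ℤ < - ((+ xv - + xu) * (- + D - + Yu) - (+ Yv - + Yu) * (0ℤ - + xu))
  deep-right {D} {xu} {xv} {Yu} {Yv} lt x< =
    subst (0ℤ <_) (trans (cong (λ h → (((+ D - h) + (+ xv - + xu - 1ℤ) * (+ D + + Yu)) + + Yu) + + Yu * + xu) (pos-* xu Yv))
        (go (+ D) (+ xu) (+ xv) (+ Yu) (+ Yv)))
      (<⇒0< (+<+ lt) ⊕′ (gap-1 x< ⊗ (0≤+ {D} ⊕ 0≤+ {Yu})) ⊕′ 0≤+ ⊕′ 0≤* Yu xu)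
    where
    go : ∀ D xu xv Yu Yv → (((D - xu * Yv) + (xv - xu - 1ℤ) * (D + Yu)) + Yu) + Yu * xu
       ≡ - ((xv - xu) * (- D - Yu) - (Yv - Yu) * (0ℤ - xu))
    go = solve-∀

  deep-left : ∀ {D xu xv Yu Yv} → 0 ℕ.< D → Yu ℕ.≤ Yv → xv ℕ.< xu →
    0ℤ < (+ xv - + xu) * (- + D - + Yu) - (+ Yv - + Yu) * (0ℤ - + xu)
  deep-left {D} {xu} {xv} {Yu} {Yv} lt le x< =
    subst (0ℤ <_) (go (+ D) (+ xu) (+ xv) (+ Yu) (+ Yv))
      (+<+ lt ⊕′ (gap-1 x< ⊗ (0≤+ {D} ⊕ 0≤+ {Yu})) ⊕′ 0≤+ ⊕′ (gap-0 le ⊗ 0≤+))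
    where
    go : ∀ D xu xv Yu Yv → ((D + (xu - xv - 1ℤ) * (D + Yu)) + Yu) + (Yv - Yu) * xu
       ≡ (xv - xu) * (- D - Yu) - (Yv - Yu) * (0ℤ - xu)
    go = solve-∀

  -- Half of v pays for the multiples of m and half for those of k; the base 2b + 2 of the heights
  -- is chosen for this.
  dominate : ∀ b m k v → 0 ℕ.< m → (2 ℕ.* b ℕ.+ 2) ℕ.* m ℕ.≤ v → (2 ℕ.* b ℕ.+ 2) ℕ.* k ℕ.≤ v → b ℕ.* m ℕ.+ b ℕ.* k ℕ.+ k ℕ.< v
  dominate b m k v 0<m lm lk = ℕ.<-≤-trans (ℕ.m<m+n _ 0<m)
    (ℕ.*-cancelˡ-≤ 2 (ℕ.≤-trans (ℕ.≤-reflexive (go b m k)) (ℕ.≤-trans (ℕ.+-mono-≤ lm lk) (ℕ.≤-reflexive (double v)))))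
    where
    go : ∀ b m k → 2 ℕ.* (b ℕ.* m ℕ.+ b ℕ.* k ℕ.+ k ℕ.+ m) ≡ (2 ℕ.* b ℕ.+ 2) ℕ.* m ℕ.+ (2 ℕ.* b ℕ.+ 2) ℕ.* k
    go = ℕ-solver.solve-∀
    double : ∀ v → v ℕ.+ v ≡ 2 ℕ.* v
    double = ℕ-solver.solve-∀

  module _ {n : ℕ} {G : Graph n} {S Q : Subset n} {s t : Fin n} {L} (ly : Layout G s Q L)
           (S⊆ : ∀ {v} → v ∈ S → v ≡ s ⊎ v ∈ Q) (s∉Q : s ∉ Q) (t∈Q : t ∈ Q)
           (last : ∀ {v} → v ∈ Q → v ≢ t → Layout.τ ly v ℕ.< Layout.τ ly t)
           (leftmost : ∀ {v} → v ∈ Q → v ≢ t → Layout.x ly t ℕ.< Layout.x ly v) where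
    open Layout ly

    private
      b = proj₁ (bounded {n} x)
      x≤b : ∀ v → x v ℕ.≤ b
      x≤b = proj₂ (bounded {n} x)
      M = 2 ℕ.* b ℕ.+ 2
      instance
        M≢0 : ℕ.NonZero M
        M≢0 = ℕ.>-nonZero (ℕ.≤-trans (ℕ.s≤s ℕ.z≤n) (ℕ.m≤n+m 2 (2 ℕ.* b)))
      -- Exponential heights: each exceeds every earlier one by the factor M, so that straight edges
      -- rise almost vertically from their older end, as the layout prescribes.
      height : Fin n → ℕ
      height v = M ℕ.^ τ v
      -- Larger than every product of an abscissa and a height in Q, as the lemmas about the pole s
      -- require.
      D = ℕ.suc (b ℕ.* M ℕ.^ clock)

      X Y : Fin n → ℤ
      X v with v ≟ s
      ... | yes _ = 0ℤ
      ... | no _ = + x v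
      Y v with v ≟ s
      ... | yes _ = - + D
      ... | no _ = + height v

      X-s : X s ≡ 0ℤ
      X-s with s ≟ s
      ... | yes _ = refl
      ... | no ne = ⊥-elim (ne refl)
      Y-s : Y s ≡ - + D
      Y-s with s ≟ s
      ... | yes _ = refl
      ... | no ne = ⊥-elim (ne refl)
      X-Q : ∀ {v} → v ∈ Q → X v ≡ + x v
      X-Q {v} v∈ with v ≟ s
      ... | yes refl = ⊥-elim (s∉Q v∈)
      ... | no _ = refl
      Y-Q : ∀ {v} → v ∈ Q → Y v ≡ + height v
      Y-Q {v} v∈ with v ≟ s
      ... | yes refl = ⊥-elim (s∉Q v∈)
      ... | no _ = refl

      open Plane X Y

      height-≤ : ∀ {u v} → τ u ℕ.< τ v → height u ℕ.≤ height v
      height-≤ lt = ℕ.^-monoʳ-≤ M (ℕ.<⇒≤ lt)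

      height-far : ∀ {u v} → τ u ℕ.< τ v → M ℕ.* height u ℕ.≤ height v
      height-far lt = ℕ.^-monoʳ-≤ M lt

      0<height : ∀ v → 0 ℕ.< height v
      0<height v = ℕ.m^n>0 M (τ v)

      product<D : ∀ {z w} → w ∈ Q → x z ℕ.* height w ℕ.< D
      product<D {z} {w} w∈ = ℕ.s≤s (ℕ.*-mono-≤ (x≤b z) (ℕ.^-monoʳ-≤ M (ℕ.<⇒≤ (τ< w∈))))

      det-Q : ∀ {u v z} → u ∈ Q → v ∈ Q → z ∈ Q →
        (+ x v - + x u) * (+ height z - + height u) - (+ height v - + height u) * (+ x z - + x u) ≡ det u v z
      det-Q u∈ v∈ z∈ rewrite X-Q u∈ | X-Q v∈ | X-Q z∈ | Y-Q u∈ | Y-Q v∈ | Y-Q z∈ = refl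

      det-s : ∀ {w z} → w ∈ Q → z ∈ Q →
        (+ x w - 0ℤ) * (+ height z - - + D) - (+ height w - - + D) * (+ x z - 0ℤ) ≡ det s w z
      det-s w∈ z∈ rewrite X-s | Y-s | X-Q w∈ | X-Q z∈ | Y-Q w∈ | Y-Q z∈ = refl

      det-at-s : ∀ {u v} → u ∈ Q → v ∈ Q →
        (+ x v - + x u) * (- + D - + height u) - (+ height v - + height u) * (0ℤ - + x u) ≡ det u v s
      det-at-s u∈ v∈ rewrite X-s | Y-s | X-Q u∈ | X-Q v∈ | Y-Q u∈ | Y-Q v∈ = refl

      unneg : ∀ {a b} → 0ℤ < - a → a ≡ b → b < 0ℤ
      unneg {a} lt refl = subst (_< 0ℤ) (Data.Integer.Properties.neg-involutive a) (pos⇒neg lt)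

      right-of : ∀ {u v z} → u ∈ Q → v ∈ Q → z ∈ Q → τ u ℕ.< τ v → τ z ℕ.< τ v → x u ℕ.< x z → det u v z < 0ℤ
      right-of {u} {v} {z} u∈ v∈ z∈ uv zv lt = unneg (lean-right (x≤b u) (x≤b v) (height-≤ uv)
        (dominate b _ _ _ (0<height z) (height-far zv) (height-far uv)) lt) (det-Q u∈ v∈ z∈)

      left-of : ∀ {u v z} → u ∈ Q → v ∈ Q → z ∈ Q → τ u ℕ.< τ v → τ z ℕ.< τ v → x z ℕ.< x u → 0ℤ < det u v z
      left-of {u} {v} {z} u∈ v∈ z∈ uv zv lt = subst (0ℤ <_) (det-Q u∈ v∈ z∈) (lean-left (x≤b u) (x≤b v) (height-≤ uv)
        (dominate b _ _ _ (0<height z) (height-far zv) (height-far uv)) lt)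

      left-of-s : ∀ {w z} → w ∈ Q → z ∈ Q → x z ℕ.< x w → 0ℤ < det s w z
      left-of-s {w} {z} w∈ z∈ lt = subst (0ℤ <_) (det-s w∈ z∈) (steep {Yz = height z} (product<D {z} w∈) lt)

      right-of-s : ∀ {w z} → w ∈ Q → z ∈ Q → x w ℕ.< x z → det s w z < 0ℤ
      right-of-s {w} {z} w∈ z∈ lt = subst (_< 0ℤ) (sym (det-exchange s z w)) (pos⇒neg (left-of-s z∈ w∈ lt))

      s-right-of : ∀ {u v} → u ∈ Q → v ∈ Q → x u ℕ.< x v → det u v s < 0ℤ
      s-right-of {u} {v} u∈ v∈ lt = unneg (deep-right {Yu = height u} (product<D {u} v∈) lt) (det-at-s u∈ v∈)

      s-left-of : ∀ {u v} → u ∈ Q → v ∈ Q → τ u ℕ.< τ v → x v ℕ.< x u → 0ℤ < det u v s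
      s-left-of u∈ v∈ uv lt = subst (0ℤ <_) (det-at-s u∈ v∈) (deep-left (ℕ.s≤s ℕ.z≤n) (height-≤ uv) lt)

      Y-mono : ∀ {u v} → u ∈ Q → v ∈ Q → τ u ℕ.< τ v → Y u < Y v
      Y-mono {u} {v} u∈ v∈ lt = subst₂ _<_ (sym (Y-Q u∈)) (sym (Y-Q v∈)) (+<+ (ℕ.<-≤-trans
        (ℕ.m<m*n (height u) M {{ℕ.>-nonZero (0<height u)}} (ℕ.m≤n+m 2 (2 ℕ.* b)))
        (ℕ.≤-trans (ℕ.≤-reflexive (ℕ.*-comm (height u) M)) (height-far lt))))

      Y-low : ∀ {v} → v ∈ Q → Y s < Y v
      Y-low v∈ = subst₂ _<_ (sym Y-s) (sym (Y-Q v∈)) -<+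

      <⇒≤ℤ : ∀ {a b} → a < b → a ≤ b
      <⇒≤ℤ = Data.Integer.Properties.<⇒≤
      refl≤ : ∀ {a} → a ≤ a
      refl≤ = ≤-reflexive refl

      nonzero⁺ : ∀ {a} → 0ℤ < a → a ≢ 0ℤ
      nonzero⁺ (+<+ ()) refl
      nonzero⁻ : ∀ {a} → a < 0ℤ → a ≢ 0ℤ
      nonzero⁻ (+<+ ()) refl

      lateral : ∀ {u z} → u ∈ Q → z ∈ Q → u ≢ z → x u ℕ.< x z ⊎ x z ℕ.< x u
      lateral {u} {z} u∈ z∈ ne with ℕ.<-cmp (x u) (x z)
      ... | tri< lt _ _ = inj₁ lt
      ... | tri≈ _ e _ = ⊥-elim (ne (x-inj u∈ z∈ e))
      ... | tri> _ _ gt = inj₂ gt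

      time : ∀ {u z} → u ∈ Q → z ∈ Q → u ≢ z → τ u ℕ.< τ z ⊎ τ z ℕ.< τ u
      time {u} {z} u∈ z∈ ne with ℕ.<-cmp (τ u) (τ z)
      ... | tri< lt _ _ = inj₁ lt
      ... | tri≈ _ e _ = ⊥-elim (ne (τ-inj u∈ z∈ e))
      ... | tri> _ _ gt = inj₂ gt

      ≢-τ : ∀ {u v} → τ u ℕ.< τ v → u ≢ v
      ≢-τ lt refl = ℕ.<-irrefl refl lt

      det-nonzero : ∀ {u v z} → u ∈ Q → v ∈ Q → z ∈ Q → τ u ℕ.< τ v → τ z ℕ.< τ v → u ≢ z → det u v z ≢ 0ℤ
      det-nonzero u∈ v∈ z∈ uv zv ne with lateral u∈ z∈ ne
      ... | inj₁ lt = nonzero⁻ (right-of u∈ v∈ z∈ uv zv lt)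
      ... | inj₂ gt = nonzero⁺ (left-of u∈ v∈ z∈ uv zv gt)

      det-nonzero-s : ∀ {w z} → w ∈ Q → z ∈ Q → w ≢ z → det s w z ≢ 0ℤ
      det-nonzero-s w∈ z∈ ne with lateral w∈ z∈ ne
      ... | inj₁ lt = nonzero⁻ (right-of-s w∈ z∈ lt)
      ... | inj₂ gt = nonzero⁺ (left-of-s w∈ z∈ gt)

      neg≢0 : ∀ {a b} → b ≡ - a → a ≢ 0ℤ → b ≢ 0ℤ
      neg≢0 {+0} e ne _ = ne refl
      neg≢0 {+[1+ n ]} refl ne ()
      neg≢0 { -[1+ n ]} refl ne ()

      det-rotate : ∀ u v w → det v w u ≡ det u v w
      det-rotate u v w = go (X u) (Y u) (X v) (Y v) (X w) (Y w)
        where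
        go : ∀ xu yu xv yv xw yw → (xw - xv) * (yu - yv) - (yw - yv) * (xu - xv)
             ≡ (xv - xu) * (yw - yu) - (yv - yu) * (xw - xu)
        go = solve-∀

      data Kind : Fin n → Fin n → Set where
        dot  : ∀ {z} → z ∈ Q → Kind z z
        foot : Kind s s
        up   : ∀ {u v} → u ∈ Q → v ∈ Q → Adj G u v → τ u ℕ.< τ v → Kind u v
        base : ∀ {w} → w ∈ Q → Adj G s w → Kind s w

      kind : ∀ {u v} → u ∈ S → v ∈ S → Cell G u v → Kind u v ⊎ Kind v u
      kind u∈ _ (inj₁ refl) with S⊆ u∈
      ... | inj₁ refl = inj₁ foot
      ... | inj₂ u∈Q = inj₁ (dot u∈Q)
      kind u∈ v∈ (inj₂ uv) with S⊆ u∈ | S⊆ v∈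
      ... | inj₁ refl | inj₁ refl = ⊥-elim (irrefl G refl uv)
      ... | inj₁ refl | inj₂ v∈Q = inj₁ (base v∈Q uv)
      ... | inj₂ u∈Q | inj₁ refl = inj₂ (base u∈Q (symm G uv))
      ... | inj₂ u∈Q | inj₂ v∈Q with time u∈Q v∈Q (λ e → irrefl G e uv)
      ...   | inj₁ lt = inj₁ (up u∈Q v∈Q uv lt)
      ...   | inj₂ gt = inj₂ (up v∈Q u∈Q (symm G uv) gt)

      dot-dot : ∀ {z z′} → z ∈ Q → z′ ∈ Q → z ≢ z′ → Sep z z z′ z′
      dot-dot z∈ z∈′ ne with time z∈ z∈′ ne
      ... | inj₁ lt = horizontal _ refl≤ refl≤ (Y-mono z∈ z∈′ lt) (Y-mono z∈ z∈′ lt)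
      ... | inj₂ gt = sep-sym (horizontal _ refl≤ refl≤ (Y-mono z∈′ z∈ gt) (Y-mono z∈′ z∈ gt))

      foot-up : ∀ {u v} → u ∈ Q → v ∈ Q → Sep s s u v
      foot-up u∈ v∈ = horizontal _ refl≤ refl≤ (Y-low u∈) (Y-low v∈)

      dot-up : ∀ {z u v} → z ∈ Q → u ∈ Q → v ∈ Q → τ u ℕ.< τ v → z ≢ u → z ≢ v → Sep z z u v
      dot-up {z} {u} {v} z∈ u∈ v∈ uv z≢u z≢v with time z∈ u∈ z≢u | time z∈ v∈ z≢v
      ... | inj₁ lt | _ = horizontal _ refl≤ refl≤ (Y-mono z∈ u∈ lt) (Y-mono z∈ v∈ (ℕ.<-trans lt uv))
      ... | inj₂ _ | inj₂ gt = sep-sym (horizontal _ (<⇒≤ℤ (Y-mono u∈ v∈ uv)) refl≤ (Y-mono v∈ z∈ gt) (Y-mono v∈ z∈ gt))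
      ... | inj₂ _ | inj₁ zv with lateral u∈ z∈ (λ e → z≢u (sym e))
      ...   | inj₁ lt = let d = right-of u∈ v∈ z∈ uv zv lt in sep-sym (same-side (inj₂ (d , d)))
      ...   | inj₂ gt = let d = left-of u∈ v∈ z∈ uv zv gt in sep-sym (same-side (inj₁ (d , d)))

      dot-base : ∀ {z w} → z ∈ Q → w ∈ Q → z ≢ w → Sep z z s w
      dot-base z∈ w∈ ne with lateral w∈ z∈ (λ e → ne (sym e))
      ... | inj₁ lt = let d = right-of-s w∈ z∈ lt in sep-sym (same-side (inj₂ (d , d)))
      ... | inj₂ gt = let d = left-of-s w∈ z∈ gt in sep-sym (same-side (inj₁ (d , d)))

      base-base : ∀ {w w′} → w ∈ Q → w′ ∈ Q → w ≢ w′ → Sep s w s w′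
      base-base w∈ w∈′ ne = common-end (det-nonzero-s w∈ w∈′ ne)

      -- The line of the edge that ends later separates. If pq does not lie below u and shares no
      -- end with uv, `good` puts p and q on the same side of u, hence of the line uv.
      up-up : ∀ {u v p q} → u ∈ Q → v ∈ Q → p ∈ Q → q ∈ Q → Adj G u v → Adj G p q → τ u ℕ.< τ v → τ p ℕ.< τ q →
              τ q ℕ.≤ τ v → ¬ (u ≡ p × v ≡ q) → Sep u v p q
      up-up {u} {v} {p} {q} u∈ v∈ p∈ q∈ e f uv pq le ne with q ≟ v
      ... | yes refl = sep-swap (sep-swapʳ (common-end (neg≢0 (det-swap u v p)
              (det-nonzero u∈ v∈ p∈ uv pq (λ u≡p → ne (u≡p , refl))))))
      ... | no q≢v with q ≟ u
      ...   | yes refl = sep-swapʳ (common-end (det-nonzero u∈ v∈ p∈ uv (ℕ.<-trans pq uv) (λ e → ≢-τ pq (sym e))))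
      ...   | no q≢u with time q∈ u∈ q≢u
      ...     | inj₁ qu = sep-sym (horizontal _ (<⇒≤ℤ (Y-mono p∈ q∈ pq)) refl≤ (Y-mono q∈ u∈ qu) (Y-mono q∈ v∈ (ℕ.<-trans qu uv)))
      ...     | inj₂ uq with p ≟ u
      ...       | yes refl = common-end (det-nonzero u∈ v∈ q∈ uv qv (λ e → q≢u (sym e)))
        where qv = ℕ.≤∧≢⇒< le (λ e → q≢v (τ-inj q∈ v∈ e))
      ...       | no p≢u with lateral u∈ p∈ (λ e → p≢u (sym e)) | lateral u∈ q∈ (λ e → q≢u (sym e))
      ...         | inj₁ a | inj₁ b = same-side (inj₂ (right-of u∈ v∈ p∈ uv (ℕ.<-≤-trans pq le) a , right-of u∈ v∈ q∈ uv qv b))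
        where qv = ℕ.≤∧≢⇒< le (λ e → q≢v (τ-inj q∈ v∈ e))
      ...         | inj₂ a | inj₂ b = same-side (inj₁ (left-of u∈ v∈ p∈ uv (ℕ.<-≤-trans pq le) a , left-of u∈ v∈ q∈ uv qv b))
        where qv = ℕ.≤∧≢⇒< le (λ e → q≢v (τ-inj q∈ v∈ e))
      ...         | inj₁ a | inj₂ b = ⊥-elim (good u∈ v∈ p∈ q∈ e f uv pq uq qv (inj₂ (b , a)))
        where qv = ℕ.≤∧≢⇒< le (λ e → q≢v (τ-inj q∈ v∈ e))
      ...         | inj₂ a | inj₁ b = ⊥-elim (good u∈ v∈ p∈ q∈ e f uv pq uq qv (inj₁ (a , b)))
        where qv = ℕ.≤∧≢⇒< le (λ e → q≢v (τ-inj q∈ v∈ e))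

      -- If w is inserted between u and v, it broke the record on one side of u. Depending on the
      -- place of v, either sw has u and v on one side, or uv has s and w on one side.
      up-base : ∀ {u v w} → u ∈ Q → v ∈ Q → w ∈ Q → Adj G s w → τ u ℕ.< τ v → Sep u v s w
      up-base {u} {v} {w} u∈ v∈ w∈ sw uv with w ≟ u
      ... | yes refl = sep-swapʳ (common-end (λ e → det-nonzero-s u∈ v∈ (≢-τ uv) (trans (sym (det-rotate s u v)) e)))
      ... | no w≢u with w ≟ v
      ...   | yes refl = sep-swap (sep-swapʳ (common-end (neg≢0 (det-exchange v s u) (neg≢0 (det-swap s v u)
                            (det-nonzero-s v∈ u∈ (λ e′ → ≢-τ uv (sym e′)))))))
      ...   | no w≢v with time w∈ u∈ w≢u | time w∈ v∈ w≢v
      ...     | inj₁ wu | _ = sep-sym (horizontal _ (<⇒≤ℤ (Y-low w∈)) refl≤ (Y-mono w∈ u∈ wu) (Y-mono w∈ v∈ (ℕ.<-trans wu uv)))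
      ...     | inj₂ uw | inj₂ vw with record-breaking w∈ sw
      ...       | inj₁ r = sep-sym (same-side (inj₁ (left-of-s w∈ u∈ (r u∈ uw) , left-of-s w∈ v∈ (r v∈ vw))))
      ...       | inj₂ r = sep-sym (same-side (inj₂ (right-of-s w∈ u∈ (r u∈ uw) , right-of-s w∈ v∈ (r v∈ vw))))
      up-base {u} {v} {w} u∈ v∈ w∈ sw uv | no w≢u | no w≢v | inj₂ uw | inj₁ wv with record-breaking w∈ sw | lateral w∈ v∈ w≢v
      ... | inj₁ r | inj₂ v<w = sep-sym (same-side (inj₁ (left-of-s w∈ u∈ (r u∈ uw) , left-of-s w∈ v∈ v<w)))
      ... | inj₁ r | inj₁ w<v = same-side (inj₂ (s-right-of u∈ v∈ (ℕ.<-trans (r u∈ uw) w<v) , right-of u∈ v∈ w∈ uv wv (r u∈ uw)))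
      ... | inj₂ r | inj₁ w<v = sep-sym (same-side (inj₂ (right-of-s w∈ u∈ (r u∈ uw) , right-of-s w∈ v∈ w<v)))
      ... | inj₂ r | inj₂ v<w = same-side (inj₁ (s-left-of u∈ v∈ uv (ℕ.<-trans v<w (r u∈ uw)) , left-of u∈ v∈ w∈ uv wv (r u∈ uw)))

      sep-kind : ∀ {u v p q} → Kind u v → Kind p q → ¬ Inside u v p q → ¬ Inside p q u v → Sep u v p q
      sep-kind (dot z∈) (dot z∈′) i _ = dot-dot z∈ z∈′ (λ { refl → i (inj₁ refl , inj₁ refl) })
      sep-kind (dot z∈) foot _ _ = sep-sym (foot-up z∈ z∈)
      sep-kind foot (dot z∈) _ _ = foot-up z∈ z∈
      sep-kind foot foot i _ = ⊥-elim (i (inj₁ refl , inj₁ refl))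
      sep-kind foot (up u∈ v∈ _ _) _ _ = foot-up u∈ v∈
      sep-kind (up u∈ v∈ _ _) foot _ _ = sep-sym (foot-up u∈ v∈)
      sep-kind foot (base _ _) i _ = ⊥-elim (i (inj₁ refl , inj₁ refl))
      sep-kind (base _ _) foot _ i = ⊥-elim (i (inj₁ refl , inj₁ refl))
      sep-kind (dot z∈) (up u∈ v∈ _ uv) i _ = dot-up z∈ u∈ v∈ uv (λ e → i (inj₁ e , inj₁ e)) (λ e → i (inj₂ e , inj₂ e))
      sep-kind (up u∈ v∈ _ uv) (dot z∈) _ i = sep-sym (dot-up z∈ u∈ v∈ uv (λ e → i (inj₁ e , inj₁ e)) (λ e → i (inj₂ e , inj₂ e)))
      sep-kind (dot z∈) (base w∈ _) i _ = dot-base z∈ w∈ (λ e → i (inj₂ e , inj₂ e))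
      sep-kind (base w∈ _) (dot z∈) _ i = sep-sym (dot-base z∈ w∈ (λ e → i (inj₂ e , inj₂ e)))
      sep-kind (base w∈ _) (base w∈′ _) i _ = base-base w∈ w∈′ (λ { refl → i (inj₁ refl , inj₂ refl) })
      sep-kind (up u∈ v∈ _ uv) (base w∈ sw) _ _ = up-base u∈ v∈ w∈ sw uv
      sep-kind (base w∈ sw) (up u∈ v∈ _ uv) _ _ = sep-sym (up-base u∈ v∈ w∈ sw uv)
      sep-kind (up {u} {v} u∈ v∈ e uv) (up {p} {q} p∈ q∈ f pq) i _ with ℕ.≤-total (τ q) (τ v)
      ... | inj₁ le = up-up u∈ v∈ p∈ q∈ e f uv pq le (λ { (refl , refl) → i (inj₁ refl , inj₂ refl) })
      ... | inj₂ ge = sep-sym (up-up p∈ q∈ u∈ v∈ f e pq uv ge (λ { (refl , refl) → i (inj₁ refl , inj₂ refl) }))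

      swap-left : ∀ {u v p q} → Inside v u p q → Inside u v p q
      swap-left (a , b) = b , a
      swap-right : ∀ {u v p q} → Inside u v q p → Inside u v p q
      swap-right (a , b) = swap₂ a , swap₂ b

      drawing : Drawing G S
      drawing u∈ v∈ p∈ q∈ e f i j with kind u∈ v∈ e | kind p∈ q∈ f
      ... | inj₁ a | inj₁ b = sep-kind a b i j
      ... | inj₂ a | inj₁ b = sep-swap (sep-kind a b (λ k → i (swap-left k)) (λ k → j (swap-right k)))
      ... | inj₁ a | inj₂ b = sep-swapʳ (sep-kind a b (λ k → i (swap-right k)) (λ k → j (swap-left k)))
      ... | inj₂ a | inj₂ b = sep-swap (sep-swapʳ (sep-kind a b (λ k → i (swap-left (swap-right k))) (λ k → j (swap-left (swap-right k)))))

    straight : Poles G S s t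
    straight = record
      { X = X ; Y = Y ; drawing = drawing
      ; low = λ v∈ v≢s → [ (λ e → ⊥-elim (v≢s e)) , Y-low ]′ (S⊆ v∈)
      ; high = λ v∈ v≢t → [ (λ { refl → Y-low t∈Q }) , (λ v∈Q → Y-mono v∈Q t∈Q (last v∈Q v≢t)) ]′ (S⊆ v∈)
      ; right = λ v∈ v≢s v≢t → [ (λ e → ⊥-elim (v≢s e)) , (λ v∈Q → right-of-s t∈Q v∈Q (leftmost v∈Q v≢t)) ]′ (S⊆ v∈) }

-- Gluing two drawings along an edge

module Glue where

  import Data.Integer.Properties
  open import Data.Empty using (⊥; ⊥-elim)
  open import Data.Fin.Base using (Fin; zero; suc)
  open import Data.Fin.Properties using (_≟_)
  open import Data.Fin.Subset using (Subset; _∈_; _∉_)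
  open import Data.Fin.Subset.Properties using (_∈?_)
  open import Data.Integer.Base hiding (suc; pred)
  open import Data.Integer.Properties using (<⇒≤; <-trans; ≤-reflexive; +-inverseʳ; <-irrefl)
  open import Data.Integer.Tactic.RingSolver using (solve-∀)
  open import Data.Nat.Base as ℕ using (ℕ)
  import Data.Nat.Properties as ℕ
  open import Data.Product.Base using (_×_; _,_; proj₁; proj₂)
  open import Data.Sum.Base as Sum using (_⊎_; inj₁; inj₂; [_,_]′)
  open import Relation.Binary.PropositionalEquality hiding ([_])
  open import Relation.Nullary using (¬_; Dec; yes; no)
  open import Relation.Nullary.Decidable using (_×-dec_; _⊎-dec_; ¬?)
  open Eventual
  open Geometry
  open VirtualEdges

  -- A positive integer k is at least 1, so N only has to exceed the absolute value of c.
  leading : ∀ {k} c → 0ℤ < k → Eventually (λ N → 0ℤ < + N * k + c)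
  leading {k} c 0<k = ℕ.suc ∣ c ∣ , λ N le → subst (0ℤ <_) (go (+ N) k c (+ ∣ c ∣))
      (<⇒0< (+<+ le) ⊕′ (0≤ℕ N ⊗ 0<⇒1≤ 0<k) ⊕′ abs c)
    where
    0≤ℕ : ∀ N → 0ℤ ≤ + N
    0≤ℕ N = +≤+ ℕ.z≤n
    go : ∀ N k c d → ((N - d) + N * (k - 1ℤ)) + (d + c) ≡ N * k + c
    go = solve-∀
    abs : ∀ c → 0ℤ ≤ + ∣ c ∣ + c
    abs (+ m) = +≤+ ℕ.z≤n
    abs -[1+ m ] = ≤-reflexive (sym (+-inverseʳ +[1+ m ]))

  convex : ∀ {σ d x y} → 0ℤ < σ → σ < d → 0ℤ ≤ x → 0ℤ ≤ y → 0ℤ < x ⊎ 0ℤ < y → 0ℤ < (d - σ) * x + σ * y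
  convex 0<σ σ<d 0≤x 0≤y (inj₁ 0<x) = (<⇒0< σ<d ⊗′ 0<x) ⊕′ (<⇒≤ 0<σ ⊗ 0≤y)
  convex {σ} {d} {x} {y} 0<σ σ<d 0≤x 0≤y (inj₂ 0<y) =
    subst (0ℤ <_) (Data.Integer.Properties.+-comm (σ * y) ((d - σ) * x)) ((0<σ ⊗′ 0<y) ⊕′ (<⇒≤ (<⇒0< σ<d) ⊗ 0≤x))

  square-pos : ∀ x → x ≢ 0ℤ → 0ℤ < x * x
  square-pos (+ ℕ.zero) ne = ⊥-elim (ne refl)
  square-pos (+ ℕ.suc m) ne = +<+ (ℕ.s≤s ℕ.z≤n)
  square-pos -[1+ m ] ne = +<+ (ℕ.s≤s ℕ.z≤n)

  square-nonneg : ∀ x → 0ℤ ≤ x * x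
  square-nonneg (+ ℕ.zero) = +≤+ ℕ.z≤n
  square-nonneg (+ ℕ.suc m) = +≤+ ℕ.z≤n
  square-nonneg -[1+ m ] = +≤+ ℕ.z≤n

  module _ {n : ℕ} {G : Graph n} {S S₁ S₂ : Subset n} {s t a b : Fin n} (a≢b : a ≢ b)
    (P₁ : Poles (addEdge G a≢b) S₁ s t) (P₂ : Poles (addEdge G a≢b) S₂ a b)
    (s∈ : s ∈ S₁) (t∈ : t ∈ S₁) (a∈₁ : a ∈ S₁) (b∈₁ : b ∈ S₁) (a∈₂ : a ∈ S₂) (b∈₂ : b ∈ S₂)
    (s≢t : s ≢ t) (a≢t : a ≢ t) (b≢s : b ≢ s)
    (cover : ∀ {v} → v ∈ S → v ∈ S₁ ⊎ v ∈ S₂)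
    (meet : ∀ {v} → v ∈ S₁ → v ∈ S₂ → v ≡ a ⊎ v ≡ b)
    (edges : ∀ {u v} → u ∈ S → v ∈ S → Adj G u v → (u ∈ S₁ × v ∈ S₁) ⊎ (u ∈ S₂ × v ∈ S₂)) where

    private
      module P₁ = Poles P₁
      module P₂ = Poles P₂
      module A = Plane P₁.X P₁.Y
      module B = Plane P₂.X P₂.Y
      X₁ = P₁.X
      Y₁ = P₁.Y
      X₂ = P₂.X
      Y₂ = P₂.Y

      d e dx dy : ℤ
      d = Y₂ b - Y₂ a
      e = X₂ b - X₂ a
      dx = X₁ b - X₁ a
      dy = Y₁ b - Y₁ a
      -- Coordinates relative to the poles of P₂: `σ` rises from 0 at a to d at b, while `h` is a
      -- negated determinant, 0 at a and b and positive to the right of ab.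
      σ h : Fin n → ℤ
      σ v = Y₂ v - Y₂ a
      h v = d * (X₂ v - X₂ a) - e * (Y₂ v - Y₂ a)

      0<d : 0ℤ < d
      0<d = <⇒0< (P₂.low b∈₂ (λ e → a≢b (sym e)))

      split₁ : ∀ v → v ∈ S₁ ⊎ v ∉ S₁
      split₁ v with v ∈? S₁
      ... | yes m = inj₁ m
      ... | no n = inj₂ n

      Interior : Fin n → Set
      Interior v = v ∈ S₂ × v ∉ S₁

      module _ {v} (i : Interior v) where
        v≢a : v ≢ a
        v≢a refl = proj₂ i a∈₁
        v≢b : v ≢ b
        v≢b refl = proj₂ i b∈₁
        0<σ : 0ℤ < σ v
        0<σ = <⇒0< (P₂.low (proj₁ i) v≢a)
        σ<d : σ v < d
        σ<d = 0<⇒< (subst (0ℤ <_) (go (Y₂ v) (Y₂ a) (Y₂ b)) (<⇒0< (P₂.high (proj₁ i) v≢b)))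
          where
          go : ∀ v a b → b - v ≡ (b - a) - (v - a)
          go = solve-∀
        0<h : 0ℤ < h v
        0<h = subst (0ℤ <_) (go (X₂ a) (Y₂ a) (X₂ b) (Y₂ b) (X₂ v) (Y₂ v)) (neg⇒pos (P₂.right (proj₁ i) v≢a v≢b))
          where
          go : ∀ xa ya xb yb xv yv → - ((xb - xa) * (yv - ya) - (yb - ya) * (xv - xa))
               ≡ (yb - ya) * (xv - xa) - (xb - xa) * (yv - ya)
          go = solve-∀

      0<D : 0ℤ < dx * dx + dy * dy
      0<D with dx Data.Integer.Properties.≟ 0ℤ | dy Data.Integer.Properties.≟ 0ℤ
      ... | no ne | _ = square-pos dx ne ⊕′ square-nonneg dy
      ... | yes _ | no ne = subst (0ℤ <_) (Data.Integer.Properties.+-comm (dy * dy) (dx * dx)) (square-pos dy ne ⊕′ square-nonneg dx)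
      ... | yes ex | yes ey = ⊥-elim (coincide (P₁.drawing a∈₁ a∈₁ b∈₁ b∈₁ (inj₁ refl) (inj₁ refl) out out′))
        where
        out : ¬ A.Inside a a b b
        out (inj₁ x , _) = a≢b x
        out (inj₂ x , _) = a≢b x
        out′ : ¬ A.Inside b b a a
        out′ (inj₁ x , _) = a≢b (sym x)
        out′ (inj₂ x , _) = a≢b (sym x)
        eq : ∀ x y → y - x ≡ 0ℤ → x ≡ y
        eq x y z = sym (Data.Integer.Properties.i-j≡0⇒i≡j y x z)
        coincide : A.Sep a a b b → ⊥
        coincide (A.sep ℓ mn ps) with mn (inj₁ refl) | ps (inj₁ refl)
        ... | inj₂ (_ , m) | _ = out (m , m)
        ... | inj₁ _ | inj₂ (_ , m) = out′ (m , m)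
        ... | inj₁ lt | inj₁ gt = <-irrefl (cong₂ (eval ℓ) (eq _ _ ex) (eq _ _ ey)) (<-trans lt gt)

      -- For large N the drawing P₂ is squeezed to the right of the segment ab of P₁.
      module At (N : ℕ) where
        Nd : ℤ
        Nd = + N * d
        X Y : Fin n → ℤ
        X v with v ∈? S₁
        ... | yes _ = Nd * X₁ v
        -- Affine in the coordinates of P₂: it takes ab to the scaled segment ab of P₁, and its
        -- normal part along (dy, - dx) carries no factor N. Hence the strip has relative width 1/N.
        ... | no _ = Nd * X₁ a + (+ N * σ v * dx + h v * dy)
        Y v with v ∈? S₁
        ... | yes _ = Nd * Y₁ v
        ... | no _ = Nd * Y₁ a + (+ N * σ v * dy - h v * dx)
        X-1 : ∀ {v} → v ∈ S₁ → X v ≡ Nd * X₁ v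
        X-1 {v} v∈ with v ∈? S₁
        ... | yes _ = refl
        ... | no v∉ = ⊥-elim (v∉ v∈)
        Y-1 : ∀ {v} → v ∈ S₁ → Y v ≡ Nd * Y₁ v
        Y-1 {v} v∈ with v ∈? S₁
        ... | yes _ = refl
        ... | no v∉ = ⊥-elim (v∉ v∈)
        X-2 : ∀ {v} → v ∈ S₂ → X v ≡ Nd * X₁ a + (+ N * σ v * dx + h v * dy)
        X-2 {v} v∈ with v ∈? S₁
        ... | no _ = refl
        ... | yes v∈₁ with meet v∈₁ v∈
        ...   | inj₁ refl = go (+ N) (X₁ a) (Y₂ a) (X₂ a) d e dx dy
          where
          go : ∀ N x y x₂ d e dx dy → N * d * x ≡ N * d * x + (N * (y - y) * dx + (d * (x₂ - x₂) - e * (y - y)) * dy)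
          go = solve-∀
        ...   | inj₂ refl = go (+ N) (X₁ a) (X₁ b) (Y₂ a) (X₂ a) (Y₂ b) (X₂ b) dy
          where
          go : ∀ N xa xb ya₂ xa₂ yb₂ xb₂ dy → N * (yb₂ - ya₂) * xb ≡ N * (yb₂ - ya₂) * xa + (N * (yb₂ - ya₂) * (xb - xa)
                 + ((yb₂ - ya₂) * (xb₂ - xa₂) - (xb₂ - xa₂) * (yb₂ - ya₂)) * dy)
          go = solve-∀
        Y-2 : ∀ {v} → v ∈ S₂ → Y v ≡ Nd * Y₁ a + (+ N * σ v * dy - h v * dx)
        Y-2 {v} v∈ with v ∈? S₁
        ... | no _ = refl
        ... | yes v∈₁ with meet v∈₁ v∈
        ...   | inj₁ refl = go (+ N) (Y₁ a) (Y₂ a) (X₂ a) d e dx dy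
          where
          go : ∀ N x y x₂ d e dx dy → N * d * x ≡ N * d * x + (N * (y - y) * dy - (d * (x₂ - x₂) - e * (y - y)) * dx)
          go = solve-∀
        ...   | inj₂ refl = go (+ N) (Y₁ a) (Y₁ b) (Y₂ a) (X₂ a) (Y₂ b) (X₂ b) dx
          where
          go : ∀ N xa xb ya₂ xa₂ yb₂ xb₂ dy → N * (yb₂ - ya₂) * xb ≡ N * (yb₂ - ya₂) * xa + (N * (yb₂ - ya₂) * (xb - xa)
                 - ((yb₂ - ya₂) * (xb₂ - xa₂) - (xb₂ - xa₂) * (yb₂ - ya₂)) * dy)
          go = solve-∀
        open Plane X Y public

        scaled : Form → Form
        scaled (form α β γ) = form α β (Nd * γ)

        at-1 : ∀ ℓ {v} → v ∈ S₁ → at (scaled ℓ) v ≡ Nd * A.at ℓ v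
        at-1 (form α β γ) {v} v∈ rewrite X-1 v∈ | Y-1 v∈ = go α β γ Nd (X₁ v) (Y₁ v)
          where
          go : ∀ α β γ k x y → α * (k * x) + β * (k * y) + k * γ ≡ k * (α * x + β * y + γ)
          go = solve-∀

        twist : Form → ℤ
        twist (form α β γ) = α * dy - β * dx

        -- The coefficient of N is a weighted mean of the values at a and b, so for large N these
        -- decide the sign; the `h` term decides only where both vanish.
        at-2 : ∀ ℓ {v} → v ∈ S₂ → at (scaled ℓ) v ≡ + N * ((d - σ v) * A.at ℓ a + σ v * A.at ℓ b) + h v * twist ℓ
        at-2 (form α β γ) {v} v∈ rewrite X-2 v∈ | Y-2 v∈ = go α β γ (+ N) d (σ v) (h v) (X₁ a) (Y₁ a) (X₁ b) (Y₁ b)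
          where
          go : ∀ α β γ N d σ h xa ya xb yb →
            α * (N * d * xa + (N * σ * (xb - xa) + h * (yb - ya))) + β * (N * d * ya + (N * σ * (yb - ya) - h * (xb - xa))) + N * d * γ
            ≡ N * ((d - σ) * (α * xa + β * ya + γ) + σ * (α * xb + β * yb + γ)) + h * (α * (yb - ya) - β * (xb - xa))
          go = solve-∀

        -- The form ℓ of P₂ composed with the inverse of the affine map, with denominators cleared
        -- by its determinant N d (dx² + dy²), up to sign.
        pulled : Form → Form
        pulled (form α β γ) = form α′ β′ (+ N * (dx * dx + dy * dy) * (d * (α * X₂ a + β * Y₂ a + γ)) - (α′ * (Nd * X₁ a) + β′ * (Nd * Y₁ a)))
          where
          α′ = α * + N * dy + (α * e + d * β) * dx
          β′ = (α * e + d * β) * dy - α * + N * dx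

        at-pulled : ∀ ℓ {v} → v ∈ S₂ → at (pulled ℓ) v ≡ Nd * (dx * dx + dy * dy) * B.at ℓ v
        at-pulled (form α β γ) {v} v∈ rewrite X-2 v∈ | Y-2 v∈ =
          go α β γ (+ N) d e dx dy (X₂ a) (Y₂ a) (X₂ v) (Y₂ v) (Nd * X₁ a) (Nd * Y₁ a)
          where
          go : ∀ α β γ N d e dx dy xa ya xv yv p q →
            (α * N * dy + (α * e + d * β) * dx) * (p + (N * (yv - ya) * dx + (d * (xv - xa) - e * (yv - ya)) * dy))
            + ((α * e + d * β) * dy - α * N * dx) * (q + (N * (yv - ya) * dy - (d * (xv - xa) - e * (yv - ya)) * dx))
            + (N * (dx * dx + dy * dy) * (d * (α * xa + β * ya + γ))
               - ((α * N * dy + (α * e + d * β) * dx) * p + ((α * e + d * β) * dy - α * N * dx) * q))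
            ≡ N * d * (dx * dx + dy * dy) * (α * xv + β * yv + γ)
          go = solve-∀

        module _ (0<N : 0 ℕ.< N) where
          0<Nd : 0ℤ < Nd
          0<Nd = +<+ 0<N ⊗′ 0<d

          scale-neg : ∀ {k x} → 0ℤ < k → x < 0ℤ → k * x < 0ℤ
          scale-neg {k} {x} 0<k lt = subst (_< 0ℤ) (go k x) (pos⇒neg (0<k ⊗′ neg⇒pos lt))
            where
            go : ∀ k x → - (k * - x) ≡ k * x
            go = solve-∀

          scale-zero : ∀ k {x} → x ≡ 0ℤ → k * x ≡ 0ℤ
          scale-zero k refl = Data.Integer.Properties.*-zeroʳ k

          first : ∀ {u v p q} → u ∈ S₁ → v ∈ S₁ → p ∈ S₁ → q ∈ S₁ → A.Sep u v p q → Sep u v p q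
          first u∈ v∈ p∈ q∈ (A.sep ℓ mn ps) = sep (scaled ℓ)
            (λ m → Sum.map (λ lt → subst (_< 0ℤ) (sym (at-1 ℓ (in₂ u∈ v∈ m))) (scale-neg 0<Nd lt))
                           (λ (z , m′) → trans (at-1 ℓ (in₂ u∈ v∈ m)) (scale-zero Nd z) , m′) (mn m))
            (λ m → Sum.map (λ lt → subst (0ℤ <_) (sym (at-1 ℓ (in₂ p∈ q∈ m))) (0<Nd ⊗′ lt))
                           (λ (z , m′) → trans (at-1 ℓ (in₂ p∈ q∈ m)) (scale-zero Nd z) , m′) (ps m))
            where
            in₂ : ∀ {u v w} → u ∈ S₁ → v ∈ S₁ → w ∈₂ u , v → w ∈ S₁
            in₂ u∈ v∈ (inj₁ refl) = u∈
            in₂ u∈ v∈ (inj₂ refl) = v∈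

          second : ∀ {u v p q} → u ∈ S₂ → v ∈ S₂ → p ∈ S₂ → q ∈ S₂ → B.Sep u v p q → Sep u v p q
          second u∈ v∈ p∈ q∈ (B.sep ℓ mn ps) = sep (pulled ℓ)
            (λ m → Sum.map (λ lt → subst (_< 0ℤ) (sym (at-pulled ℓ (in₂ u∈ v∈ m))) (scale-neg 0<k lt))
                           (λ (z , m′) → trans (at-pulled ℓ (in₂ u∈ v∈ m)) (scale-zero k z) , m′) (mn m))
            (λ m → Sum.map (λ lt → subst (0ℤ <_) (sym (at-pulled ℓ (in₂ p∈ q∈ m))) (0<k ⊗′ lt))
                           (λ (z , m′) → trans (at-pulled ℓ (in₂ p∈ q∈ m)) (scale-zero k z) , m′) (ps m))
            where
            k = Nd * (dx * dx + dy * dy)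
            0<k : 0ℤ < k
            0<k = 0<Nd ⊗′ 0<D
            in₂ : ∀ {u v w} → u ∈ S₂ → v ∈ S₂ → w ∈₂ u , v → w ∈ S₂
            in₂ u∈ v∈ (inj₁ refl) = u∈
            in₂ u∈ v∈ (inj₂ refl) = v∈

          -- A line separating uv from ab also separates uv from the cells near ab.
          module Mixed {u v} (u∈ : u ∈ S₁) (v∈ : v ∈ S₁) (u∨v : ¬ A.Inside u v a b) (a∧b : ¬ A.Inside a b u v) (sp : A.Sep u v a b) where
            open A.Sep sp
            ℓ = scaled line
            below : ∀ {w} → w ∈₂ u , v → at ℓ w < 0ℤ ⊎ at ℓ w ≡ 0ℤ × A.at line w ≡ 0ℤ × w ∈₂ a , b
            below {w} m = Sum.map (λ lt → subst (_< 0ℤ) (sym (at-1 line w∈)) (scale-neg 0<Nd lt))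
                              (λ (z , m′) → trans (at-1 line w∈) (scale-zero Nd z) , z , m′) (minus m)
              where
              w∈ : w ∈ S₁
              w∈ = [ (λ { refl → u∈ }) , (λ { refl → v∈ }) ]′ m
            below≤ : ∀ {w} → w ∈₂ u , v → at ℓ w ≤ 0ℤ
            below≤ m = [ <⇒≤ , (λ (z , _) → ≤-reflexive z) ]′ (below m)

            sep-mixed : ∀ {p q} → p ∈ S₂ → (Interior p → 0ℤ < at ℓ p) → 0ℤ < at ℓ q → Sep u v p q
            sep-mixed {p} {q} p∈ inner q>0 with split₁ p
            ... | inj₂ p∉ = half-strict ℓ (below≤ (inj₁ refl)) (below≤ (inj₂ refl)) (inner (p∈ , p∉)) q>0
            ... | inj₁ p∈₁ with plus (meet p∈₁ p∈)
            ...   | inj₁ lt = half-strict ℓ (below≤ (inj₁ refl)) (below≤ (inj₂ refl))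
                      (subst (0ℤ <_) (sym (at-1 line p∈₁)) (0<Nd ⊗′ lt)) q>0
            -- Here p is a or b, lies on the line and is shared. The line cannot contain both a and
            -- b, so p is the only point of uv on it.
            ...   | inj₂ (z , p∈e) = sep ℓ
                      (λ m → Sum.map₂ (λ (zero-w , zw , w∈ab) → zero-w , inj₁ (only-p m zw w∈ab)) (below m))
                      (λ { (inj₁ refl) → inj₂ (trans (at-1 line p∈₁) (scale-zero Nd z) , p∈e) ; (inj₂ refl) → inj₁ q>0 })
              where
              both : A.at line a ≡ 0ℤ → A.at line b ≡ 0ℤ → ⊥
              both za zb with plus (inj₁ refl) | plus (inj₂ refl)
              ... | inj₁ lt | _ = <-irrefl (sym za) lt
              ... | inj₂ _ | inj₁ lt = <-irrefl (sym zb) lt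
              ... | inj₂ (_ , ma) | inj₂ (_ , mb) = a∧b (ma , mb)
              only-p : ∀ {w} → w ∈₂ u , v → A.at line w ≡ 0ℤ → w ∈₂ a , b → w ≡ p
              only-p _ zw w∈ab with w∈ab | meet p∈₁ p∈
              ... | inj₁ refl | inj₁ refl = refl
              ... | inj₂ refl | inj₂ refl = refl
              ... | inj₁ refl | inj₂ refl = ⊥-elim (both zw z)
              ... | inj₂ refl | inj₁ refl = ⊥-elim (both z zw)

      -- An interior vertex has 0 < σ < d, so both ends have positive weight and one strict end
      -- suffices.
      lies-above : ∀ ℓ {v} → Interior v → 0ℤ ≤ A.at ℓ a → 0ℤ ≤ A.at ℓ b → 0ℤ < A.at ℓ a ⊎ 0ℤ < A.at ℓ b →
                   Eventually (λ N → 0ℤ < At.at N (At.scaled N ℓ) v)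
      lies-above ℓ {v} i za zb z = eventually-map (λ N lt → subst (0ℤ <_) (sym (At.at-2 N ℓ (proj₁ i))) lt)
        (leading (h v * At.twist 0 ℓ) (convex (0<σ i) (σ<d i) za zb z))

      mixed : ∀ u v p q → Eventually (λ N → 0 ℕ.< N → u ∈ S₁ → v ∈ S₁ → A.Cell (addEdge G a≢b) u v →
                ¬ A.Inside u v a b → ¬ A.Inside a b u v → p ∈ S₂ → Interior q → At.Sep N u v p q)
      mixed u v p q with u ∈? S₁ | v ∈? S₁ | (u ≟ v) ⊎-dec adj? (addEdge G a≢b) u v
                       | inside? u v a b | inside? a b u v | p ∈? S₂ | (q ∈? S₂) ×-dec ¬? (q ∈? S₁)
        where
        inside? : ∀ u v p q → Dec (A.Inside u v p q)
        inside? u v p q = ((u ≟ p) ⊎-dec (u ≟ q)) ×-dec ((v ≟ p) ⊎-dec (v ≟ q))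
      ... | no n | _ | _ | _ | _ | _ | _ = 0 , λ _ _ _ y → ⊥-elim (n y)
      ... | _ | no n | _ | _ | _ | _ | _ = 0 , λ _ _ _ _ y → ⊥-elim (n y)
      ... | _ | _ | no n | _ | _ | _ | _ = 0 , λ _ _ _ _ _ y → ⊥-elim (n y)
      ... | _ | _ | _ | yes y | _ | _ | _ = 0 , λ _ _ _ _ _ _ n → ⊥-elim (n y)
      ... | _ | _ | _ | _ | yes y | _ | _ = 0 , λ _ _ _ _ _ _ _ n → ⊥-elim (n y)
      ... | _ | _ | _ | _ | _ | no n | _ = 0 , λ _ _ _ _ _ _ _ _ y → ⊥-elim (n y)
      ... | _ | _ | _ | _ | _ | _ | no n = 0 , λ _ _ _ _ _ _ _ _ _ y → ⊥-elim (n y)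
      ... | yes u∈ | yes v∈ | yes uv | no out | no out′ | yes p∈ | yes qi =
        eventually-map (λ N (f , g) 0<N _ _ _ _ _ _ _ → At.Mixed.sep-mixed N 0<N u∈ v∈ out out′ sp p∈ f g)
          (eventually-× inner (lies-above line qi (nonneg (inj₁ refl)) (nonneg (inj₂ refl)) some))
        where
        sp : A.Sep u v a b
        sp = P₁.drawing u∈ v∈ a∈₁ b∈₁ uv (inj₂ (inj₂ (inj₁ (refl , refl)))) out out′
        open A.Sep sp
        nonneg : ∀ {w} → w ∈₂ a , b → 0ℤ ≤ A.at line w
        nonneg m = [ <⇒≤ , (λ (z , _) → ≤-reflexive (sym z)) ]′ (plus m)
        some : 0ℤ < A.at line a ⊎ 0ℤ < A.at line b
        some with plus (inj₁ refl) | plus (inj₂ refl)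
        ... | inj₁ lt | _ = inj₁ lt
        ... | inj₂ _ | inj₁ lt = inj₂ lt
        ... | inj₂ (_ , ma) | inj₂ (_ , mb) = ⊥-elim (out′ (ma , mb))
        inner : Eventually (λ N → Interior p → 0ℤ < At.at N (At.scaled N line) p)
        inner with split₁ p
        ... | inj₁ p∈₁ = 0 , λ _ _ i → ⊥-elim (proj₂ i p∈₁)
        ... | inj₂ p∉ = eventually-map (λ N lt _ → lt) (lies-above line (p∈ , p∉) (nonneg (inj₁ refl)) (nonneg (inj₂ refl)) some)

      Good : ℕ → Fin n → Set
      Good N v = Interior v → At.Y N s < At.Y N v × At.Y N v < At.Y N t × At.det N s t v < 0ℤ

      interior-good : ∀ v → Interior v → Eventually (λ N → 0 ℕ.< N → Good N v)
      interior-good v i = eventually-map (λ N (f , g , k) 0<N _ → low N f , high N g , right N 0<N k)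
          -- Strictness comes from b for the lower bound and from a for the upper one; this fixes
          -- the orientation of ab.
          (eventually-× (lies-above lowℓ i (lo≥ a∈₁) (lo≥ b∈₁) (inj₂ (lo> b∈₁ b≢s)))
            (eventually-× (lies-above highℓ i (hi≥ a∈₁) (hi≥ b∈₁) (inj₁ (hi> a∈₁ a≢t))) rightEv))
        where
        lowℓ highℓ rightℓ : Form
        lowℓ = form 0ℤ 1ℤ (- Y₁ s)
        highℓ = form 0ℤ -1ℤ (Y₁ t)
        rightℓ = A.det-form t s
        at-low : ∀ w → A.at lowℓ w ≡ Y₁ w - Y₁ s
        at-low w = go (X₁ w) (Y₁ w) (Y₁ s)
          where
          go : ∀ x y c → 0ℤ * x + 1ℤ * y + - c ≡ y - c
          go = solve-∀
        at-high : ∀ w → A.at highℓ w ≡ Y₁ t - Y₁ w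
        at-high w = go (X₁ w) (Y₁ w) (Y₁ t)
          where
          go : ∀ x y c → 0ℤ * x + -1ℤ * y + c ≡ c - y
          go = solve-∀
        lo> : ∀ {w} → w ∈ S₁ → w ≢ s → 0ℤ < A.at lowℓ w
        lo> {w} w∈ ne = subst (0ℤ <_) (sym (at-low w)) (<⇒0< (P₁.low w∈ ne))
        lo≥ : ∀ {w} → w ∈ S₁ → 0ℤ ≤ A.at lowℓ w
        lo≥ {w} w∈ with w ≟ s
        ... | yes refl = ≤-reflexive (sym (trans (at-low s) (+-inverseʳ (Y₁ s))))
        ... | no ne = <⇒≤ (lo> w∈ ne)
        hi> : ∀ {w} → w ∈ S₁ → w ≢ t → 0ℤ < A.at highℓ w
        hi> {w} w∈ ne = subst (0ℤ <_) (sym (at-high w)) (<⇒0< (P₁.high w∈ ne))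
        hi≥ : ∀ {w} → w ∈ S₁ → 0ℤ ≤ A.at highℓ w
        hi≥ {w} w∈ with w ≟ t
        ... | yes refl = ≤-reflexive (sym (trans (at-high t) (+-inverseʳ (Y₁ t))))
        ... | no ne = <⇒≤ (hi> w∈ ne)
        at-right : ∀ w → A.at rightℓ w ≡ - A.det s t w
        at-right w = trans (A.at-det t s w) (A.det-swap s t w)
        ri> : ∀ {w} → w ∈ S₁ → w ≢ s → w ≢ t → 0ℤ < A.at rightℓ w
        ri> {w} w∈ ne ne′ = subst (0ℤ <_) (sym (at-right w)) (neg⇒pos (P₁.right w∈ ne ne′))
        ri≥ : ∀ {w} → w ∈ S₁ → 0ℤ ≤ A.at rightℓ w
        ri≥ {w} w∈ with w ≟ s | w ≟ t
        ... | yes refl | _ = ≤-reflexive (sym (trans (at-right s) (cong -_ (A.det-self s t))))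
        ... | no _ | yes refl = ≤-reflexive (sym (trans (at-right t) (cong -_ (A.det-self′ s t))))
        ... | no ne | no ne′ = <⇒≤ (ri> w∈ ne ne′)

        low : ∀ N → 0ℤ < At.at N (At.scaled N lowℓ) v → At.Y N s < At.Y N v
        low N lt = 0<⇒< (subst (0ℤ <_) (trans (go (At.X N v) (At.Y N v) (At.Nd N) (Y₁ s)) (cong (λ z → At.Y N v - z) (sym (At.Y-1 N s∈)))) lt)
          where
          go : ∀ x y k c → 0ℤ * x + 1ℤ * y + k * - c ≡ y - k * c
          go = solve-∀
        high : ∀ N → 0ℤ < At.at N (At.scaled N highℓ) v → At.Y N v < At.Y N t
        high N lt = 0<⇒< (subst (0ℤ <_) (trans (go (At.X N v) (At.Y N v) (At.Nd N) (Y₁ t)) (cong (λ z → z - At.Y N v) (sym (At.Y-1 N t∈)))) lt)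
          where
          go : ∀ x y k c → 0ℤ * x + -1ℤ * y + k * c ≡ k * c - y
          go = solve-∀
        right : ∀ N → 0 ℕ.< N → 0ℤ < At.at N (At.scaled N rightℓ) v → At.det N s t v < 0ℤ
        right N 0<N lt = subst (_< 0ℤ) (trans (go (X₁ s) (Y₁ s) (X₁ t) (Y₁ t) (At.Nd N) (At.X N v) (At.Y N v))
            (sym (det-N N))) (pos⇒neg (At.0<Nd N 0<N ⊗′ lt))
          where
          go : ∀ xs ys xt yt k x y → - (k * (- (ys - yt) * x + (xs - xt) * y + k * ((ys - yt) * xt - (xs - xt) * yt)))
               ≡ (k * xt - k * xs) * (y - k * ys) - (k * yt - k * ys) * (x - k * xs)
          go = solve-∀
          det-N : ∀ N → At.det N s t v ≡ (At.Nd N * X₁ t - At.Nd N * X₁ s) * (At.Y N v - At.Nd N * Y₁ s)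
                                          - (At.Nd N * Y₁ t - At.Nd N * Y₁ s) * (At.X N v - At.Nd N * X₁ s)
          det-N N rewrite At.X-1 N s∈ | At.Y-1 N s∈ | At.X-1 N t∈ | At.Y-1 N t∈ = refl

        rightEv : Eventually (λ N → 0ℤ < At.at N (At.scaled N rightℓ) v)
        rightEv with a ≟ s | b ≟ t
        ... | no a≢s | _ = lies-above rightℓ i (ri≥ a∈₁) (ri≥ b∈₁) (inj₁ (ri> a∈₁ a≢s a≢t))
        ... | yes _ | no b≢t = lies-above rightℓ i (ri≥ a∈₁) (ri≥ b∈₁) (inj₂ (ri> b∈₁ b≢s b≢t))
        -- If ab is st itself, the leading term vanishes and the positive `h` keeps the strip on the
        -- right.
        ... | yes refl | yes refl = 0 , λ N _ → subst (0ℤ <_) (sym (trans (At.at-2 N rightℓ (proj₁ i))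
                (trans (cong₂ (λ p q → + N * ((d - σ v) * p + σ v * q) + h v * At.twist N rightℓ)
                         (trans (at-right a) (cong -_ (A.det-self a b))) (trans (at-right b) (cong -_ (A.det-self′ a b))))
                       (go (+ N) d (σ v) (h v) (X₁ a) (Y₁ a) (X₁ b) (Y₁ b)))))
                (0<h i ⊗′ 0<D)
          where
          go : ∀ N d σ h xa ya xb yb → N * ((d - σ) * 0ℤ + σ * 0ℤ) + h * (- (ya - yb) * (yb - ya) - (xa - xb) * (xb - xa))
               ≡ h * ((xb - xa) * (xb - xa) + (yb - ya) * (yb - ya))
          go = solve-∀

      good : ∀ v → Eventually (λ N → 0 ℕ.< N → Good N v)
      good v = decided ((v ∈? S₂) ×-dec ¬? (v ∈? S₁))
        where
        decided : Dec (Interior v) → Eventually (λ N → 0 ℕ.< N → Good N v)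
        decided (no n) = 0 , λ _ _ _ i → ⊥-elim (n i)
        decided (yes i) = interior-good v i

      abstract
        all-good : Eventually (λ N → (∀ u v p q → 0 ℕ.< N → u ∈ S₁ → v ∈ S₁ → A.Cell (addEdge G a≢b) u v →
                  ¬ A.Inside u v a b → ¬ A.Inside a b u v → p ∈ S₂ → Interior q → At.Sep N u v p q) × (∀ v → 0 ℕ.< N → Good N v))
        all-good = eventually-× (eventually-all λ u → eventually-all λ v → eventually-all λ p → eventually-all λ q → mixed u v p q)
                                (eventually-all good)

        N₀ : ℕ
        N₀ = ℕ.suc (proj₁ all-good)
        0<N₀ : 0 ℕ.< N₀
        0<N₀ = ℕ.s≤s ℕ.z≤n
        mixed₀ : ∀ u v p q → u ∈ S₁ → v ∈ S₁ → A.Cell (addEdge G a≢b) u v →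
                 ¬ A.Inside u v a b → ¬ A.Inside a b u v → p ∈ S₂ → Interior q → At.Sep N₀ u v p q
        mixed₀ u v p q = proj₁ (proj₂ all-good N₀ (ℕ.n≤1+n _)) u v p q 0<N₀
        good₀ : ∀ v → Good N₀ v
        good₀ v = proj₂ (proj₂ all-good N₀ (ℕ.n≤1+n _)) v 0<N₀
      open At N₀

      to-S₂ : ∀ {u v} → A.Inside u v a b → u ∈ S₂ × v ∈ S₂
      to-S₂ (m , m′) = one m , one m′
        where
        one : ∀ {w} → w ∈₂ a , b → w ∈ S₂
        one (inj₁ refl) = a∈₂
        one (inj₂ refl) = b∈₂
      cell : ∀ {u v} → Cell G u v → A.Cell (addEdge G a≢b) u v
      cell (inj₁ eq) = inj₁ eq
      cell (inj₂ uv) = inj₂ (inj₁ uv)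
      home : ∀ {u v} → u ∈ S → v ∈ S → Cell G u v → (u ∈ S₁ × v ∈ S₁) ⊎ (u ∈ S₂ × v ∈ S₂)
      home u∈ v∈ (inj₁ refl) = Sum.map (λ m → m , m) (λ m → m , m) (cover u∈)
      home u∈ v∈ (inj₂ uv) = edges u∈ v∈ uv

      cross : ∀ {u v p q} → u ∈ S₁ → v ∈ S₁ → p ∈ S₂ → q ∈ S₂ → Cell G u v → Cell G p q →
              ¬ Inside u v p q → ¬ Inside p q u v → Sep u v p q
      cross {u} {v} {p} {q} u∈ v∈ p∈ q∈ e f i j with ((u ≟ a) ⊎-dec (u ≟ b)) ×-dec ((v ≟ a) ⊎-dec (v ≟ b))
      -- A cell within ab belongs to both drawings, so P₂ separates it from pq.
      ... | yes in-ab = let (u∈₂ , v∈₂) = to-S₂ in-ab in second 0<N₀ u∈₂ v∈₂ p∈ q∈ (P₂.drawing u∈₂ v∈₂ p∈ q∈ (cell e) (cell f) i j)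
      ... | no out with ((a ≟ u) ⊎-dec (a ≟ v)) ×-dec ((b ≟ u) ⊎-dec (b ≟ v))
      ...   | yes (ma , mb) = ⊥-elim (out (same ma mb))
        where
        same : a ∈₂ u , v → b ∈₂ u , v → A.Inside u v a b
        same (inj₁ refl) (inj₁ refl) = ⊥-elim (a≢b refl)
        same (inj₁ refl) (inj₂ refl) = inj₁ refl , inj₂ refl
        same (inj₂ refl) (inj₁ refl) = inj₂ refl , inj₁ refl
        same (inj₂ refl) (inj₂ refl) = ⊥-elim (a≢b refl)
      ...   | no out′ with q ∈? S₁ | p ∈? S₁
      ...     | no q∉ | _ = mixed₀ u v p q u∈ v∈ (cell e) out out′ p∈ (q∈ , q∉)
      ...     | yes _ | no p∉ = sep-swapʳ (mixed₀ u v q p u∈ v∈ (cell e) out out′ q∈ (p∈ , p∉))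
      ...     | yes q∈₁ | yes p∈₁ = first 0<N₀ u∈ v∈ p∈₁ q∈₁ (P₁.drawing u∈ v∈ p∈₁ q∈₁ (cell e) (cell f) i j)

    glue : Poles G S s t
    glue = record
      { X = X ; Y = Y
      ; drawing = λ u∈ v∈ p∈ q∈ e f i j → draw e f i j (home u∈ v∈ e) (home p∈ q∈ f)
      ; low = λ {v} v∈ ne → low v v∈ ne
      ; high = λ {v} v∈ ne → high v v∈ ne
      ; right = λ {v} v∈ ne ne′ → right v v∈ ne ne′ }
      where
      draw : ∀ {u v p q} → Cell G u v → Cell G p q → ¬ Inside u v p q → ¬ Inside p q u v →
        (u ∈ S₁ × v ∈ S₁) ⊎ (u ∈ S₂ × v ∈ S₂) → (p ∈ S₁ × q ∈ S₁) ⊎ (p ∈ S₂ × q ∈ S₂) → Sep u v p q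
      draw e f i j (inj₁ (u∈ , v∈)) (inj₁ (p∈ , q∈)) = first 0<N₀ u∈ v∈ p∈ q∈ (P₁.drawing u∈ v∈ p∈ q∈ (cell e) (cell f) i j)
      draw e f i j (inj₁ (u∈ , v∈)) (inj₂ (p∈ , q∈)) = cross u∈ v∈ p∈ q∈ e f i j
      draw e f i j (inj₂ (u∈ , v∈)) (inj₁ (p∈ , q∈)) = sep-sym (cross p∈ q∈ u∈ v∈ f e j i)
      draw e f i j (inj₂ (u∈ , v∈)) (inj₂ (p∈ , q∈)) = second 0<N₀ u∈ v∈ p∈ q∈ (P₂.drawing u∈ v∈ p∈ q∈ (cell e) (cell f) i j)
      place : ∀ v → v ∈ S → v ∈ S₁ ⊎ Interior v
      place v v∈ with v ∈? S₁ | cover v∈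
      ... | yes m | _ = inj₁ m
      ... | no v∉ | inj₁ m = ⊥-elim (v∉ m)
      ... | no v∉ | inj₂ m = inj₂ (m , v∉)
      scale : ∀ {x y} → x < y → Nd * x < Nd * y
      scale {x} {y} lt = 0<⇒< (subst (0ℤ <_) (go Nd x y) (0<Nd 0<N₀ ⊗′ <⇒0< lt))
        where
        go : ∀ k x y → k * (y - x) ≡ k * y - k * x
        go = solve-∀
      low : ∀ v → v ∈ S → v ≢ s → Y s < Y v
      low v v∈ ne with place v v∈
      ... | inj₁ m = subst₂ _<_ (sym (Y-1 s∈)) (sym (Y-1 m)) (scale (P₁.low m ne))
      ... | inj₂ i = proj₁ (good₀ v i)
      high : ∀ v → v ∈ S → v ≢ t → Y v < Y t
      high v v∈ ne with place v v∈
      ... | inj₁ m = subst₂ _<_ (sym (Y-1 m)) (sym (Y-1 t∈)) (scale (P₁.high m ne))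
      ... | inj₂ i = proj₁ (proj₂ (good₀ v i))
      det-1 : ∀ {v} → v ∈ S₁ → det s t v ≡ Nd * Nd * A.det s t v
      det-1 {v} m = trans (cong₂ _-_
          (cong₂ _*_ (cong₂ _-_ (X-1 t∈) (X-1 s∈)) (cong₂ _-_ (Y-1 m) (Y-1 s∈)))
          (cong₂ _*_ (cong₂ _-_ (Y-1 t∈) (Y-1 s∈)) (cong₂ _-_ (X-1 m) (X-1 s∈))))
        (go Nd (X₁ s) (Y₁ s) (X₁ t) (Y₁ t) (X₁ v) (Y₁ v))
        where
        go : ∀ k xs ys xt yt xv yv → (k * xt - k * xs) * (k * yv - k * ys) - (k * yt - k * ys) * (k * xv - k * xs)
             ≡ k * k * ((xt - xs) * (yv - ys) - (yt - ys) * (xv - xs))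
        go = solve-∀
      right : ∀ v → v ∈ S → v ≢ s → v ≢ t → det s t v < 0ℤ
      right v v∈ ne ne′ with place v v∈
      ... | inj₁ m = subst (_< 0ℤ) (sym (det-1 m)) (scale-neg 0<N₀ (0<Nd 0<N₀ ⊗′ 0<Nd 0<N₀) (P₁.right m ne ne′))
      ... | inj₂ i = proj₂ (proj₂ (good₀ v i))

-- Drawing a 3-connected part ear by ear

module Sweep where

  open import Data.Empty using (⊥-elim)
  open import Data.Fin.Base using (Fin)
  open import Data.Fin.Properties using (_≟_) renaming (any? to anyFin?)
  open import Data.Fin.Subset using (Subset; _∈_; _∉_; _⊆_; ∣_∣) renaming (⊥ to ∅)
  open import Data.Fin.Subset.Properties using (_∈?_; ∉⊥)
  open import Data.List.Base using (List; []; _∷_; _++_; [_]; reverse)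
  open import Data.List.Properties using (++-assoc; ++-identityʳ; reverse-++; unfold-reverse)
  open import Data.List.Membership.Propositional using (find; lose) renaming (_∈_ to _∈ˡ_)
  open import Data.List.Membership.Propositional.Properties using (∈-++⁺ˡ; ∈-++⁺ʳ; ∈-++⁻; ∈-∃++)
  import Data.List.Relation.Unary.All as All
  open import Data.List.Relation.Unary.AllPairs using ([]; _∷_)
  open import Data.List.Relation.Unary.Any using (here; there; any?)
  open import Data.List.Relation.Unary.Any.Properties using (reverse⁻; reverse⁺)
  open import Data.List.Relation.Unary.Unique.Propositional using (Unique)
  open import Data.Nat.Base using (ℕ; _<_)
  open import Data.Nat.Induction using (<-wellFounded)
  import Data.Nat.Properties as ℕ
  open import Data.Product.Base using (∃; ∃₂; _×_; _,_; proj₁; proj₂)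
  open import Data.Sum.Base as Sum using (_⊎_; inj₁; inj₂; [_,_]′)
  open import Induction.WellFounded using (Acc; acc)
  open import Relation.Binary.PropositionalEquality hiding ([_])
  open import Relation.Nullary using (¬_; yes; no)
  open import Relation.Nullary.Decidable using (_×-dec_; _⊎-dec_; ¬?)
  open import Relation.Unary using (Decidable)
  open Sets
  open Ears
  open Obstructions
  open Layouts
  open Geometry
  open StraightLines

  module _ {A : Set} {D : A → Set} (D? : Decidable D) where

    split-first : ∀ xs {v} → v ∈ˡ xs → D v → ∃₂ λ as u → ∃ λ bs → xs ≡ as ++ u ∷ bs × D u × (∀ {w} → w ∈ˡ as → ¬ D w)
    split-first (x ∷ xs) m d with D? x
    ... | yes dx = [] , x , xs , refl , dx , λ ()
    split-first (x ∷ xs) (here refl) d | no ndx = ⊥-elim (ndx d)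
    split-first (x ∷ xs) (there m) d | no ndx with split-first xs m d
    ... | as , u , bs , refl , du , none = x ∷ as , u , bs , refl , du , λ { (here refl) → ndx ; (there p) → none p }

    split-last : ∀ xs {v} → v ∈ˡ xs → D v → ∃₂ λ as u → ∃ λ bs → xs ≡ as ++ u ∷ bs × D u × (∀ {w} → w ∈ˡ bs → ¬ D w)
    split-last (x ∷ xs) m d with any? D? xs
    ... | yes more with split-last xs (proj₁ (proj₂ (find more))) (proj₂ (proj₂ (find more)))
    ...   | as , u , bs , refl , du , none = x ∷ as , u , bs , refl , du , none
    split-last (x ∷ xs) (here refl) d | no none = [] , x , xs , refl , d , λ m dw → none (lose m dw)
    split-last (x ∷ xs) (there m) d | no none = ⊥-elim (none (lose m d))

  module _ {n : ℕ} where

    sorted-unique : ∀ {x : Fin n → ℕ} {k ys} → Sorted x k ys → Unique ys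
    sorted-unique [] = []
    sorted-unique {x} (lt ∷ so) = All.tabulate (λ m e → ℕ.<-irrefl (cong x e) (above so m)) ∷ sorted-unique so

    -- The vertex of the cycle just before the ear: s itself if L₁ is empty, otherwise the end of
    -- L₁.
    data Left (s : Fin n) : List (Fin n) → Fin n → Set where
      start : Left s [] s
      after : ∀ {A p} → Left s (A ++ [ p ]) p

    module _ {G : Graph n} where

      left-chain : ∀ {s L₁ p Z v} → Left s L₁ p → Chain G s (L₁ ++ Z) v → Chain G p Z v
      left-chain start c = c
      left-chain {s} {Z = Z} {v} (after {A} {p}) c = proj₂ (chain-split A (subst (λ z → Chain G s z v) (++-assoc A [ p ] Z) c))

      left-replace : ∀ {s L₁ p Z Z′ v} → Left s L₁ p → Chain G s (L₁ ++ Z) v → Chain G p Z′ v → Chain G s (L₁ ++ Z′) v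
      left-replace start _ c′ = c′
      left-replace {s} {Z = Z} {Z′} {v} (after {A} {p}) c c′ = subst (λ z → Chain G s z v) (sym (++-assoc A [ p ] Z′))
        (chain-++ A (proj₁ (chain-split A (subst (λ z → Chain G s z v) (++-assoc A [ p ] Z) c))) c′)

      chain-reverse : ∀ {u v} xs → Chain G u xs v → Chain G v (reverse xs) u
      chain-reverse [] c = symm G c
      chain-reverse {u} {v} (x ∷ xs) (ux , c) = subst (λ z → Chain G v z u) (sym (unfold-reverse x xs))
        (chain-++ (reverse xs) (chain-reverse xs c) (symm G ux))

    Minimal : Graph n → Subset n → Subset n → Set
    Minimal G Q P = ∀ X → X ⊆ P → Conn G X → Touch₂ G Q X → P ⊆ X

    module _ {G : Graph n} {s : Fin n} where

      joint? : (P Q : Subset n) → Decidable (λ v → v ∈ P ⊎ v ∈ Q)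
      joint? P Q v = (v ∈? P) ⊎-dec (v ∈? Q)

      with? : (Q : Subset n) (x : Fin n) → Decidable (λ v → v ∈ Q ⊎ v ≡ x)
      with? Q x v = (v ∈? Q) ⊎-dec (v ≟ x)

      removed? : (P : Subset n) (y : Fin n) → Decidable (λ u → u ∈ P × u ≢ y)
      removed? P y u = (u ∈? P) ×-dec ¬? (u ≟ y)

      record Inserted (Q″ P : Subset n) (L₁ : List (Fin n)) (p q : Fin n) (L₂ : List (Fin n)) : Set where
        field
          path   : List (Fin n)
          layout : Layout G s Q″ (L₁ ++ path ++ q ∷ L₂)
          chain  : Chain G p path q
          covers : ∀ {v} → v ∈ P → v ∈ˡ path

      -- An ear P is a path from p to q: the first vertex x of P is its only
      -- neighbour of p, and P - x is an ear from x to q.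
      insert-ear : ∀ {Q Q′ Q″ P} L₁ M {p q} L₂ → Acc _<_ ∣ P ∣ →
        Layout G s Q (L₁ ++ M ++ q ∷ L₂) → Left s L₁ p → s ∉ Q →
        (∀ {v} → v ∈ Q′ → v ∈ Q ⊎ v ≡ s) → (∀ {v} → v ∈ Q ⊎ v ≡ s → v ∈ Q′) →
        p ∈ Q′ → p ≢ q → (∀ {v} → v ∈ P → v ∉ Q) → s ∉ P →
        Q ⊆ Q″ → P ⊆ Q″ → (∀ {v} → v ∈ Q″ → v ∈ Q ⊎ v ∈ P) →
        Conn G P → Touch G P p → Touch G P q → Minimal G Q′ P →
        (∀ {w} → w ∈ Q → Touch G P w → w ≡ p ⊎ w ∈ˡ M ⊎ w ≡ q) → (Touch G P s → L₁ ≡ []) →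
        Inserted Q″ P L₁ p q L₂
      insert-ear {Q} {Q′} {Q″} {P} L₁ M {p} {q} L₂ (acc rs) ly left s∉Q Q′⊆ ⊆Q′ p∈ p≢q P≁Q s∉P Q⊆ P⊆ Q″⊆ cP (x , x∈P , xp) tq mn within sL
        with anyFin? (λ y → (y ∈? P) ×-dec ¬? (y ≟ x))
      ... | no none = record
        { path = [ x ]
        ; layout = place L₁ M (q ∷ L₂) ly (P≁Q x∈P) Q⊆ (P⊆ x∈P) (λ z∈ → Sum.map₂ only (Q″⊆ z∈))
            (λ w∈ wx → nbr w∈ (within w∈ (x , x∈P , symm G wx))) (λ sx → sL (x , x∈P , symm G sx))
        ; chain = symm G xp , subst (λ z → Adj G z q) (only (proj₁ (proj₂ tq))) (proj₂ (proj₂ tq))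
        ; covers = λ v∈ → here (only v∈) }
        where
        only : ∀ {z} → z ∈ P → z ≡ x
        only {z} z∈ with z ≟ x
        ... | yes e = e
        ... | no ne = ⊥-elim (none (z , z∈ , ne))
        last-of : ∀ {w L₁} → w ∈ Q → Left s L₁ w → ∃ λ A → L₁ ≡ A ++ [ w ]
        last-of w∈ start = ⊥-elim (s∉Q w∈)
        last-of w∈ (after {A}) = A , refl
        nbr : ∀ {w} → w ∈ Q → w ≡ p ⊎ w ∈ˡ M ⊎ w ≡ q → (∃ λ A → L₁ ≡ A ++ [ w ]) ⊎ w ∈ˡ M ⊎ (∃ λ B → q ∷ L₂ ≡ w ∷ B)
        nbr w∈ (inj₁ refl) = inj₁ (last-of w∈ left)
        nbr w∈ (inj₂ (inj₁ m)) = inj₂ (inj₁ m)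
        nbr w∈ (inj₂ (inj₂ refl)) = inj₂ (inj₂ (L₂ , refl))
      ... | yes (y , y∈P , y≢x) = record
        { path = x ∷ I.path
        ; layout = subst (Layout G s Q″) (++-assoc L₁ [ x ] (I.path ++ q ∷ L₂)) I.layout
        ; chain = symm G xp , I.chain
        ; covers = λ v∈ → [ (λ e → here e) , (λ v∈J → there (I.covers v∈J)) ]′ (P⊆J v∈) }
        where
        q∈Q : q ∈ Q
        q∈Q = Layout.L⊆Q ly (∈-++⁺ʳ L₁ (∈-++⁺ʳ M (here refl)))
        u = proj₁ tq
        u∈P = proj₁ (proj₂ tq)
        -- With a second neighbour in Q′ the vertex x alone would be an ear, and by minimality all
        -- of P.
        one-sided : ∀ {w} → w ∈ Q′ → Adj G x w → w ≡ p
        one-sided {w} w∈ xw with w ≟ p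
        ... | yes e = e
        ... | no ne = ⊥-elim (y≢x (in⁻ (single? x) (mn (sub (single? x))
                (λ m → subst (_∈ P) (sym (in⁻ (single? x) m)) x∈P) (conn-single (in⁻ (single? x)))
                (w , p , w∈ , p∈ , ne , (x , in⁺ (single? x) refl , xw) , (x , in⁺ (single? x) refl , xp)) y∈P)))
        u≢x : u ≢ x
        u≢x refl = p≢q (sym (one-sided (⊆Q′ (inj₁ q∈Q)) (proj₂ (proj₂ tq))))
        module J = Component (component G (sub (removed? P x)) u)
        u∈ = in⁺ (removed? P x) (u∈P , u≢x)
        J⊆P : J.set ⊆ P
        J⊆P m = proj₁ (in⁻ (removed? P x) (J.⊆X m))
        x∉J : x ∉ J.set
        x∉J m = proj₂ (in⁻ (removed? P x) (J.⊆X m)) refl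
        link : Touch G J.set x
        link with touch? G J.set x
        ... | yes tk = tk
        ... | no nt = ⊥-elim (x∉J (conn-ind cP (λ v → v ∈? J.set) step u∈P (J.root u∈) x∈P))
          where
          step : ∀ a b → a ∈ P → b ∈ P → a ∈ J.set → Adj G a b → b ∈ J.set
          step a b _ b∈ a∈J ab with b ≟ x
          ... | yes refl = ⊥-elim (nt (a , a∈J , ab))
          ... | no ne = J.closed a∈J (in⁺ (removed? P x) (b∈ , ne)) ab
        -- Adding x turns a connection from x to r into one from p to r, to which the minimality of
        -- P applies.
        plus : ∀ {X} → X ⊆ J.set → Conn G X → Touch G X x → ∀ {r} → r ∈ Q′ → r ≢ p → Touch G X r → P ⊆ sub (with? X x)
        plus {X} X⊆ cX (a , a∈ , ax) {r} r∈ r≢p tr = mn (sub (with? X x))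
          (λ m → [ (λ v∈ → J⊆P (X⊆ v∈)) , (λ { refl → x∈P }) ]′ (in⁻ (with? X x) m))
          (conn-add cX a∈ ax (λ m → in⁺ (with? X x) (inj₁ m)) (in⁺ (with? X x) (inj₂ refl)) (in⁻ (with? X x)))
          (r , p , r∈ , p∈ , r≢p , touch-mono {G = G} (λ m → in⁺ (with? X x) (inj₁ m)) tr , (x , in⁺ (with? X x) (inj₂ refl) , xp))
        tqJ : Touch G J.set q
        tqJ = u , J.root u∈ , proj₂ (proj₂ tq)
        P⊆J : ∀ {v} → v ∈ P → v ≡ x ⊎ v ∈ J.set
        P⊆J v∈ = Sum.swap (in⁻ (with? J.set x) (plus (λ m → m) (J.conn u∈) link (⊆Q′ (inj₁ q∈Q)) (λ e → p≢q (sym e)) tqJ v∈))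
        not-two : ¬ Touch₂ G Q′ J.set
        not-two tw = x∉J (mn J.set J⊆P (J.conn u∈) tw x∈P)
        only-q : ∀ {w} → w ∈ Q′ → Touch G J.set w → w ≡ q
        only-q {w} w∈ tw with w ≟ q
        ... | yes e = e
        ... | no ne = ⊥-elim (not-two (w , q , w∈ , ⊆Q′ (inj₁ q∈Q) , ne , tw , tqJ))
        Q₁ = sub (with? Q x)
        Q₁′ = sub (with? Q′ x)
        s∉J : s ∉ J.set
        s∉J m = s∉P (J⊆P m)
        x≢s : x ≢ s
        x≢s refl = s∉P x∈P
        -- J has at most one attachment in Q′, so one of the two attachments of X is x, and `plus`
        -- applies.
        mn₁ : Minimal G Q₁′ J.set
        mn₁ X X⊆ cX (a , b , a∈ , b∈ , a≢b , ta , tb) = go (in⁻ (with? Q′ x) a∈) (in⁻ (with? Q′ x) b∈)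
          where
          ext : ∀ {r} → r ∈ Q′ → Touch G X x → Touch G X r → J.set ⊆ X
          ext {r} r∈ tx tr {z} z∈ with in⁻ (with? X x) (plus X⊆ cX tx r∈
                (λ { refl → p≢q (only-q p∈ (touch-mono {G = G} X⊆ tr)) }) tr (J⊆P z∈))
          ... | inj₁ z∈X = z∈X
          ... | inj₂ refl = ⊥-elim (x∉J z∈)
          go : a ∈ Q′ ⊎ a ≡ x → b ∈ Q′ ⊎ b ≡ x → J.set ⊆ X
          go (inj₁ a∈) (inj₁ b∈) = ⊥-elim (not-two (a , b , a∈ , b∈ , a≢b , touch-mono {G = G} X⊆ ta , touch-mono {G = G} X⊆ tb))
          go (inj₁ a∈) (inj₂ refl) = ext a∈ tb ta
          go (inj₂ refl) (inj₁ b∈) = ext b∈ ta tb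
          go (inj₂ refl) (inj₂ refl) = ⊥-elim (a≢b refl)
        last-of : ∀ {w L₁} → w ∈ Q → Left s L₁ w → ∃ λ A → L₁ ≡ A ++ [ w ]
        last-of w∈ start = ⊥-elim (s∉Q w∈)
        last-of w∈ (after {A}) = A , refl
        ly₁ : Layout G s Q₁ ((L₁ ++ [ x ]) ++ M ++ q ∷ L₂)
        ly₁ = subst (Layout G s Q₁) (sym (++-assoc L₁ [ x ] (M ++ q ∷ L₂)))
          (place L₁ [] (M ++ q ∷ L₂) ly (P≁Q x∈P) (λ m → in⁺ (with? Q x) (inj₁ m)) (in⁺ (with? Q x) (inj₂ refl)) (in⁻ (with? Q x))
            (λ {w} w∈ wx → inj₁ (last-of w∈ (subst (Left s L₁) (sym (one-sided (⊆Q′ (inj₁ w∈)) (symm G wx))) left)))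
            (λ sx → sL (x , x∈P , symm G sx)))
        inserted : Inserted Q″ J.set (L₁ ++ [ x ]) x q L₂
        inserted = insert-ear {Q₁} {Q₁′} {Q″} {J.set} (L₁ ++ [ x ]) M L₂ (rs (card-< J⊆P x∈P x∉J)) ly₁ after
          (λ m → [ s∉Q , (λ e → x≢s (sym e)) ]′ (in⁻ (with? Q x) m))
          (λ m → [ (λ v∈ → Sum.map₁ (λ v∈Q → in⁺ (with? Q x) (inj₁ v∈Q)) (Q′⊆ v∈)) , (λ e → inj₁ (in⁺ (with? Q x) (inj₂ e))) ]′ (in⁻ (with? Q′ x) m))
          (λ m → in⁺ (with? Q′ x) ([ (λ v∈ → Sum.map₁ (λ v∈Q → ⊆Q′ (inj₁ v∈Q)) (in⁻ (with? Q x) v∈)) , (λ e → inj₁ (⊆Q′ (inj₂ e))) ]′ m))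
          (in⁺ (with? Q′ x) (inj₂ refl)) (λ { refl → P≁Q x∈P q∈Q })
          (λ v∈J v∈Q₁ → [ P≁Q (J⊆P v∈J) , (λ { refl → x∉J v∈J }) ]′ (in⁻ (with? Q x) v∈Q₁)) s∉J
          (λ m → [ Q⊆ , (λ { refl → P⊆ x∈P }) ]′ (in⁻ (with? Q x) m)) (λ m → P⊆ (J⊆P m))
          (λ z∈ → [ (λ z∈Q → inj₁ (in⁺ (with? Q x) (inj₁ z∈Q))) , (λ z∈P → Sum.map₁ (λ e → in⁺ (with? Q x) (inj₂ e)) (P⊆J z∈P)) ]′ (Q″⊆ z∈))
          (J.conn u∈) link tqJ mn₁
          (λ w∈ tw → [ (λ w∈Q → inj₂ (inj₂ (only-q (⊆Q′ (inj₁ w∈Q)) tw))) , (λ e → inj₁ e) ]′ (in⁻ (with? Q x) w∈))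
          (λ ts → ⊥-elim (s∉Q (subst (_∈ Q) (sym (only-q (⊆Q′ (inj₂ refl)) ts)) q∈Q)))
        module I = Inserted inserted

    -- The ear P fits between p and q, and hides the vertices M, which K does not need.
    record Fit (G : Graph n) (s : Fin n) (P K : Subset n) (L : List (Fin n)) : Set where
      field
        L₁ M L₂ : List (Fin n)
        p q     : Fin n
        L≡      : L ≡ L₁ ++ M ++ q ∷ L₂
        left    : Left s L₁ p
        Pp      : Touch G P p
        Pq      : Touch G P q
        hidden  : ∀ {v} → v ∈ˡ M → ¬ Touch G K v
        within  : ∀ {v} → v ∈ˡ L → Touch G P v → v ≡ p ⊎ v ∈ˡ M ⊎ v ≡ q
        s-left  : Touch G P s → L₁ ≡ []

    module _ {G : Graph n} {S : Subset n} {s : Fin n} {P K : Subset n} where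

      Outcome : List (Fin n) → Set
      Outcome L = (Model K₃,₃ S G ⊎ Model K₅ S G) ⊎ (Fit G s P K L ⊎ Fit G s P K (reverse L))

      private
        TP? : Decidable (Touch G P)
        TP? = touch? G P
        TK? : Decidable (Touch G K)
        TK? = touch? G K

      some? : ∀ xs → (∃ λ v → v ∈ˡ xs × Touch G K v) ⊎ (∀ {v} → v ∈ˡ xs → ¬ Touch G K v)
      some? xs with any? TK? xs
      ... | yes a = inj₁ (find a)
      ... | no na = inj₂ (λ m t → na (lose m t))

      reverse-split : ∀ (A : List (Fin n)) v B → reverse (A ++ v ∷ B) ≡ reverse B ++ v ∷ reverse A
      reverse-split A v B = trans (reverse-++ A (v ∷ B)) (trans (cong (_++ reverse A) (unfold-reverse v B)) (++-assoc (reverse B) [ v ] (reverse A)))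

      fit-left : ∀ {L} A q B → L ≡ A ++ q ∷ B → Touch G P s → Touch G P q → (∀ {v} → v ∈ˡ A → ¬ Touch G K v) →
                 (∀ {v} → v ∈ˡ B → ¬ Touch G P v) → Fit G s P K L
      fit-left A q B refl Ps Pq none out = record
        { L₁ = [] ; M = A ; L₂ = B ; p = s ; q = q ; L≡ = refl ; left = start ; Pp = Ps ; Pq = Pq ; hidden = none
        ; within = λ m tv → inj₂ (w (∈-++⁻ A m) tv) ; s-left = λ _ → refl }
        where
        w : ∀ {v} → v ∈ˡ A ⊎ v ∈ˡ q ∷ B → Touch G P v → v ∈ˡ A ⊎ v ≡ q
        w (inj₁ m) _ = inj₁ m
        w (inj₂ (here e)) _ = inj₂ e
        w (inj₂ (there m)) tv = ⊥-elim (out m tv)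

      -- Either the attachments of K avoid the stretch of the cycle that P would hide, in one of the
      -- two directions, or those of P and K contain crossing pairs. The only exception is that both
      -- sets see s and the same two further vertices, which gives K₅.
      dichotomy : ∀ {L} → Ring G S s L P K → Touch G K s →
                  Touch₂ G (sub (with? {G} {s} (fromList L) s)) P → Outcome L
      dichotomy {L} r Ks (a , b , a∈ , b∈ , a≢b , Pa , Pb) with TP? s
      ... | no nPs = go (inL a∈ Pa) (inL b∈ Pb)
        where
        inL : ∀ {v} → v ∈ sub (with? {G} {s} (fromList L) s) → Touch G P v → v ∈ˡ L
        inL m tv = [ ∈⁻ {G = G} L , (λ { refl → ⊥-elim (nPs tv) }) ]′ (in⁻ (with? {G} {s} (fromList L) s) m)
        go : a ∈ˡ L → b ∈ˡ L → Outcome L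
        go a∈L b∈L with split-first TP? L a∈L Pa
        ... | A , p , B , refl , Pp , noneA with any? TP? B
        ...   | no noneB = ⊥-elim (a≢b (trans (is-p (∈-++⁻ A a∈L) Pa) (sym (is-p (∈-++⁻ A b∈L) Pb))))
          where
          is-p : ∀ {v} → v ∈ˡ A ⊎ v ∈ˡ p ∷ B → Touch G P v → v ≡ p
          is-p (inj₁ m) tv = ⊥-elim (noneA m tv)
          is-p (inj₂ (here e)) _ = e
          is-p (inj₂ (there m)) tv = ⊥-elim (noneB (lose m tv))
        ...   | yes anyB with split-last TP? B (proj₁ (proj₂ (find anyB))) (proj₂ (proj₂ (find anyB)))
        ...     | M , q , C , refl , Pq , noneC with some? M
        ...       | inj₁ (m , m∈ , Km) with ∈-∃++ m∈
        ...         | M₁ , M₂ , refl = inj₁ (inj₁ (crossing-chords A M₁ (M₂ ++ q ∷ C)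
                        (ring-sym (subst (λ z → Ring G S s (A ++ p ∷ z) P K) (++-assoc M₁ (m ∷ M₂) (q ∷ C)) r))
                        (∈-++⁺ʳ M₂ (here refl)) Ks Km Pp Pq))
        go a∈L b∈L | A , p , _ , refl , Pp , noneA | yes anyB | M , q , C , refl , Pq , noneC | inj₂ none = inj₂ (inj₁ record
          { L₁ = A ++ [ p ] ; M = M ; L₂ = C ; p = p ; q = q ; L≡ = sym (++-assoc A [ p ] (M ++ q ∷ C)) ; left = after
          ; Pp = Pp ; Pq = Pq ; hidden = none ; within = λ m tv → w (∈-++⁻ A m) tv ; s-left = λ ts → ⊥-elim (nPs ts) })
          where
          w′ : ∀ {v} → v ∈ˡ M ⊎ v ∈ˡ q ∷ C → Touch G P v → v ≡ p ⊎ v ∈ˡ M ⊎ v ≡ q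
          w′ (inj₁ m) _ = inj₂ (inj₁ m)
          w′ (inj₂ (here e)) _ = inj₂ (inj₂ e)
          w′ (inj₂ (there m)) tv = ⊥-elim (noneC m tv)
          w : ∀ {v} → v ∈ˡ A ⊎ v ∈ˡ p ∷ M ++ q ∷ C → Touch G P v → v ≡ p ⊎ v ∈ˡ M ⊎ v ≡ q
          w (inj₁ m) tv = ⊥-elim (noneA m tv)
          w (inj₂ (here e)) _ = inj₁ e
          w (inj₂ (there m)) tv = w′ (∈-++⁻ M m) tv
      ... | yes Ps = go other
        where
        other : ∃ λ v → v ∈ˡ L × Touch G P v
        other with in⁻ (with? {G} {s} (fromList L) s) a∈ | in⁻ (with? {G} {s} (fromList L) s) b∈
        ... | inj₁ m | _ = a , ∈⁻ {G = G} L m , Pa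
        ... | inj₂ _ | inj₁ m = b , ∈⁻ {G = G} L m , Pb
        ... | inj₂ e | inj₂ e′ = ⊥-elim (a≢b (trans e (sym e′)))
        -- P sees s and b, K sees a and c, in the cyclic order s, a, b, c.
        chords : ∀ {A u w B q} → Ring G S s (A ++ q ∷ B) P K → Touch G P q → u ∈ˡ A → Touch G K u → w ∈ˡ B → Touch G K w → Model K₃,₃ S G
        chords {B = B} {q} r Pq u∈ Ku w∈ Kw with ∈-∃++ u∈
        ... | A₁ , A₂ , refl = crossing-chords A₁ A₂ B (subst (λ z → Ring G S s z P K) (++-assoc A₁ (_ ∷ A₂) (q ∷ B)) r) w∈ Ps Pq Ku Kw
        -- K sees s and w, P sees p and q.
        chords′ : ∀ {C p D q B w} → Ring G S s ((C ++ p ∷ D) ++ q ∷ B) P K → Touch G P p → Touch G P q → w ∈ˡ D → Touch G K w → Model K₃,₃ S G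
        chords′ {C} {p} {q = q} {B} r Pp Pq w∈ Kw with ∈-∃++ w∈
        ... | D₁ , D₂ , refl = crossing-chords C D₁ (D₂ ++ q ∷ B)
                (ring-sym (subst (λ z → Ring G S s z P K) (trans (++-assoc C (p ∷ D₁ ++ _ ∷ D₂) (q ∷ B)) (cong (λ z → C ++ p ∷ z) (++-assoc D₁ (_ ∷ D₂) (q ∷ B)))) r))
                (∈-++⁺ʳ D₂ (here refl)) Ks Kw Pp Pq
        go : (∃ λ v → v ∈ˡ L × Touch G P v) → Outcome L
        go (v , v∈ , Pv) with split-last TP? L v∈ Pv
        ... | A , q , B , refl , Pq , noneB with some? A
        ...   | inj₂ none = inj₂ (inj₁ (fit-left A q B refl Ps Pq none noneB))
        ...   | inj₁ (u , u∈ , Ku) with any? TP? A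
        ...     | no noneA with some? B
        ...       | inj₁ (w , w∈ , Kw) = inj₁ (inj₁ (chords r Pq u∈ Ku w∈ Kw))
        ...       | inj₂ none = inj₂ (inj₂ (fit-left (reverse B) q (reverse A) (reverse-split A q B) Ps Pq
                      (λ m → none (reverse⁻ m)) (λ m tv → noneA (lose (reverse⁻ m) tv))))
        go (v , v∈ , Pv) | A , q , B , refl , Pq , noneB | inj₁ (u , u∈ , Ku) | yes anyA
          with split-first TP? A (proj₁ (proj₂ (find anyA))) (proj₂ (proj₂ (find anyA)))
        ... | C , p , D , refl , Pp , noneC with some? (D ++ q ∷ B)
        ...   | inj₂ none = inj₂ (inj₂ (fit-left (reverse (D ++ q ∷ B)) p (reverse C)
                  (trans (cong reverse (++-assoc C (p ∷ D) (q ∷ B))) (reverse-split C p (D ++ q ∷ B))) Ps Pp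
                  (λ m → none (reverse⁻ m)) (λ m → noneC (reverse⁻ m))))
        ...   | inj₁ (w , w∈ , Kw) with ∈-++⁻ D w∈
        ...     | inj₁ w∈D = inj₁ (inj₁ (chords′ r Pp Pq w∈D Kw))
        ...     | inj₂ (there w∈B) = inj₁ (inj₁ (chords r Pq u∈ Ku w∈B Kw))
        ...     | inj₂ (here refl) with ∈-++⁻ C u∈
        ...       | inj₁ u∈C = inj₁ (inj₁ (chords (subst (λ z → Ring G S s z P K) (++-assoc C (p ∷ D) (q ∷ B)) r) Pp u∈C Ku (∈-++⁺ʳ D (here refl)) Kw))
        ...       | inj₂ (there u∈D) = inj₁ (inj₁ (chords′ r Pp Pq u∈D Ku))
        -- All positions with crossing pairs are exhausted: P and K both see s, p and q.
        ...       | inj₂ (here refl) = inj₁ (inj₂ (three-common C (D ++ q ∷ B) (subst (λ z → Ring G S s z P K) (++-assoc C (p ∷ D) (q ∷ B)) r)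
                      (∈-++⁺ʳ D (here refl)) Ps Pp Pq Ks Ku Kw))

    module _ {G : Graph n} {S : Subset n} {s t : Fin n} (st : Adj G s t) where

      -- Once t is the only undrawn vertex, it may hide all of L. Inserting it before everything
      -- makes it both last and leftmost, hence the upper pole with the drawing on the right of st.
      finish : ∀ {Q} L → Layout G s Q L → s ∉ Q → t ∉ Q → s ≢ t → (∀ {v} → v ∈ S → v ≡ s ⊎ v ∈ Q ⊎ v ≡ t) →
               (∀ {q} → q ∈ Q → Adj G q t → q ∈ˡ L) → Poles G S s t
      finish {Q} L ly s∉Q t∉Q s≢t cover front = straight ly′ (λ v∈ → Sum.map₂ (in⁺ Q⁺?) (cover v∈))
          (λ m → [ s∉Q , s≢t ]′ (in⁻ Q⁺? m)) (in⁺ Q⁺? (inj₂ refl)) last leftmost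
        where
        Q⁺? = with? {G} {s} Q t
        ly₀ : Layout G s Q ([] ++ L ++ [])
        ly₀ = subst (Layout G s Q) (sym (++-identityʳ L)) ly
        placed = insert-vertex [] L [] ly₀ t∉Q (λ m → in⁺ Q⁺? (inj₁ m)) (in⁺ Q⁺? (inj₂ refl)) (in⁻ Q⁺?)
                (λ w∈ wt → inj₂ (inj₁ (front w∈ wt))) (λ _ → refl)
        ly′ : Layout G s (sub Q⁺?) (t ∷ [])
        ly′ = proj₁ placed
        open Layout ly′ using (τ; x)
        old : ∀ {v} → v ∈ sub Q⁺? → v ≢ t → v ∈ Q
        old v∈ ne = [ (λ m → m) , (λ e → ⊥-elim (ne e)) ]′ (in⁻ Q⁺? v∈)
        last : ∀ {v} → v ∈ sub Q⁺? → v ≢ t → τ v < τ t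
        last v∈ ne = proj₁ (proj₂ placed) (old v∈ ne)
        leftmost : ∀ {v} → v ∈ sub Q⁺? → v ≢ t → x t < x v
        leftmost v∈ ne = proj₂ (proj₂ placed) refl (old v∈ ne)

      single-layout : ∀ {b} → s ≢ b → Layout G s (sub (single? b)) [ b ]
      single-layout {b} s≢b = place {Q = ∅} [] [] [] (empty-layout ∉⊥) ∉⊥
          (λ m → ⊥-elim (∉⊥ m)) (in⁺ (single? b) refl) (λ m → inj₂ (in⁻ (single? b) m))
          (λ m → ⊥-elim (∉⊥ m)) (λ _ → refl)

    module _ {G : Graph n} {S : Subset n} (nc : NoCut G S) {s t : Fin n} (s∈S : s ∈ S) (st : Adj G s t) where

      -- Invariant of the sweep: s and L form a closed chain along the drawn part, and by `frontier`
      -- all contact with the undrawn part R goes through it.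
      record State (Q R : Subset n) (L : List (Fin n)) : Set where
        field
          Q⊆S      : Q ⊆ S
          R⊆S      : R ⊆ S
          cover    : ∀ {v} → v ∈ S → v ≡ s ⊎ v ∈ Q ⊎ v ∈ R
          s∉Q      : s ∉ Q
          s∉R      : s ∉ R
          Q≁R      : Q ≁ R
          t∈R      : t ∈ R
          connR    : Conn G R
          layout   : Layout G s Q L
          chain    : Chain G s L s
          frontier : ∀ {q r} → q ∈ Q → r ∈ R → Adj G q r → q ∈ˡ L

      mirror-state : ∀ {Q R L} → State Q R L → State Q R (reverse L)
      mirror-state {L = L} σ = record
        { Q⊆S = Q⊆S ; R⊆S = R⊆S ; cover = cover ; s∉Q = s∉Q ; s∉R = s∉R ; Q≁R = Q≁R ; t∈R = t∈R ; connR = connR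
        ; layout = mirror layout ; chain = chain-reverse {G = G} {s} {s} L chain ; frontier = λ a b c → reverse⁺ (frontier a b c) }
        where
        open State σ

      advance : ∀ {Q R L} (σ : State Q R L) → let Q⁺ = sub (with? {G} {s} Q s) in (e : Ear G Q⁺ R t) → Fit G s (Ear.P e) (Ear.K e) L →
                ∃ λ L′ → State (sub (joint? {G} {s} Q (Ear.P e))) (Ear.K e) L′
      advance {Q} {R} σ e f = _ , record
        { Q⊆S = λ m → [ Q⊆S , (λ v∈P → R⊆S (P⊆R v∈P)) ]′ (in⁻ Q″? m)
        ; R⊆S = λ m → R⊆S (K⊆R m)
        ; cover = λ v∈S → [ inj₁ , (λ m → inj₂ ([ (λ v∈Q → inj₁ (in⁺ Q″? (inj₁ v∈Q))) , (λ v∈R → Sum.map₁ (λ v∈P → in⁺ Q″? (inj₂ v∈P)) (split v∈R)) ]′ m)) ]′ (cover v∈S)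
        ; s∉Q = λ m → [ s∉Q , (λ s∈P → s∉R (P⊆R s∈P)) ]′ (in⁻ Q″? m)
        ; s∉R = λ m → s∉R (K⊆R m)
        ; Q≁R = λ m k → [ (λ v∈Q → Q≁R v∈Q (K⊆R k)) , (λ v∈P → disj v∈P k) ]′ (in⁻ Q″? m)
        ; t∈R = t∈K ; connR = connK
        ; layout = I.layout
        ; chain = left-replace left chain′ (chain-++ I.path I.chain (proj₂ (chain-split M (left-chain left chain′))))
        ; frontier = λ q∈ r∈ qr → [ (λ q∈Q → keep (∈-++⁻ L₁ (subst (_ ∈ˡ_) L≡ (frontier q∈Q (K⊆R r∈) qr))) (_ , r∈ , symm G qr))
                                  , (λ q∈P → ∈-++⁺ʳ L₁ (∈-++⁺ˡ (I.covers q∈P))) ]′ (in⁻ Q″? q∈) }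
        where
        open State σ
        open Ear e
        open Fit f
        layout′ = subst (Layout G s Q) L≡ layout
        chain′ = subst (λ z → Chain G s z s) L≡ chain
        Q″? = joint? {G} {s} Q P
        P≁Q : ∀ {v} → v ∈ P → v ∉ Q
        P≁Q v∈P v∈Q = Q≁R v∈Q (P⊆R v∈P)
        q∈Q : q ∈ Q
        q∈Q = Layout.L⊆Q layout′ (∈-++⁺ʳ L₁ (∈-++⁺ʳ M (here refl)))
        left-∈ : ∀ {L₁ p} → Left s L₁ p → (∀ {v} → v ∈ˡ L₁ → v ∈ Q) → p ∈ Q ⊎ p ≡ s
        left-∈ start _ = inj₂ refl
        left-∈ (after {A}) ⊆Q = inj₁ (⊆Q (∈-++⁺ʳ A (here refl)))
        unique : Unique (L₁ ++ M ++ q ∷ L₂)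
        unique = sorted-unique (Layout.sorted layout′)
        p≢q : ∀ {L₁ p} → Left s L₁ p → Unique (L₁ ++ M ++ q ∷ L₂) → p ≢ q
        p≢q start _ refl = s∉Q q∈Q
        p≢q (after {A}) u refl = unique-disjoint (A ++ [ _ ]) u (∈-++⁺ʳ A (here refl)) (∈-++⁺ʳ M (here refl))
        module I = Inserted (insert-ear {G} {s} {Q} {sub (with? {G} {s} Q s)} {sub Q″?} {P} L₁ M L₂ (<-wellFounded _) layout′ left s∉Q
          (in⁻ (with? {G} {s} Q s)) (in⁺ (with? {G} {s} Q s)) (in⁺ (with? {G} {s} Q s) (left-∈ left (λ m → Layout.L⊆Q layout′ (∈-++⁺ˡ m))))
          (p≢q left unique) P≁Q (λ s∈P → s∉R (P⊆R s∈P))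
          (λ m → in⁺ Q″? (inj₁ m)) (λ m → in⁺ Q″? (inj₂ m)) (in⁻ Q″?)
          connP Pp Pq minimal
          (λ w∈ (u , u∈ , uw) → within (frontier w∈ (P⊆R u∈) (symm G uw)) (u , u∈ , uw)) s-left)
        keep : ∀ {v} → v ∈ˡ L₁ ⊎ v ∈ˡ M ++ q ∷ L₂ → Touch G K v → v ∈ˡ L₁ ++ I.path ++ q ∷ L₂
        keep (inj₁ m) _ = ∈-++⁺ˡ m
        keep (inj₂ m) tv with ∈-++⁻ M m
        ... | inj₁ m∈M = ⊥-elim (hidden m∈M tv)
        ... | inj₂ m∈ = ∈-++⁺ʳ L₁ (∈-++⁺ʳ I.path m∈)

      Result : Set
      Result = (Model K₃,₃ S G ⊎ Model K₅ S G) ⊎ Poles G S s t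

      step : ∀ {Q R L} (σ : State Q R L) → let Q⁺ = sub (with? {G} {s} Q s) in (e : Ear G Q⁺ R t) →
             (Model K₃,₃ S G ⊎ Model K₅ S G) ⊎ (∃₂ λ Q′ L′ → State Q′ (Ear.K e) L′)
      -- As t is kept for the end, the edge st always makes K see s.
      step {Q} {R} {L} σ e = go (dichotomy ring (t , t∈K , symm G st) two′)
        where
        open State σ
        open Ear e
        ring : Ring G S s L P K
        ring = record
          { chain = chain ; s∈S = s∈S ; L⊆S = λ m → Q⊆S (L⊆Q m) ; X⊆S = λ m → R⊆S (P⊆R m) ; Y⊆S = λ m → R⊆S (K⊆R m)
          ; s∉L = λ m → s∉Q (L⊆Q m) ; unique = sorted-unique sorted ; connX = connP ; connY = connK
          ; join = j ; X≁Y = disj ; s∉X = λ m → s∉R (P⊆R m) ; s∉Y = λ m → s∉R (K⊆R m)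
          ; X≁L = λ m l → Q≁R (L⊆Q l) (P⊆R m) ; Y≁L = λ m l → Q≁R (L⊆Q l) (K⊆R m) }
          where
          open Layout layout
          j : Join G P K
          j with proj₁ (proj₂ (proj₂ (proj₂ (proj₂ (proj₂ two)))))
          ... | (u , u∈ , _) with nearK u∈
          ...   | (k , k∈ , ku) = u , k , u∈ , k∈ , symm G ku
        two′ : Touch₂ G (sub (with? {G} {s} (fromList L) s)) P
        two′ = let (a , b , a∈ , b∈ , ne , ta , tb) = two in a , b , conv a∈ ta , conv b∈ tb , ne , ta , tb
          where
          conv : ∀ {v} → v ∈ sub (with? {G} {s} Q s) → Touch G P v → v ∈ sub (with? {G} {s} (fromList L) s)
          conv v∈ (u , u∈ , uv) = in⁺ (with? {G} {s} (fromList L) s)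
            (Sum.map₁ (λ v∈Q → ∈⁺ {G = G} L (frontier v∈Q (P⊆R u∈) (symm G uv))) (in⁻ (with? {G} {s} Q s) v∈))
        go : Outcome L → (Model K₃,₃ S G ⊎ Model K₅ S G) ⊎ (∃₂ λ Q′ L′ → State Q′ K L′)
        go (inj₁ m) = inj₁ m
        go (inj₂ (inj₁ f)) = let (L′ , σ′) = advance σ e f in inj₂ (_ , L′ , σ′)
        go (inj₂ (inj₂ f)) = let (L′ , σ′) = advance (mirror-state σ) e f in inj₂ (_ , L′ , σ′)

      sweep : ∀ {Q R L} → Acc _<_ ∣ R ∣ → State Q R L → Result
      sweep {Q} {R} {L} (acc rs) σ with anyFin? (λ r → (r ∈? R) ×-dec ¬? (r ≟ t))
      ... | no none = inj₂ (finish st L layout s∉Q (λ m → Q≁R m t∈R) (λ { refl → s∉R t∈R })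
              (λ v∈ → Sum.map₂ (Sum.map₂ only) (cover v∈)) (λ q∈ qt → frontier q∈ t∈R qt))
        where
        open State σ
        only : ∀ {v} → v ∈ R → v ≡ t
        only {v} m with v ≟ t
        ... | yes e = e
        ... | no ne = ⊥-elim (none (v , m , ne))
      ... | yes (r , r∈ , r≢t) = go (step σ ear)
        where
        open State σ
        Q⁺? = with? {G} {s} Q s
        head : ∀ L → Chain G s L s → (∀ {v} → v ∈ˡ L → v ∈ Q) → ∃ λ q → q ∈ Q
        head [] ss _ = ⊥-elim (irrefl G refl ss)
        head (q ∷ _) _ ⊆Q = q , ⊆Q (here refl)
        q = head L chain (Layout.L⊆Q layout)
        ear : Ear G (sub Q⁺?) R t
        ear = exists-ear nc (λ m → [ Q⊆S , (λ { refl → s∈S }) ]′ (in⁻ Q⁺? m)) R⊆S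
          (λ v∈ → [ (λ e → inj₁ (in⁺ Q⁺? (inj₂ e))) , Sum.map₁ (λ m → in⁺ Q⁺? (inj₁ m)) ]′ (cover v∈))
          (λ m → [ (λ a → Q≁R a) , (λ { refl → s∉R }) ]′ (in⁻ Q⁺? m)) t∈R connR
          {s} {proj₁ q} (in⁺ Q⁺? (inj₂ refl)) (in⁺ Q⁺? (inj₁ (proj₂ q))) (λ e → s∉Q (subst (_∈ Q) (sym e) (proj₂ q))) r∈ r≢t
        shrink : ∣ Ear.K ear ∣ < ∣ R ∣
        shrink with Ear.two ear
        ... | _ , _ , _ , _ , _ , (u , u∈ , _) , _ = card-< (Ear.K⊆R ear) (Ear.P⊆R ear u∈) (Ear.disj ear u∈)
        go : (Model K₃,₃ S G ⊎ Model K₅ S G) ⊎ (∃₂ λ Q′ L′ → State Q′ (Ear.K ear) L′) → Result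
        go (inj₁ m) = inj₁ m
        go (inj₂ (Q′ , L′ , σ′)) = sweep (rs shrink) σ′

      start-sweep : ∀ {b} → t ∈ S → b ∈ S → Adj G s b → b ≢ t → Result
      start-sweep {b} t∈S b∈S sb b≢t = sweep (<-wellFounded _) record
        { Q⊆S = λ m → subst (_∈ S) (sym (in⁻ (single? b) m)) b∈S
        ; R⊆S = λ m → proj₁ (in⁻ R? m)
        ; cover = cov
        ; s∉Q = λ m → s≢b (in⁻ (single? b) m)
        ; s∉R = λ m → proj₁ (proj₂ (in⁻ R? m)) refl
        ; Q≁R = λ m r → proj₂ (proj₂ (in⁻ R? r)) (in⁻ (single? b) m)
        ; t∈R = in⁺ R? (t∈S , (λ { refl → irrefl G refl st }) , (λ e → b≢t (sym e)))
        ; connR = connected cR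
        ; layout = single-layout {S = S} st s≢b
        -- The sweep starts with the degenerate cycle that runs from s to b and back.
        ; chain = sb , symm G sb
        ; frontier = λ m _ _ → here (in⁻ (single? b) m) }
        where
        s≢b : s ≢ b
        s≢b e = irrefl G e sb
        R? : Decidable (λ v → v ∈ S × v ≢ s × v ≢ b)
        R? v = (v ∈? S) ×-dec (¬? (v ≟ s) ×-dec ¬? (v ≟ b))
        cov : ∀ {v} → v ∈ S → v ≡ s ⊎ v ∈ sub (single? b) ⊎ v ∈ sub R?
        cov {v} v∈ with v ≟ s | v ≟ b
        ... | yes e | _ = inj₁ e
        ... | no _ | yes e = inj₂ (inj₁ (in⁺ (single? b) e))
        ... | no n₁ | no n₂ = inj₂ (inj₂ (in⁺ R? (v∈ , n₁ , n₂)))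
        cR : ∀ Y {u v} → u ∈ sub R? → u ∈ Y → Closed G (sub R?) Y → v ∈ sub R? → v ∈ Y
        -- The part of R inside Y has outer neighbours only in s and b, so `NoCut` makes it all of
        -- R.
        cR Y {u} {v} u∈R u∈Y cl v∈R with
          nc s b (sub M?) s∈S b∈S (λ m → proj₁ (proj₂ (in⁻ R? (proj₁ (in⁻ M? m)))) refl)
            (λ m → proj₂ (proj₂ (in⁻ R? (proj₁ (in⁻ M? m)))) refl) (λ m → proj₁ (in⁻ R? (proj₁ (in⁻ M? m))))
            (in⁺ M? (u∈R , u∈Y)) nbr v (proj₁ (in⁻ R? v∈R))
          where
          M? : Decidable (λ w → w ∈ sub R? × w ∈ Y)
          M? w = (w ∈? sub R?) ×-dec (w ∈? Y)
          nbr : ∀ x w → x ∈ sub M? → w ∈ S → Adj G x w → w ∈ sub M? ⊎ w ≡ s ⊎ w ≡ b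
          nbr x w x∈ w∈S xw with cov w∈S
          ... | inj₁ e = inj₂ (inj₁ e)
          ... | inj₂ (inj₁ m) = inj₂ (inj₂ (in⁻ (single? b) m))
          ... | inj₂ (inj₂ w∈R) = inj₁ (in⁺ M? (w∈R , cl x w (proj₁ (in⁻ M? x∈)) w∈R (proj₂ (in⁻ M? x∈)) xw))
        ... | inj₁ m = proj₂ (in⁻ _ m)
        ... | inj₂ (inj₁ e) = ⊥-elim (proj₁ (proj₂ (in⁻ R? v∈R)) e)
        ... | inj₂ (inj₂ e) = ⊥-elim (proj₂ (proj₂ (in⁻ R? v∈R)) e)

-- Separating pairs and the induction on the vertex set

module Cuts where

  open import Data.Empty using (⊥; ⊥-elim)
  open import Data.Fin.Base using (Fin)
  open import Data.Fin.Properties using (any?; all?; _≟_)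
  open import Data.Fin.Subset using (Subset; _∈_; _∉_; _⊆_; ∣_∣) renaming (⊥ to ∅)
  open import Data.Fin.Subset.Properties using (_∈?_; ∉⊥; anySubset?; _⊆?_)
  open import Data.List.Base using ([]; [_])
  open import Data.List.Relation.Unary.Any using (here)
  open import Data.Nat.Base using (ℕ; _<_)
  open import Data.Product.Base using (∃; _×_; _,_; proj₁; proj₂)
  open import Data.Sum.Base as Sum using (_⊎_; inj₁; inj₂; [_,_]′)
  open import Induction.WellFounded using (Acc; acc)
  open import Relation.Binary.PropositionalEquality hiding ([_])
  open import Relation.Nullary using (¬_; Dec; yes; no)
  open import Relation.Nullary.Decidable using (_×-dec_; _⊎-dec_; _→-dec_; ¬?)
  open import Relation.Unary using (Decidable)
  open Sets
  open Ears
  open Obstructions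
  open VirtualEdges
  open Layouts using (empty-layout)
  open Geometry using (Poles)
  open Glue using (glue)
  open Sweep using (finish; single-layout; start-sweep)

  module _ {n : ℕ} where

    Attached : Graph n → Subset n → Fin n → Fin n → Subset n → Set
    Attached G S a b M = ∀ u v → u ∈ M → v ∈ S → Adj G u v → v ∈ M ⊎ v ≡ a ⊎ v ≡ b

    -- M avoids both poles, so the edge st stays on the first side. `some` makes that side smaller
    -- than S, and `rest` does the same for M with a and b.
    record Cut (G : Graph n) (S : Subset n) (s t a b : Fin n) (M : Subset n) : Set where
      field
        a≢b      : a ≢ b
        a∈S      : a ∈ S
        b∈S      : b ∈ S
        a∉M      : a ∉ M
        b∉M      : b ∉ M
        M⊆S      : M ⊆ S
        s∉M      : s ∉ M
        t∉M      : t ∉ M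
        some     : ∃ λ m → m ∈ M
        attached : Attached G S a b M
        rest     : ∃ λ z → z ∈ S × z ∉ M × z ≢ a × z ≢ b

    cut? : ∀ G S s t a b M → Dec (Cut G S s t a b M)
    cut? G S s t a b M with ¬? (a ≟ b) ×-dec ((a ∈? S) ×-dec ((b ∈? S) ×-dec (¬? (a ∈? M) ×-dec (¬? (b ∈? M) ×-dec
        ((M ⊆? S) ×-dec (¬? (s ∈? M) ×-dec (¬? (t ∈? M) ×-dec (any? (λ m → m ∈? M) ×-dec
        (all? (λ u → all? (λ v → (u ∈? M) →-dec ((v ∈? S) →-dec (adj? G u v →-dec ((v ∈? M) ⊎-dec ((v ≟ a) ⊎-dec (v ≟ b)))))))
        ×-dec any? (λ z → (z ∈? S) ×-dec (¬? (z ∈? M) ×-dec (¬? (z ≟ a) ×-dec ¬? (z ≟ b)))))))))))))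
    ... | yes (c₁ , c₂ , c₃ , c₄ , c₅ , c₆ , c₇ , c₈ , c₉ , c₁₀ , c₁₁) = yes (record
            { a≢b = c₁ ; a∈S = c₂ ; b∈S = c₃ ; a∉M = c₄ ; b∉M = c₅ ; M⊆S = c₆ ; s∉M = c₇ ; t∉M = c₈ ; some = c₉ ; attached = c₁₀ ; rest = c₁₁ })
    ... | no none = no λ c → let open Cut c in none (a≢b , a∈S , b∈S , a∉M , b∉M , M⊆S , s∉M , t∉M , some , attached , rest)

    cut-swap : ∀ {G S s t a b M} → Cut G S s t a b M → Cut G S s t b a M
    cut-swap c = record { a≢b = ≢-sym a≢b ; a∈S = b∈S ; b∈S = a∈S ; a∉M = b∉M ; b∉M = a∉M ; M⊆S = M⊆S ; s∉M = s∉M ; t∉M = t∉M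
      ; some = some ; attached = λ u v p q r → Sum.map₂ Sum.swap (attached u v p q r)
      ; rest = let (z , p , q , r , r′) = rest in z , p , q , r′ , r }
      where
      open Cut c

    -- A substitute for the edge ab outside of S′.
    Connector : Graph n → Subset n → Subset n → Fin n → Fin n → Set
    Connector G S S′ a b = Adj G a b ⊎ (∃ λ C → C ⊆ S × C ≁ S′ × Conn G C × Touch G C a × Touch G C b)

    connector-swap : ∀ {G S S′ a b} → Connector G S S′ a b → Connector G S S′ b a
    connector-swap {G} (inj₁ ab) = inj₁ (symm G ab)
    connector-swap (inj₂ (C , p , q , r , ta , tb)) = inj₂ (C , p , q , r , tb , ta)

    lift-connector : ∀ {G : Graph n} {S S′ a b k} {H : Graph k} (a≢b : a ≢ b) → Connector G S S′ a b → a ∈ S → S′ ⊆ S →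
                     Model H S′ (addEdge G a≢b) → Model H S G
    lift-connector {G} {S} {S′} {a} {b} a≢b (inj₁ ab) a∈S S′⊆S m =
      lift {G = G} a≢b {D = sub (single? a)} m S′⊆S (λ v∈ → subst (_∈ S) (sym (in⁻ (single? a) v∈)) a∈S) (conn-single (in⁻ (single? a)))
        (in⁺ (single? a) refl) (λ v∈ _ → in⁻ (single? a) v∈) (a , in⁺ (single? a) refl , ab)
    lift-connector {G} {S} {S′} {a} {b} a≢b (inj₂ (C , C⊆S , C≁S′ , cC , (u , u∈ , ua) , tb)) a∈S S′⊆S m =
      lift {G = G} a≢b {D = sub D?} m S′⊆S (λ v∈ → [ C⊆S , (λ { refl → a∈S }) ]′ (in⁻ D? v∈))
        (conn-add cC u∈ ua (λ v∈ → in⁺ D? (inj₁ v∈)) (in⁺ D? (inj₂ refl)) (in⁻ D?)) (in⁺ D? (inj₂ refl))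
        (λ v∈ v∈S′ → [ (λ v∈C → ⊥-elim (C≁S′ v∈C v∈S′)) , (λ e → e) ]′ (in⁻ D? v∈))
        (touch-mono {G = G} (λ v∈ → in⁺ D? (inj₁ v∈)) tb)
      where
      D? : Decidable (λ v → v ∈ C ⊎ v ≡ a)
      D? v = (v ∈? C) ⊎-dec (v ≟ a)

    Outcomes : Graph n → Subset n → Fin n → Fin n → Set
    Outcomes G S s t = (Model K₃,₃ S G ⊎ Model K₅ S G) ⊎ Poles G S s t

    Solver : Subset n → Set₁
    Solver S = ∀ G′ S′ s t → ∣ S′ ∣ < ∣ S ∣ → s ∈ S′ → t ∈ S′ → Adj G′ s t → Conn G′ S′ → Outcomes G′ S′ s t

    module _ {G : Graph n} {S : Subset n} {s t : Fin n} (s∈ : s ∈ S) (t∈ : t ∈ S) (st : Adj G s t) (cS : Conn G S) where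

      outer? : (M : Subset n) → Decidable (λ v → v ∈ S × v ∉ M)
      outer? M v = (v ∈? S) ×-dec ¬? (v ∈? M)

      inner? : (a b : Fin n) (M : Subset n) → Decidable (λ v → v ∈ M ⊎ v ≡ a ⊎ v ≡ b)
      inner? a b M v = (v ∈? M) ⊎-dec ((v ≟ a) ⊎-dec (v ≟ b))

      module _ (solve : Solver S) where

        -- Both sides of the cut are solved with the edge ab added and glued along ab.
        solve-cut : ∀ {a b M} (c : Cut G S s t a b M) → a ≢ t → b ≢ s →
          Connector G S (sub (outer? M)) a b → Connector G S (sub (inner? a b M)) a b → Outcomes G S s t
        solve-cut {a} {b} {M} c a≢t b≢s k₁ k₂ = go first second
          where
          open Cut c
          S₁ = sub (outer? M)
          S₂? = inner? a b M
          S₂ = sub S₂?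
          S₁⊆ : S₁ ⊆ S
          S₁⊆ m = proj₁ (in⁻ (outer? M) m)
          S₂⊆ : S₂ ⊆ S
          S₂⊆ m = [ M⊆S , [ (λ { refl → a∈S }) , (λ { refl → b∈S }) ]′ ]′ (in⁻ S₂? m)
          a∈₁ = in⁺ (outer? M) (a∈S , a∉M)
          b∈₁ = in⁺ (outer? M) (b∈S , b∉M)
          a∈₂ = in⁺ S₂? (inj₂ (inj₁ refl))
          b∈₂ = in⁺ S₂? (inj₂ (inj₂ refl))
          s∈₁ = in⁺ (outer? M) (s∈ , s∉M)
          t∈₁ = in⁺ (outer? M) (t∈ , t∉M)
          conn₁ : Conn (addEdge G a≢b) S₁
          conn₁ = conn-shortcut a≢b cS S₁⊆ a∈₁ b∈₁ att
            where
            att : ∀ u v → u ∈ S → u ∉ S₁ → v ∈ S₁ → Adj G u v → v ≡ a ⊎ v ≡ b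
            att u v u∈ u∉ v∈ uv with u ∈? M
            ... | no u∉M = ⊥-elim (u∉ (in⁺ (outer? M) (u∈ , u∉M)))
            ... | yes u∈M = [ (λ m → ⊥-elim (proj₂ (in⁻ (outer? M) v∈) m)) , (λ e → e) ]′ (attached u v u∈M (S₁⊆ v∈) uv)
          conn₂ : Conn (addEdge G a≢b) S₂
          conn₂ = conn-shortcut a≢b cS S₂⊆ a∈₂ b∈₂ att
            where
            att : ∀ u v → u ∈ S → u ∉ S₂ → v ∈ S₂ → Adj G u v → v ≡ a ⊎ v ≡ b
            att u v u∈ u∉ v∈ uv = [ (λ m → ⊥-elim (u∉ (in⁺ S₂? (attached v u m u∈ (symm G uv))))) , (λ e → e) ]′ (in⁻ S₂? v∈)
          first : Outcomes (addEdge G a≢b) S₁ s t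
          first = solve _ S₁ s t (card-< S₁⊆ (M⊆S (proj₂ some)) (λ m → proj₂ (in⁻ (outer? M) m) (proj₂ some))) s∈₁ t∈₁ (inj₁ st) conn₁
          second : Outcomes (addEdge G a≢b) S₂ a b
          second = let (z , z∈ , z∉M , z≢a , z≢b) = rest in
            solve _ S₂ a b (card-< S₂⊆ z∈ (λ m → [ z∉M , [ z≢a , z≢b ]′ ]′ (in⁻ S₂? m))) a∈₂ b∈₂ (inj₂ (inj₁ (refl , refl))) conn₂
          s≢t : s ≢ t
          s≢t e = irrefl G e st
          cover : ∀ {v} → v ∈ S → v ∈ S₁ ⊎ v ∈ S₂
          cover {v} v∈ with v ∈? M
          ... | yes m = inj₂ (in⁺ S₂? (inj₁ m))
          ... | no v∉ = inj₁ (in⁺ (outer? M) (v∈ , v∉))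
          edges : ∀ {u v} → u ∈ S → v ∈ S → Adj G u v → (u ∈ S₁ × v ∈ S₁) ⊎ (u ∈ S₂ × v ∈ S₂)
          edges {u} {v} u∈ v∈ uv with u ∈? M | v ∈? M
          ... | yes mu | _ = inj₂ (in⁺ S₂? (inj₁ mu) , in⁺ S₂? (attached u v mu v∈ uv))
          ... | no _ | yes mv = inj₂ (in⁺ S₂? (attached v u mv u∈ (symm G uv)) , in⁺ S₂? (inj₁ mv))
          ... | no nu | no nv = inj₁ (in⁺ (outer? M) (u∈ , nu) , in⁺ (outer? M) (v∈ , nv))
          go : Outcomes (addEdge G a≢b) S₁ s t → Outcomes (addEdge G a≢b) S₂ a b → Outcomes G S s t
          go (inj₁ m) _ = inj₁ (Sum.map (lift-connector a≢b k₁ a∈S S₁⊆) (lift-connector a≢b k₁ a∈S S₁⊆) m)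
          go (inj₂ _) (inj₁ m) = inj₁ (Sum.map (lift-connector a≢b k₂ a∈S S₂⊆) (lift-connector a≢b k₂ a∈S S₂⊆) m)
          go (inj₂ p₁) (inj₂ p₂) = inj₂ (glue {S = S} a≢b p₁ p₂ s∈₁ t∈₁ a∈₁ b∈₁ a∈₂ b∈₂ s≢t a≢t b≢s cover
            (λ m₁ m₂ → [ (λ m → ⊥-elim (proj₂ (in⁻ (outer? M) m₁) m)) , (λ e → e) ]′ (in⁻ S₂? m₂)) edges)

        swap-inner : ∀ {a b M C} → C ≁ sub (inner? a b M) → C ≁ sub (inner? b a M)
        swap-inner {a} {b} {M} d m m′ = d m (in⁺ (inner? a b M) (Sum.map₂ Sum.swap (in⁻ (inner? b a M) m′)))

        -- Gluing wants a ≢ t and b ≢ s. If one of these fails, exchanging a and b repairs both.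
        solve-cut′ : ∀ {a b M} (c : Cut G S s t a b M) →
          Connector G S (sub (outer? M)) a b → Connector G S (sub (inner? a b M)) a b → Outcomes G S s t
        solve-cut′ {a} {b} {M} c k₁ k₂ with a ≟ t | b ≟ s
        ... | no a≢t | no b≢s = solve-cut c a≢t b≢s k₁ k₂
        ... | yes refl | _ = solve-cut (cut-swap c) (λ e → Cut.a≢b c (sym e)) (λ e → irrefl G (sym e) st)
                (connector-swap k₁) (Sum.map₂ (λ (C , p , q , r) → C , p , swap-inner q , r) (connector-swap k₂))
        ... | no _ | yes refl = solve-cut (cut-swap c) (λ e → irrefl G e st) (Cut.a≢b c)
                (connector-swap k₁) (Sum.map₂ (λ (C , p , q , r) → C , p , swap-inner q , r) (connector-swap k₂))

      module _ (no-edge-cut : ∀ {a b M} → Adj G a b → ¬ Cut G S s t a b M)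
               {y₁ y₂} (y₁∈ : y₁ ∈ S) (y₂∈ : y₂ ∈ S) (y₁≢y₂ : y₁ ≢ y₂)
               (y₁≢s : y₁ ≢ s) (y₁≢t : y₁ ≢ t) (y₂≢s : y₂ ≢ s) (y₂≢t : y₂ ≢ t) where

        -- A cut vertex a yields an edge cut: a neighbour c of a outside of M does, provided that
        -- something else remains there. Otherwise a and c are the poles, and a neighbour d of a
        -- inside M is used.
        no-cut-vertex′ : ∀ {a M m w} → a ∈ S → a ∉ M → M ⊆ S → m ∈ M → Attached G S a a M →
                         w ∈ S → w ∉ M → w ≢ a → s ∉ M → t ∉ M → ⊥
        no-cut-vertex′ {a} {M} {m} {w} a∈ a∉M M⊆S m∈ att w∈ w∉M w≢a s∉M t∉M
          with any? (λ c → (c ∈? S) ×-dec (¬? (c ∈? M) ×-dec (¬? (c ≟ a) ×-dec adj? G a c)))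
        ... | no none = proj₁ (conn-ind cS (λ v → ¬? (v ∈? M) ×-dec ¬? (v ≟ a)) step w∈ (w∉M , w≢a) (M⊆S m∈)) m∈
          where
          step : ∀ u v → u ∈ S → v ∈ S → u ∉ M × u ≢ a → Adj G u v → v ∉ M × v ≢ a
          step u v u∈ v∈ (u∉ , u≢a) uv = (λ v∈M → [ u∉ , [ u≢a , u≢a ]′ ]′ (att v u v∈M u∈ (symm G uv))) ,
            (λ { refl → none (u , u∈ , u∉ , u≢a , symm G uv) })
        ... | yes (c , c∈ , c∉M , c≢a , ac) with any? (λ z → (z ∈? S) ×-dec (¬? (z ∈? M) ×-dec (¬? (z ≟ a) ×-dec ¬? (z ≟ c))))
        ...   | yes z = no-edge-cut ac (record
                { a≢b = λ e → c≢a (sym e) ; a∈S = a∈ ; b∈S = c∈ ; a∉M = a∉M ; b∉M = c∉M ; M⊆S = M⊆S ; s∉M = s∉M ; t∉M = t∉M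
                ; some = m , m∈ ; attached = λ u v p q r → Sum.map₂ (λ e → inj₁ (Sum.[ (λ e → e) , (λ e → e) ] e)) (att u v p q r) ; rest = z })
        ...   | no only = go
          where
          W : ∀ {v} → v ∈ S → v ∉ M → v ≡ a ⊎ v ≡ c
          W {v} v∈ v∉ with v ≟ a | v ≟ c
          ... | yes e | _ = inj₁ e
          ... | no _ | yes e = inj₂ e
          ... | no p | no q = ⊥-elim (only (v , v∈ , v∉ , p , q))
          third : ∀ {y} → y ∈ S → y ≢ s → y ≢ t → y ∈ M
          third {y} y∈ y≢s y≢t with y ∈? M
          ... | yes p = p
          ... | no y∉ with W s∈ s∉M | W t∈ t∉M | W y∈ y∉
          ...   | inj₁ e | inj₁ e′ | _ = ⊥-elim (irrefl G (trans e (sym e′)) st)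
          ...   | inj₂ e | inj₂ e′ | _ = ⊥-elim (irrefl G (trans e (sym e′)) st)
          ...   | inj₁ e | _ | inj₁ e′ = ⊥-elim (y≢s (trans e′ (sym e)))
          ...   | inj₂ e | _ | inj₂ e′ = ⊥-elim (y≢s (trans e′ (sym e)))
          ...   | _ | inj₁ e | inj₁ e′ = ⊥-elim (y≢t (trans e′ (sym e)))
          ...   | _ | inj₂ e | inj₂ e′ = ⊥-elim (y≢t (trans e′ (sym e)))
          go : ⊥
          go with any? (λ d → (d ∈? M) ×-dec adj? G a d)
          ... | no none = w∉M (conn-ind cS (λ v → v ∈? M) (λ u v u∈ v∈ u∈M uv →
                  [ (λ p → p) , (λ e → ⊥-elim (none (u , u∈M , symm G (subst (Adj G u) (Sum.[ (λ e → e) , (λ e → e) ] e) uv)))) ]′ (att u v u∈M v∈ uv)) (M⊆S m∈) m∈ w∈)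
          -- M without d is not empty, because y₁ and y₂ differ from the poles and so both lie in M.
          ... | yes (d , d∈M , ad) = no-edge-cut ad (record
                { a≢b = λ { refl → a∉M d∈M } ; a∈S = a∈ ; b∈S = M⊆S d∈M ; a∉M = λ p → a∉M (proj₁ (in⁻ M′? p)) ; b∉M = λ p → proj₂ (in⁻ M′? p) refl
                ; M⊆S = λ p → M⊆S (proj₁ (in⁻ M′? p)) ; s∉M = λ p → s∉M (proj₁ (in⁻ M′? p)) ; t∉M = λ p → t∉M (proj₁ (in⁻ M′? p))
                ; some = some ; attached = att′ ; rest = c , c∈ , (λ p → c∉M (proj₁ (in⁻ M′? p))) , c≢a , (λ { refl → c∉M d∈M }) })
            where
            M′? : Decidable (λ v → v ∈ M × v ≢ d)
            M′? v = (v ∈? M) ×-dec ¬? (v ≟ d)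
            some : ∃ λ v → v ∈ sub M′?
            some with y₁ ≟ d
            ... | no ne = y₁ , in⁺ M′? (third y₁∈ y₁≢s y₁≢t , ne)
            ... | yes refl = y₂ , in⁺ M′? (third y₂∈ y₂≢s y₂≢t , ≢-sym y₁≢y₂)
            att′ : Attached G S a d (sub M′?)
            att′ u v u∈ v∈ uv with att u v (proj₁ (in⁻ M′? u∈)) v∈ uv | v ≟ d
            ... | _ | yes e = inj₂ (inj₂ e)
            ... | inj₁ v∈M | no ne = inj₁ (in⁺ M′? (v∈M , ne))
            ... | inj₂ (inj₁ e) | no _ = inj₂ (inj₁ e)
            ... | inj₂ (inj₂ e) | no _ = inj₂ (inj₁ e)

        co? : (a b : Fin n) (M : Subset n) → Decidable (λ v → v ∈ S × v ∉ M × v ≢ a × v ≢ b)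
        co? a b M v = (v ∈? S) ×-dec (¬? (v ∈? M) ×-dec (¬? (v ≟ a) ×-dec ¬? (v ≟ b)))

        co-attached : ∀ {a b M} → Attached G S a b M → Attached G S a b (sub (co? a b M))
        co-attached {a} {b} {M} att u v u∈ v∈ uv with v ≟ a | v ≟ b | v ∈? M
        ... | yes e | _ | _ = inj₂ (inj₁ e)
        ... | no _ | yes e | _ = inj₂ (inj₂ e)
        ... | no p | no q | no r = inj₁ (in⁺ (co? a b M) (v∈ , r , p , q))
        ... | no _ | no _ | yes v∈M with in⁻ (co? a b M) u∈
        ...   | u∈S , u∉M , u≢a , u≢b = ⊥-elim ([ u∉M , [ u≢a , u≢b ]′ ]′ (att v u v∈M u∈S (symm G uv)))

        -- Since st is an edge, s or t in M keeps both out of the other side.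
        poles-outside : ∀ {a b M} → Attached G S a b M → s ∈ M ⊎ t ∈ M → s ∉ sub (co? a b M) × t ∉ sub (co? a b M)
        poles-outside {a} {b} {M} att (inj₁ s∈M) = (λ p → proj₁ (proj₂ (in⁻ (co? a b M) p)) s∈M) ,
          (λ p → let (_ , q , r , r′) = in⁻ (co? a b M) p in [ q , [ r , r′ ]′ ]′ (att s t s∈M t∈ st))
        poles-outside {a} {b} {M} att (inj₂ t∈M) =
          (λ p → let (_ , q , r , r′) = in⁻ (co? a b M) p in [ q , [ r , r′ ]′ ]′ (att t s t∈M s∈ (symm G st))) ,
          (λ p → proj₁ (proj₂ (in⁻ (co? a b M) p)) t∈M)

        poles? : ∀ M → (s ∈ M ⊎ t ∈ M) ⊎ (s ∉ M × t ∉ M)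
        poles? M with s ∈? M | t ∈? M
        ... | yes p | _ = inj₁ (inj₁ p)
        ... | no _ | yes p = inj₁ (inj₂ p)
        ... | no p | no q = inj₂ (p , q)

        no-cut-vertex : ∀ {a M m w} → a ∈ S → a ∉ M → M ⊆ S → m ∈ M → Attached G S a a M → w ∈ S → w ∉ M → w ≢ a → ⊥
        no-cut-vertex {a} {M} {m} {w} a∈ a∉M M⊆S m∈ att w∈ w∉M w≢a with poles? M
        ... | inj₂ (p , q) = no-cut-vertex′ a∈ a∉M M⊆S m∈ att w∈ w∉M w≢a p q
        ... | inj₁ p = let (ns , nt) = poles-outside att p in
          no-cut-vertex′ a∈ (λ p → proj₁ (proj₂ (proj₂ (in⁻ (co? a a M) p))) refl) (λ p → proj₁ (in⁻ (co? a a M) p))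
            (in⁺ (co? a a M) (w∈ , w∉M , w≢a , w≢a)) (co-attached att) (M⊆S m∈)
            (λ p → proj₁ (proj₂ (in⁻ (co? a a M) p)) m∈) (λ { refl → a∉M m∈ }) ns nt

        -- A component of X that misses a would be cut off by b alone, and conversely; but there are
        -- no cut vertices.
        bridge : ∀ {a b X x} → a ≢ b → a ∈ S → b ∈ S → a ∉ X → b ∉ X → X ⊆ S → x ∈ X → Attached G S a b X →
                 ∃ λ C → C ⊆ X × Conn G C × Touch G C a × Touch G C b
        bridge {a} {b} {X} {x} a≢b a∈ b∈ a∉ b∉ X⊆S x∈ att = C.set , C.⊆X , C.conn x∈ , toA , toB
          where
          module C = Component (component G X x)
          att-C : ∀ u v → u ∈ C.set → v ∈ S → Adj G u v → v ∈ C.set ⊎ v ≡ a ⊎ v ≡ b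
          att-C u v u∈ v∈ uv = Sum.map₁ (λ v∈X → C.closed u∈ v∈X uv) (att u v (C.⊆X u∈) v∈ uv)
          toA : Touch G C.set a
          toA with touch? G C.set a
          ... | yes tk = tk
          ... | no nt = ⊥-elim (no-cut-vertex b∈ (λ p → b∉ (C.⊆X p)) (λ p → X⊆S (C.⊆X p)) (C.root x∈)
                  (λ u v u∈ v∈ uv → Sum.map₂ [ (λ { refl → ⊥-elim (nt (u , u∈ , uv)) }) , inj₁ ]′ (att-C u v u∈ v∈ uv))
                  a∈ (λ p → a∉ (C.⊆X p)) a≢b)
          toB : Touch G C.set b
          toB with touch? G C.set b
          ... | yes tk = tk
          ... | no nt = ⊥-elim (no-cut-vertex a∈ (λ p → a∉ (C.⊆X p)) (λ p → X⊆S (C.⊆X p)) (C.root x∈)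
                  (λ u v u∈ v∈ uv → Sum.map₂ [ inj₁ , (λ { refl → ⊥-elim (nt (u , u∈ , uv)) }) ]′ (att-C u v u∈ v∈ uv))
                  b∈ (λ p → b∉ (C.⊆X p)) (≢-sym a≢b))

        connectors : ∀ {a b M} → Cut G S s t a b M →
          Connector G S (sub (outer? M)) a b × Connector G S (sub (inner? a b M)) a b
        connectors {a} {b} {M} c = inj₂ (C , (λ p → M⊆S (C⊆ p)) , (λ p q → proj₂ (in⁻ (outer? M) q) (C⊆ p)) , more) ,
            inj₂ (C′ , (λ p → proj₁ (in⁻ (co? a b M) (C′⊆ p))) ,
              (λ p q → let (_ , x , y , z) = in⁻ (co? a b M) (C′⊆ p) in [ x , [ y , z ]′ ]′ (in⁻ (inner? a b M) q)) , more′)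
          where
          open Cut c
          r = bridge a≢b a∈S b∈S a∉M b∉M M⊆S (proj₂ some) attached
          C = proj₁ r
          C⊆ : C ⊆ M
          C⊆ = proj₁ (proj₂ r)
          more = proj₂ (proj₂ r)
          r′ = bridge a≢b a∈S b∈S (λ p → proj₁ (proj₂ (proj₂ (in⁻ (co? a b M) p))) refl) (λ p → proj₂ (proj₂ (proj₂ (in⁻ (co? a b M) p))) refl)
                 (λ p → proj₁ (in⁻ (co? a b M) p)) (in⁺ (co? a b M) (proj₂ rest)) (co-attached attached)
          C′ = proj₁ r′
          C′⊆ : C′ ⊆ sub (co? a b M)
          C′⊆ = proj₁ (proj₂ r′)
          more′ = proj₂ (proj₂ r′)

        three-connected : (∀ {a b M} → ¬ Cut G S s t a b M) → NoCut G S
        three-connected no-cut a b M a∈ b∈ a∉ b∉ M⊆S {m} m∈ att z z∈ with z ∈? M | z ≟ a | z ≟ b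
        ... | yes p | _ | _ = inj₁ p
        ... | no _ | yes e | _ = inj₂ (inj₁ e)
        ... | no _ | no _ | yes e = inj₂ (inj₂ e)
        ... | no z∉ | no z≢a | no z≢b with a ≟ b
        ...   | yes refl = ⊥-elim (no-cut-vertex a∈ a∉ M⊆S m∈ att z∈ z∉ z≢a)
        ...   | no a≢b with poles? M
        ...     | inj₂ (p , q) = ⊥-elim (no-cut (record { a≢b = a≢b ; a∈S = a∈ ; b∈S = b∈ ; a∉M = a∉ ; b∉M = b∉ ; M⊆S = M⊆S
                    ; s∉M = p ; t∉M = q ; some = m , m∈ ; attached = att ; rest = z , z∈ , z∉ , z≢a , z≢b }))
        ...     | inj₁ p = ⊥-elim (no-cut (record
                    { a≢b = a≢b ; a∈S = a∈ ; b∈S = b∈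
                    ; a∉M = λ p → proj₁ (proj₂ (proj₂ (in⁻ (co? a b M) p))) refl ; b∉M = λ p → proj₂ (proj₂ (proj₂ (in⁻ (co? a b M) p))) refl
                    ; M⊆S = λ p → proj₁ (in⁻ (co? a b M) p) ; s∉M = proj₁ (poles-outside att p) ; t∉M = proj₂ (poles-outside att p)
                    ; some = z , in⁺ (co? a b M) (z∈ , z∉ , z≢a , z≢b) ; attached = co-attached att
                    ; rest = m , M⊆S m∈ , (λ p → proj₁ (proj₂ (in⁻ (co? a b M) p)) m∈) , (λ { refl → a∉ m∈ }) , (λ { refl → b∉ m∈ }) }))

        solve-three-connected : NoCut G S → Outcomes G S s t
        solve-three-connected nc with any? (λ b → (b ∈? S) ×-dec (adj? G s b ×-dec ¬? (b ≟ t)))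
        ... | yes (b , b∈ , sb , b≢t) = start-sweep nc s∈ st t∈ b∈ sb b≢t
        -- If t were the only neighbour of s, then t and y₁ would separate s from y₂.
        ... | no none with nc t y₁ (sub (single? s)) t∈ y₁∈ (λ p → irrefl G (sym (in⁻ (single? s) p)) st) (λ p → y₁≢s (in⁻ (single? s) p))
                (λ p → subst (_∈ S) (sym (in⁻ (single? s) p)) s∈) (in⁺ (single? s) refl) nbr y₂ y₂∈
          where
          nbr : ∀ u v → u ∈ sub (single? s) → v ∈ S → Adj G u v → v ∈ sub (single? s) ⊎ v ≡ t ⊎ v ≡ y₁
          nbr u v u∈ v∈ uv with v ≟ t
          ... | yes e = inj₂ (inj₁ e)
          ... | no v≢t = ⊥-elim (none (v , v∈ , subst (λ z → Adj G z v) (in⁻ (single? s) u∈) uv , v≢t))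
        ...   | inj₁ p = ⊥-elim (y₂≢s (in⁻ (single? s) p))
        ...   | inj₂ (inj₁ e) = ⊥-elim (y₂≢t e)
        ...   | inj₂ (inj₂ e) = ⊥-elim (y₁≢y₂ (sym e))

    find-cut? : ∀ G S s t → Dec (∃ λ a → ∃ λ b → ∃ λ M → Cut G S s t a b M)
    find-cut? G S s t = any? λ a → any? λ b → anySubset? λ M → cut? G S s t a b M

    find-edge-cut? : ∀ G S s t → Dec (∃ λ a → ∃ λ b → Adj G a b × ∃ λ M → Cut G S s t a b M)
    find-edge-cut? G S s t = any? λ a → any? λ b → adj? G a b ×-dec anySubset? λ M → cut? G S s t a b M

    -- Edge cuts come first: the edge ab is its own connector, and only after their exclusion does
    -- `bridge` provide connectors for other cuts. Excluding cut vertices takes two vertices besides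
    -- the poles, so sets of at most three vertices are drawn directly.
    connected-case : ∀ G S s t → Acc _<_ ∣ S ∣ → s ∈ S → t ∈ S → Adj G s t → Conn G S → Outcomes G S s t
    connected-case G S s t (acc rs) s∈ t∈ st cS with any? (λ y → (y ∈? S) ×-dec (¬? (y ≟ s) ×-dec ¬? (y ≟ t)))
    ... | no none = inj₂ (finish st [] (empty-layout ∉⊥) ∉⊥ ∉⊥ (λ e → irrefl G e st) cover (λ m → ⊥-elim (∉⊥ m)))
      where
      cover : ∀ {v} → v ∈ S → v ≡ s ⊎ v ∈ ∅ ⊎ v ≡ t
      cover {v} v∈ with v ≟ s | v ≟ t
      ... | yes e | _ = inj₁ e
      ... | no _ | yes e = inj₂ (inj₂ e)
      ... | no p | no q = ⊥-elim (none (v , v∈ , p , q))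
    ... | yes (y₁ , y₁∈ , y₁≢s , y₁≢t) with any? (λ y → (y ∈? S) ×-dec (¬? (y ≟ s) ×-dec (¬? (y ≟ t) ×-dec ¬? (y ≟ y₁))))
    ...   | no none = inj₂ (finish st [ y₁ ] (single-layout {S = S} st (≢-sym y₁≢s)) (λ m → y₁≢s (sym (in⁻ (single? y₁) m)))
              (λ m → y₁≢t (sym (in⁻ (single? y₁) m))) (λ e → irrefl G e st) cover (λ m _ → here (in⁻ (single? y₁) m)))
      where
      cover : ∀ {v} → v ∈ S → v ≡ s ⊎ v ∈ sub (single? y₁) ⊎ v ≡ t
      cover {v} v∈ with v ≟ s | v ≟ t | v ≟ y₁
      ... | yes e | _ | _ = inj₁ e
      ... | no _ | yes e | _ = inj₂ (inj₂ e)
      ... | no _ | no _ | yes e = inj₂ (inj₁ (in⁺ (single? y₁) e))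
      ... | no p | no q | no r = ⊥-elim (none (v , v∈ , p , q , r))
    ...   | yes (y₂ , y₂∈ , y₂≢s , y₂≢t , y₂≢y₁) with find-edge-cut? G S s t
    ...     | yes (a , b , ab , M , c) = solve-cut′ s∈ t∈ st cS solve c (inj₁ ab) (inj₁ ab)
      where
      solve : Solver S
      solve G′ S′ s t lt = connected-case G′ S′ s t (rs lt)
    ...     | no no-edge-cut with find-cut? G S s t
    ...       | yes (a , b , M , c) = solve-cut′ s∈ t∈ st cS solve c (proj₁ ks) (proj₂ ks)
      where
      solve : Solver S
      solve G′ S′ s t lt = connected-case G′ S′ s t (rs lt)
      ks = connectors s∈ t∈ st cS (λ ab c → no-edge-cut (_ , _ , ab , _ , c)) y₁∈ y₂∈ (≢-sym y₂≢y₁) y₁≢s y₁≢t y₂≢s y₂≢t c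
    ...       | no no-cut = solve-three-connected s∈ t∈ st cS nec y₁∈ y₂∈ (≢-sym y₂≢y₁) y₁≢s y₁≢t y₂≢s y₂≢t
                  (three-connected s∈ t∈ st cS nec y₁∈ y₂∈ (≢-sym y₂≢y₁) y₁≢s y₁≢t y₂≢s y₂≢t (λ c → no-cut (_ , _ , _ , c)))
      where
      nec : ∀ {a b M} → Adj G a b → ¬ Cut G S s t a b M
      nec ab c = no-edge-cut (_ , _ , ab , _ , c)

-- Disconnected graphs: components side by side

module Kuratowski where

  import Data.Integer.Properties
  open import Data.Empty using (⊥-elim)
  open import Data.Fin.Base using (Fin; suc)
  open import Data.Fin.Properties using (any?; _≟_)
  open import Data.Fin.Subset using (Subset; _∈_; _∉_; _⊆_; ∣_∣; ⊤)
  open import Data.Fin.Subset.Properties using (_∈?_; ∈⊤)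
  open import Data.Integer.Base using (ℤ; +_; -[1+_]; 0ℤ; 1ℤ; _+_; _*_; _-_; -_; _≤_; _<_; +≤+; -≤+; +<+) renaming (∣_∣ to abs)
  open import Data.Integer.Properties using (≤-trans; ≤-reflexive; i≤j⇒i-j≤0)
  open import Data.Integer.Tactic.RingSolver using (solve-∀)
  open import Data.Nat.Base as ℕ using (ℕ)
  open import Data.Nat.Induction using (<-wellFounded)
  import Data.Nat.Properties as ℕ
  open import Data.Product.Base using (∃₂; _×_; _,_; proj₁; proj₂)
  open import Data.Sum.Base as Sum using (_⊎_; inj₁; inj₂)
  open import Induction.WellFounded using (Acc; acc)
  open import Relation.Binary.PropositionalEquality hiding ([_])
  open import Relation.Nullary using (yes; no)
  open import Relation.Nullary.Decidable using (_×-dec_; ¬?)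
  open import Relation.Unary using (Decidable)
  open Sets
  open Obstructions using (Model)
  open Layouts using (bounded)
  open Geometry
  open Cuts using (connected-case)

  module _ {n : ℕ} {G : Graph n} where

    Drawn : Subset n → Set
    Drawn S = ∃₂ λ (X Y : Fin n → ℤ) → Plane.Drawing X Y G S

    module _ (c : ℤ) {X X′ Y Y′ : Fin n → ℤ} where

      sep-shift : ∀ {u v p q} → (∀ {w} → w ∈₂ u , v ⊎ w ∈₂ p , q → X′ w ≡ X w + c × Y′ w ≡ Y w) →
                  Plane.Sep X Y u v p q → Plane.Sep X′ Y′ u v p q
      sep-shift same (Plane.sep (form α β γ) mn ps) = Plane.sep (form α β (γ - α * c))
        (λ m → Sum.map (λ lt → subst (_< 0ℤ) (sym (e (inj₁ m))) lt) (λ (z , m′) → trans (e (inj₁ m)) z , m′) (mn m))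
        (λ m → Sum.map (λ lt → subst (0ℤ <_) (sym (e (inj₂ m))) lt) (λ (z , m′) → trans (e (inj₂ m)) z , m′) (ps m))
        where
        e : ∀ {w} → _ → eval (form α β (γ - α * c)) (X′ w) (Y′ w) ≡ eval (form α β γ) (X w) (Y w)
        e {w} m rewrite proj₁ (same {w} m) | proj₂ (same {w} m) = go α β γ c (X w) (Y w)
          where
          go : ∀ α β γ c x y → α * (x + c) + β * y + (γ - α * c) ≡ α * x + β * y + γ
          go = solve-∀

    beside : ∀ {S A B} → (∀ {v} → v ∈ S → v ∈ A ⊎ v ∈ B) → (∀ {v} → v ∈ A → v ∉ B) →
             (∀ {u v} → u ∈ A → v ∈ S → Adj G u v → v ∈ A) → Drawn A → Drawn B → Drawn S
    beside {S} {A} {B} cover disj closed (X₁ , Y₁ , d₁) (X₂ , Y₂ , d₂) = X , Y , draw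
      where
      b₁ = proj₁ (bounded {n} (λ v → abs (X₁ v)))
      b₂ = proj₁ (bounded {n} (λ v → abs (X₂ v)))
      -- Moves B beyond the abscissa b₁ that bounds A, even if its own abscissas go down to - b₂.
      c = + b₁ + + b₂ + 1ℤ
      X Y : Fin n → ℤ
      X v with v ∈? A
      ... | yes _ = X₁ v + 0ℤ
      ... | no _ = X₂ v + c
      Y v with v ∈? A
      ... | yes _ = Y₁ v
      ... | no _ = Y₂ v
      at-A : ∀ {v} → v ∈ A → X v ≡ X₁ v + 0ℤ × Y v ≡ Y₁ v
      at-A {v} m with v ∈? A
      ... | yes _ = refl , refl
      ... | no n = ⊥-elim (n m)
      at-B : ∀ {v} → v ∈ B → X v ≡ X₂ v + c × Y v ≡ Y₂ v
      at-B {v} m with v ∈? A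
      ... | yes a = ⊥-elim (disj a m)
      ... | no n = refl , refl
      open Plane X Y
      ≤abs : ∀ x → x ≤ + abs x
      ≤abs (+ m) = ≤-reflexive refl
      ≤abs -[1+ m ] = -≤+
      -abs≤ : ∀ x → 0ℤ ≤ x + + abs x
      -abs≤ (+ m) = +≤+ ℕ.z≤n
      -abs≤ -[1+ m ] = ≤-reflexive (sym (Data.Integer.Properties.+-inverseˡ (+ ℕ.suc m)))
      barrier : Form
      barrier = form 1ℤ 0ℤ (- + b₁)
      left : ∀ {v} → v ∈ A → at barrier v ≤ 0ℤ
      left {v} m = subst (_≤ 0ℤ) (sym (trans (cong (λ x → 1ℤ * x + 0ℤ * Y v + - + b₁) (proj₁ (at-A m))) (go (X₁ v) (Y v) (+ b₁))))
        (i≤j⇒i-j≤0 (≤-trans (≤abs (X₁ v)) (+≤+ (proj₂ (bounded {n} (λ v → abs (X₁ v))) v))))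
        where
        go : ∀ x y b → 1ℤ * (x + 0ℤ) + 0ℤ * y + - b ≡ x - b
        go = solve-∀
      right : ∀ {v} → v ∈ B → 0ℤ < at barrier v
      right {v} m = subst (0ℤ <_) (sym (trans (cong (λ x → 1ℤ * x + 0ℤ * Y v + - + b₁) (proj₁ (at-B m))) (go (X₂ v) (Y v) (+ b₁) (+ b₂) (+ abs (X₂ v)))))
        (+<+ (ℕ.s≤s ℕ.z≤n) ⊕′ (-abs≤ (X₂ v) ⊕ ≤⇒0≤ (+≤+ (proj₂ (bounded {n} (λ v → abs (X₂ v))) v))))
        where
        go : ∀ x y b₁ b₂ a → 1ℤ * (x + (b₁ + b₂ + 1ℤ)) + 0ℤ * y + - b₁ ≡ 1ℤ + ((x + a) + (b₂ - a))
        go = solve-∀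
      home : ∀ {u v} → u ∈ S → v ∈ S → Cell G u v → (u ∈ A × v ∈ A) ⊎ (u ∈ B × v ∈ B)
      home u∈ v∈ (inj₁ refl) = Sum.map (λ m → m , m) (λ m → m , m) (cover u∈)
      home u∈ v∈ (inj₂ uv) with cover u∈ | cover v∈
      ... | inj₁ a | _ = inj₁ (a , closed a v∈ uv)
      ... | inj₂ b | inj₁ a = ⊥-elim (disj (closed a u∈ (symm G uv)) b)
      ... | inj₂ b | inj₂ b′ = inj₂ (b , b′)
      four : ∀ {P : Fin n → Set} {u v p q} → P u → P v → P p → P q → ∀ {w} → w ∈₂ u , v ⊎ w ∈₂ p , q → P w
      four a b c d (inj₁ (inj₁ refl)) = a
      four a b c d (inj₁ (inj₂ refl)) = b
      four a b c d (inj₂ (inj₁ refl)) = c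
      four a b c d (inj₂ (inj₂ refl)) = d
      draw : Drawing G S
      draw u∈ v∈ p∈ q∈ e f i j with home u∈ v∈ e | home p∈ q∈ f
      ... | inj₁ (ua , va) | inj₁ (pa , qa) = sep-shift 0ℤ (λ {w} m → four {P = λ w → X w ≡ X₁ w + 0ℤ × Y w ≡ Y₁ w} (at-A ua) (at-A va) (at-A pa) (at-A qa) m) (d₁ ua va pa qa e f i j)
      ... | inj₂ (ua , va) | inj₂ (pa , qa) = sep-shift c (λ {w} m → four {P = λ w → X w ≡ X₂ w + c × Y w ≡ Y₂ w} (at-B ua) (at-B va) (at-B pa) (at-B qa) m) (d₂ ua va pa qa e f i j)
      ... | inj₁ (ua , va) | inj₂ (pb , qb) = half-strict barrier (left ua) (left va) (right pb) (right qb)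
      ... | inj₂ (ub , vb) | inj₁ (pa , qa) = sep-sym (half-strict barrier (left pa) (left qa) (right ub) (right vb))

    model-mono : ∀ {k} {H : Graph k} {S S′} → S ⊆ S′ → Model H S G → Model H S′ G
    model-mono S⊆ m = record { branch = branch ; inside = λ i v∈ → S⊆ (inside i v∈) ; disjoint = disjoint ; nonempty = nonempty ; conn = conn ; edge = edge }
      where
      open Model m

    -- One component is split off at a time; any edge at v provides its poles, and an isolated v is
    -- a single point.
    solve : ∀ S → Acc ℕ._<_ ∣ S ∣ → (∀ {u v} → u ∈ S → Adj G u v → v ∈ S) → (Model K₃,₃ S G ⊎ Model K₅ S G) ⊎ Drawn S
    solve S (acc rs) closed with any? (λ v → v ∈? S)
    ... | no none = inj₂ ((λ _ → 0ℤ) , (λ _ → 0ℤ) , λ u∈ → ⊥-elim (none (_ , u∈)))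
    ... | yes (v , v∈) = go first (solve (sub R?) (rs (card-< R⊆ v∈ (λ m → proj₂ (in⁻ R? m) (J.root v∈))))
          (λ u∈ uw → let (uS , u∉J) = in⁻ R? u∈ ; wS = closed uS uw in
             in⁺ R? (wS , λ w∈J → u∉J (J.closed w∈J uS (symm G uw)))))
      where
      module J = Component (component G S v)
      R? : Decidable (λ w → w ∈ S × w ∉ J.set)
      R? w = (w ∈? S) ×-dec ¬? (w ∈? J.set)
      R⊆ : sub R? ⊆ S
      R⊆ m = proj₁ (in⁻ R? m)
      first : (Model K₃,₃ J.set G ⊎ Model K₅ J.set G) ⊎ Drawn J.set
      first with any? (λ u → (u ∈? J.set) ×-dec adj? G v u)
      ... | yes (u , u∈ , vu) = Sum.map₂ (λ p → Poles.X p , Poles.Y p , Poles.drawing p)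
              (connected-case G J.set v u (<-wellFounded _) (J.root v∈) u∈ vu (J.conn v∈))
      ... | no none = inj₂ ((λ _ → 0ℤ) , (λ _ → 0ℤ) , λ u∈ w∈ p∈ q∈ _ _ i _ →
              ⊥-elim (i (inj₁ (trans (only u∈) (sym (only p∈))) , inj₁ (trans (only w∈) (sym (only p∈))))))
        where
        only : ∀ {w} → w ∈ J.set → w ≡ v
        only = conn-ind (J.conn v∈) (λ w → w ≟ v) (λ { a b _ b∈ refl ab → ⊥-elim (none (b , b∈ , ab)) }) (J.root v∈) refl
      go : (Model K₃,₃ J.set G ⊎ Model K₅ J.set G) ⊎ Drawn J.set →
           (Model K₃,₃ (sub R?) G ⊎ Model K₅ (sub R?) G) ⊎ Drawn (sub R?) → (Model K₃,₃ S G ⊎ Model K₅ S G) ⊎ Drawn S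
      go (inj₁ m) _ = inj₁ (Sum.map (model-mono J.⊆X) (model-mono J.⊆X) m)
      go (inj₂ _) (inj₁ m) = inj₁ (Sum.map (model-mono R⊆) (model-mono R⊆) m)
      go (inj₂ d₁) (inj₂ d₂) = inj₂ (beside cover (λ a b → proj₂ (in⁻ R? b) a) (λ u∈ v∈ uv → J.closed u∈ v∈ uv) d₁ d₂)
        where
        cover : ∀ {w} → w ∈ S → w ∈ J.set ⊎ w ∈ sub R?
        cover {w} w∈ with w ∈? J.set
        ... | yes m = inj₁ m
        ... | no n = inj₂ (in⁺ R? (w∈ , n))

    kuratowski : (Model K₃,₃ ⊤ G ⊎ Model K₅ ⊤ G) ⊎ Drawn ⊤
    kuratowski = solve ⊤ (<-wellFounded _) (λ _ _ → ∈⊤)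

-- From models to minors, and minimality of K₅ and K₃,₃

module Minors where

  open import Data.Bool.Base using (Bool; true; false)
  import Data.Bool.Properties as Bool
  open import Data.Empty using (⊥; ⊥-elim)
  open import Data.Fin.Base using (Fin; zero; suc; punchIn; punchOut)
  open import Data.Fin.Patterns
  open import Data.Fin.Properties using (any?; all?; _≟_; punchIn-injective; punchInᵢ≢i; punchIn-punchOut; punchOut-injective; injective⇒≤)
  open import Data.Fin.Subset using (_∈_; _∉_; ⊤)
  open import Data.Fin.Subset.Properties using (_∈?_; ∈⊤)
  open import Data.List.Base using ([]; _∷_; allFin; cartesianProduct)
  open import Data.List.Membership.Propositional using () renaming (_∈_ to _∈ˡ_)
  open import Data.List.Membership.Propositional.Properties using (∈-cartesianProduct⁺; ∈-allFin)
  open import Data.List.Relation.Unary.Any using (here; there)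
  open import Data.Nat.Base using (ℕ; zero; suc; _≤_; _<_; s≤s)
  import Data.Nat.Properties as ℕ
  open import Data.Product.Base using (∃; ∃₂; _×_; _,_; proj₁; proj₂)
  open import Data.Sum.Base as Sum using (_⊎_; inj₁; inj₂; [_,_]′)
  open import Function.Base using (_∘_)
  open import Function.Bundles using (mk⇔; mk↔ₛ′; Equivalence; Inverse)
  open import Relation.Binary.PropositionalEquality hiding ([_])
  open import Relation.Nullary using (¬_; Dec; yes; no)
  open import Relation.Nullary.Decidable using (_×-dec_; ¬?; decidable-stable)
  open import Relation.Unary using (Decidable)
  open Sets
  open Obstructions using (Model)

  Injective : ∀ {m n} → (Fin m → Fin n) → Set
  Injective f = ∀ {x y} → f x ≡ f y → x ≡ y

  injective⇒surjective : ∀ {m n} (f : Fin m → Fin n) → Injective f → n ≤ m → ∀ y → ∃ λ x → f x ≡ y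
  injective⇒surjective {m} {suc n} f inj n≤m y with any? (λ x → f x ≟ y)
  ... | yes w = w
  ... | no none = ⊥-elim (ℕ.<⇒≱ n≤m (injective⇒≤ {f = λ x → punchOut (avoid x)}
          (λ {x} {x′} e → inj (punchOut-injective (avoid x) (avoid x′) e))))
    where
    avoid : ∀ x → y ≢ f x
    avoid x e = none (x , sym e)

  -- When the branch sets are single vertices covering G, only edges are left to delete. The list
  -- `ps` contains all candidates, and its length ensures termination.
  module Prune {m n} (H : Graph m) (φ : Fin n → Fin m) (ψ : Fin m → Fin n)
               (φψ : ∀ i → φ (ψ i) ≡ i) (ψφ : ∀ v → ψ (φ v) ≡ v) where

    prune : ∀ ps (G : Graph n) → (∀ i j → Adj H i j → Adj G (ψ i) (ψ j)) →
            (∀ u v → Adj G u v → ¬ Adj H (φ u) (φ v) → (u , v) ∈ˡ ps) → H ≺ G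
    prune [] G hom extra = iso record
      { bijection = mk↔ₛ′ ψ φ ψφ φψ
      ; adj⇔ = λ i j → mk⇔ (hom i j) (λ a → subst₂ (Adj H) (φψ i) (φψ j)
          (decidable-stable (adj? H _ _) (λ na → nothing-left (extra _ _ a na)))) }
      where
      nothing-left : ∀ {p : Fin n × Fin n} → ¬ p ∈ˡ []
      nothing-left ()
    prune ((u , v) ∷ ps) G hom extra with adj? G u v | adj? H (φ u) (φ v)
    ... | yes uv | no nh = edgeDeleted u v uv (prune ps (deleteEdge G u v)
            (λ i j ij → hom i j ij , λ { (inj₁ (refl , refl)) → nh (subst₂ (Adj H) (sym (φψ i)) (sym (φψ j)) ij)
                                       ; (inj₂ (refl , refl)) → nh (symm H (subst₂ (Adj H) (sym (φψ i)) (sym (φψ j)) ij)) })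
            (λ x y (xy , ne) na → skip (extra x y xy na) (λ { refl → ne (inj₁ (refl , refl)) })))
      where
      skip : ∀ {p} → p ∈ˡ (u , v) ∷ ps → p ≢ (u , v) → p ∈ˡ ps
      skip (here e) ne = ⊥-elim (ne e)
      skip (there p) _ = p
    ... | no nuv | _ = prune ps G hom (λ x y xy na → skip (extra x y xy na) (λ { refl → nuv xy }))
      where
      skip : ∀ {p} → p ∈ˡ (u , v) ∷ ps → p ≢ (u , v) → p ∈ˡ ps
      skip (here e) ne = ⊥-elim (ne e)
      skip (there p) _ = p
    ... | yes _ | yes h = prune ps G hom (λ x y xy na → skip (extra x y xy na) (λ { refl → na h }))
      where
      skip : ∀ {p} → p ∈ˡ (u , v) ∷ ps → p ≢ (u , v) → p ∈ˡ ps
      skip (here e) ne = ⊥-elim (ne e)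
      skip (there p) _ = p

  module _ {m} {H : Graph m} where

    module _ {n} {G : Graph (suc n)} (M : Model H ⊤ G) where
      open Model M

      pulled? : ∀ v i → Decidable (λ x → punchIn v x ∈ branch i)
      pulled? v i x = punchIn v x ∈? branch i

      delete-model : ∀ v → (∀ i → v ∉ branch i) → Model H ⊤ (deleteVertex G v)
      delete-model v out = record
        { branch = λ i → sub (pulled? v i)
        ; inside = λ _ _ → ∈⊤
        ; disjoint = λ {i} {j} p q → disjoint (in⁻ (pulled? v i) p) (in⁻ (pulled? v j) q)
        ; nonempty = λ i → let (w , w∈) = nonempty i in r w (v≢ w∈) , in⁺ (pulled? v i) (r∈ w∈)
        ; conn = λ i → connected (cn i)
        ; edge = λ i j ij → let (p , q , p∈ , q∈ , pq) = edge i j ij in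
            r p (v≢ p∈) , r q (v≢ q∈) , in⁺ (pulled? v i) (r∈ p∈) , in⁺ (pulled? v j) (r∈ q∈) ,
            subst₂ (Adj G) (sym (punchIn-punchOut (v≢ p∈))) (sym (punchIn-punchOut (v≢ q∈))) pq }
        where
        r : ∀ w → v ≢ w → Fin n
        r w ne = punchOut ne
        v≢ : ∀ {i w} → w ∈ branch i → v ≢ w
        v≢ {i} w∈ refl = out i w∈
        r∈ : ∀ {i w} (w∈ : w ∈ branch i) → punchIn v (r w (v≢ w∈)) ∈ branch i
        r∈ {i} w∈ = subst (_∈ branch i) (sym (punchIn-punchOut (v≢ w∈))) w∈
        cn : ∀ i Y {x y} → x ∈ sub (pulled? v i) → x ∈ Y → Closed (deleteVertex G v) (sub (pulled? v i)) Y →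
             y ∈ sub (pulled? v i) → y ∈ Y
        cn i Y {x} {y} x∈ x∈Y cl y∈ = back (conn-ind (conn i) P? step (in⁻ (pulled? v i) x∈) (x , refl , x∈Y) (in⁻ (pulled? v i) y∈))
          where
          P? : Decidable (λ w → ∃ λ z → w ≡ punchIn v z × z ∈ Y)
          P? w = any? (λ z → (w ≟ punchIn v z) ×-dec (z ∈? Y))
          back : (∃ λ z → punchIn v y ≡ punchIn v z × z ∈ Y) → y ∈ Y
          back (z , e , z∈) = subst (_∈ Y) (sym (punchIn-injective v y z e)) z∈
          step : ∀ a b → a ∈ branch i → b ∈ branch i → (∃ λ z → a ≡ punchIn v z × z ∈ Y) → Adj G a b →
                 ∃ λ z → b ≡ punchIn v z × z ∈ Y
          step a b a∈ b∈ (z , refl , z∈) ab = r b (v≢ b∈) , sym eb ,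
            cl z (r b (v≢ b∈)) (in⁺ (pulled? v i) a∈) (in⁺ (pulled? v i) (r∈ b∈)) z∈ (subst (Adj G (punchIn v z)) (sym eb) ab)
            where eb = punchIn-punchOut (v≢ b∈)

      contract-model : ∀ {u v i₀} → u ∈ branch i₀ → v ∈ branch i₀ → v ≢ u → Model H ⊤ (contractEdge G u v)
      contract-model {u} {v} {i₀} u∈ v∈ v≢u = record
        { branch = λ i → sub (pulled? v i)
        ; inside = λ _ _ → ∈⊤
        ; disjoint = λ {i} {j} p q → disjoint (in⁻ (pulled? v i) p) (in⁻ (pulled? v j) q)
        ; nonempty = λ i → let (w , w∈) = nonempty i in r w , r∈ w∈
        ; conn = λ i → connected (cn i)
        ; edge = λ i j ij → let (p , q , p∈ , q∈ , pq) = edge i j ij in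
            r p , r q , r∈ p∈ , r∈ q∈ , apart i j ij (r∈ p∈) (r∈ q∈) , p , q , merged p , merged q , pq }
        where
        r : Fin (suc n) → Fin n
        r w with v ≟ w
        ... | yes _ = punchOut v≢u
        ... | no ne = punchOut ne
        merged : ∀ w → w ≡ punchIn v (r w) ⊎ (w ≡ v × punchIn v (r w) ≡ u)
        merged w with v ≟ w
        ... | yes refl = inj₂ (refl , punchIn-punchOut v≢u)
        ... | no ne = inj₁ (sym (punchIn-punchOut ne))
        r∈ : ∀ {i w} → w ∈ branch i → r w ∈ sub (pulled? v i)
        r∈ {i} {w} w∈ with merged w
        ... | inj₁ e = in⁺ (pulled? v i) (subst (_∈ branch i) e w∈)
        ... | inj₂ (refl , e) = in⁺ (pulled? v i) (subst (_∈ branch i) (sym e) (subst (λ j → u ∈ branch j) (disjoint v∈ w∈) u∈))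
        r-in : ∀ x → r (punchIn v x) ≡ x
        r-in x with merged (punchIn v x)
        ... | inj₁ e = sym (punchIn-injective v x _ e)
        ... | inj₂ (e , _) = ⊥-elim (punchInᵢ≢i v x e)
        apart : ∀ i j → Adj H i j → ∀ {x y} → x ∈ sub (pulled? v i) → y ∈ sub (pulled? v j) → x ≢ y
        apart i j ij p q refl = irrefl H (disjoint (in⁻ (pulled? v i) p) (in⁻ (pulled? v j) q)) ij
        cn : ∀ i Y {x y} → x ∈ sub (pulled? v i) → x ∈ Y → Closed (contractEdge G u v) (sub (pulled? v i)) Y →
             y ∈ sub (pulled? v i) → y ∈ Y
        cn i Y {x} {y} x∈ x∈Y cl y∈ = subst (_∈ Y) (r-in y) (conn-ind (conn i) (λ w → r w ∈? Y) step
            (in⁻ (pulled? v i) x∈) (subst (_∈ Y) (sym (r-in x)) x∈Y) (in⁻ (pulled? v i) y∈))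
          where
          step : ∀ a b → a ∈ branch i → b ∈ branch i → r a ∈ Y → Adj G a b → r b ∈ Y
          step a b a∈ b∈ ra∈ ab with r a ≟ r b
          ... | yes e = subst (_∈ Y) e ra∈
          ... | no ne = cl (r a) (r b) (r∈ a∈) (r∈ b∈) ra∈ (ne , a , b , merged a , merged b , ab)

    -- Uncovered vertices are deleted, then branch sets with two vertices are contracted along an
    -- inner edge, which connectedness supplies. Both steps lower the number of vertices; then
    -- `Prune` takes over.
    model⇒minor : ∀ {n} {G : Graph n} → Model H ⊤ G → H ≺ G
    model⇒minor {n} {G} M with all? (λ v → any? (λ i → v ∈? Model.branch M i))
                             | any? (λ u → any? (λ v → any? (λ i → (u ∈? Model.branch M i) ×-dec ((v ∈? Model.branch M i) ×-dec ¬? (v ≟ u)))))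
    model⇒minor {zero} {G} M | no notall | _ = ⊥-elim (notall λ ())
    model⇒minor {suc n} {G} M | no notall | _ with any? (λ v → ¬? (any? (λ i → v ∈? Model.branch M i)))
    ... | yes (v , out) = vertexDeleted v (model⇒minor (delete-model M v (λ i v∈ → out (i , v∈))))
    ... | no none = ⊥-elim (notall (λ v → decidable-stable (any? (λ i → v ∈? Model.branch M i)) (λ nv → none (v , nv))))
    model⇒minor {suc n} {G} M | yes _ | yes (u , v , i , u∈ , v∈ , v≢u) with any? (λ w → (w ∈? Model.branch M i) ×-dec adj? G u w)
    ... | yes (w , w∈ , uw) = edgeContracted u w uw (model⇒minor (contract-model M u∈ w∈ (λ { refl → irrefl G refl uw })))
    ... | no none = ⊥-elim (v≢u (conn-ind (Model.conn M i) (λ w → w ≟ u)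
            (λ { a b _ b∈ refl ab → ⊥-elim (none (b , b∈ , ab)) }) u∈ refl v∈))
    model⇒minor {n} {G} M | yes all | no single = prune (cartesianProduct (allFin n) (allFin n)) G
        (λ i j ij → let (p , q , p∈ , q∈ , pq) = edge i j ij in subst₂ (Adj G) (only p∈ (ψ∈ i)) (only q∈ (ψ∈ j)) pq)
        (λ u v _ _ → ∈-cartesianProduct⁺ (∈-allFin u) (∈-allFin v))
      where
      open Model M
      φ : Fin n → Fin m
      φ v = proj₁ (all v)
      ψ : Fin m → Fin n
      ψ i = proj₁ (nonempty i)
      ψ∈ : ∀ i → ψ i ∈ branch i
      ψ∈ i = proj₂ (nonempty i)
      only : ∀ {i u v} → u ∈ branch i → v ∈ branch i → u ≡ v
      only {i} {u} {v} u∈ v∈ with u ≟ v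
      ... | yes e = e
      ... | no ne = ⊥-elim (single (u , v , i , u∈ , v∈ , λ e → ne (sym e)))
      open Prune H φ ψ (λ i → disjoint (proj₂ (all (ψ i))) (ψ∈ i)) (λ v → only (ψ∈ (φ v)) (proj₂ (all v)))

  ≅-sym : ∀ {m n} {G : Graph m} {H : Graph n} → G ≅ H → H ≅ G
  ≅-sym {G = G} {H} e = record
    { bijection = mk↔ₛ′ from to (λ x → Inverse.strictlyInverseʳ bijection x) (λ y → Inverse.strictlyInverseˡ bijection y)
    ; adj⇔ = λ u v → mk⇔ (λ uv → Equivalence.from (adj⇔ (from u) (from v)) (subst₂ (Adj H) (sym (back u)) (sym (back v)) uv))
                         (λ uv → subst₂ (Adj H) (back u) (back v) (Equivalence.to (adj⇔ (from u) (from v)) uv)) }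
    where
    open _≅_ e
    back : ∀ y → to (from y) ≡ y
    back y = Inverse.strictlyInverseˡ bijection y

  record Hom {m n} (H : Graph m) (G : Graph n) : Set where
    constructor hom
    field
      map       : Fin m → Fin n
      injective : Injective map
      preserves : ∀ {i j} → Adj H i j → Adj G (map i) (map j)

  hom-∘ : ∀ {l m n} {F : Graph l} {H : Graph m} {G : Graph n} → Hom H G → Hom F H → Hom F G
  hom-∘ (hom f i p) (hom g j q) = hom (f ∘ g) (j ∘ i) (p ∘ q)

  ≅⇒hom : ∀ {m n} {H : Graph m} {G : Graph n} → H ≅ G → Hom H G
  ≅⇒hom e = hom to (λ {x} {y} eq → trans (sym (Inverse.strictlyInverseʳ bijection x)) (trans (cong from eq) (Inverse.strictlyInverseʳ bijection y)))
                (λ {i} {j} → Equivalence.to (adj⇔ i j))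
    where
    open _≅_ e

  hom⇒≤ : ∀ {m n} {H : Graph m} {G : Graph n} → Hom H G → m ≤ n
  hom⇒≤ (hom f i _) = injective⇒≤ {f = f} i

  deleteEdge-hom : ∀ {n} {G : Graph n} u v → Hom (deleteEdge G u v) G
  deleteEdge-hom u v = hom (λ x → x) (λ e → e) proj₁

  -- Every operation except the deletion of an edge costs a vertex. So a minor with as many vertices
  -- is a spanning subgraph.
  minor⇒hom : ∀ {m n} {H : Graph m} {G : Graph n} → H ≺ G → m < n ⊎ Hom H G
  minor⇒≤ : ∀ {m n} {H : Graph m} {G : Graph n} → H ≺ G → m ≤ n
  minor⇒≤ p = [ ℕ.<⇒≤ , hom⇒≤ ]′ (minor⇒hom p)
  minor⇒hom (iso e) = inj₂ (≅⇒hom e)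
  minor⇒hom (vertexDeleted v p) = inj₁ (s≤s (minor⇒≤ p))
  minor⇒hom (edgeDeleted u v _ p) = Sum.map₂ (hom-∘ (deleteEdge-hom u v)) (minor⇒hom p)
  minor⇒hom (edgeContracted u v _ p) = inj₁ (s≤s (minor⇒≤ p))

  spanning : ∀ {m n} {H : Graph m} {G : Graph n} → H ≺ G → n ≤ m → Hom H G
  spanning p n≤m with minor⇒hom p
  ... | inj₁ lt = ⊥-elim (ℕ.<⇒≱ lt n≤m)
  ... | inj₂ h = h

  Bipartite : ∀ {n} → Graph n → Set
  Bipartite {n} G = ∃ λ (c : Fin n → Bool) → ∀ {x y} → Adj G x y → c x ≢ c y

  -- Bipartite after the deletion of the vertices marked by e, at most one.
  NearlyBipartite : ∀ {n} → Graph n → Set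
  NearlyBipartite {n} G = ∃₂ λ (c e : Fin n → Bool) → (∀ {x y} → e x ≡ true → e y ≡ true → x ≡ y) ×
    (∀ {x y} → Adj G x y → e x ≡ true ⊎ e y ≡ true ⊎ c x ≢ c y)

  hom-bipartite : ∀ {m n} {H : Graph m} {G : Graph n} → Hom H G → Bipartite G → Bipartite H
  hom-bipartite (hom f _ p) (c , col) = c ∘ f , λ xy → col (p xy)

  hom-nearly : ∀ {m n} {H : Graph m} {G : Graph n} → Hom H G → NearlyBipartite G → NearlyBipartite H
  hom-nearly (hom f i p) (c , e , one , col) = c ∘ f , e ∘ f , (λ a b → i (one a b)) , λ xy → col (p xy)

  bipartite⇒nearly : ∀ {n} {G : Graph n} → Bipartite G → NearlyBipartite G
  bipartite⇒nearly (c , col) = c , (λ _ → false) , (λ ()) , λ xy → inj₂ (inj₂ (col xy))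

  -- At most one vertex is lost, hence at most one edge is contracted, and the merged vertex is the
  -- one to be marked.
  minor-nearly : ∀ {m n} {H : Graph m} {G : Graph n} → H ≺ G → Bipartite G → n ≤ suc m → NearlyBipartite H
  minor-nearly {G = G} (iso e) b _ = hom-nearly (≅⇒hom e) (bipartite⇒nearly {G = G} b)
  minor-nearly {G = G} (vertexDeleted v p) (c , col) (s≤s n≤m) =
    hom-nearly (spanning p n≤m) (bipartite⇒nearly {G = deleteVertex G v} (c ∘ punchIn v , λ xy → col xy))
  minor-nearly (edgeDeleted u v _ p) (c , col) n≤m = minor-nearly p (c , λ (xy , _) → col xy) n≤m
  minor-nearly (edgeContracted {n = n} {G} u v _ p) (c , col) (s≤s n≤m) =
    hom-nearly (spanning p n≤m) (c ∘ punchIn v , e , one , near)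
    where
    e : Fin n → Bool
    e z with punchIn v z ≟ u
    ... | yes _ = true
    ... | no _ = false
    e-true : ∀ {z} → punchIn v z ≡ u → e z ≡ true
    e-true {z} eq with punchIn v z ≟ u
    ... | yes _ = refl
    ... | no ne = ⊥-elim (ne eq)
    true-e : ∀ {z} → e z ≡ true → punchIn v z ≡ u
    true-e {z} t with punchIn v z ≟ u
    true-e t | yes eq = eq
    true-e () | no _
    one : ∀ {x y} → e x ≡ true → e y ≡ true → x ≡ y
    one {x} {y} a b = punchIn-injective v x y (trans (true-e a) (sym (true-e b)))
    near : ∀ {x y} → Adj (contractEdge G u v) x y → e x ≡ true ⊎ e y ≡ true ⊎ c (punchIn v x) ≢ c (punchIn v y)
    near (_ , _ , _ , inj₂ (_ , q) , _ , _) = inj₁ (e-true q)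
    near (_ , _ , _ , inj₁ _ , inj₂ (_ , q) , _) = inj₂ (inj₁ (e-true q))
    near (_ , _ , _ , inj₁ refl , inj₁ refl , xy) = inj₂ (inj₂ (col xy))

  two-colours : ∀ {a b c : Bool} → a ≢ b → b ≢ c → a ≢ c → ⊥
  two-colours {false} {false} p _ _ = p refl
  two-colours {false} {true} {false} _ _ r = r refl
  two-colours {false} {true} {true} _ q _ = q refl
  two-colours {true} {false} {false} _ q _ = q refl
  two-colours {true} {false} {true} _ _ r = r refl
  two-colours {true} {true} p _ _ = p refl

  -- Among the first four vertices, three are unmarked and form a triangle.
  K₅-not-nearly-bipartite : ¬ NearlyBipartite K₅
  K₅-not-nearly-bipartite (c , e , one , col) = go (Bool._≟_ (e 0F) true) (Bool._≟_ (e 1F) true) (Bool._≟_ (e 2F) true)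
    where
    strong : ∀ {i j} → e i ≢ true → e j ≢ true → i ≢ j → c i ≢ c j
    strong ni nj ij with col ij
    ... | inj₁ t = ⊥-elim (ni t)
    ... | inj₂ (inj₁ t) = ⊥-elim (nj t)
    ... | inj₂ (inj₂ ne) = ne
    three : ∀ {i j k} → e i ≢ true → e j ≢ true → e k ≢ true → i ≢ j → j ≢ k → i ≢ k → ⊥
    three a b c ij jk ik = two-colours (strong a b ij) (strong b c jk) (strong a c ik)
    other : ∀ {i j} → e i ≡ true → i ≢ j → e j ≢ true
    other t ne t′ = ne (one t t′)
    go : Dec (e 0F ≡ true) → Dec (e 1F ≡ true) → Dec (e 2F ≡ true) → ⊥
    go (yes t) _ _ = three {1F} {2F} {3F} (other t λ ()) (other t λ ()) (other t λ ()) (λ ()) (λ ()) (λ ())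
    go (no _) (yes t) _ = three {0F} {2F} {3F} (other t λ ()) (other t λ ()) (other t λ ()) (λ ()) (λ ()) (λ ())
    go (no _) (no _) (yes t) = three {0F} {1F} {3F} (other t λ ()) (other t λ ()) (other t λ ()) (λ ()) (λ ()) (λ ())
    go (no a) (no b) (no c) = three {0F} {1F} {2F} a b c (λ ()) (λ ()) (λ ())

  K₃,₃-bipartite : Bipartite K₃,₃
  K₃,₃-bipartite = side 3 , λ ne → ne

  module _ {n} {G : Graph n} where

    -- Every proper minor misses an edge or a vertex, so it has no K₅ minor.
    K₅-minimal : G ≅ K₅ → ∀ {m} {H : Graph m} → H ≺ G → K₅ ≺ H ⊎ K₃,₃ ≺ H → H ≅ G
    K₅-minimal G≅ {H = H} H≺G which with hom⇒≤ (≅⇒hom G≅)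
    ... | n≤5 with which
    ...   | inj₂ p = ⊥-elim (ℕ.<⇒≱ (ℕ.≤-trans (minor⇒≤ p) (minor⇒≤ H≺G)) n≤5)
    ...   | inj₁ p = go H≺G n≤5 (≅⇒hom (≅-sym G≅))
      where
      go : ∀ {n} {G : Graph n} → H ≺ G → n ≤ 5 → Hom K₅ G → H ≅ G
      go (iso e) _ _ = e
      go (vertexDeleted v q) n≤5 _ = ⊥-elim (ℕ.<⇒≱ n≤5 (ℕ.≤-trans (minor⇒≤ p) (minor⇒≤ q)))
      go (edgeContracted u v _ q) n≤5 _ = ⊥-elim (ℕ.<⇒≱ n≤5 (ℕ.≤-trans (minor⇒≤ p) (minor⇒≤ q)))
      go {G = G} (edgeDeleted u v uv q) n≤5 _ = ⊥-elim (missing (surj u) (surj v))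
        where
        h = hom-∘ (spanning q (ℕ.≤-trans n≤5 (minor⇒≤ p))) (spanning p (ℕ.≤-trans (minor⇒≤ q) n≤5))
        open Hom h
        surj = injective⇒surjective map injective n≤5
        missing : (∃ λ i → map i ≡ u) → (∃ λ j → map j ≡ v) → ⊥
        missing (i , iu) (j , jv) = proj₂ (preserves {i} {j} (λ { refl → irrefl G (trans (sym iu) jv) uv })) (inj₁ (iu , jv))

    -- K₅ has one vertex less than K₃,₃, so as a minor it would be nearly bipartite. A K₃,₃ in H
    -- needs all six vertices, so H can only have lost edges; already the first deleted edge is
    -- missed by every spanning copy.
    K₃,₃-minimal : G ≅ K₃,₃ → ∀ {m} {H : Graph m} → H ≺ G → K₅ ≺ H ⊎ K₃,₃ ≺ H → H ≅ G
    K₃,₃-minimal G≅ {m} {H} H≺G (inj₁ p) = ⊥-elim (K₅-not-nearly-bipartite no-K₅)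
      where
      b : Bipartite G
      b = hom-bipartite (≅⇒hom G≅) K₃,₃-bipartite
      n≤6 = hom⇒≤ (≅⇒hom G≅)
      no-K₅ : NearlyBipartite K₅
      no-K₅ with ℕ.≤-<-connex 6 m
      ... | inj₁ 6≤m = minor-nearly p (hom-bipartite (spanning H≺G (ℕ.≤-trans n≤6 6≤m)) b) (ℕ.≤-trans (minor⇒≤ H≺G) n≤6)
      ... | inj₂ (s≤s m≤5) = hom-nearly (spanning p m≤5) (minor-nearly H≺G b (ℕ.≤-trans n≤6 (s≤s (minor⇒≤ p))))
    K₃,₃-minimal G≅ {m} {H} H≺G (inj₂ p) = go H≺G (hom⇒≤ (≅⇒hom G≅)) (≅⇒hom G≅)
      where
      go : ∀ {n} {G : Graph n} → H ≺ G → n ≤ 6 → Hom G K₃,₃ → H ≅ G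
      go (iso e) _ _ = e
      go (vertexDeleted v q) n≤6 _ = ⊥-elim (ℕ.<⇒≱ n≤6 (ℕ.≤-trans (minor⇒≤ p) (minor⇒≤ q)))
      go (edgeContracted u v _ q) n≤6 _ = ⊥-elim (ℕ.<⇒≱ n≤6 (ℕ.≤-trans (minor⇒≤ p) (minor⇒≤ q)))
      go {G = G} (edgeDeleted u v uv q) n≤6 g = ⊥-elim (missing (surj u) (surj v))
        where
        h = hom-∘ (spanning q (ℕ.≤-trans n≤6 (minor⇒≤ p))) (spanning p (ℕ.≤-trans (minor⇒≤ q) n≤6))
        open Hom h
        surj = injective⇒surjective map injective n≤6
        colour : Fin _ → Bool
        colour w = side 3 (Hom.map g w)
        across : ∀ i → ∃ λ k → side 3 i ≢ side 3 k
        across 0F = 3F , λ ()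
        across 1F = 3F , λ ()
        across 2F = 3F , λ ()
        across 3F = 0F , λ ()
        across 4F = 0F , λ ()
        across 5F = 0F , λ ()
        missing : (∃ λ i → map i ≡ u) → (∃ λ j → map j ≡ v) → ⊥
        missing (i , iu) (j , jv) with side 3 i Bool.≟ side 3 j
        ... | no ij = proj₂ (preserves {i} {j} ij) (inj₁ (iu , jv))
        -- If i and j are on one side, then u and v have a common neighbour, the image of k, and
        -- form a triangle with it in a bipartite graph.
        ... | yes same with across i
        ...   | k , ik = two-colours (Hom.preserves g uv)
                  (subst (λ w → colour w ≢ colour (map k)) jv (Hom.preserves g (proj₁ (preserves {j} {k} (λ e → ik (trans same e))))))
                  (subst (λ w → colour w ≢ colour (map k)) iu (Hom.preserves g (proj₁ (preserves {i} {k} ik))))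

-- Rational estimates and approximations of real numbers

module Rationals where

  open import Data.Integer.Base as ℤ using (ℤ; +_; -[1+_])
  import Data.Integer.Properties as ℤ
  import Data.Integer.Tactic.RingSolver as ℤ-solver
  open import Data.Nat.Base as ℕ using (ℕ; zero; suc)
  open import Data.Nat.Coprimality using (1-coprimeTo) renaming (sym to coprime-sym)
  import Data.Nat.Properties as ℕ
  open import Data.Product.Base using (∃; _,_)
  open import Data.Rational.Base
  open import Data.Rational.Properties
  import Data.Rational.Unnormalised.Base as ℚᵘ
  import Data.Rational.Unnormalised.Properties as ℚᵘ
  open import Data.Rational.Solver using (module +-*-Solver)
  open import Data.Sum.Base using (inj₁; inj₂)
  open import Relation.Binary.PropositionalEquality
  open +-*-Solver

  abstract
    unit : ℕ → ℚ
    unit k = + 1 / suc k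

    index : ℕ → ℚ
    index k = + 2 / suc k

    unit-def : ∀ k → unit k ≡ + 1 / suc k
    unit-def k = refl

    index-def : ∀ k → index k ≡ + 2 / suc k
    index-def k = refl

    two-units : ∀ k → unit k + unit k ≡ index k
    two-units k = toℚᵘ-injective (ℚᵘ.≃-trans (toℚᵘ-homo-+ (unit k) (unit k))
      (ℚᵘ.≃-trans (ℚᵘ.+-cong (toℚᵘ-fromℚᵘ (ℚᵘ.mkℚᵘ (+ 1) k)) (toℚᵘ-fromℚᵘ (ℚᵘ.mkℚᵘ (+ 1) k)))
      (ℚᵘ.≃-trans (ℚᵘ.*≡* (eq (+ suc k))) (ℚᵘ.≃-sym (toℚᵘ-fromℚᵘ (ℚᵘ.mkℚᵘ (+ 2) k))))))
      where
      eq : ∀ K → (+ 1 ℤ.* K ℤ.+ + 1 ℤ.* K) ℤ.* K ≡ + 2 ℤ.* (K ℤ.* K)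
      eq = ℤ-solver.solve-∀

    0≤unit : ∀ k → 0ℚ ≤ unit k
    0≤unit k = nonNegative⁻¹ (unit k) {{normalize-nonNeg 1 (suc k)}}

    0<unit : ∀ k → 0ℚ < unit k
    0<unit k = positive⁻¹ (unit k) {{normalize-pos 1 (suc k)}}

    small : ∀ {ε} → 0ℚ < ε → ∃ λ m → index m ≤ ε
    small {mkℚ (+ zero) d c} (*<* (ℤ.+<+ ()))
    small {mkℚ -[1+ n ] d c} (*<* ())
    small {mkℚ (+ suc n) d c} _ = 2 ℕ.* suc d , toℚᵘ-cancel-≤
      (ℚᵘ.≤-respˡ-≃ (ℚᵘ.≃-sym (toℚᵘ-fromℚᵘ (ℚᵘ.mkℚᵘ (+ 2) (2 ℕ.* suc d))))
        (ℚᵘ.*≤* (ℤ.+≤+ (ℕ.≤-trans (ℕ.n≤1+n (2 ℕ.* suc d)) (ℕ.m≤m+n (suc (2 ℕ.* suc d)) (n ℕ.* suc (2 ℕ.* suc d)))))))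

    nat : ℕ → ℚ
    nat k = mkℚ (+ k) 0 (coprime-sym (1-coprimeTo k))

    nat-suc : ∀ k → nat (suc k) ≡ 1ℚ + nat k
    nat-suc k = toℚᵘ-injective (ℚᵘ.≃-trans (ℚᵘ.*≡* (eq (+ k))) (ℚᵘ.≃-sym (toℚᵘ-homo-+ 1ℚ (nat k))))
      where
      eq : ∀ K → (+ 1 ℤ.+ K) ℤ.* + 1 ≡ (+ 1 ℤ.* + 1 ℤ.+ K ℤ.* + 1) ℤ.* + 1
      eq = ℤ-solver.solve-∀

    0≤nat : ∀ k → 0ℚ ≤ nat k
    0≤nat k = *≤* (ℤ.≤-trans (ℤ.≤-reflexive (ℤ.*-zeroˡ (+ 1))) (ℤ.≤-trans (ℤ.+≤+ ℕ.z≤n) (ℤ.≤-reflexive (sym (ℤ.*-identityʳ (+ k))))))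

    below-nat : ∀ q → ∃ λ k → q ≤ nat k
    below-nat (mkℚ (+ n) d c) = n , *≤* (subst₂ ℤ._≤_ (sym (ℤ.*-identityʳ (+ n))) (ℤ.pos-* n (suc d)) (ℤ.+≤+ (ℕ.m≤m*n n (suc d))))
    below-nat (mkℚ -[1+ n ] d c) = 0 , *≤* ℤ.-≤+

    int : ℤ → ℚ
    int z = mkℚ z 0 (coprime-sym (1-coprimeTo ℤ.∣ z ∣))

    int-+ : ∀ a b → int (a ℤ.+ b) ≡ int a + int b
    int-+ a b = toℚᵘ-injective (ℚᵘ.≃-trans (ℚᵘ.*≡* (go a b)) (ℚᵘ.≃-sym (toℚᵘ-homo-+ (int a) (int b))))
      where
      go : ∀ a b → (a ℤ.+ b) ℤ.* + 1 ≡ (a ℤ.* + 1 ℤ.+ b ℤ.* + 1) ℤ.* + 1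
      go = ℤ-solver.solve-∀

    int-* : ∀ a b → int (a ℤ.* b) ≡ int a * int b
    int-* a b = toℚᵘ-injective (ℚᵘ.≃-trans (ℚᵘ.*≡* refl) (ℚᵘ.≃-sym (toℚᵘ-homo-* (int a) (int b))))

    int-≤ : ∀ {a b} → a ℤ.≤ b → int a ≤ int b
    int-≤ {a} {b} le = *≤* (subst₂ ℤ._≤_ (sym (ℤ.*-identityʳ a)) (sym (ℤ.*-identityʳ b)) le)

    nat-≤ : ∀ {m n} → m ℕ.≤ n → nat m ≤ nat n
    nat-≤ le = int-≤ (ℤ.+≤+ le)

    nat-unit : ∀ k → nat (suc k) * unit k ≡ 1ℚ
    nat-unit k = toℚᵘ-injective (ℚᵘ.≃-trans (toℚᵘ-homo-* (nat (suc k)) (unit k))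
      (ℚᵘ.≃-trans (ℚᵘ.*-congˡ {toℚᵘ (nat (suc k))} (toℚᵘ-fromℚᵘ (ℚᵘ.mkℚᵘ (+ 1) k))) (ℚᵘ.*≡* (go (+ suc k)))))
      where
      go : ∀ K → (K ℤ.* + 1) ℤ.* + 1 ≡ + 1 ℤ.* (+ 1 ℤ.* K)
      go = ℤ-solver.solve-∀

    int-≥0 : ∀ {z} → + 0 ℤ.≤ z → 0ℚ ≤ int z
    int-≥0 le = int-≤ le

    int-≤0 : ∀ {z} → z ℤ.≤ + 0 → int z ≤ 0ℚ
    int-≤0 le = int-≤ le

    int-≡0 : ∀ {z} → z ≡ + 0 → int z ≡ 0ℚ
    int-≡0 refl = refl

    int-≥1 : ∀ {z} → + 0 ℤ.< z → 1ℚ ≤ int z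
    int-≥1 {z} lt = int-≤ {+ 1} {z} (ℤ.i<j⇒suc[i]≤j lt)

    int-≤-1 : ∀ {z} → z ℤ.< + 0 → 1ℚ ≤ - int z
    int-≤-1 {z} lt = neg-antimono-≤ (int-≤ {z} { -[1+ 0 ]} (ℤ.i<j⇒i≤pred[j] lt))

    int-≤-abs : ∀ z → int z ≤ nat ℤ.∣ z ∣
    int-≤-abs (+ m) = ≤-refl
    int-≤-abs -[1+ m ] = int-≤ ℤ.-≤+

    -int-≤-abs : ∀ z → - int z ≤ nat ℤ.∣ z ∣
    -int-≤-abs (+ zero) = ≤-refl
    -int-≤-abs (+ suc m) = ≤-trans (neg-antimono-≤ (0≤nat (suc m))) (0≤nat (suc m))
    -int-≤-abs -[1+ m ] = ≤-refl

    nat-+ : ∀ m n → nat (m ℕ.+ n) ≡ nat m + nat n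
    nat-+ m n = int-+ (+ m) (+ n)

    nat-zero : nat 0 ≡ 0ℚ
    nat-zero = refl

  infixl 6 _⊹_
  _⊹_ : ∀ {a b} → 0ℚ ≤ a → 0ℚ ≤ b → 0ℚ ≤ a + b
  _⊹_ = +-mono-≤

  _⊛_ : ∀ {a b} → 0ℚ ≤ a → 0ℚ ≤ b → 0ℚ ≤ a * b
  _⊛_ {a} {b} p q = nonNegative⁻¹ (a * b) {{nonNeg*nonNeg⇒nonNeg a {{nonNegative p}} b {{nonNegative q}}}}

  gap : ∀ {a b} → a ≤ b → 0ℚ ≤ b - a
  gap {a} {b} le = subst (_≤ b - a) (+-inverseʳ a) (+-monoˡ-≤ (- a) le)

  ungap : ∀ {a b} → 0ℚ ≤ b - a → a ≤ b
  ungap {a} {b} le = subst₂ _≤_ (+-identityˡ a) (solve 2 (λ a b → b :- a :+ a := b) refl a b) (+-monoˡ-≤ a le)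

  -- Linear consequences: the differences of the hypotheses sum up to the
  -- difference of the conclusion.
  linear₁ : ∀ {a a′ c c′} → a ≤ a′ → a′ - a ≡ c′ - c → c ≤ c′
  linear₁ p e = ungap (subst (0ℚ ≤_) e (gap p))

  linear₂ : ∀ {a a′ b b′ c c′} → a ≤ a′ → b ≤ b′ → (a′ - a) + (b′ - b) ≡ c′ - c → c ≤ c′
  linear₂ p q e = ungap (subst (0ℚ ≤_) e (gap p ⊹ gap q))

  linear₄ : ∀ {a a′ b b′ d d′ f f′ c c′} → a ≤ a′ → b ≤ b′ → d ≤ d′ → f ≤ f′ →
            (a′ - a) + (b′ - b) + (d′ - d) + (f′ - f) ≡ c′ - c → c ≤ c′
  linear₄ p q r s e = ungap (subst (0ℚ ≤_) e (gap p ⊹ gap q ⊹ gap r ⊹ gap s))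

  ≤∣∣ : ∀ p → p ≤ ∣ p ∣
  ≤∣∣ p with ≤-total 0ℚ p
  ... | inj₁ 0≤p = ≤-reflexive (sym (0≤p⇒∣p∣≡p 0≤p))
  ... | inj₂ p≤0 = ≤-trans p≤0 (0≤∣p∣ p)

  -≤∣∣ : ∀ p → - p ≤ ∣ p ∣
  -≤∣∣ p = subst (- p ≤_) (∣-p∣≡∣p∣ p) (≤∣∣ (- p))

  ∣∣≤ : ∀ {p e} → p ≤ e → - p ≤ e → ∣ p ∣ ≤ e
  ∣∣≤ {p} a b with ∣p∣≡p∨∣p∣≡-p p
  ... | inj₁ eq = subst (_≤ _) (sym eq) a
  ... | inj₂ eq = subst (_≤ _) (sym eq) b

  upper : ∀ a b {e} → ∣ a - b ∣ ≤ e → a - b ≤ e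
  upper a b le = ≤-trans (≤∣∣ (a - b)) le

  lower : ∀ a b {e} → ∣ a - b ∣ ≤ e → b - a ≤ e
  lower a b {e} le = subst (_≤ e) (solve 2 (λ a b → :- (a :- b) := b :- a) refl a b) (≤-trans (-≤∣∣ (a - b)) le)

  within : ∀ a b {e} → a - b ≤ e → b - a ≤ e → ∣ a - b ∣ ≤ e
  within a b {e} p q = ∣∣≤ p (subst (_≤ e) (solve 2 (λ a b → b :- a := :- (a :- b)) refl a b) q)

  abstract
    half : ℚ → ℚ
    half ε = ½ * ε

    half-pos : ∀ {ε} → 0ℚ < ε → 0ℚ < half ε
    half-pos {ε} p = positive⁻¹ (½ * ε) {{pos*pos⇒pos ½ ε {{positive p}}}}

    half+half : ∀ ε → half ε + half ε ≡ ε
    half+half ε = trans (sym (*-distribʳ-+ ε ½ ½)) (*-identityˡ ε)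

  -- By regularity each number moves by at most `unit k + unit m` between stages k and m. Twice this
  -- is `index k`, which `Close` grants, and `index m`, which the hypothesis provides.
  close-from : ∀ ε m (a c : ℝ) → ∣ approx a m - approx c m ∣ + index m ≤ ε → Close ε a c
  close-from ε m a c le k = subst (λ i → ∣ p - s ∣ ≤ ε + i) (index-def k) (within p s
    (linear₄ (upper p q (reg a k m)) (upper q r ≤-refl) (upper r s (reg c m k)) le
      (trans (cong (λ x → (unit k + unit m) - (p - q) + (e - (q - r)) + ((unit m + unit k) - (r - s)) + (ε - (e + x))) (sym (two-units m)))
        (trans (go p q r s (unit k) (unit m) e ε) (cong (λ x → ε + x - (p - s)) (two-units k)))))
    (linear₄ (lower p q (reg a k m)) (lower q r ≤-refl) (lower r s (reg c m k)) le
      (trans (cong (λ x → (unit k + unit m) - (q - p) + (e - (r - q)) + ((unit m + unit k) - (s - r)) + (ε - (e + x))) (sym (two-units m)))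
        (trans (go′ p q r s (unit k) (unit m) e ε) (cong (λ x → ε + x - (s - p)) (two-units k))))))
    where
    p = approx a k
    q = approx a m
    r = approx c m
    s = approx c k
    e = ∣ q - r ∣
    reg : ∀ a j k → ∣ approx a j - approx a k ∣ ≤ unit j + unit k
    reg a j k = subst₂ (λ x y → ∣ approx a j - approx a k ∣ ≤ x + y) (sym (unit-def j)) (sym (unit-def k)) (regular a j k)
    go : ∀ p q r s u v e ε → (u + v) - (p - q) + (e - (q - r)) + ((v + u) - (r - s)) + (ε - (e + (v + v))) ≡ ε + (u + u) - (p - s)
    go = solve 8 (λ p q r s u v e ε → (u :+ v) :- (p :- q) :+ (e :- (q :- r)) :+ ((v :+ u) :- (r :- s)) :+ (ε :- (e :+ (v :+ v))) := ε :+ (u :+ u) :- (p :- s)) refl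
    go′ : ∀ p q r s u v e ε → (u + v) - (q - p) + (e - (r - q)) + ((v + u) - (s - r)) + (ε - (e + (v + v))) ≡ ε + (u + u) - (s - p)
    go′ = solve 8 (λ p q r s u v e ε → (u :+ v) :- (q :- p) :+ (e :- (r :- q)) :+ ((v :+ u) :- (s :- r)) :+ (ε :- (e :+ (v :+ v))) := ε :+ (u :+ u) :- (s :- p)) refl

  close-at : ∀ ε m (a c : ℝ) → Close ε a c → ∣ approx a m - approx c m ∣ ≤ ε + index m
  close-at ε m a c h = subst (λ i → ∣ approx a m - approx c m ∣ ≤ ε + i) (sym (index-def m)) (h m)

  ≤-at : ∀ m {a c : ℝ} → a ≤ᴿ c → approx a m ≤ approx c m + index m
  ≤-at m {a} {c} h = subst (λ i → approx a m ≤ approx c m + i) (sym (index-def m)) (h m)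

  0≤index : ∀ m → 0ℚ ≤ index m
  0≤index m = subst (0ℚ ≤_) (two-units m) (0≤unit m ⊹ 0≤unit m)

-- Distance estimates from separating lines

module Distances where

  open import Data.Empty using (⊥-elim)
  open import Data.Fin.Base using (Fin)
  open import Data.Integer.Base as ℤ using (ℤ; +_)
  import Data.Integer.Properties as ℤ
  open import Data.Nat.Base as ℕ using (ℕ)
  import Data.Nat.Properties as ℕ
  open import Data.Product.Base using (_×_; _,_; proj₁; proj₂)
  open import Data.Rational.Base
  open import Data.Rational.Properties hiding (_≟_)
  open import Data.Rational.Solver using (module +-*-Solver)
  open import Data.Sum.Base using (inj₁; inj₂)
  open import Relation.Binary.PropositionalEquality hiding ([_])
  open import Relation.Nullary using (¬_)
  open Eventual
  open Geometry using (module Plane; _∈₂_,_; Form; form)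
  open Rationals
  open +-*-Solver

  *-monoˡ : ∀ {a b c} → 0ℚ ≤ c → a ≤ b → c * a ≤ c * b
  *-monoˡ {c = c} 0≤c le = *-monoˡ-≤-nonNeg c {{nonNegative 0≤c}} le

  product≤ : ∀ {α A η} → ∣ A ∣ ≤ η → α * A ≤ ∣ α ∣ * η
  product≤ {α} {A} le = ≤-trans (≤∣∣ (α * A)) (≤-trans (≤-reflexive (∣p*q∣≡∣p∣*∣q∣ α A)) (*-monoˡ (0≤∣p∣ α) le))

  -- The other summands are at least - κ times their coefficients, so what they give back to `w₁` is
  -- at most the κ term.
  weight : ∀ {κ σ w₁ w₂ w₃ w₄ k₁ k₂ k₃ k₄} → 0ℚ ≤ κ → 0ℚ ≤ σ →
    - κ ≤ w₁ → - κ ≤ w₂ → - κ ≤ w₃ → - κ ≤ w₄ → 0ℚ ≤ k₁ → 0ℚ ≤ k₂ → 0ℚ ≤ k₃ → 0ℚ ≤ k₄ →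
    w₁ * k₁ + w₂ * k₂ + w₃ * k₃ + w₄ * k₄ ≤ σ → 1ℚ ≤ k₁ → w₁ ≤ σ + κ * (k₁ + k₂ + k₃ + k₄)
  weight {κ} {σ} {w₁} {w₂} {w₃} {w₄} {k₁} {k₂} {k₃} {k₄} 0≤κ 0≤σ l₁ l₂ l₃ l₄ p₁ p₂ p₃ p₄ le 1≤k with ≤-total 0ℚ w₁
  ... | inj₂ w≤0 = ≤-trans w≤0 (0≤σ ⊹ (0≤κ ⊛ (p₁ ⊹ p₂ ⊹ p₃ ⊹ p₄)))
  ... | inj₁ 0≤w = ungap (subst (0ℚ ≤_)
        (solve 10 (λ κ σ w₁ w₂ w₃ w₄ k₁ k₂ k₃ k₄ →
          (σ :- (w₁ :* k₁ :+ w₂ :* k₂ :+ w₃ :* k₃ :+ w₄ :* k₄)) :+ w₁ :* (k₁ :- con 1ℚ) :+ κ :* k₁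
            :+ (w₂ :- (:- κ)) :* k₂ :+ (w₃ :- (:- κ)) :* k₃ :+ (w₄ :- (:- κ)) :* k₄
          := σ :+ κ :* (k₁ :+ k₂ :+ k₃ :+ k₄) :- w₁) refl κ σ w₁ w₂ w₃ w₄ k₁ k₂ k₃ k₄)
        (gap le ⊹ (0≤w ⊛ gap 1≤k) ⊹ (0≤κ ⊛ p₁) ⊹ (gap l₂ ⊛ p₂) ⊹ (gap l₃ ⊛ p₃) ⊹ (gap l₄ ⊛ p₄)))

  -- The position, in integer coordinates, of the point with parameter t on uv.
  blend : ℚ → ℚ → ℚ → ℚ
  blend a b t = a + t * (b - a)

  module _ {n} (X Y : Fin n → ℤ) where
    open Plane X Y

    x y : Fin n → ℚ
    x v = int (X v)
    y v = int (Y v)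

    level : Form → Fin n → ℚ
    level ℓ w = int (at ℓ w)

    level-expand : ∀ α β γ w → level (form α β γ) w ≡ int α * x w + int β * y w + int γ
    level-expand α β γ w = trans (int-+ (α ℤ.* X w ℤ.+ β ℤ.* Y w) γ)
      (cong (_+ int γ) (trans (int-+ (α ℤ.* X w) (β ℤ.* Y w)) (cong₂ _+_ (int-* α (X w)) (int-* β (Y w)))))

    level-blend : ∀ α β γ u v t → int α * blend (x u) (x v) t + int β * blend (y u) (y v) t + int γ
                  ≡ (1ℚ - t) * level (form α β γ) u + t * level (form α β γ) v
    level-blend α β γ u v t rewrite level-expand α β γ u | level-expand α β γ v =
      solve 8 (λ a b g xu xv yu yv t → a :* (xu :+ t :* (xv :- xu)) :+ b :* (yu :+ t :* (yv :- yu)) :+ g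
        := (con 1ℚ :- t) :* (a :* xu :+ b :* yu :+ g) :+ t :* (a :* xv :+ b :* yv :+ g)) refl
        (int α) (int β) (int γ) (x u) (x v) (y u) (y v) t

    steepness : Form → ℚ
    steepness (form α β γ) = ∣ int α ∣ + ∣ int β ∣

    0≤steepness : ∀ ℓ → 0ℚ ≤ steepness ℓ
    0≤steepness (form α β γ) = 0≤∣p∣ (int α) ⊹ 0≤∣p∣ (int β)

    level-close : ∀ ℓ u v p q {t t′ η} →
      ∣ blend (x p) (x q) t′ - blend (x u) (x v) t ∣ ≤ η → ∣ blend (y p) (y q) t′ - blend (y u) (y v) t ∣ ≤ η →
      ((1ℚ - t′) * level ℓ p + t′ * level ℓ q) - ((1ℚ - t) * level ℓ u + t * level ℓ v) ≤ steepness ℓ * η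
    level-close (form α β γ) u v p q {t} {t′} {η} dx dy = ≤-trans (≤-reflexive (trans
        (cong₂ _-_ (sym (level-blend α β γ p q t′)) (sym (level-blend α β γ u v t)))
        (solve 7 (λ a b g P Q R S → (a :* P :+ b :* Q :+ g) :- (a :* R :+ b :* S :+ g) := a :* (P :- R) :+ b :* (Q :- S)) refl
          (int α) (int β) (int γ) (blend (x p) (x q) t′) (blend (y p) (y q) t′) (blend (x u) (x v) t) (blend (y u) (y v) t))))
      (≤-trans (+-mono-≤ (product≤ {int α} dx) (product≤ {int β} dy)) (≤-reflexive (sym (*-distribʳ-+ η ∣ int α ∣ ∣ int β ∣))))

    -- A sampled parameter may leave the unit interval by the sampling error κ.
    Range : ℚ → ℚ → Set
    Range κ t = - κ ≤ t × - κ ≤ 1ℚ - t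

    -- The points with parameters t and t′ on the cells uv and pq are η-close only
    -- if they lie near the common vertices.
    Apart : ℕ → (u v p q : Fin n) → Set
    Apart C u v p q = ∀ {η κ t t′} → 0ℚ ≤ η → 0ℚ ≤ κ → Range κ t → Range κ t′ →
      ∣ blend (x p) (x q) t′ - blend (x u) (x v) t ∣ ≤ η → ∣ blend (y p) (y q) t′ - blend (y u) (y v) t ∣ ≤ η →
      (¬ v ∈₂ p , q → t ≤ nat C * (η + κ)) × (¬ u ∈₂ p , q → 1ℚ - t ≤ nat C * (η + κ)) ×
      (¬ q ∈₂ u , v → t′ ≤ nat C * (η + κ)) × (¬ p ∈₂ u , v → 1ℚ - t′ ≤ nat C * (η + κ))

    -- Along two close points the separating form changes by at most its steepness times η, while
    -- its values at all four ends pull in the right directions. At an end that is not shared the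
    -- value has size at least 1, so by `weight` the share of this end is small.
    apart : ∀ {u v p q} → Sep u v p q → Eventually (λ C → Apart C u v p q)
    apart {u} {v} {p} {q} (sep ℓ mn ps) = proj₁ big , λ C le {η} {κ} {t} {t′} 0≤η 0≤κ (lt , lt₁) (lt′ , lt₁′) dx dy →
        let S≤ = ≤-trans (≤-reflexive (regroup t t′)) (level-close ℓ u v p q {t} {t′} dx dy)
            0≤σ = (0≤steepness ℓ) ⊛ 0≤η
            final = λ {w} {k} (h : w ≤ steepness ℓ * η + κ * k) (ke : k ≡ total) →
              ≤-trans h (≤-trans (≤-reflexive (cong (λ z → steepness ℓ * η + κ * z) ke)) (enough C le 0≤η 0≤κ))
        in (λ out → final (weight 0≤κ 0≤σ lt lt₁ lt₁′ lt′ (A≥ v∈) (A≥ u∈) (B≥ p∈) (B≥ q∈)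
                      (≤-trans (≤-reflexive (perm₁ t t′)) S≤) (A≥1 v∈ out)) sum₁)
         , (λ out → final (weight 0≤κ 0≤σ lt₁ lt lt₁′ lt′ (A≥ u∈) (A≥ v∈) (B≥ p∈) (B≥ q∈) S≤ (A≥1 u∈ out)) refl)
         , (λ out → final (weight 0≤κ 0≤σ lt′ lt₁ lt lt₁′ (B≥ q∈) (A≥ u∈) (A≥ v∈) (B≥ p∈)
                      (≤-trans (≤-reflexive (perm₃ t t′)) S≤) (B≥1 q∈ out)) sum₃)
         , (λ out → final (weight 0≤κ 0≤σ lt₁′ lt₁ lt lt′ (B≥ p∈) (A≥ u∈) (A≥ v∈) (B≥ q∈)
                      (≤-trans (≤-reflexive (perm₄ t t′)) S≤) (B≥1 p∈ out)) sum₄)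
      where
      L = level ℓ
      u∈ : u ∈₂ u , v
      u∈ = inj₁ refl
      v∈ : v ∈₂ u , v
      v∈ = inj₂ refl
      p∈ : p ∈₂ p , q
      p∈ = inj₁ refl
      q∈ : q ∈₂ p , q
      q∈ = inj₂ refl
      total = (- L u) + (- L v) + L p + L q
      big = below-nat (steepness ℓ + total)
      A≥ : ∀ {w} → w ∈₂ u , v → 0ℚ ≤ - L w
      A≥ m with mn m
      ... | inj₁ lt = neg-antimono-≤ (int-≤0 (ℤ.<⇒≤ lt))
      ... | inj₂ (e , _) = neg-antimono-≤ (≤-reflexive (int-≡0 e))
      A≥1 : ∀ {w} → w ∈₂ u , v → ¬ w ∈₂ p , q → 1ℚ ≤ - L w
      A≥1 {w} m out with mn m
      ... | inj₁ lt = int-≤-1 lt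
      ... | inj₂ (_ , m′) = ⊥-elim (out m′)
      B≥ : ∀ {w} → w ∈₂ p , q → 0ℚ ≤ L w
      B≥ m with ps m
      ... | inj₁ lt = int-≥0 (ℤ.<⇒≤ lt)
      ... | inj₂ (e , _) = ≤-reflexive (sym (int-≡0 e))
      B≥1 : ∀ {w} → w ∈₂ p , q → ¬ w ∈₂ u , v → 1ℚ ≤ L w
      B≥1 {w} m out with ps m
      ... | inj₁ lt = int-≥1 lt
      ... | inj₂ (_ , m′) = ⊥-elim (out m′)
      regroup : ∀ t t′ → (1ℚ - t) * - L u + t * - L v + (1ℚ - t′) * L p + t′ * L q
                ≡ ((1ℚ - t′) * L p + t′ * L q) - ((1ℚ - t) * L u + t * L v)
      regroup t t′ = solve 6 (λ t t′ a b c d → (con 1ℚ :- t) :* (:- a) :+ t :* (:- b) :+ (con 1ℚ :- t′) :* c :+ t′ :* d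
        := ((con 1ℚ :- t′) :* c :+ t′ :* d) :- ((con 1ℚ :- t) :* a :+ t :* b)) refl t t′ (L u) (L v) (L p) (L q)
      perm₁ : ∀ t t′ → t * - L v + (1ℚ - t) * - L u + (1ℚ - t′) * L p + t′ * L q ≡ (1ℚ - t) * - L u + t * - L v + (1ℚ - t′) * L p + t′ * L q
      perm₁ t t′ = solve 4 (λ a b c d → a :+ b :+ c :+ d := b :+ a :+ c :+ d) refl (t * - L v) ((1ℚ - t) * - L u) ((1ℚ - t′) * L p) (t′ * L q)
      perm₃ : ∀ t t′ → t′ * L q + (1ℚ - t) * - L u + t * - L v + (1ℚ - t′) * L p ≡ (1ℚ - t) * - L u + t * - L v + (1ℚ - t′) * L p + t′ * L q
      perm₃ t t′ = solve 4 (λ a b c d → d :+ a :+ b :+ c := a :+ b :+ c :+ d) refl ((1ℚ - t) * - L u) (t * - L v) ((1ℚ - t′) * L p) (t′ * L q)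
      perm₄ : ∀ t t′ → (1ℚ - t′) * L p + (1ℚ - t) * - L u + t * - L v + t′ * L q ≡ (1ℚ - t) * - L u + t * - L v + (1ℚ - t′) * L p + t′ * L q
      perm₄ t t′ = solve 4 (λ a b c d → c :+ a :+ b :+ d := a :+ b :+ c :+ d) refl ((1ℚ - t) * - L u) (t * - L v) ((1ℚ - t′) * L p) (t′ * L q)
      sum₁ : - L v + - L u + L p + L q ≡ total
      sum₁ = cong (λ z → z + L p + L q) (+-comm (- L v) (- L u))
      sum₃ : L q + - L u + - L v + L p ≡ total
      sum₃ = solve 4 (λ a b c d → d :+ a :+ b :+ c := a :+ b :+ c :+ d) refl (- L u) (- L v) (L p) (L q)
      sum₄ : L p + - L u + - L v + L q ≡ total
      sum₄ = solve 4 (λ a b c d → c :+ a :+ b :+ d := a :+ b :+ c :+ d) refl (- L u) (- L v) (L p) (L q)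
      enough : ∀ C {η κ} → proj₁ big ℕ.≤ C → 0ℚ ≤ η → 0ℚ ≤ κ → steepness ℓ * η + κ * total ≤ nat C * (η + κ)
      enough C {η} {κ} le 0≤η 0≤κ = ungap (subst (0ℚ ≤_)
          (solve 5 (λ s T η κ C → (C :- (s :+ T)) :* (η :+ κ) :+ s :* κ :+ T :* η := C :* (η :+ κ) :- (s :* η :+ κ :* T)) refl
            (steepness ℓ) total η κ (nat C))
          ((gap (≤-trans (proj₂ big) (nat-≤ le)) ⊛ (0≤η ⊹ 0≤κ)) ⊹ ((0≤steepness ℓ) ⊛ 0≤κ) ⊹ ((A≥ u∈ ⊹ A≥ v∈ ⊹ B≥ p∈ ⊹ B≥ q∈) ⊛ 0≤η)))

    Spread : ℕ → (u v : Fin n) → Set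
    Spread C u v = ∀ {η t t′} → 0ℚ ≤ η →
      ∣ blend (x u) (x v) t′ - blend (x u) (x v) t ∣ ≤ η → ∣ blend (y u) (y v) t′ - blend (y u) (y v) t ∣ ≤ η →
      t′ - t ≤ nat C * η

    -- A line between the points u and v grows by at least 1 along the edge, so close points on it
    -- have close parameters.
    spread : ∀ {u v} → u ≢ v → Sep u u v v → Eventually (λ C → Spread C u v)
    spread {u} {v} u≢v (sep ℓ mn ps) = proj₁ big , λ C le {η} {t} {t′} 0≤η dx dy → go C {η} {t} {t′} le 0≤η (level-close ℓ u v u v {t} {t′} dx dy)
      where
      L = level ℓ
      big = below-nat (steepness ℓ)
      Lu : L u ≤ 0ℚ
      Lu with mn (inj₁ refl)
      ... | inj₁ lt = int-≤0 (ℤ.<⇒≤ lt)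
      ... | inj₂ (e , _) = ≤-reflexive (int-≡0 e)
      Lv : 1ℚ ≤ L v
      Lv with ps (inj₁ refl)
      ... | inj₁ lt = int-≥1 lt
      ... | inj₂ (_ , inj₁ e) = ⊥-elim (u≢v (sym e))
      ... | inj₂ (_ , inj₂ e) = ⊥-elim (u≢v (sym e))
      go : ∀ C {η t t′} → proj₁ big ℕ.≤ C → 0ℚ ≤ η →
           ((1ℚ - t′) * L u + t′ * L v) - ((1ℚ - t) * L u + t * L v) ≤ steepness ℓ * η → t′ - t ≤ nat C * η
      go C {η} {t} {t′} le 0≤η h with ≤-total 0ℚ (t′ - t)
      ... | inj₂ neg = ≤-trans neg (0≤nat C ⊛ 0≤η)
      ... | inj₁ nonneg = ungap (subst (0ℚ ≤_)
          (solve 7 (λ t t′ a b s η C → (s :* η :- (((con 1ℚ :- t′) :* a :+ t′ :* b) :- ((con 1ℚ :- t) :* a :+ t :* b)))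
               :+ (t′ :- t) :* ((b :- con 1ℚ) :+ (con 0ℚ :- a)) :+ (C :- s) :* η := C :* η :- (t′ :- t)) refl
             t t′ (L u) (L v) (steepness ℓ) η (nat C))
          (gap h ⊹ (nonneg ⊛ (gap Lv ⊹ gap Lu)) ⊹ (gap (≤-trans (proj₂ big) (nat-≤ le)) ⊛ 0≤η)))

-- The embedding given by a straight-line drawing

module Embedding where

  open import Data.Empty using (⊥; ⊥-elim)
  open import Data.Fin.Base using (Fin; suc) renaming (_<_ to _<ᶠ_)
  open import Data.Fin.Properties using (_≟_) renaming (<-irrefl to <ᶠ-irrefl; <-asym to <ᶠ-asym)
  open import Data.Fin.Subset using (⊤)
  open import Data.Fin.Subset.Properties using (∈⊤)
  open import Data.Integer.Base as ℤ using (ℤ; +_)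
  import Data.Integer.Properties as ℤ
  open import Data.Nat.Base as ℕ using (ℕ)
  import Data.Nat.Properties as ℕ
  open import Data.Product.Base using (∃; _×_; _,_; proj₁; proj₂)
  open import Data.Rational.Base
  open import Data.Rational.Properties hiding (_≟_)
  open import Data.Rational.Solver using (module +-*-Solver)
  open import Data.Sum.Base using (inj₁; inj₂)
  open import Relation.Binary.PropositionalEquality hiding ([_])
  open import Relation.Nullary using (¬_; Dec; yes; no)
  open import Relation.Nullary.Decidable using (_×-dec_; _⊎-dec_; from-yes)
  open Eventual
  open Layouts using (bounded)
  open Geometry using (module Plane; _∈₂_,_)
  open Rationals
  open Distances
  open +-*-Solver

  ∣∣-swap : ∀ {a b e} → ∣ a - b ∣ ≤ e → ∣ b - a ∣ ≤ e
  ∣∣-swap {a} {b} le = within b a (lower a b le) (upper a b le)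

  normalised : ∀ {K c B p q} → 0ℚ ≤ c → K * c ≡ 1ℚ → B + B ≤ K → p ≤ B → - q ≤ B → c * (p - q) ≤ 1ℚ
  normalised {K} {c} {B} {p} {q} 0≤c Kc 2B≤K p≤B q≤B = begin
    c * (p - q)  ≤⟨ *-monoˡ {p - q} {B + B} 0≤c (+-mono-≤ p≤B q≤B) ⟩
    c * (B + B)  ≤⟨ *-monoˡ {B + B} {K} 0≤c 2B≤K ⟩
    c * K        ≡⟨ *-comm c K ⟩
    K * c        ≡⟨ Kc ⟩
    1ℚ           ∎
    where
    open ≤-Reasoning

  not-both : ∀ {t b r} → t ≤ b → 1ℚ - t ≤ b → b ≤ r → r + r < 1ℚ → ⊥
  not-both {t} {b} {r} p q b≤r r+r<1 = <-irrefl refl (≤-<-trans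
    (linear₄ {c = 1ℚ} {r + r} p q b≤r b≤r (solve 3 (λ t b r → (b :- t) :+ (b :- (con 1ℚ :- t)) :+ (r :- b) :+ (r :- b) := r :+ r :- con 1ℚ) refl t b r)) r+r<1)

  module _ {n} {G : Graph n} (X Y : Fin n → ℤ) (drawing : Plane.Drawing X Y G ⊤) where
    open Plane X Y using (Cell; Inside)

    private
      xs ys : Fin n → ℚ
      xs = x X Y
      ys = y X Y

      abstract
        b₁ b₂ b K₀ : ℕ
        b₁ = proj₁ (bounded {n} (λ v → ℤ.∣ X v ∣))
        b₂ = proj₁ (bounded {n} (λ v → ℤ.∣ Y v ∣))
        b = b₁ ℕ.⊔ b₂
        -- Coordinates differ by at most 2b, so division by K = 2b + 1 makes every edge at most 1
        -- long in each coordinate.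
        K₀ = 2 ℕ.* b
        K c : ℚ
        K = nat (ℕ.suc K₀)
        c = unit K₀

        Kc : K * c ≡ 1ℚ
        Kc = nat-unit K₀
        0≤c : 0ℚ ≤ c
        0≤c = 0≤unit K₀
        0≤K : 0ℚ ≤ K
        0≤K = 0≤nat (ℕ.suc K₀)

      Unit : ℚ → ℚ → Set
      Unit p q = ∣ c * (q - p) ∣ ≤ 1ℚ

      abstract
        unit-length : (Z : Fin n → ℤ) → (∀ v → ℤ.∣ Z v ∣ ℕ.≤ b) → ∀ (u v : Fin n) → Unit (int (Z u)) (int (Z v))
        unit-length Z Z≤b u v = ∣∣≤ (bound u v)
            (subst (_≤ 1ℚ) (solve 3 (λ c p q → c :* (p :- q) := :- (c :* (q :- p))) refl c (int (Z u)) (int (Z v))) (bound v u))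
          where
          doubled : nat b + nat b ≤ K
          doubled = subst (_≤ K) (nat-+ b b) (nat-≤ {b ℕ.+ b} {ℕ.suc K₀}
            (ℕ.≤-trans (ℕ.≤-reflexive (cong (b ℕ.+_) (sym (ℕ.+-identityʳ b)))) (ℕ.n≤1+n K₀)))
          bound : ∀ u v → c * (int (Z v) - int (Z u)) ≤ 1ℚ
          bound u v = normalised {K} {c} {nat b} {int (Z v)} {int (Z u)} 0≤c Kc doubled
            (≤-trans (int-≤-abs (Z v)) (nat-≤ (Z≤b v))) (≤-trans (-int-≤-abs (Z u)) (nat-≤ (Z≤b u)))

        unit-x : ∀ u v → Unit (xs u) (xs v)
        unit-x = unit-length X (λ v → ℕ.≤-trans (proj₂ (bounded {n} (λ v → ℤ.∣ X v ∣)) v) (ℕ.m≤m⊔n b₁ b₂))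
        unit-y : ∀ u v → Unit (ys u) (ys v)
        unit-y = unit-length Y (λ v → ℕ.≤-trans (proj₂ (bounded {n} (λ v → ℤ.∣ Y v ∣)) v) (ℕ.m≤n⊔m b₁ b₂))

      lipschitz : ∀ {p q s t} → Unit p q → ∣ c * blend p q s - c * blend p q t ∣ ≤ ∣ s - t ∣
      lipschitz {p} {q} {s} {t} u = ≤-trans (≤-reflexive (trans (cong ∣_∣
          (solve 5 (λ c p q s t → c :* (p :+ s :* (q :- p)) :- c :* (p :+ t :* (q :- p)) := (s :- t) :* (c :* (q :- p))) refl c p q s t))
          (∣p*q∣≡∣p∣*∣q∣ (s - t) (c * (q - p)))))
        (≤-trans (*-monoˡ (0≤∣p∣ (s - t)) u) (≤-reflexive (*-identityʳ ∣ s - t ∣)))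

      -- With Lipschitz constant at most 1, applying the map to each approximation keeps the
      -- sequence regular without reindexing; the scaling by `c` serves this purpose.
      affine : ∀ p q → Unit p q → ℝ → ℝ
      affine p q u t = record
        { approx = λ k → c * blend p q (approx t k)
        ; regular = λ j k → ≤-trans (lipschitz {p} {q} {approx t j} {approx t k} u) (regular t j k) }

      place : Point G → Plane
      place (vertex w) = fromℚ (c * xs w) , fromℚ (c * ys w)
      place (along {u} {v} _ _ (t , _)) = affine (xs u) (xs v) (unit-x u v) t , affine (ys u) (ys v) (unit-y u v) t

      module Continuity (m : ℕ) {δ : ℚ} (0≤δ : 0ℚ ≤ δ) where
        κ = index m

        Around : Fin n → Point G → Set
        Around w P = ∣ approx (proj₁ (place P)) m - c * xs w ∣ ≤ δ + κ × ∣ approx (proj₂ (place P)) m - c * ys w ∣ ≤ δ + κ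

        around : ∀ {w P} → NearVertex G δ w P → Around w P
        around {w} here = zero-distance (c * xs w) , zero-distance (c * ys w)
          where
          zero-distance : ∀ z → ∣ z - z ∣ ≤ δ + κ
          zero-distance z = subst (λ e → ∣ e ∣ ≤ δ + κ) (sym (+-inverseʳ z)) (0≤δ ⊹ 0≤index m)
        around {w} (source {v} {t = t , _} cl) = go (xs w) (xs v) (unit-x w v) , go (ys w) (ys v) (unit-y w v)
          where
          go : ∀ p q → Unit p q → ∣ c * blend p q (approx t m) - c * p ∣ ≤ δ + κ
          go p q u = ≤-trans (≤-reflexive (cong (λ e → ∣ c * blend p q (approx t m) - c * e ∣) (solve 2 (λ p q → p := p :+ con 0ℚ :* (q :- p)) refl p q)))
            (≤-trans (lipschitz {p} {q} {approx t m} {0ℚ} u) (close-at δ m t (fromℚ 0ℚ) cl))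
        around {w} (target {u} {t = t , _} cl) = go (xs u) (xs w) (unit-x u w) , go (ys u) (ys w) (unit-y u w)
          where
          go : ∀ p q → Unit p q → ∣ c * blend p q (approx t m) - c * q ∣ ≤ δ + κ
          go p q u = ≤-trans (≤-reflexive (cong (λ e → ∣ c * blend p q (approx t m) - c * e ∣) (solve 2 (λ p q → q := p :+ con 1ℚ :* (q :- p)) refl p q)))
            (≤-trans (lipschitz {p} {q} {approx t m} {1ℚ} u) (close-at δ m t (fromℚ 1ℚ) cl))

        via : ∀ {p q z} → ∣ p - z ∣ ≤ δ + κ → ∣ q - z ∣ ≤ δ + κ → ∣ p - q ∣ ≤ (δ + κ) + (δ + κ)
        via {p} {q} {z} h k = within p q
          (linear₂ (upper p z h) (lower q z k) (solve 5 (λ p q z d e → (d :+ e :- (p :- z)) :+ (d :+ e :- (z :- q)) := (d :+ e) :+ (d :+ e) :- (p :- q)) refl p q z δ κ))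
          (linear₂ (lower p z h) (upper q z k) (solve 5 (λ p q z d e → (d :+ e :- (z :- p)) :+ (d :+ e :- (q :- z)) := (d :+ e) :+ (d :+ e) :- (q :- p)) refl p q z δ κ))

        close-images : ∀ {P Q} → Near G δ P Q →
          ∣ approx (proj₁ (place P)) m - approx (proj₁ (place Q)) m ∣ ≤ (δ + κ) + (δ + κ) ×
          ∣ approx (proj₂ (place P)) m - approx (proj₂ (place Q)) m ∣ ≤ (δ + κ) + (δ + κ)
        close-images (sameEdge {u} {v} {s = s , _} {t , _} cl) = go (xs u) (xs v) (unit-x u v) , go (ys u) (ys v) (unit-y u v)
          where
          go : ∀ p q → Unit p q → ∣ c * blend p q (approx s m) - c * blend p q (approx t m) ∣ ≤ (δ + κ) + (δ + κ)
          go p q u = ≤-trans (lipschitz {p} {q} {approx s m} {approx t m} u) (≤-trans (close-at δ m s t cl)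
            (≤-trans (≤-reflexive (sym (+-identityʳ (δ + κ)))) (+-monoʳ-≤ (δ + κ) (0≤δ ⊹ 0≤index m))))
        close-images {P} {Q} (sameVertex {w} a b) with around a | around b
        ... | ax , ay | bx , by = via {approx (proj₁ (place P)) m} {approx (proj₁ (place Q)) m} {c * xs w} ax bx ,
                                 via {approx (proj₂ (place P)) m} {approx (proj₂ (place Q)) m} {c * ys w} ay by

      eighth : ℚ → ℚ
      eighth ε = half (half (half ε))

      continuous : ∀ ε → 0ℚ < ε → ∃ λ δ → 0ℚ < δ × (∀ P Q → Near G δ P Q → Close² ε (place P) (place Q))
      continuous ε 0<ε = δ , 0<δ , λ P Q near → let (hx , hy) = close-images near in
          close-from ε m (proj₁ (place P)) (proj₁ (place Q)) (enough hx) , close-from ε m (proj₂ (place P)) (proj₂ (place Q)) (enough hy)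
        where
        -- The sampled images differ by at most 2(δ + κ), and `close-from` asks for another κ. With
        -- κ ≤ δ this is at most 5δ.
        δ = eighth ε
        0<δ : 0ℚ < δ
        0<δ = half-pos (half-pos (half-pos 0<ε))
        m = proj₁ (small 0<δ)
        open Continuity m (<⇒≤ 0<δ)
        eight : ε ≡ (δ + δ + (δ + δ)) + (δ + δ + (δ + δ))
        eight = trans (sym (half+half ε)) (cong₂ _+_ four four)
          where
          four : half ε ≡ δ + δ + (δ + δ)
          four = trans (sym (half+half (half ε))) (cong₂ _+_ (sym (half+half (half (half ε)))) (sym (half+half (half (half ε)))))
        enough : ∀ {d} → d ≤ (δ + κ) + (δ + κ) → d + κ ≤ ε
        enough {d} h = subst (d + κ ≤_) (sym eight) (ungap (subst (0ℚ ≤_)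
            (solve 3 (λ d δ κ → (((δ :+ κ) :+ (δ :+ κ)) :- d) :+ (δ :- κ) :+ (δ :- κ) :+ (δ :- κ) :+ δ :+ δ :+ δ
               := ((δ :+ δ :+ (δ :+ δ)) :+ (δ :+ δ :+ (δ :+ δ))) :- (d :+ κ)) refl d δ κ)
            (gap h ⊹ gap κ≤δ ⊹ gap κ≤δ ⊹ gap κ≤δ ⊹ <⇒≤ 0<δ ⊹ <⇒≤ 0<δ ⊹ <⇒≤ 0<δ)))
          where
          κ≤δ = proj₂ (small 0<δ)

      inside? : ∀ u v p q → Dec (Inside u v p q)
      inside? u v p q = ((u ≟ p) ⊎-dec (u ≟ q)) ×-dec ((v ≟ p) ⊎-dec (v ≟ q))

      AllApart AllSpread : ℕ → Set
      AllApart C = ∀ u v p q → Cell G u v → Cell G p q → ¬ Inside u v p q → ¬ Inside p q u v → Apart X Y C u v p q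
      AllSpread C = ∀ u v → u ≢ v → Spread X Y C u v

      all-apart : Eventually AllApart
      all-apart = eventually-all λ u → eventually-all λ v → eventually-all λ p → eventually-all λ q → one u v p q
        where
        one : ∀ u v p q → Eventually (λ C → Cell G u v → Cell G p q → ¬ Inside u v p q → ¬ Inside p q u v → Apart X Y C u v p q)
        one u v p q with (u ≟ v) ⊎-dec adj? G u v | (p ≟ q) ⊎-dec adj? G p q | inside? u v p q | inside? p q u v
        ... | no ne | _ | _ | _ = 0 , λ _ _ e → ⊥-elim (ne e)
        ... | yes _ | no ne | _ | _ = 0 , λ _ _ _ e → ⊥-elim (ne e)
        ... | yes _ | yes _ | yes i | _ = 0 , λ _ _ _ _ ni → ⊥-elim (ni i)
        ... | yes _ | yes _ | no _ | yes i = 0 , λ _ _ _ _ _ ni → ⊥-elim (ni i)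
        ... | yes e | yes f | no i | no j = eventually-map (λ _ h _ _ _ _ → h) (apart X Y (drawing ∈⊤ ∈⊤ ∈⊤ ∈⊤ e f i j))

      all-spread : Eventually AllSpread
      all-spread = eventually-all λ u → eventually-all λ v → one u v
        where
        one : ∀ u v → Eventually (λ C → u ≢ v → Spread X Y C u v)
        one u v with u ≟ v
        ... | yes e = 0 , λ _ _ ne → ⊥-elim (ne e)
        ... | no ne = eventually-map (λ _ h _ → h) (spread X Y ne (drawing ∈⊤ ∈⊤ ∈⊤ ∈⊤ (inj₁ refl) (inj₁ refl)
                (λ { (inj₁ e , _) → ne e ; (inj₂ e , _) → ne e }) (λ { (inj₁ e , _) → ne (sym e) ; (inj₂ e , _) → ne (sym e) })))

      abstract
        C₀ : ℕ
        C₀ = proj₁ (eventually-× all-apart all-spread)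
        aparts : AllApart C₀
        aparts = proj₁ (proj₂ (eventually-× all-apart all-spread) C₀ ℕ.≤-refl)
        spreads : AllSpread C₀
        spreads = proj₂ (proj₂ (eventually-× all-apart all-spread) C₀ ℕ.≤-refl)

      C : ℚ
      C = nat C₀

      scale-up : ∀ {A B e} → ∣ c * A - c * B ∣ ≤ e → ∣ A - B ∣ ≤ K * e
      scale-up {A} {B} {e} le = ≤-trans (≤-reflexive (trans (cong ∣_∣ (trans (sym (*-identityˡ (A - B)))
          (trans (cong (_* (A - B)) (sym Kc)) (solve 4 (λ K c A B → K :* c :* (A :- B) := K :* (c :* A :- c :* B)) refl K c A B))))
          (trans (∣p*q∣≡∣p∣*∣q∣ K (c * A - c * B)) (cong (_* ∣ c * A - c * B ∣) (0≤p⇒∣p∣≡p 0≤K)))))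
        (*-monoˡ 0≤K le)

      -- `η` is the distance of the sampled points after undoing the scaling, `β` the resulting
      -- bound on parameters. By `tight` a parameter within β of an end is ε-near to it; by
      -- `quarter` none is within β of both ends.
      module Inverse {ε ρ : ℚ} (m : ℕ) (0≤ρ : 0ℚ ≤ ρ)
                     (tight : C * (K * (ρ + index m) + index m) + index m + index m ≤ ε)
                     (quarter : C * (K * (ρ + index m) + index m) ≤ + 1 / 4) where
        κ = index m
        η = K * (ρ + κ)
        β = C * (η + κ)
        0≤κ : 0ℚ ≤ κ
        0≤κ = 0≤index m
        0≤η : 0ℚ ≤ η
        0≤η = 0≤K ⊛ (0≤ρ ⊹ 0≤κ)
        0≤β : 0ℚ ≤ β
        0≤β = 0≤nat C₀ ⊛ (0≤η ⊹ 0≤κ)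

        end₁ end₂ : Point G → Fin n
        end₁ (vertex w) = w
        end₁ (along {u} _ _ _) = u
        end₂ (vertex w) = w
        end₂ (along {v = v} _ _ _) = v
        parameter : Point G → ℚ
        parameter (vertex w) = 0ℚ
        parameter (along _ _ (t , _)) = approx t m

        cell : ∀ P → Cell G (end₁ P) (end₂ P)
        cell (vertex w) = inj₁ refl
        cell (along _ uv _) = inj₂ uv

        range : ∀ P → Range X Y κ (parameter P)
        range (vertex w) = neg-antimono-≤ 0≤κ , ≤-trans (neg-antimono-≤ 0≤κ) (nonNegative⁻¹ 1ℚ)
        range (along _ _ (t , 0≤t , t≤1)) =
          linear₁ (≤-at m {fromℚ 0ℚ} {t} 0≤t) (solve 2 (λ t k → t :+ k :- con 0ℚ := t :- (:- k)) refl (approx t m) κ) ,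
          linear₁ (≤-at m {t} {fromℚ 1ℚ} t≤1) (solve 2 (λ t k → con 1ℚ :+ k :- t := con 1ℚ :- t :- (:- k)) refl (approx t m) κ)

        at-x : ∀ P → approx (proj₁ (place P)) m ≡ c * blend (xs (end₁ P)) (xs (end₂ P)) (parameter P)
        at-x (vertex w) = cong (c *_) (solve 1 (λ p → p := p :+ con 0ℚ :* (p :- p)) refl (xs w))
        at-x (along _ _ _) = refl
        at-y : ∀ P → approx (proj₂ (place P)) m ≡ c * blend (ys (end₁ P)) (ys (end₂ P)) (parameter P)
        at-y (vertex w) = cong (c *_) (solve 1 (λ p → p := p :+ con 0ℚ :* (p :- p)) refl (ys w))
        at-y (along _ _ _) = refl

        module _ (P Q : Point G) (cl : Close² ρ (place P) (place Q)) where
          dx : ∣ blend (xs (end₁ Q)) (xs (end₂ Q)) (parameter Q) - blend (xs (end₁ P)) (xs (end₂ P)) (parameter P) ∣ ≤ η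
          dx = scale-up {blend (xs (end₁ Q)) (xs (end₂ Q)) (parameter Q)} {blend (xs (end₁ P)) (xs (end₂ P)) (parameter P)}
            (subst₂ (λ a b → ∣ a - b ∣ ≤ ρ + κ) (at-x Q) (at-x P) (∣∣-swap {approx (proj₁ (place P)) m} {approx (proj₁ (place Q)) m} (close-at ρ m (proj₁ (place P)) (proj₁ (place Q)) (proj₁ cl))))
          dy : ∣ blend (ys (end₁ Q)) (ys (end₂ Q)) (parameter Q) - blend (ys (end₁ P)) (ys (end₂ P)) (parameter P) ∣ ≤ η
          dy = scale-up {blend (ys (end₁ Q)) (ys (end₂ Q)) (parameter Q)} {blend (ys (end₁ P)) (ys (end₂ P)) (parameter P)}
            (subst₂ (λ a b → ∣ a - b ∣ ≤ ρ + κ) (at-y Q) (at-y P) (∣∣-swap {approx (proj₂ (place P)) m} {approx (proj₂ (place Q)) m} (close-at ρ m (proj₂ (place P)) (proj₂ (place Q)) (proj₂ cl))))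

          cells-apart : ¬ Inside (end₁ P) (end₂ P) (end₁ Q) (end₂ Q) → ¬ Inside (end₁ Q) (end₂ Q) (end₁ P) (end₂ P) →
            (¬ end₂ P ∈₂ end₁ Q , end₂ Q → parameter P ≤ β) × (¬ end₁ P ∈₂ end₁ Q , end₂ Q → 1ℚ - parameter P ≤ β) ×
            (¬ end₂ Q ∈₂ end₁ P , end₂ P → parameter Q ≤ β) × (¬ end₁ Q ∈₂ end₁ P , end₂ P → 1ℚ - parameter Q ≤ β)
          cells-apart i j = aparts (end₁ P) (end₂ P) (end₁ Q) (end₂ Q) (cell P) (cell Q) i j {η} {κ} {parameter P} {parameter Q} 0≤η 0≤κ (range P) (range Q) dx dy

        impossible : ∀ {t} → t ≤ β → 1ℚ - t ≤ β → ⊥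
        impossible {t} p q = not-both {t} {β} {+ 1 / 4} p q quarter (from-yes (+ 1 / 4 + + 1 / 4 <? 1ℚ))

        close-to : ∀ {t} (z : ℚ) → approx t m - z ≤ β + κ → z - approx t m ≤ β + κ → Close ε t (fromℚ z)
        close-to {t} z p q = close-from ε m t (fromℚ z) (≤-trans (+-monoˡ-≤ κ (within (approx t m) z p q)) tight)

        β≤ : ∀ {a} → a ≤ β → a ≤ β + κ
        β≤ {a} h = linear₂ h 0≤κ (solve 3 (λ a b k → (b :- a) :+ (k :- con 0ℚ) := b :+ k :- a) refl a β κ)
        κ≤ : ∀ {a} → - κ ≤ - a → a ≤ β + κ
        κ≤ {a} h = linear₂ h 0≤β (solve 3 (λ a b k → (:- a :- (:- k)) :+ (b :- con 0ℚ) := b :+ k :- a) refl a β κ)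

        at-source : ∀ {u v} {u<v : u <ᶠ v} {uv : Adj G u v} {t} → approx (proj₁ t) m ≤ β → NearVertex G ε u (along u<v uv t)
        at-source {u<v = u<v} {uv} {t} h = source {t = t} (close-to {proj₁ t} 0ℚ
          (β≤ (subst (_≤ β) (sym (+-identityʳ (approx (proj₁ t) m))) h))
          (κ≤ (subst (- κ ≤_) (solve 1 (λ t → t := :- (con 0ℚ :- t)) refl (approx (proj₁ t) m)) (proj₁ (range (along u<v uv t))))))

        at-target : ∀ {u v} {u<v : u <ᶠ v} {uv : Adj G u v} {t} → 1ℚ - approx (proj₁ t) m ≤ β → NearVertex G ε v (along u<v uv t)
        at-target {u<v = u<v} {uv} {t} h = target {t = t} (close-to {proj₁ t} 1ℚ
          (κ≤ (subst (- κ ≤_) (solve 1 (λ t → con 1ℚ :- t := :- (t :- con 1ℚ)) refl (approx (proj₁ t) m)) (proj₂ (range (along u<v uv t)))))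
          (β≤ h))

        Cη≤β : C * η ≤ β
        Cη≤β = *-monoˡ (0≤nat C₀) (linear₁ 0≤κ (solve 2 (λ e k → k :- con 0ℚ := e :+ k :- e) refl η κ))

        vertex-along : ∀ w {u v} (u<v : u <ᶠ v) (uv : Adj G u v) t → Close² ρ (place (vertex w)) (place (along u<v uv t)) →
                       NearVertex G ε w (along u<v uv t)
        vertex-along w {u} {v} u<v uv t cl with w ≟ u | w ≟ v
        ... | yes refl | _ = at-source {t = t} (≤-trans (≤-reflexive (sym (+-identityʳ _)))
                (≤-trans (spreads w v (λ e → <ᶠ-irrefl e u<v) {η} {0ℚ} {approx (proj₁ t) m} 0≤η
                  (from-zero (xs w) (xs v) (xs w) (approx (proj₁ t) m) (dx (vertex w) (along u<v uv t) cl)) (from-zero (ys w) (ys v) (ys w) (approx (proj₁ t) m) (dy (vertex w) (along u<v uv t) cl))) Cη≤β))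
          where
          from-zero : ∀ p q r s → ∣ blend p q s - blend p r 0ℚ ∣ ≤ η → ∣ blend p q s - blend p q 0ℚ ∣ ≤ η
          from-zero p q r s = subst (λ e → ∣ blend p q s - e ∣ ≤ η) (solve 3 (λ p q r → p :+ con 0ℚ :* (r :- p) := p :+ con 0ℚ :* (q :- p)) refl p q r)
        ... | no _ | yes refl = at-target {t = t} (≤-trans (spreads u w (λ e → <ᶠ-irrefl e u<v) {η} {approx (proj₁ t) m} {1ℚ} 0≤η
                  (from-one (xs u) (xs w) (approx (proj₁ t) m) (dx (vertex w) (along u<v uv t) cl)) (from-one (ys u) (ys w) (approx (proj₁ t) m) (dy (vertex w) (along u<v uv t) cl))) Cη≤β)
          where
          from-one : ∀ p q s → ∣ blend p q s - blend q q 0ℚ ∣ ≤ η → ∣ blend p q 1ℚ - blend p q s ∣ ≤ η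
          from-one p q s h = subst (λ e → ∣ e - blend p q s ∣ ≤ η) (solve 2 (λ p q → q :+ con 0ℚ :* (q :- q) := p :+ con 1ℚ :* (q :- p)) refl p q) (∣∣-swap {blend p q s} {blend q q 0ℚ} h)
        ... | no w≢u | no w≢v = ⊥-elim (impossible {0ℚ} 0≤β (proj₁ (proj₂ (cells-apart (vertex w) (along u<v uv t) cl
                (λ (m , _) → out m) (λ { (inj₁ e , _) → w≢u (sym e) ; (inj₂ e , _) → w≢u (sym e) }))) out))
          where
          out : ¬ w ∈₂ u , v
          out (inj₁ e) = w≢u e
          out (inj₂ e) = w≢v e

        near-sym : ∀ {P Q} → Close² ρ P Q → Close² ρ Q P
        near-sym {p , q} {r , s} (h , k) = (λ i → ∣∣-swap {approx p i} {approx r i} (h i)) , (λ i → ∣∣-swap {approx q i} {approx s i} (k i))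

        -- Points of one edge are compared by `spreads`. Edges with one common end force both points
        -- near it, and disjoint edges would force a point near both ends of its edge.
        near-along : ∀ {u v p q} (u<v : u <ᶠ v) (uv : Adj G u v) t (p<q : p <ᶠ q) (pq : Adj G p q) t′ →
          Close² ρ (place (along u<v uv t)) (place (along p<q pq t′)) →
          Dec (u ≡ p) → Dec (v ≡ q) → Dec (u ≡ q) → Dec (v ≡ p) → Near G ε (along u<v uv t) (along p<q pq t′)
        near-along {u} {v} {p} {q} u<v uv t p<q pq t′ cl (yes refl) (yes refl) _ _ = sameEdge {s = t} {t = t′} (close-from ε m (proj₁ t) (proj₁ t′)
                (≤-trans (+-monoˡ-≤ κ (within (approx (proj₁ t) m) (approx (proj₁ t′) m)
                  (β≤ (≤-trans (spreads u v (λ e → <ᶠ-irrefl e u<v) {η} {approx (proj₁ t′) m} {approx (proj₁ t) m} 0≤η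
                    (∣∣-swap {blend (xs u) (xs v) (approx (proj₁ t′) m)} {blend (xs u) (xs v) (approx (proj₁ t) m)} (dx (along u<v uv t) (along p<q pq t′) cl))
                    (∣∣-swap {blend (ys u) (ys v) (approx (proj₁ t′) m)} {blend (ys u) (ys v) (approx (proj₁ t) m)} (dy (along u<v uv t) (along p<q pq t′) cl))) Cη≤β))
                  (β≤ (≤-trans (spreads u v (λ e → <ᶠ-irrefl e u<v) {η} {approx (proj₁ t) m} {approx (proj₁ t′) m} 0≤η (dx (along u<v uv t) (along p<q pq t′) cl) (dy (along u<v uv t) (along p<q pq t′) cl)) Cη≤β)))) tight))
        near-along {u} {v} {p} {q} u<v uv t p<q pq t′ cl (yes refl) (no v≢q) _ _ = sameVertex (at-source {t = t} (proj₁ bounds v∉)) (at-source {t = t′} (proj₁ (proj₂ (proj₂ bounds)) q∉))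
          where
          v∉ : ¬ v ∈₂ u , q
          v∉ (inj₁ e) = <ᶠ-irrefl (sym e) u<v
          v∉ (inj₂ e) = v≢q e
          q∉ : ¬ q ∈₂ u , v
          q∉ (inj₁ e) = <ᶠ-irrefl (sym e) p<q
          q∉ (inj₂ e) = v≢q (sym e)
          bounds = cells-apart (along u<v uv t) (along p<q pq t′) cl (λ (_ , m) → v∉ m) (λ (_ , m) → q∉ m)
        near-along {u} {v} {p} {q} u<v uv t p<q pq t′ cl (no u≢p) (yes refl) _ _ = sameVertex (at-target {t = t} (proj₁ (proj₂ bounds) u∉)) (at-target {t = t′} (proj₂ (proj₂ (proj₂ bounds)) p∉))
          where
          u∉ : ¬ u ∈₂ p , v
          u∉ (inj₁ e) = u≢p e
          u∉ (inj₂ e) = <ᶠ-irrefl e u<v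
          p∉ : ¬ p ∈₂ u , v
          p∉ (inj₁ e) = u≢p (sym e)
          p∉ (inj₂ e) = <ᶠ-irrefl e p<q
          bounds = cells-apart (along u<v uv t) (along p<q pq t′) cl (λ (m , _) → u∉ m) (λ (m , _) → p∉ m)
        near-along {u} {v} {p} {q} u<v uv t p<q pq t′ cl (no u≢p) (no v≢q) (yes refl) _ = sameVertex (at-source {t = t} (proj₁ bounds v∉)) (at-target {t = t′} (proj₂ (proj₂ (proj₂ bounds)) p∉))
          where
          v∉ : ¬ v ∈₂ p , u
          v∉ (inj₁ refl) = <ᶠ-asym p<q u<v
          v∉ (inj₂ e) = <ᶠ-irrefl (sym e) u<v
          p∉ : ¬ p ∈₂ u , v
          p∉ (inj₁ e) = u≢p (sym e)
          p∉ (inj₂ refl) = <ᶠ-asym p<q u<v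
          bounds = cells-apart (along u<v uv t) (along p<q pq t′) cl (λ (_ , m) → v∉ m) (λ (m , _) → p∉ m)
        near-along {u} {v} {p} {q} u<v uv t p<q pq t′ cl (no u≢p) (no v≢q) (no u≢q) (yes refl) = sameVertex (at-target {t = t} (proj₁ (proj₂ bounds) u∉)) (at-source {t = t′} (proj₁ (proj₂ (proj₂ bounds)) q∉))
          where
          u∉ : ¬ u ∈₂ v , q
          u∉ (inj₁ e) = u≢p e
          u∉ (inj₂ e) = u≢q e
          q∉ : ¬ q ∈₂ u , v
          q∉ (inj₁ e) = u≢q (sym e)
          q∉ (inj₂ e) = v≢q (sym e)
          bounds = cells-apart (along u<v uv t) (along p<q pq t′) cl (λ (m , _) → u∉ m) (λ (_ , m) → q∉ m)
        near-along {u} {v} {p} {q} u<v uv t p<q pq t′ cl (no u≢p) (no v≢q) (no u≢q) (no v≢p) = ⊥-elim (impossible (proj₁ bounds v∉) (proj₁ (proj₂ bounds) u∉))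
          where
          u∉ : ¬ u ∈₂ p , q
          u∉ (inj₁ e) = u≢p e
          u∉ (inj₂ e) = u≢q e
          v∉ : ¬ v ∈₂ p , q
          v∉ (inj₁ e) = v≢p e
          v∉ (inj₂ e) = v≢q e
          bounds = cells-apart (along u<v uv t) (along p<q pq t′) cl (λ (m , _) → u∉ m)
            (λ { (inj₁ e , _) → u≢p (sym e) ; (inj₂ e , _) → v≢p (sym e) })

        near : ∀ P Q → Close² ρ (place P) (place Q) → Near G ε P Q
        near (vertex w) (vertex z) cl with w ≟ z
        ... | yes refl = sameVertex here here
        ... | no w≢z = ⊥-elim (impossible {0ℚ} 0≤β (proj₁ (proj₂ (cells-apart (vertex w) (vertex z) cl (λ (m , _) → out m)
                (λ { (inj₁ e , _) → w≢z (sym e) ; (inj₂ e , _) → w≢z (sym e) }))) out))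
          where
          out : ¬ w ∈₂ z , z
          out (inj₁ e) = w≢z e
          out (inj₂ e) = w≢z e
        near (vertex w) (along u<v uv t) cl = sameVertex here (vertex-along w u<v uv t cl)
        near (along u<v uv t) (vertex w) cl = sameVertex (vertex-along w u<v uv t (near-sym {place (along u<v uv t)} {place (vertex w)} cl)) here
        near (along {u} {v} u<v uv t) (along {p} {q} p<q pq t′) cl = near-along u<v uv t p<q pq t′ cl (u ≟ p) (v ≟ q) (u ≟ q) (v ≟ p)

      inverse-continuous : ∀ ε → 0ℚ < ε → ∃ λ δ → 0ℚ < δ × (∀ P Q → Close² δ (place P) (place Q) → Near G ε P Q)
      inverse-continuous ε 0<ε = ρ , 0<ρ , Inverse.near m (<⇒≤ 0<ρ) (≤-trans bound (p⊓q≤p ε (+ 1 / 4))) (≤-trans loose (≤-trans bound (p⊓q≤q ε (+ 1 / 4))))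
        where
        ε′ = ε ⊓ (+ 1 / 4)
        0<ε′ : 0ℚ < ε′
        0<ε′ with ⊓-sel ε (+ 1 / 4)
        ... | inj₁ e = subst (0ℚ <_) (sym e) 0<ε
        ... | inj₂ e = subst (0ℚ <_) (sym e) (positive⁻¹ (+ 1 / 4))
        -- The required bound at ρ = κ = 1. It is linear in ρ and κ, so κ ≤ ρ bounds it by W ρ.
        W = C * (K * (1ℚ + 1ℚ) + 1ℚ) + 1ℚ + 1ℚ
        D = proj₁ (below-nat W)
        ρ = ε′ * unit D
        0<ρ : 0ℚ < ρ
        0<ρ = positive⁻¹ ρ {{pos*pos⇒pos ε′ {{positive 0<ε′}} (unit D) {{positive (0<unit D)}}}}
        m = proj₁ (small 0<ρ)
        κ = index m
        κ≤ρ : κ ≤ ρ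
        κ≤ρ = proj₂ (small 0<ρ)
        Wρ≤ : W * ρ ≤ ε′
        Wρ≤ = ≤-trans (subst₂ _≤_ (*-comm ρ W) (*-comm ρ (nat (ℕ.suc D))) (*-monoˡ (<⇒≤ 0<ρ) (≤-trans (proj₂ (below-nat W)) (nat-≤ (ℕ.n≤1+n D)))))
          (≤-reflexive (trans (solve 3 (λ k e u → k :* (e :* u) := (k :* u) :* e) refl (nat (ℕ.suc D)) ε′ (unit D))
            (trans (cong (_* ε′) (nat-unit D)) (*-identityˡ ε′))))
        bound : C * (K * (ρ + κ) + κ) + κ + κ ≤ ε′
        bound = ≤-trans (ungap (subst (0ℚ ≤_)
            (solve 4 (λ C K r k → C :* (K :* (r :- k)) :+ C :* (r :- k) :+ (r :- k) :+ (r :- k)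
               := (C :* (K :* (con 1ℚ :+ con 1ℚ) :+ con 1ℚ) :+ con 1ℚ :+ con 1ℚ) :* r :- (C :* (K :* (r :+ k) :+ k) :+ k :+ k)) refl C K ρ κ)
            ((0≤nat C₀ ⊛ (0≤K ⊛ gap κ≤ρ)) ⊹ (0≤nat C₀ ⊛ gap κ≤ρ) ⊹ gap κ≤ρ ⊹ gap κ≤ρ))) Wρ≤
        loose : C * (K * (ρ + κ) + κ) ≤ C * (K * (ρ + κ) + κ) + κ + κ
        loose = linear₂ (0≤index m) (0≤index m) (solve 2 (λ b k → (k :- con 0ℚ) :+ (k :- con 0ℚ) := b :+ k :+ k :- b) refl (C * (K * (ρ + κ) + κ)) κ)

    embedding : Planar G
    embedding = record { map = place ; continuous = continuous ; inverse-continuous = inverse-continuous }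

-- Linear algebra modulo 2

module Parity where

  open import Data.Bool.Base using (Bool; true; false; not; _xor_)
  open import Data.Bool.Properties using (xor-same; xor-comm; xor-assoc)
  open import Data.Bool.Solver using (module xor-∧-Solver)
  open import Data.Empty using (⊥)
  open import Data.Fin.Base using (Fin; zero; suc; toℕ)
  open import Data.Fin.Patterns
  open import Data.Fin.Properties using (_≟_)
  open import Data.List.Base using (List; []; _∷_; _++_; foldr; concatMap)
  open import Data.List.Relation.Unary.All as All using (All; []; _∷_)
  open import Data.Nat.Base using (ℕ; zero; suc; _<ᵇ_)
  open import Data.Product.Base using (_×_; _,_)
  open import Relation.Binary.PropositionalEquality hiding ([_])
  open import Relation.Nullary using (¬_; Dec; yes; no)
  open import Relation.Nullary.Decidable using (_×-dec_; ¬?; from-yes)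

  Σ₂ : (ℕ → Bool) → ℕ → Bool
  Σ₂ f zero = false
  Σ₂ f (suc k) = Σ₂ f k xor f k

  Σ₂-cong : ∀ {f g} → (∀ k → f k ≡ g k) → ∀ k → Σ₂ f k ≡ Σ₂ g k
  Σ₂-cong e zero = refl
  Σ₂-cong e (suc k) = cong₂ _xor_ (Σ₂-cong e k) (e k)

  xor-move : ∀ a b → a xor b ≡ false → a ≡ b
  xor-move false b e = sym e
  xor-move true true e = refl

  module _ where
    open xor-∧-Solver

    Σ₂-telescope : ∀ (f c : ℕ → Bool) k → Σ₂ (λ i → f i xor (c i xor c (suc i))) k ≡ Σ₂ f k xor (c 0 xor c k)
    Σ₂-telescope f c zero = sym (xor-same (c 0))
    Σ₂-telescope f c (suc k) = trans (cong (_xor (f k xor (c k xor c (suc k)))) (Σ₂-telescope f c k))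
      (solve 5 (λ S z a f b → (S :+ (z :+ a)) :+ (f :+ (a :+ b)) := (S :+ f) :+ (z :+ b)) refl (Σ₂ f k) (c 0) (c k) (f k) (c (suc k)))

    module _ (h v : ℕ → ℕ → Bool)
             (square : ∀ i j → ((h i j xor v (suc i) j) xor h i (suc j)) xor v i j ≡ false) where

      strip : ∀ A j → Σ₂ (λ i → h i j) A xor Σ₂ (λ i → h i (suc j)) A ≡ v 0 j xor v A j
      strip zero j = sym (xor-same (v 0 j))
      strip (suc A) j = trans (solve 4 (λ s t a b → (s :+ a) :+ (t :+ b) := (s :+ t) :+ (a :+ b)) refl
          (Σ₂ (λ i → h i j) A) (Σ₂ (λ i → h i (suc j)) A) (h A j) (h A (suc j)))
        (trans (cong₂ _xor_ (strip A j) corner) (solve 3 (λ z a b → (z :+ a) :+ (a :+ b) := z :+ b) refl (v 0 j) (v A j) (v (suc A) j)))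
        where
        corner : h A j xor h A (suc j) ≡ v A j xor v (suc A) j
        corner = xor-move _ _ (trans (solve 4 (λ a w b c → (a :+ b) :+ (c :+ w) := ((a :+ w) :+ b) :+ c) refl
          (h A j) (v (suc A) j) (h A (suc j)) (v A j)) (square A j))

      -- A discrete Stokes theorem modulo 2: summing over all squares of the grid, the inner edges
      -- cancel.
      boundary : ∀ A B → Σ₂ (λ i → h i 0) A xor Σ₂ (λ i → h i B) A ≡ Σ₂ (v 0) B xor Σ₂ (v A) B
      boundary A zero = xor-same (Σ₂ (λ i → h i 0) A)
      boundary A (suc B) = trans (solve 3 (λ a b c → a :+ c := (a :+ b) :+ (b :+ c)) refl (Σ₂ (λ i → h i 0) A) (Σ₂ (λ i → h i B) A) (Σ₂ (λ i → h i (suc B)) A))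
        (trans (cong₂ _xor_ (boundary A B) (strip A B))
          (solve 4 (λ a b c d → (a :+ b) :+ (c :+ d) := (a :+ c) :+ (b :+ d)) refl (Σ₂ (v 0) B) (Σ₂ (v A) B) (v 0 B) (v A B)))

  -- The parity system of a graph drawn without crossings of disjoint edges:
  -- above i j k is the parity of the number of times that the edge ij passes
  -- above the vertex k, right k i tells whether k lies to the right of i.
  record Passing {p} (T : Graph p) : Set where
    field
      above     : Fin p → Fin p → Fin p → Bool
      right     : Fin p → Fin p → Bool
      antisym   : ∀ {i j} → i ≢ j → right i j ≡ not (right j i)
      even      : ∀ {i j k l} → Adj T i j → Adj T k l → i ≢ k → i ≢ l → j ≢ k → j ≢ l →
        above i j k xor above i j l ≡
        (above k l i xor (right k i xor right l i)) xor (above k l j xor (right k j xor right l j))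

  data Term (p : ℕ) : Set where
    edge  : Fin p → Fin p → Fin p → Term p
    order : Fin p → Fin p → Term p
    unit  : Term p

  module _ {p : ℕ} where

    _≟ᵗ_ : (s t : Term p) → Dec (s ≡ t)
    edge i j k ≟ᵗ edge i′ j′ k′ with (i ≟ i′) ×-dec ((j ≟ j′) ×-dec (k ≟ k′))
    ... | yes (refl , refl , refl) = yes refl
    ... | no ne = no λ { refl → ne (refl , refl , refl) }
    order i j ≟ᵗ order i′ j′ with (i ≟ i′) ×-dec (j ≟ j′)
    ... | yes (refl , refl) = yes refl
    ... | no ne = no λ { refl → ne (refl , refl) }
    unit ≟ᵗ unit = yes refl
    edge _ _ _ ≟ᵗ order _ _ = no λ ()
    edge _ _ _ ≟ᵗ unit = no λ ()
    order _ _ ≟ᵗ edge _ _ _ = no λ ()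
    order _ _ ≟ᵗ unit = no λ ()
    unit ≟ᵗ edge _ _ _ = no λ ()
    unit ≟ᵗ order _ _ = no λ ()

    -- Addition over the field with two elements: a term that is already present cancels.
    toggle : Term p → List (Term p) → List (Term p)
    toggle t [] = t ∷ []
    toggle t (s ∷ ss) with t ≟ᵗ s
    ... | yes _ = ss
    ... | no _ = s ∷ toggle t ss

    cancel : List (Term p) → List (Term p)
    cancel = foldr toggle []

    -- Antisymmetry is built in: only one order of each pair is an unknown, and the other
    -- contributes an additional `unit`. These constants are the source of the final 1.
    order-terms : Fin p → Fin p → List (Term p)
    order-terms k i with toℕ i <ᵇ toℕ k
    ... | true = order k i ∷ []
    ... | false = order i k ∷ unit ∷ []

    Pair : Set
    Pair = Fin p × Fin p × Fin p × Fin p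

    equation : Pair → List (Term p)
    equation (i , j , k , l) = edge i j k ∷ edge i j l ∷ edge k l i ∷ edge k l j ∷
      order-terms k i ++ order-terms l i ++ order-terms k j ++ order-terms l j

    module _ {T : Graph p} (P : Passing T) where
      open Passing P

      value : Term p → Bool
      value (edge i j k) = above i j k
      value (order i j) = right i j
      value unit = true

      total : List (Term p) → Bool
      total [] = false
      total (t ∷ ts) = value t xor total ts

      total-++ : ∀ ss ts → total (ss ++ ts) ≡ total ss xor total ts
      total-++ [] ts = refl
      total-++ (s ∷ ss) ts = trans (cong (value s xor_) (total-++ ss ts)) (sym (xor-assoc (value s) (total ss) (total ts)))

      total-toggle : ∀ t ts → total (toggle t ts) ≡ value t xor total ts
      total-toggle t [] = refl
      total-toggle t (s ∷ ss) with t ≟ᵗ s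
      ... | yes refl = sym (trans (sym (xor-assoc (value t) (value t) (total ss))) (cong (_xor total ss) (xor-same (value t))))
      ... | no _ = trans (cong (value s xor_) (total-toggle t ss)) (trans (sym (xor-assoc (value s) (value t) (total ss)))
            (trans (cong (_xor total ss) (xor-comm (value s) (value t))) (xor-assoc (value t) (value s) (total ss))))

      total-cancel : ∀ ts → total (cancel ts) ≡ total ts
      total-cancel [] = refl
      total-cancel (t ∷ ts) = trans (total-toggle t (cancel ts)) (cong (value t xor_) (total-cancel ts))

      Valid : Pair → Set
      Valid (i , j , k , l) = Adj T i j × Adj T k l × i ≢ k × i ≢ l × j ≢ k × j ≢ l

      order-total : ∀ k i → k ≢ i → total (order-terms k i) ≡ right k i
      order-total k i ne with toℕ i <ᵇ toℕ k
      ... | true = go (right k i)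
        where
        go : ∀ b → b xor false ≡ b
        go false = refl
        go true = refl
      ... | false = trans (go (right i k)) (sym (antisym ne))
        where
        go : ∀ b → b xor true ≡ not b
        go false = refl
        go true = refl

      equation-total : ∀ q → Valid q → total (equation q) ≡ false
      equation-total (i , j , k , l) (ij , kl , ik , il , jk , jl) =
        trans (cong (λ z → above i j k xor (above i j l xor (above k l i xor (above k l j xor z)))) orders)
          (trans (rearrange (above i j k) (above i j l) (above k l i) (above k l j) (right k i) (right l i) (right k j) (right l j))
            (trans (cong (_xor ((above k l i xor (right k i xor right l i)) xor (above k l j xor (right k j xor right l j)))) (even ij kl ik il jk jl)) (xor-same ((above k l i xor (right k i xor right l i)) xor (above k l j xor (right k j xor right l j))))))
        where
        open xor-∧-Solver
        orders : total (order-terms k i ++ order-terms l i ++ order-terms k j ++ order-terms l j)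
                 ≡ right k i xor (right l i xor (right k j xor right l j))
        orders = trans (total-++ (order-terms k i) _) (cong₂ _xor_ (order-total k i (≢-sym ik))
          (trans (total-++ (order-terms l i) _) (cong₂ _xor_ (order-total l i (≢-sym il))
            (trans (total-++ (order-terms k j) _) (cong₂ _xor_ (order-total k j (≢-sym jk)) (order-total l j (≢-sym jl)))))))
        rearrange : ∀ a b c d e f g h → a xor (b xor (c xor (d xor (e xor (f xor (g xor h)))))) ≡ (a xor b) xor ((c xor (e xor f)) xor (d xor (g xor h)))
        rearrange = solve 8 (λ a b c d e f g h → a :+ (b :+ (c :+ (d :+ (e :+ (f :+ (g :+ h)))))) := (a :+ b) :+ ((c :+ (e :+ f)) :+ (d :+ (g :+ h)))) refl

      all-even : ∀ qs → All Valid qs → total (concatMap equation qs) ≡ false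
      all-even [] [] = refl
      all-even (q ∷ qs) (v ∷ vs) = trans (total-++ (equation q) (concatMap equation qs)) (cong₂ _xor_ (equation-total q v) (all-even qs vs))

      valid? : ∀ q → Dec (Valid q)
      valid? (i , j , k , l) = adj? T i j ×-dec (adj? T k l ×-dec (¬? (i ≟ k) ×-dec (¬? (i ≟ l) ×-dec (¬? (j ≟ k) ×-dec ¬? (j ≟ l)))))

      contradictory : ∀ qs → All Valid qs → cancel (concatMap equation qs) ≡ unit ∷ [] → ⊥
      contradictory qs vs e with trans (sym (cong total e)) (trans (total-cancel (concatMap equation qs)) (all-even qs vs))
      ... | ()

  -- The fifteen pairs of disjoint edges: the three perfect matchings on each set of four vertices.
  pairs₅ : List (Pair {5})
  pairs₅ = concatMap matchings
    ((0F , 1F , 2F , 3F) ∷ (0F , 1F , 2F , 4F) ∷ (0F , 1F , 3F , 4F) ∷ (0F , 2F , 3F , 4F) ∷ (1F , 2F , 3F , 4F) ∷ [])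
    where
    matchings : Pair {5} → List (Pair {5})
    matchings (a , b , c , d) = (a , b , c , d) ∷ (a , c , b , d) ∷ (a , d , b , c) ∷ []

  -- The eighteen pairs of disjoint edges, by their ends i and k on the first side and two ordered
  -- ends on the second.
  pairs₃,₃ : List (Pair {6})
  pairs₃,₃ = concatMap matchings ((0F , 1F) ∷ (0F , 2F) ∷ (1F , 2F) ∷ [])
    where
    matchings : Fin 6 × Fin 6 → List (Pair {6})
    matchings (i , k) = (i , 3F , k , 4F) ∷ (i , 4F , k , 3F) ∷ (i , 3F , k , 5F) ∷ (i , 5F , k , 3F) ∷ (i , 4F , k , 5F) ∷ (i , 5F , k , 4F) ∷ []

  K₅-impassable : ¬ Passing K₅
  K₅-impassable P = contradictory P pairs₅ (from-yes (All.all? (valid? P) pairs₅)) refl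

  K₃,₃-impassable : ¬ Passing K₃,₃
  K₃,₃-impassable P = contradictory P pairs₃,₃ (from-yes (All.all? (valid? P) pairs₃,₃)) refl

-- Passages across a vertical ray, for sampled paths

module Crossing where

  open import Data.Bool.Base using (Bool; true; false; not; _∧_; _∨_; _xor_)
  open import Data.Bool.Properties using (xor-same)
  open import Data.Bool.Solver using (module xor-∧-Solver)
  open import Data.Empty using (⊥-elim)
  open import Data.Nat.Base using (ℕ; suc)
  open import Data.Product.Base using (_×_; _,_; proj₁; proj₂)
  open import Data.Rational.Base
  open import Data.Rational.Properties
  open import Data.Rational.Solver using (module +-*-Solver)
  open import Data.Sum.Base using (_⊎_; inj₁; inj₂)
  open import Relation.Binary.Definitions using (tri<; tri≈; tri>)
  open import Relation.Binary.PropositionalEquality hiding ([_])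
  open import Relation.Nullary using (¬_; yes; no; does)
  open import Relation.Nullary.Decidable using (dec-true; dec-false)
  open Parity using (Σ₂; Σ₂-cong; Σ₂-telescope; boundary)
  open Rationals

  abstract
    positive? : ℚ → Bool
    positive? q = does (0ℚ <? q)

    positive?-true : ∀ {q} → 0ℚ < q → positive? q ≡ true
    positive?-true {q} = dec-true (0ℚ <? q)

    positive?-false : ∀ {q} → q ≤ 0ℚ → positive? q ≡ false
    positive?-false {q} le = dec-false (0ℚ <? q) (λ lt → <-irrefl refl (<-≤-trans lt le))

  neg-neg : ∀ a → - - a ≡ a
  neg-neg = solve 1 (λ a → :- (:- a) := a) refl
    where
    open +-*-Solver

  positive?-neg : ∀ q → 0ℚ ≢ q → positive? (- q) ≡ not (positive? q)
  positive?-neg q ne with <-cmp 0ℚ q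
  ... | tri< lt _ _ = trans (positive?-false (neg-antimono-≤ (<⇒≤ lt))) (sym (cong not (positive?-true lt)))
  ... | tri≈ _ e _ = ⊥-elim (ne e)
  ... | tri> _ _ gt = trans (positive?-true (neg-antimono-< gt)) (sym (cong not (positive?-false (<⇒≤ gt))))

  Vector : Set
  Vector = ℚ × ℚ

  infixl 6 _⊝_
  _⊝_ : Vector → Vector → Vector
  (a , b) ⊝ (c , d) = a - c , b - d

  opposite : Vector → Vector
  opposite (a , b) = - a , - b

  opposite-⊝ : ∀ p q → opposite (p ⊝ q) ≡ q ⊝ p
  opposite-⊝ (a , b) (c , d) = cong₂ _,_ (go a c) (go b d)
    where
    open +-*-Solver
    go : ∀ a c → - (a - c) ≡ c - a
    go = solve 2 (λ a c → :- (a :- c) := c :- a) refl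

  -- Lexicographic: vertical displacements count as leading to the right when
  -- they lead upwards, so that opposite nonzero vectors are distinguished.
  rightward : Vector → Bool
  rightward (a , b) = positive? a ∨ (not (positive? (- a)) ∧ positive? b)

  upward : Vector → Bool
  upward (_ , b) = positive? b

  -- Whether moving from d to d′ crosses the vertical ray that goes up from 0.
  passes : Vector → Vector → Bool
  passes d d′ = (rightward d xor rightward d′) ∧ upward d

  rightward-opposite : ∀ a b → (0ℚ ≢ a) ⊎ (0ℚ ≢ b) → rightward (opposite (a , b)) ≡ not (rightward (a , b))
  rightward-opposite a b nz with <-cmp 0ℚ a
  ... | tri< lt _ _ = go (positive?-true lt) (positive?-false (neg-antimono-≤ (<⇒≤ lt))) (cong positive? (neg-neg a))
    where
    go : ∀ {p n n′ q q′} → p ≡ true → n ≡ false → n′ ≡ p → n ∨ (not n′ ∧ q′) ≡ not (p ∨ (not n ∧ q))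
    go refl refl refl = refl
  ... | tri> _ _ gt = go {n′ = positive? (- - a)} {q′ = positive? (- b)} (positive?-false (<⇒≤ gt)) (positive?-true (neg-antimono-< gt))
    where
    go : ∀ {p n n′ q q′} → p ≡ false → n ≡ true → n ∨ (not n′ ∧ q′) ≡ not (p ∨ (not n ∧ q))
    go refl refl = refl
  ... | tri≈ _ refl _ = go (positive?-false ≤-refl) (positive?-neg b (nonzero nz))
    where
    go : ∀ {p q q′} → p ≡ false → q′ ≡ not q → p ∨ (not p ∧ q′) ≡ not (p ∨ (not p ∧ q))
    go refl refl = refl
    nonzero : (0ℚ ≢ 0ℚ) ⊎ (0ℚ ≢ b) → 0ℚ ≢ b
    nonzero (inj₁ ne) = ⊥-elim (ne refl)
    nonzero (inj₂ ne) = ne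

  module Walks {τ : ℚ} (0≤τ : 0ℚ ≤ τ) where

    Big : ℚ → Set
    Big q = τ < ∣ q ∣

    Far : Vector → Set
    Far (a , b) = Big a ⊎ Big b

    Step : Vector → Vector → Set
    Step (a , b) (c , d) = ∣ a - c ∣ ≤ τ × ∣ b - d ∣ ≤ τ

    far? : ∀ d → ¬ (∣ proj₁ d ∣ ≤ τ × ∣ proj₂ d ∣ ≤ τ) → Far d
    far? (a , b) h with τ <? ∣ a ∣ | τ <? ∣ b ∣
    ... | yes p | _ = inj₁ p
    ... | no _ | yes p = inj₂ p
    ... | no p | no q = ⊥-elim (h (≮⇒≥ p , ≮⇒≥ q))

    big-neg : ∀ {q} → Big q → Big (- q)
    big-neg {q} h = subst (τ <_) (sym (∣-p∣≡∣p∣ q)) h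

    big≢0 : ∀ {q} → Big q → 0ℚ ≢ q
    big≢0 h refl = <-irrefl refl (<-≤-trans h 0≤τ)

    positive?-stable : ∀ {a c} → Big a → ∣ a - c ∣ ≤ τ → positive? c ≡ positive? a × 0ℚ ≢ c
    positive?-stable {a} {c} big le with ∣p∣≡p∨∣p∣≡-p a
    ... | inj₁ e = trans (positive?-true 0<c) (sym (positive?-true (≤-<-trans 0≤τ τ<a))) , λ z → <-irrefl z 0<c
      where
      open +-*-Solver
      τ<a : τ < a
      τ<a = subst (τ <_) e big
      0<c : 0ℚ < c
      0<c = subst₂ _<_ (+-inverseʳ τ) (solve 2 (λ a c → a :+ (:- (a :- c)) := c) refl a c)
        (+-mono-<-≤ τ<a (neg-antimono-≤ (upper a c le)))
    ... | inj₂ e = trans (positive?-false (<⇒≤ c<0)) (sym (positive?-false (<⇒≤ a<0))) , λ z → <-irrefl (sym z) c<0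
      where
      open +-*-Solver
      τ<-a : τ < - a
      τ<-a = subst (τ <_) e big
      a<0 : a < 0ℚ
      a<0 = subst (_< 0ℚ) (solve 1 (λ a → :- (:- a) := a) refl a) (neg-antimono-< (≤-<-trans 0≤τ τ<-a))
      c<0 : c < 0ℚ
      c<0 = subst₂ _<_ (solve 2 (λ a c → (:- (:- a)) :+ (c :- a) := c) refl a c) (+-inverseˡ τ)
        (+-mono-<-≤ (neg-antimono-< τ<-a) (lower a c le))

    rightward-stable : ∀ {a b c d} → Big a → Step (a , b) (c , d) → rightward (c , d) ≡ rightward (a , b)
    rightward-stable {a} {b} {c} {d} big (le , _) with <-cmp 0ℚ a
    ... | tri≈ _ e _ = ⊥-elim (big≢0 big e)
    ... | tri< lt _ _ rewrite trans (proj₁ (positive?-stable {a} {c} big le)) (positive?-true lt) | positive?-true lt = refl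
    ... | tri> _ _ gt rewrite positive?-neg c (proj₂ (positive?-stable {a} {c} big le))
                            | positive?-neg a (big≢0 big)
                            | proj₁ (positive?-stable {a} {c} big le)
                            | positive?-false (<⇒≤ gt) = refl

    upward-stable : ∀ {a b c d} → Big b → Step (a , b) (c , d) → upward (c , d) ≡ upward (a , b)
    upward-stable {b = b} {d = d} big (_ , le) = proj₁ (positive?-stable {b} {d} big le)

    far-nonzero : ∀ a b → Far (a , b) → (0ℚ ≢ a) ⊎ (0ℚ ≢ b)
    far-nonzero a b (inj₁ h) = inj₁ (big≢0 h)
    far-nonzero a b (inj₂ h) = inj₂ (big≢0 h)

    far-opposite : ∀ {d} → Far d → Far (opposite d)
    far-opposite (inj₁ h) = inj₁ (big-neg h)
    far-opposite (inj₂ h) = inj₂ (big-neg h)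

    xor-∧ : ∀ {r r′} u → r′ ≡ r → (r xor r′) ∧ u ≡ false
    xor-∧ {r} u refl = cong (_∧ u) (xor-same r)

    step-opposite : ∀ d d′ → Step d d′ → Step (opposite d) (opposite d′)
    step-opposite (a , b) (c , d) (p , q) = go a c p , go b d q
      where
      open +-*-Solver
      go : ∀ a c → ∣ a - c ∣ ≤ τ → ∣ - a - - c ∣ ≤ τ
      go a c le = within (- a) (- c)
        (≤-trans (≤-reflexive (solve 2 (λ a c → (:- a) :- (:- c) := c :- a) refl a c)) (lower a c le))
        (≤-trans (≤-reflexive (solve 2 (λ a c → (:- c) :- (:- a) := a :- c) refl a c)) (upper a c le))

    -- A move that changes sides crosses the upper or the lower ray, and stays away from 0. So the
    -- passages through both rays add up to the change of sides.
    passes-opposite : ∀ d d′ → Far d → Step d d′ → passes (opposite d) (opposite d′) ≡ passes d d′ xor (rightward d xor rightward d′)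
    passes-opposite d@(a , b) d′@(a′ , b′) (inj₁ big) st =
      trans (xor-∧ (upward (opposite d)) (rightward-stable { - a } { - b } { - a′ } { - b′ } (big-neg big) (step-opposite d d′ st)))
        (sym (trans (cong₂ _xor_ (xor-∧ (upward d) stable) (cong (rightward d xor_) stable)) (xor-same (rightward d))))
      where
      stable : rightward d′ ≡ rightward d
      stable = rightward-stable {a} {b} {a′} {b′} big st
    passes-opposite d@(a , b) d′@(a′ , b′) (inj₂ big) st =
      trans (cong₂ _∧_ (cong₂ _xor_ (rightward-opposite a b (inj₂ (big≢0 big)))
          (rightward-opposite a′ b′ (inj₂ (proj₂ (positive?-stable {b} {b′} big (proj₂ st)))))) (positive?-neg b (big≢0 big)))
        (go (rightward d) (rightward d′) (upward d))
      where
      go : ∀ r r′ u → (not r xor not r′) ∧ not u ≡ ((r xor r′) ∧ u) xor (r xor r′)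
      go false false false = refl
      go false false true = refl
      go false true false = refl
      go false true true = refl
      go true false false = refl
      go true false true = refl
      go true true false = refl
      go true true true = refl

    -- A square away from 0 has winding number 0. If the first coordinate is big, no corner changes
    -- sides; if the second is, the factor `upward` is constant and the changes of sides cancel
    -- around the square.
    passes-square : ∀ d₀₀ d₁₀ d₁₁ d₀₁ → Far d₀₀ → Step d₀₀ d₁₀ → Step d₀₀ d₁₁ → Step d₀₀ d₀₁ →
      ((passes d₀₀ d₁₀ xor passes d₁₀ d₁₁) xor passes d₀₁ d₁₁) xor passes d₀₀ d₀₁ ≡ false
    passes-square d₀₀@(a , b) d₁₀@(a₁ , b₁) d₁₁@(a₂ , b₂) d₀₁@(a₃ , b₃) (inj₁ big) s₁ s₂ s₃
      rewrite rightward-stable {a} {b} {a₁} {b₁} big s₁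
            | rightward-stable {a} {b} {a₂} {b₂} big s₂
            | rightward-stable {a} {b} {a₃} {b₃} big s₃
            | xor-same (rightward d₀₀) = refl
    passes-square d₀₀@(a , b) d₁₀@(a₁ , b₁) d₁₁@(a₂ , b₂) d₀₁@(a₃ , b₃) (inj₂ big) s₁ s₂ s₃ =
      trans (cong₂ (λ p q → ((passes d₀₀ d₁₀ xor ((rightward d₁₀ xor rightward d₁₁) ∧ p)) xor ((rightward d₀₁ xor rightward d₁₁) ∧ q)) xor passes d₀₀ d₀₁)
          (upward-stable {a} {b} {a₁} {b₁} big s₁) (upward-stable {a} {b} {a₃} {b₃} big s₃))
        (go (rightward d₀₀) (rightward d₁₀) (rightward d₁₁) (rightward d₀₁) (upward d₀₀))
      where
      open xor-∧-Solver
      go : ∀ p q r s u → ((((p xor q) ∧ u) xor ((q xor r) ∧ u)) xor ((s xor r) ∧ u)) xor ((p xor s) ∧ u) ≡ false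
      go = solve 5 (λ p q r s u → (((((p :+ q) :* u) :+ ((q :+ r) :* u)) :+ ((s :+ r) :* u)) :+ ((p :+ s) :* u)) := con false) refl

    passages : (ℕ → Vector) → ℕ → Vector → Bool
    passages f A w = Σ₂ (λ k → passes (f k ⊝ w) (f (suc k) ⊝ w)) A

    -- The grid of the differences of two paths without close points avoids 0.
    passages-even : ∀ (f g : ℕ → Vector) A B →
      (∀ i j → Far (f i ⊝ g j)) →
      (∀ i j → Step (f i ⊝ g j) (f (suc i) ⊝ g j)) →
      (∀ i j → Step (f i ⊝ g j) (f i ⊝ g (suc j))) →
      (∀ i j → Step (f i ⊝ g j) (f (suc i) ⊝ g (suc j))) →
      passages f A (g 0) xor passages f A (g B) ≡
      (passages g B (f 0) xor (rightward (g 0 ⊝ f 0) xor rightward (g B ⊝ f 0))) xor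
      (passages g B (f A) xor (rightward (g 0 ⊝ f A) xor rightward (g B ⊝ f A)))
    passages-even f g A B far right up diagonal =
      trans (boundary h v (λ i j → passes-square (f i ⊝ g j) (f (suc i) ⊝ g j) (f (suc i) ⊝ g (suc j)) (f i ⊝ g (suc j))
          (far i j) (right i j) (diagonal i j) (up i j)) A B)
        (cong₂ _xor_ (column 0) (column A))
      where
      h v : ℕ → ℕ → Bool
      h i j = passes (f i ⊝ g j) (f (suc i) ⊝ g j)
      v i j = passes (f i ⊝ g j) (f i ⊝ g (suc j))
      -- Along a column g moves and f rests. Reversing the differences turns this into passages of g
      -- above a point of f, at the cost of changes of sides that telescope.
      column : ∀ i → Σ₂ (v i) B ≡ passages g B (f i) xor (rightward (g 0 ⊝ f i) xor rightward (g B ⊝ f i))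
      column i = trans (Σ₂-cong turned B) (Σ₂-telescope (λ j → passes (g j ⊝ f i) (g (suc j) ⊝ f i)) (λ j → rightward (g j ⊝ f i)) B)
        where
        turned : ∀ j → v i j ≡ passes (g j ⊝ f i) (g (suc j) ⊝ f i) xor (rightward (g j ⊝ f i) xor rightward (g (suc j) ⊝ f i))
        turned j = trans (sym (cong₂ passes (opposite-⊝ (g j) (f i)) (opposite-⊝ (g (suc j)) (f i))))
          (passes-opposite (g j ⊝ f i) (g (suc j) ⊝ f i)
            (subst Far (opposite-⊝ (f i) (g j)) (far-opposite {f i ⊝ g j} (far i j)))
            (subst₂ Step (opposite-⊝ (f i) (g j)) (opposite-⊝ (f i) (g (suc j)))
              (step-opposite (f i ⊝ g j) (f i ⊝ g (suc j)) (up i j))))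

-- The parity system of a plane embedding

module Passage where

  open import Data.Bool.Base using (Bool; false; not; _xor_)
  open import Data.Empty using (⊥; ⊥-elim)
  open import Data.Fin.Base using (Fin)
  open import Data.Fin.Properties using () renaming (<-cmp to <ᶠ-cmp)
  open import Data.Nat.Base as ℕ using (ℕ; zero; suc)
  import Data.Nat.Properties as ℕ
  open import Data.Product.Base using (∃; _×_; _,_; proj₁; proj₂)
  open import Data.Rational.Base
  open import Data.Rational.Properties
  open import Data.Rational.Solver using (module +-*-Solver)
  open import Data.Sum.Base using (inj₁; inj₂)
  open import Relation.Binary.Definitions using (tri<; tri≈; tri>)
  open import Relation.Binary.PropositionalEquality hiding ([_])
  open import Relation.Nullary using (Dec; yes; no)
  open Geometry using (_∈₂_,_)
  open Minors using (Hom)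
  open Parity using (Passing)
  open Rationals
  open Crossing
  open +-*-Solver

  fromℚ-≤ : ∀ {p q} → p ≤ q → fromℚ p ≤ᴿ fromℚ q
  fromℚ-≤ {p} {q} le k = subst (λ i → p ≤ q + i) (index-def k) (subst (_≤ q + index k) (+-identityʳ p) (+-mono-≤ le (0≤index k)))

  fromℚ-close : ∀ {δ} p q → ∣ p - q ∣ ≤ δ → Close δ (fromℚ p) (fromℚ q)
  fromℚ-close {δ} p q le k = subst (λ i → ∣ p - q ∣ ≤ δ + i) (index-def k) (subst (_≤ δ + index k) (+-identityʳ ∣ p - q ∣) (+-mono-≤ le (0≤index k)))

  fromℚ-equal : ∀ {δ p q} → 0ℚ ≤ δ → p ≡ q → Close δ (fromℚ p) (fromℚ q)
  fromℚ-equal {δ} {p} 0≤δ refl = fromℚ-close p p (subst (λ z → ∣ z ∣ ≤ δ) (sym (+-inverseʳ p)) 0≤δ)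

  module _ {n} {G : Graph n} where

    Within : (Fin n → Set) → Point G → Set
    Within S (vertex w) = S w
    Within S (along {u} {v} _ _ _) = S u × S v

    nearVertex-within : ∀ {ε w S P} → NearVertex G ε w P → Within S P → S w
    nearVertex-within here s = s
    nearVertex-within (source _) (s , _) = s
    nearVertex-within (target _) (_ , s) = s

    -- `Near` has no case for cells without a common end, whatever ε is.
    near-within : ∀ {ε S T P Q} → Near G ε P Q → Within S P → Within T Q → ∃ λ w → S w × T w
    near-within (sameEdge _) (s , _) (t , _) = _ , s , t
    near-within {S = S} {T} (sameVertex a b) s t = _ , nearVertex-within {S = S} a s , nearVertex-within {S = T} b t

    -- An edge run through from u to v in either vertex order; against the orientation of `along`
    -- the parameter is 1 - t.
    record Link (δ : ℚ) (u v : Fin n) : Set where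
      field
        point  : ∀ t → 0ℚ ≤ t → t ≤ 1ℚ → Point G
        near   : ∀ {s t p q p′ q′} → ∣ s - t ∣ ≤ δ → Near G δ (point s p q) (point t p′ q′)
        start  : ∀ {t p q} → t ≡ 0ℚ → Near G δ (vertex u) (point t p q)
        finish : ∀ {t p q} → t ≡ 1ℚ → Near G δ (point t p q) (vertex v)
        within-ends : ∀ t p q → Within (_∈₂ u , v) (point t p q)

    link : ∀ {δ u v} → 0ℚ ≤ δ → Adj G u v → Link δ u v
    link {δ} {u} {v} 0≤δ a with <ᶠ-cmp u v
    ... | tri≈ _ e _ = ⊥-elim (irrefl G e a)
    ... | tri< u<v _ _ = record
      { point = λ t p q → along u<v a (fromℚ t , fromℚ-≤ p , fromℚ-≤ q)
      ; near = λ {s} {t} le → sameEdge (fromℚ-close s t le)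
      ; start = λ e → sameVertex here (source (fromℚ-equal 0≤δ e))
      ; finish = λ e → sameVertex (target (fromℚ-equal 0≤δ e)) here
      ; within-ends = λ t p q → inj₁ refl , inj₂ refl }
    ... | tri> _ _ v<u = record
      { point = λ t p q → along v<u (symm G a) (fromℚ (1ℚ - t) ,
          fromℚ-≤ {0ℚ} {1ℚ - t} (gap q) ,
          fromℚ-≤ {1ℚ - t} {1ℚ} (linear₁ {0ℚ} {t} {1ℚ - t} {1ℚ} p (solve 1 (λ t → t :- con 0ℚ := con 1ℚ :- (con 1ℚ :- t)) refl t)))
      ; near = λ {s} {t} le → sameEdge (fromℚ-close (1ℚ - s) (1ℚ - t) (within (1ℚ - s) (1ℚ - t)
          (≤-trans (≤-reflexive (solve 2 (λ s t → (con 1ℚ :- s) :- (con 1ℚ :- t) := t :- s) refl s t)) (lower s t le))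
          (≤-trans (≤-reflexive (solve 2 (λ s t → (con 1ℚ :- t) :- (con 1ℚ :- s) := s :- t) refl s t)) (upper s t le))))
      ; start = λ { refl → sameVertex here (target (fromℚ-equal {δ} {1ℚ - 0ℚ} {1ℚ} 0≤δ refl)) }
      ; finish = λ { refl → sameVertex (source (fromℚ-equal {δ} {1ℚ - 1ℚ} {0ℚ} 0≤δ refl)) here }
      ; within-ends = λ t p q → inj₂ refl , inj₁ refl }

    -- `visit` has values at all indices because the grid argument asks for steps everywhere; the
    -- walk built below rests at v after its end.
    record Walk (δ : ℚ) (u v : Fin n) : Set where
      field
        visit  : ℕ → Point G
        length : ℕ
        start  : visit 0 ≡ vertex u
        finish : visit length ≡ vertex v
        steps  : ∀ k → Near G δ (visit k) (visit (suc k))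
        within-ends : ∀ k → Within (_∈₂ u , v) (visit k)

    walk : ∀ {δ u v} → 0ℚ < δ → Link δ u v → Walk δ u v
    walk {δ} {u} {v} 0<δ L = record
      { visit = visit
      -- The visits are u, the N + 2 parameters from 0 to 1 in steps of 1/(N + 1), and v. The ends
      -- of the edge are visited twice since `vertex u` and the point with parameter 0 are near but
      -- not equal.
      ; length = suc (suc (suc N))
      ; start = refl
      ; finish = finished (suc N ℕ.<? suc N)
      ; steps = steps
      ; within-ends = on }
      where
      N : ℕ
      N = proj₁ (small 0<δ)

      unit≤δ : unit N ≤ δ
      unit≤δ = ≤-trans (linear₁ (0≤unit N) (trans (solve 1 (λ u → u :- con 0ℚ := (u :+ u) :- u) refl (unit N)) (cong (_- unit N) (two-units N)))) (proj₂ (small 0<δ))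

      time : ℕ → ℚ
      time k = nat k * unit N

      0≤time : ∀ k → 0ℚ ≤ time k
      0≤time k = 0≤nat k ⊛ 0≤unit N

      time≤1 : ∀ {k} → k ℕ.< suc (suc N) → time k ≤ 1ℚ
      time≤1 {k} le = ≤-trans (*-monoʳ-≤-nonNeg (unit N) {{nonNegative (0≤unit N)}} (nat-≤ (ℕ.s≤s⁻¹ le))) (≤-reflexive (nat-unit N))

      at : ∀ k → Dec (k ℕ.< suc (suc N)) → Point G
      at k (yes le) = Link.point L (time k) (0≤time k) (time≤1 le)
      at k (no _) = vertex v

      visit : ℕ → Point G
      visit zero = vertex u
      visit (suc k) = at k (k ℕ.<? suc (suc N))

      finished : ∀ d → visit (suc (suc (suc N))) ≡ vertex v
      finished d with suc (suc N) ℕ.<? suc (suc N)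
      ... | yes lt = ⊥-elim (ℕ.<-irrefl refl lt)
      ... | no _ = refl

      steps : ∀ k → Near G δ (visit k) (visit (suc k))
      steps zero = Link.start L (trans (cong (_* unit N) nat-zero) (*-zeroˡ (unit N)))
      steps (suc k) with k ℕ.<? suc (suc N) | suc k ℕ.<? suc (suc N)
      ... | yes p | yes q = Link.near L (within (time k) (time (suc k))
              (≤-trans (linear₂ (0≤unit N) (0≤unit N) (trans (solve 2 (λ u k → (u :- con 0ℚ) :+ (u :- con 0ℚ) := u :- (k :* u :- (con 1ℚ :+ k) :* u)) refl (unit N) (nat k))
                 (cong (λ z → unit N - (time k - z * unit N)) (sym (nat-suc k))))) unit≤δ)
              (≤-trans (≤-reflexive (trans (cong (λ z → z * unit N - time k) (nat-suc k)) (solve 2 (λ u k → (con 1ℚ :+ k) :* u :- k :* u := u) refl (unit N) (nat k)))) unit≤δ))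
      ... | yes p | no q = Link.finish L (subst (λ j → time j ≡ 1ℚ) (ℕ.≤-antisym (ℕ.s≤s⁻¹ (ℕ.≮⇒≥ q)) (ℕ.s≤s⁻¹ p)) (nat-unit N))
      ... | no p | yes q = ⊥-elim (p (ℕ.<-trans (ℕ.n<1+n k) q))
      ... | no _ | no _ = sameVertex here here

      on : ∀ k → Within (_∈₂ u , v) (visit k)
      on zero = inj₁ refl
      on (suc k) with k ℕ.<? suc (suc N)
      ... | yes p = Link.within-ends L (time k) (0≤time k) (time≤1 p)
      ... | no _ = inj₂ refl

    module _ (E : PlaneEmbedding G) where
      open PlaneEmbedding E

      private
        -- Any ε would do: by `near-within` even 1-near points lie on cells with a common vertex.
        separation = inverse-continuous 1ℚ (positive⁻¹ 1ℚ)
        δ₁ τ σ η : ℚ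
        δ₁ = proj₁ separation
        -- The other half of `δ₁` pays for sampling. A diagonal step of the grid adds steps of both
        -- paths, hence `σ` is half of `τ`; and `η` is half of `σ`, which leaves room for the
        -- sampling error again.
        τ = half δ₁
        σ = half τ
        η = half σ
        0<δ₁ : 0ℚ < δ₁
        0<δ₁ = proj₁ (proj₂ separation)
        0<τ : 0ℚ < τ
        0<τ = half-pos 0<δ₁
        0<σ : 0ℚ < σ
        0<σ = half-pos 0<τ
        0<η : 0ℚ < η
        0<η = half-pos 0<σ
        m : ℕ
        m = proj₁ (small 0<η)
        modulus = continuous η 0<η
        δ₀ : ℚ
        δ₀ = proj₁ modulus
        0<δ₀ : 0ℚ < δ₀
        0<δ₀ = proj₁ (proj₂ modulus)

        half-≤ : ∀ {ε} → 0ℚ < ε → half ε ≤ ε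
        half-≤ {ε} p = subst₂ _≤_ (+-identityʳ (half ε)) (half+half ε) (+-monoʳ-≤ (half ε) (<⇒≤ (half-pos p)))

        η+κ≤σ : η + index m ≤ σ
        η+κ≤σ = ≤-trans (+-monoʳ-≤ η (proj₂ (small 0<η))) (≤-reflexive (half+half σ))

        τ+κ≤δ₁ : τ + index m ≤ δ₁
        τ+κ≤δ₁ = ≤-trans (+-monoʳ-≤ τ (≤-trans (proj₂ (small 0<η)) (≤-trans (half-≤ 0<σ) (half-≤ 0<τ)))) (≤-reflexive (half+half δ₁))

      open Walks (<⇒≤ 0<τ)

      image : Point G → Vector
      image P = approx (proj₁ (map P)) m , approx (proj₂ (map P)) m

      Near-step : Vector → Vector → Set
      Near-step (a , b) (c , d) = ∣ a - c ∣ ≤ σ × ∣ b - d ∣ ≤ σ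

      image-step : ∀ {P Q} → Near G δ₀ P Q → Near-step (image P) (image Q)
      image-step {P} {Q} h = go (proj₁ (map P)) (proj₁ (map Q)) (proj₁ cl) , go (proj₂ (map P)) (proj₂ (map Q)) (proj₂ cl)
        where
        cl : Close² η (map P) (map Q)
        cl = proj₂ (proj₂ modulus) P Q h
        go : ∀ a c → Close η a c → ∣ approx a m - approx c m ∣ ≤ σ
        go a c h = ≤-trans (close-at η m a c h) η+κ≤σ

      image-far : ∀ S T {P Q} → Within S P → Within T Q → (∀ {w} → S w → T w → ⊥) → Far (image P ⊝ image Q)
      image-far S T {P} {Q} s t disjoint = far? (image P ⊝ image Q) λ (hx , hy) →
        let (_ , sw , tw) = near-within {S = S} {T} (proj₂ (proj₂ separation) P Q
              (go (proj₁ (map P)) (proj₁ (map Q)) hx , go (proj₂ (map P)) (proj₂ (map Q)) hy)) s t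
        in disjoint sw tw
        where
        go : ∀ a c → ∣ approx a m - approx c m ∣ ≤ τ → Close δ₁ a c
        go a c h = close-from δ₁ m a c (≤-trans (+-monoˡ-≤ (index m) h) τ+κ≤δ₁)

      corner : Fin n → Vector
      corner w = image (vertex w)

      tour : ∀ {u v} → Adj G u v → Walk δ₀ u v
      tour a = walk 0<δ₀ (link (<⇒≤ 0<δ₀) a)

      path : ∀ {u v} → Adj G u v → ℕ → Vector
      path a k = image (Walk.visit (tour a) k)

      over : ∀ u v → Dec (Adj G u v) → Fin n → Bool
      over u v (yes a) w = passages (path a) (Walk.length (tour a)) (corner w)
      over u v (no _) w = false

      passing : Passing G
      passing = record
        { above = λ u v → over u v (adj? G u v)
        ; right = λ k i → rightward (corner k ⊝ corner i)
        ; antisym = λ {i} {j} i≢j → trans (cong rightward (sym (opposite-⊝ (corner j) (corner i))))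
            (rightward-opposite′ (corner j ⊝ corner i) (image-far (_≡ j) (_≡ i) {vertex j} {vertex i} refl refl λ { refl refl → i≢j refl }))
        ; even = λ {i} {j} {k} {l} → even i j k l (adj? G i j) (adj? G k l) }
        where
        rightward-opposite′ : ∀ d → Far d → rightward (opposite d) ≡ not (rightward d)
        rightward-opposite′ (a , b) far = rightward-opposite a b (far-nonzero a b far)

        even : ∀ i j k l (d : Dec (Adj G i j)) (e : Dec (Adj G k l)) → Adj G i j → Adj G k l → i ≢ k → i ≢ l → j ≢ k → j ≢ l →
          over i j d k xor over i j d l ≡
          (over k l e i xor (rightward (corner k ⊝ corner i) xor rightward (corner l ⊝ corner i))) xor
          (over k l e j xor (rightward (corner k ⊝ corner j) xor rightward (corner l ⊝ corner j)))
        even i j k l (no na) _ a b = ⊥-elim (na a)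
        even i j k l (yes _) (no nb) a b = ⊥-elim (nb b)
        even i j k l (yes a) (yes b) _ _ ik il jk jl =
          subst₂ (λ p q → over i j (yes a) k xor over i j (yes a) l ≡
              (passages g B p xor (rightward (corner k ⊝ p) xor rightward (corner l ⊝ p))) xor
              (passages g B q xor (rightward (corner k ⊝ q) xor rightward (corner l ⊝ q))))
            (cong image (Walk.start (tour a))) (cong image (Walk.finish (tour a)))
            (subst₂ (λ p q → passages f A p xor passages f A q ≡
              (passages g B (f 0) xor (rightward (p ⊝ f 0) xor rightward (q ⊝ f 0))) xor
              (passages g B (f A) xor (rightward (p ⊝ f A) xor rightward (q ⊝ f A))))
            (cong image (Walk.start (tour b))) (cong image (Walk.finish (tour b)))
            (passages-even f g A B
              (λ s t → image-far (_∈₂ i , j) (_∈₂ k , l) (Walk.within-ends (tour a) s) (Walk.within-ends (tour b) t) disjoint)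
              (λ s t → left (f s) (f (suc s)) (g t) (f-step s))
              (λ s t → right (f s) (g t) (g (suc t)) (g-step t))
              (λ s t → both (f s) (f (suc s)) (g t) (g (suc t)) (f-step s) (g-step t))))
          where
          f = path a
          g = path b
          A = Walk.length (tour a)
          B = Walk.length (tour b)
          f-step : ∀ s → Near-step (f s) (f (suc s))
          f-step s = image-step (Walk.steps (tour a) s)
          g-step : ∀ s → Near-step (g s) (g (suc s))
          g-step s = image-step (Walk.steps (tour b) s)
          disjoint : ∀ {w} → w ∈₂ i , j → w ∈₂ k , l → ⊥
          disjoint (inj₁ refl) (inj₁ e) = ik e
          disjoint (inj₁ refl) (inj₂ e) = il e
          disjoint (inj₂ refl) (inj₁ e) = jk e
          disjoint (inj₂ refl) (inj₂ e) = jl e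
          move : ∀ a b c d → ∣ a - b ∣ ≤ σ → ∣ c - d ∣ ≤ σ → ∣ (a - c) - (b - d) ∣ ≤ τ
          move a b c d p q = within (a - c) (b - d)
            (≤-trans (linear₂ (upper a b p) (lower c d q) (solve 5 (λ a b c d s → (s :- (a :- b)) :+ (s :- (d :- c)) := s :+ s :- ((a :- c) :- (b :- d))) refl a b c d σ)) (≤-reflexive (half+half τ)))
            (≤-trans (linear₂ (lower a b p) (upper c d q) (solve 5 (λ a b c d s → (s :- (b :- a)) :+ (s :- (c :- d)) := s :+ s :- ((b :- d) :- (a :- c))) refl a b c d σ)) (≤-reflexive (half+half τ)))
          stay : ∀ c → ∣ c - c ∣ ≤ σ
          stay c = subst (λ z → ∣ z ∣ ≤ σ) (sym (+-inverseʳ c)) (<⇒≤ 0<σ)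
          both : ∀ p p′ q q′ → Near-step p p′ → Near-step q q′ → Step (p ⊝ q) (p′ ⊝ q′)
          both (a , b) (a′ , b′) (c , d) (c′ , d′) (x , y) (z , w) = move a a′ c c′ x z , move b b′ d d′ y w
          left : ∀ p p′ q → Near-step p p′ → Step (p ⊝ q) (p′ ⊝ q)
          left p p′ q h = both p p′ q q h (stay (proj₁ q) , stay (proj₂ q))
          right : ∀ p q q′ → Near-step q q′ → Step (p ⊝ q) (p ⊝ q′)
          right p q q′ h = both p p q q′ (stay (proj₁ p) , stay (proj₂ p)) h

  -- Transports the system to the standard K₅ or K₃,₃, whose concrete vertices let the equations be
  -- evaluated.
  passing-pull : ∀ {m n} {T : Graph m} {G : Graph n} → Hom T G → Passing G → Passing T
  passing-pull h P = record
    { above = λ i j k → above (map i) (map j) (map k)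
    ; right = λ i j → right (map i) (map j)
    ; antisym = λ i≢j → antisym (λ e → i≢j (injective e))
    ; even = λ ij kl ik il jk jl → even (preserves ij) (preserves kl) (λ e → ik (injective e)) (λ e → il (injective e))
               (λ e → jk (injective e)) (λ e → jl (injective e)) }
    where
    open Passing P
    open Hom h

-- The two inclusions

open Kuratowski using (kuratowski)
open Minors
open Embedding using (embedding)
open Parity using (K₅-impassable; K₃,₃-impassable)
open Passage using (passing; passing-pull)

¬planar-K₅ : ∀ {n} {G : Graph n} → G ≅ K₅ → ¬ Planar G
¬planar-K₅ e E = K₅-impassable (passing-pull (≅⇒hom (≅-sym e)) (passing E))

¬planar-K₃,₃ : ∀ {n} {G : Graph n} → G ≅ K₃,₃ → ¬ Planar G
¬planar-K₃,₃ e E = K₃,₃-impassable (passing-pull (≅⇒hom (≅-sym e)) (passing E))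

-- `kuratowski` produces a model or a drawing outright, so nonplanarity only has to refute the
-- drawing.
nonplanar⇒minor : ∀ {n} {G : Graph n} → ¬ Planar G → K₅ ≺ G ⊎ K₃,₃ ≺ G
nonplanar⇒minor {G = G} ¬planar with kuratowski {G = G}
... | inj₁ (inj₁ M) = inj₂ (model⇒minor M)
... | inj₁ (inj₂ M) = inj₁ (model⇒minor M)
... | inj₂ (X , Y , drawing) = ⊥-elim (¬planar (embedding X Y drawing))

≅-refl : ∀ {n} {G : Graph n} → G ≅ G
≅-refl = record { bijection = ↔-id _ ; adj⇔ = λ u v → mk⇔ (λ a → a) (λ a → a) }

theorem15 : ∀ {n : ℕ} (G : Graph n) → F Planar G ⇔ (G ≅ K₅ ⊎ G ≅ K₃,₃)
theorem15 G = mk⇔ forward backward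
  where
  forward : F Planar G → G ≅ K₅ ⊎ G ≅ K₃,₃
  forward (¬planar , minimal) = Sum.map
    -- K₅ is nonplanar itself, so the minimality of G identifies the two.
    (λ K≺G → ≅-sym (minimal K₅ (¬planar-K₅ ≅-refl) K≺G))
    (λ K≺G → ≅-sym (minimal K₃,₃ (¬planar-K₃,₃ ≅-refl) K≺G)) (nonplanar⇒minor ¬planar)

  backward : G ≅ K₅ ⊎ G ≅ K₃,₃ → F Planar G
  -- A nonplanar minor H again contains K₅ or K₃,₃, which reduces minimality to counting vertices
  -- and edges.
  backward (inj₁ e) = ¬planar-K₅ e , λ H ¬planar H≺G → K₅-minimal e H≺G (nonplanar⇒minor ¬planar)
  backward (inj₂ e) = ¬planar-K₃,₃ e , λ H ¬planar H≺G → K₃,₃-minimal e H≺G (nonplanar⇒minor ¬planar)
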